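{- For a real quadratic field $K$, let $\Delta_K$ denote its discriminant and $\varepsilon_K$ its fundamental unit. Having $\operatorname{Tr}(\varepsilon_K)$ odd is equivalent to $K$ having a totally positive fundamental unit of odd trace, and equivalent to $K$ having some unit of odd trace. Moreover, as $X\to\infty$, $$\frac{2}{27}+o(1)\;\le\;\frac{\#\{K : [K:\mathbb{Q}]=2,\ 0<\Delta_K<X,\ 2\nmid \operatorname{Tr}(\varepsilon_K)\}}{\#\{K : [K:\mathbb{Q}]=2,\ 0<\Delta_K<X\}}\;\le\;\frac13+O(X^{ -1/2}),$$ where $K$ ranges over quadratic number fields (up to isomorphism).
   Context: For a real quadratic field $K$ (viewed inside $\mathbb{R}$), the fundamental unit $\varepsilon_K$ is the smallest unit of the ring of integers $\mathcal{O}_K$ that is greater than $1$; the totally positive fundamental unit is the smallest unit greater than $1$ of norm $+1$. $\operatorname{Tr}$ denotes the field trace $K\to\mathbb{Q}$. -}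

module Defs where

open import Data.Nat as ℕ using (ℕ; suc; _%_)
open import Data.Nat.Divisibility as ℕD using ()
open import Data.Nat.Primality using (Prime)
open import Data.Integer as ℤ using (ℤ; +_; _-_; _*_; _>_; _<_; _≥_)
open import Data.Integer.Divisibility using (_∣_)
open import Data.List using (List; length)
open import Data.List.Membership.Propositional using (_∈_)
open import Data.List.Relation.Unary.Unique.Propositional using (Unique)
open import Data.Product using (Σ; _×_; ∃; ∃-syntax)
open import Data.Sum using (_⊎_)
open import Relation.Nullary using (¬_)
open import Relation.Binary.PropositionalEquality using (_≡_)
open import Function.Bundles using (_⇔_)
open import Data.Unit using (⊤)

SquareFree : ℕ → Set
SquareFree m = ∀ p → Prime p → ¬ (p ℕ.* p ℕD.∣ m)

-- fundamental discriminant of a REAL quadratic field (D > 1):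
-- D ≡ 1 mod 4 squarefree, or D = 4m with m ≡ 2,3 mod 4 squarefree.
-- These are exactly the discriminants Δ_K of real quadratic fields K,
-- and K ↦ Δ_K is a bijection from real quadratic fields up to isomorphism.
RealQuadDisc : ℕ → Set
RealQuadDisc D =
  1 ℕ.< D ×
  ((D % 4 ≡ 1 × SquareFree D) ⊎
   (∃[ m ] (D ≡ 4 ℕ.* m × (m % 4 ≡ 2 ⊎ m % 4 ≡ 3) × SquareFree m)))

-- Elements of O_K (K of discriminant D) are written (a + b√D)/2 with a,b ∈ ℤ
-- and a ≡ bD (mod 2).  Trace = a, norm = (a² - D b²)/4.

InOK : ℕ → ℤ → ℤ → Set
InOK D a b = (+ 2) ∣ (a - b * (+ D))

Trace : ℕ → ℤ → ℤ → ℤ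
Trace D a b = a

Norm4 : ℕ → ℤ → ℤ → ℤ
Norm4 D a b = a * a - (+ D) * (b * b)

IsUnit : ℕ → ℤ → ℤ → Set
IsUnit D a b = InOK D a b × (Norm4 D a b ≡ + 4 ⊎ Norm4 D a b ≡ ℤ.- (+ 4))

IsUnitNormOne : ℕ → ℤ → ℤ → Set
IsUnitNormOne D a b = InOK D a b × Norm4 D a b ≡ + 4

-- the real number p + q√D is > 0  (D > 0 not a square)
PosRe : ℕ → ℤ → ℤ → Set
PosRe D p q =
  (p ≥ + 0 × q ≥ + 0 × (p > + 0 ⊎ q > + 0)) ⊎
  (p > + 0 × q < + 0 × p * p > (+ D) * (q * q)) ⊎
  (p < + 0 × q > + 0 × (+ D) * (q * q) > p * p)

NonNegRe : ℕ → ℤ → ℤ → Set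
NonNegRe D p q = PosRe D p q ⊎ (p ≡ + 0 × q ≡ + 0)

-- (a + b√D)/2 > 1   iff  (a - 2) + b√D > 0
GtOne : ℕ → ℤ → ℤ → Set
GtOne D a b = PosRe D (a - + 2) b

LeRe : ℕ → ℤ → ℤ → ℤ → ℤ → Set
LeRe D a b a' b' = NonNegRe D (a' - a) (b' - b)

IsFundUnit : ℕ → ℤ → ℤ → Set
IsFundUnit D a b =
  IsUnit D a b × GtOne D a b ×
  (∀ a' b' → IsUnit D a' b' → GtOne D a' b' → LeRe D a b a' b')

IsTotPosFundUnit : ℕ → ℤ → ℤ → Set
IsTotPosFundUnit D a b =
  IsUnitNormOne D a b × GtOne D a b ×
  (∀ a' b' → IsUnitNormOne D a' b' → GtOne D a' b' → LeRe D a b a' b')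

OddZ : ℤ → Set
OddZ a = ¬ ((+ 2) ∣ a)

FundUnitTraceOdd : ℕ → Set
FundUnitTraceOdd D = ∃[ a ] ∃[ b ] (IsFundUnit D a b × OddZ (Trace D a b))

CountsTo : (ℕ → Set) → ℕ → ℕ → Set
CountsTo P X n =
  Σ (List ℕ) λ L → Unique L ×
    (∀ D → (D ∈ L) ⇔ (0 ℕ.< D × D ℕ.< X × RealQuadDisc D × P D)) ×
    length L ≡ n

Always : ℕ → Set
Always _ = ⊤

{-# OPTIONS --safe #-}
-- The units greater than 1 are the (a + b√D)/2 with a, b > 0 and a² - Db² = ±4, and comparing them amounts to comparing
-- a. All units are ± powers of the least one, so one unit of odd trace forces the least one to have odd trace, and the
-- totally positive fundamental unit is the least one or its square.
--
-- A unit of odd trace forces D ≡ 5 (mod 8). Multiplication by squares of odd numbers preserves the classes D ≡ 1, D ≡ 5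
-- (mod 8) and D ≡ 8, 12 (mod 16), so inclusion-exclusion over odd squares shows that each contains a third of the real
-- quadratic discriminants below X, up to O(√X). This is the upper bound.
--
-- For the lower bound, let D ≡ 5 (mod 8) have no unit of odd trace, and let δ = t + u√D be the least solution of
-- t² - Du² = 1. The coefficient of √D in 2δz³, for z running over the ring of integers, is a binary cubic form
-- px³ + 3qx²y + 3rxy² + sy³ with p, s even and q, r odd, whose discriminant is -27D. It does not represent 0, since δ is
-- not a cube. A basis that is reduced with respect to the definite quadratic factor of the form (computed from a rational
-- approximation h + k√D to the real root) has p² + 3(q² - pr) ≤ √D. With A = q² - pr and G = p²s - 3pqr + 2q³ the syzygy
-- G² = 4A³ + p²D confines s to a short interval once p, q, r are fixed. Summing over an explicit grid of cells in the
-- (p, A)-plane, together with dyadic estimates near the cusp p = 0, and over the residue classes with 9 ∤ D, bounds the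
-- number of such D < X by 0.0739X. At least 0.0956X square-free D < X have D ≡ 5 (mod 8), so more than 2/9 of
-- these, which make up a third of all real quadratic discriminants below X, have a unit of odd trace.
module Submission where

-- The Hessian of the cubic form is the norm form, which is indefinite. Reduction therefore has to
-- use the definite factor, whose coefficients involve the cube root of δ. Replacing that root by
-- `h + k√D` perturbs the bound on `p² + 3A` by a relative error `1/(3D)`, which integrality
-- removes.
--
-- The constants answer to one inequality. If `M` discriminants are 5 modulo 8 and `B` of them are
-- exceptional, then `n ≥ M - B`, and `27n ≥ 2m` with `m ≈ 3M` requires `B ≤ 7M/9`, which is about
-- `0.0744X` for the available bound on `M`. Without a congruence condition the same cells would
-- give about `0.092X`; discarding the 153 of 729 residue classes with `9 ∣ D` multiplies this by
-- 64/81 and brings it under the threshold.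
--
-- Least units and least Pell solutions come from well-foundedness without a decision procedure,
-- hence only up to double negation. This is harmless, because the exceptions enter only through a
-- bound on the length of a list, which is a decidable statement.

-- Inequalities between integers

module IntegerOrder where

  open import Data.Nat as ℕ using (ℕ; zero; suc; z≤n; s≤s)
  import Data.Nat.Properties as ℕ
  open import Data.Integer hiding (suc)
  open import Data.Integer.Properties
  open import Data.Integer.DivMod using (n%ℕd<d; a≡a%ℕn+[a/ℕn]*n)
  open import Data.Integer.Solver
  open import Data.Product using (∃-syntax; _×_; _,_)
  open import Data.Empty using (⊥-elim)
  open import Relation.Nullary using (yes; no)
  open import Relation.Binary.PropositionalEquality

  nonneg-+ : ∀ {i j} → + 0 ≤ i → + 0 ≤ j → + 0 ≤ i + j
  nonneg-+ = +-mono-≤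

  nonneg-* : ∀ {i j} → + 0 ≤ i → + 0 ≤ j → + 0 ≤ i * j
  nonneg-* {+ m} {+ n} _ _ = subst (+ 0 ≤_) (pos-* m n) (+≤+ z≤n)

  nonneg-scale : ∀ n {j} → + 0 ≤ j → + 0 ≤ + n * j
  nonneg-scale n = nonneg-* {+ n} (+≤+ z≤n)

  nonneg-sq : ∀ i → + 0 ≤ i * i
  nonneg-sq (+ n) = nonneg-* {+ n} {+ n} (+≤+ z≤n) (+≤+ z≤n)
  nonneg-sq -[1+ n ] = +≤+ z≤n

  -- The template for most inequalities below: `E` is a visibly nonnegative certificate, and the
  -- ring solver checks that it equals the difference.
  ≤-by-diff : ∀ {a b} E → + 0 ≤ E → b - a ≡ E → a ≤ b
  ≤-by-diff E 0≤E eq = 0≤i-j⇒j≤i (subst (+ 0 ≤_) (sym eq) 0≤E)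

  ≤⇒nonneg : ∀ {a b} → a ≤ b → + 0 ≤ b - a
  ≤⇒nonneg = i≤j⇒0≤j-i

  <⇒1≤diff : ∀ {a b} → a < b → + 1 ≤ b - a
  <⇒1≤diff {a} {b} a<b = ≤-by-diff (b - (+ 1 + a)) (≤⇒nonneg (i<j⇒suc[i]≤j a<b))
    (solve 2 (λ a b → b :- a :- con (+ 1) := b :- (con (+ 1) :+ a)) refl a b)
    where open +-*-Solver

  1≤diff⇒< : ∀ {a b} → + 1 ≤ b - a → a < b
  1≤diff⇒< {a} {b} h = suc[i]≤j⇒i<j (≤-by-diff (b - a - + 1) (≤⇒nonneg h)
    (solve 2 (λ a b → b :- (con (+ 1) :+ a) := b :- a :- con (+ 1)) refl a b))
    where open +-*-Solver

  <-by-diff : ∀ {a b} E → + 1 ≤ E → b - a ≡ E → a < b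
  <-by-diff E 1≤E eq = 1≤diff⇒< (subst (+ 1 ≤_) (sym eq) 1≤E)

  0<⇒1≤ : ∀ {a} → + 0 < a → + 1 ≤ a
  0<⇒1≤ = i<j⇒suc[i]≤j

  1≤⇒0< : ∀ {a} → + 1 ≤ a → + 0 < a
  1≤⇒0< = suc[i]≤j⇒i<j

  1≤⇒0≤ : ∀ {a} → + 1 ≤ a → + 0 ≤ a
  1≤⇒0≤ = ≤-trans (+≤+ z≤n)

  pos-*′ : ∀ {i j} → + 1 ≤ i → + 1 ≤ j → + 1 ≤ i * j
  pos-*′ {+ suc m} {+ suc n} _ _ = +≤+ (s≤s z≤n)
  pos-*′ {+ zero} (+≤+ ()) _
  pos-*′ {+ suc m} {+ zero} _ (+≤+ ())

  *-mono-≤′ : ∀ {a b c d} → + 0 ≤ a → + 0 ≤ d → a ≤ b → c ≤ d → a * c ≤ b * d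
  *-mono-≤′ {a} {b} {c} {d} 0≤a 0≤d a≤b c≤d =
    ≤-by-diff ((b - a) * d + a * (d - c)) (nonneg-+ (nonneg-* (≤⇒nonneg a≤b) 0≤d) (nonneg-* 0≤a (≤⇒nonneg c≤d)))
      (solve 4 (λ a b c d → b :* d :- a :* c := (b :- a) :* d :+ a :* (d :- c)) refl a b c d)
    where open +-*-Solver

  *-cancel-≤′ : ∀ {a b c} → + 1 ≤ c → c * a ≤ c * b → a ≤ b
  *-cancel-≤′ {a} {b} {+ suc c} _ h = *-cancelˡ-≤-pos a b (+ suc c) h
  *-cancel-≤′ {a} {b} {+ zero} (+≤+ ()) _

  sq-≤⇒≤ : ∀ {a b} → + 0 ≤ b → a * a ≤ b * b → a ≤ b
  sq-≤⇒≤ {a} {b} 0≤b h with a ≤? b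
  ... | yes a≤b = a≤b
  ... | no a≰b = ⊥-elim (<⇒≱ (1≤diff⇒< (≤-trans (pos-*′ 1≤a-b 1≤a+b) (≤-reflexive
          (solve 2 (λ a b → (a :- b) :* (a :+ b) := a :* a :- b :* b) refl a b)))) h)
    where
    open +-*-Solver
    1≤a-b = <⇒1≤diff (≰⇒> a≰b)
    1≤a+b : + 1 ≤ a + b
    1≤a+b = ≤-trans 1≤a-b (≤-by-diff (b + b) (nonneg-+ 0≤b 0≤b) (solve 2 (λ a b → a :+ b :- (a :- b) := b :+ b) refl a b))

  -- The translation step of Gauss reduction. The remainder of `b + a` modulo `2a` lies in
  -- `[0, 2a)`, and shifting it back by `a` centres it.
  centred-residue : ∀ {a} b → + 1 ≤ a → ∃[ k ] (- a ≤ b + + 2 * (a * k) × b + + 2 * (a * k) ≤ a)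
  centred-residue {+ suc a} b _ = - q ,
      ≤-by-diff (+ r) (+≤+ z≤n) lower ,
      ≤-by-diff (+ d - + r) (≤⇒nonneg (+≤+ (ℕ.<⇒≤ (n%ℕd<d (b + + suc a) d)))) upper
    where
    open +-*-Solver
    d = 2 ℕ.* suc a
    r = (b + + suc a) %ℕ d
    q = (b + + suc a) /ℕ d
    eq : b + + suc a ≡ + r + q * (+ 2 * + suc a)
    eq = trans (a≡a%ℕn+[a/ℕn]*n (b + + suc a) d) (cong (λ w → + r + q * w) (pos-* 2 (suc a)))
    eq′ : + r ≡ b + + suc a - q * (+ 2 * + suc a)
    eq′ = trans (solve 2 (λ r x → r := r :+ x :- x) refl (+ r) (q * (+ 2 * + suc a)))
                (cong (λ w → w - q * (+ 2 * + suc a)) (sym eq))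
    lower : b + + 2 * (+ suc a * - q) - - + suc a ≡ + r
    lower = trans (solve 3 (λ a b q → b :+ con (+ 2) :* (a :* :- q) :- :- a := b :+ a :- q :* (con (+ 2) :* a)) refl (+ suc a) b q) (sym eq′)
    upper : + suc a - (b + + 2 * (+ suc a * - q)) ≡ + d - + r
    upper = trans (solve 3 (λ a b q → a :- (b :+ con (+ 2) :* (a :* :- q)) := con (+ 2) :* a :- (b :+ a :- q :* (con (+ 2) :* a))) refl (+ suc a) b q)
                  (cong₂ _-_ (sym (pos-* 2 (suc a))) (sym eq′))
  centred-residue {+ zero} b (+≤+ ())

-- Gauss reduction of definite binary quadratic forms

module Reduction where

  open import Data.Nat as ℕ using (zero; suc; z≤n; s≤s)
  open import Data.Integer hiding (suc)
  open import Data.Integer.Properties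
  open import Data.Integer.Solver
  open import Data.Product using (∃-syntax; _×_; _,_)
  open import Data.Empty using (⊥-elim)
  open import Relation.Nullary using (yes; no)
  open import Relation.Binary.PropositionalEquality
  open IntegerOrder
  open +-*-Solver

  quadForm : ℤ → ℤ → ℤ → ℤ → ℤ → ℤ
  quadForm a b c x y = a * (x * x) + b * (x * y) + c * (y * y)

  negDisc : ℤ → ℤ → ℤ → ℤ
  negDisc a b c = + 4 * (a * c) - b * b

  -- Only the first basis vector has to be short. The second one is recorded because the cubic form
  -- is later rewritten in the whole basis.
  SmallBasis : ℤ → ℤ → ℤ → Set
  SmallBasis a b c = ∃[ x₀ ] ∃[ y₀ ] ∃[ x₁ ] ∃[ y₁ ]
    (x₀ * y₁ - x₁ * y₀ ≡ + 1
     × + 1 ≤ quadForm a b c x₀ y₀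
     × + 3 * (quadForm a b c x₀ y₀ * quadForm a b c x₀ y₀) ≤ negDisc a b c)

  negDisc-translate : ∀ a b c k → negDisc a (b + + 2 * (a * k)) (a * (k * k) + b * k + c) ≡ negDisc a b c
  negDisc-translate = solve 4 (λ a b c k →
    con (+ 4) :* (a :* (a :* (k :* k) :+ b :* k :+ c)) :- (b :+ con (+ 2) :* (a :* k)) :* (b :+ con (+ 2) :* (a :* k))
    := con (+ 4) :* (a :* c) :- b :* b) refl

  negDisc-swap : ∀ a b c → negDisc c (- b) a ≡ negDisc a b c
  negDisc-swap = solve 3 (λ a b c → con (+ 4) :* (c :* a) :- (:- b) :* (:- b) := con (+ 4) :* (a :* c) :- b :* b) refl

  -- A translation by `k` followed by a quarter turn, which moves the last coefficient to the front.
  quadForm-step : ∀ a b c k x y →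
    quadForm (a * (k * k) + b * k + c) (- (b + + 2 * (a * k))) a x y ≡ quadForm a b c (k * x - y) x
  quadForm-step = solve 6 (λ a b c k x y →
    (a :* (k :* k) :+ b :* k :+ c) :* (x :* x) :+ (:- (b :+ con (+ 2) :* (a :* k))) :* (x :* y) :+ a :* (y :* y)
    := a :* ((k :* x :- y) :* (k :* x :- y)) :+ b :* ((k :* x :- y) :* x) :+ c :* (x :* x)) refl

  third-coefficient-pos : ∀ {a b c} → + 1 ≤ a → + 1 ≤ negDisc a b c → + 1 ≤ c
  third-coefficient-pos {a} {b} {c} 1≤a h with + 1 ≤? c
  ... | yes 1≤c = 1≤c
  ... | no 1≰c = ⊥-elim (<⇒≱ (1≤⇒0< (≤-trans h (≤-by-diff (+ 4 * (a * (+ 0 - c)) + b * b)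
        (nonneg-+ (nonneg-scale 4 (nonneg-* (1≤⇒0≤ 1≤a) (≤⇒nonneg c≤0))) (nonneg-sq b))
        (solve 3 (λ a b c → con (+ 0) :- (con (+ 4) :* (a :* c) :- b :* b) := con (+ 4) :* (a :* (con (+ 0) :- c)) :+ b :* b) refl a b c)))) ≤-refl)
    where
    c≤0 : c ≤ + 0
    c≤0 = i<j⇒i≤pred[j] (≰⇒> 1≰c)

  unit-basis-small : ∀ {a b c} → + 1 ≤ a → - a ≤ b → b ≤ a → a ≤ c → + 3 * (a * a) ≤ negDisc a b c
  unit-basis-small {a} {b} {c} 1≤a lo hi a≤c =
    ≤-by-diff (+ 4 * (a * (c - a)) + (b - - a) * (a - b))
      (nonneg-+ (nonneg-scale 4 (nonneg-* (1≤⇒0≤ 1≤a) (≤⇒nonneg a≤c))) (nonneg-* (≤⇒nonneg lo) (≤⇒nonneg hi)))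
      (solve 3 (λ a b c → con (+ 4) :* (a :* c) :- b :* b :- con (+ 3) :* (a :* a)
         := con (+ 4) :* (a :* (c :- a)) :+ (b :- :- a) :* (a :- b)) refl a b c)

  smallBasis-step : ∀ a b c k → SmallBasis (a * (k * k) + b * k + c) (- (b + + 2 * (a * k))) a → SmallBasis a b c
  smallBasis-step a b c k (x₀ , y₀ , x₁ , y₁ , det , pos , small) =
    k * x₀ - y₀ , x₀ , k * x₁ - y₁ , x₁ ,
    trans (solve 5 (λ k x₀ y₀ x₁ y₁ → (k :* x₀ :- y₀) :* x₁ :- (k :* x₁ :- y₁) :* x₀ := x₀ :* y₁ :- x₁ :* y₀) refl k x₀ y₀ x₁ y₁) det ,
    subst (+ 1 ≤_) eq pos ,
    subst₂ _≤_ (cong (λ w → + 3 * (w * w)) eq)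
      (trans (negDisc-swap a (b + + 2 * (a * k)) (a * (k * k) + b * k + c)) (negDisc-translate a b c k)) small
    where
    eq : quadForm (a * (k * k) + b * k + c) (- (b + + 2 * (a * k))) a x₀ y₀ ≡ quadForm a b c (k * x₀ - y₀) x₀
    eq = quadForm-step a b c k x₀ y₀

  smallBasis-unit : ∀ a b c → + 1 ≤ a → + 3 * (a * a) ≤ negDisc a b c → SmallBasis a b c
  smallBasis-unit a b c 1≤a h = + 1 , + 0 , + 0 , + 1 , refl ,
    subst (+ 1 ≤_) (sym eq) 1≤a , subst (_≤ negDisc a b c) (cong (λ w → + 3 * (w * w)) (sym eq)) h
    where
    eq : quadForm a b c (+ 1) (+ 0) ≡ a
    eq = solve 3 (λ a b c → a :* (con (+ 1) :* con (+ 1)) :+ b :* (con (+ 1) :* con (+ 0)) :+ c :* (con (+ 0) :* con (+ 0)) := a) refl a b c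

  -- After centring the middle coefficient, either the first coefficient is at most the last, where
  -- `4ac - b² ≥ 3a²`, or the two are exchanged and the first coefficient drops. `n` bounds it and
  -- drives the induction.
  smallBasis : ∀ n a b c → a ≤ + n → + 1 ≤ a → + 1 ≤ negDisc a b c → SmallBasis a b c
  smallBasis zero a b c a≤n 1≤a _ = ⊥-elim (<⇒≱ (1≤⇒0< 1≤a) a≤n)
  smallBasis (suc n) a b c a≤n 1≤a 1≤Δ with centred-residue b 1≤a
  ... | k , lo , hi with a ≤? a * (k * k) + b * k + c
  ... | yes a≤c′ = smallBasis-unit a b c 1≤a (subst (+ 3 * (a * a) ≤_) (negDisc-translate a b c k) (unit-basis-small 1≤a lo hi a≤c′))
  ... | no a≰c′ = smallBasis-step a b c k (smallBasis n (a * (k * k) + b * k + c) (- (b + + 2 * (a * k))) a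
        (≤-trans (i<j⇒i≤pred[j] (≰⇒> a≰c′)) (pred-mono a≤n))
        (third-coefficient-pos {a} {b + + 2 * (a * k)} 1≤a (subst (+ 1 ≤_) (sym (negDisc-translate a b c k)) 1≤Δ))
        (subst (+ 1 ≤_) (sym (trans (negDisc-swap a (b + + 2 * (a * k)) (a * (k * k) + b * k + c)) (negDisc-translate a b c k))) 1≤Δ))

  -- Q₁ = D y² and Q₂ = β² stand for the squares of the two components of α³; the cross term is absorbed by AM-GM.
  square-sum-bound : ∀ {D P v y β g e N₃} → + 1 ≤ D → + 0 ≤ P → + 0 ≤ P + v → + 0 ≤ P - + 3 * v → + 0 ≤ e → e ≤ g →
    D * (y * y) ≡ P * P * (P - + 3 * v) → β * β ≡ (P + v) * ((P - + 2 * v) * (P - + 2 * v)) →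
    g * g - D * (e * e) ≡ N₃ →
    D * ((g * y + e * β) * (g * y + e * β)) ≤ N₃ * (P * P * (P - + 3 * v)) + + 12 * (D * (g * e * (P * P * P)))
  square-sum-bound {D} {P} {v} {y} {β} {g} {e} {N₃} 1≤D 0≤P 0≤P+v 0≤P-3v 0≤e e≤g yEq βEq refl =
    ≤-by-diff E 0≤E eq
    where
    Q₁ = P * P * (P - + 3 * v)
    P₃ = P * P * P
    0≤D = 1≤⇒0≤ 1≤D
    0≤P₃ = nonneg-* (nonneg-* 0≤P 0≤P) 0≤P
    -- The constraints `-P ≤ v ≤ P/3` make both squares `O(P³)`: the defects of `Q₁ ≤ 4P³` and
    -- `β² ≤ 2P³` factor as `3P²(P + v)` and `(P - v)(P + 2v)²`.
    Q₁≤ : + 0 ≤ + 4 * P₃ - Q₁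
    Q₁≤ = subst (+ 0 ≤_) (solve 2 (λ P v → con (+ 3) :* (P :* P :* (P :+ v)) := con (+ 4) :* (P :* P :* P) :- P :* P :* (P :- con (+ 3) :* v)) refl P v)
            (nonneg-scale 3 (nonneg-* (nonneg-* 0≤P 0≤P) 0≤P+v))
    0≤4P-v : + 0 ≤ P - v
    0≤4P-v = *-cancel-≤′ {c = + 3} (+≤+ (s≤s z≤n)) (subst (+ 0 ≤_)
       (solve 2 (λ P v → con (+ 2) :* P :+ (P :- con (+ 3) :* v) := con (+ 3) :* (P :- v)) refl P v) (nonneg-+ (nonneg-scale 2 0≤P) 0≤P-3v))
    β²≤ : + 0 ≤ + 2 * P₃ - β * β
    β²≤ = subst (+ 0 ≤_) (trans (solve 2 (λ P v → (P :- v) :* ((P :+ con (+ 2) :* v) :* (P :+ con (+ 2) :* v))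
              := con (+ 2) :* (P :* P :* P) :- (P :+ v) :* ((P :- con (+ 2) :* v) :* (P :- con (+ 2) :* v))) refl P v)
              (cong (λ w → + 2 * P₃ - w) (sym βEq)))
            (nonneg-* 0≤4P-v (nonneg-sq (P + + 2 * v)))
    cross : + 0 ≤ + 6 * (D * P₃) - + 2 * (D * (y * β))
    cross = subst (+ 0 ≤_) eq′ (nonneg-+ (nonneg-+ (nonneg-+ (nonneg-* 0≤D (nonneg-sq (y - β))) Q₁≤) (nonneg-* 0≤D β²≤)) (nonneg-scale 4 (nonneg-* (≤⇒nonneg 1≤D) 0≤P₃)))
      where
      eq′ : D * ((y - β) * (y - β)) + (+ 4 * P₃ - Q₁) + D * (+ 2 * P₃ - β * β) + + 4 * ((D - + 1) * P₃) ≡ + 6 * (D * P₃) - + 2 * (D * (y * β))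
      eq′ = trans (solve 5 (λ D y β P₃ Q → D :* ((y :- β) :* (y :- β)) :+ (con (+ 4) :* P₃ :- Q) :+ D :* (con (+ 2) :* P₃ :- β :* β) :+ con (+ 4) :* ((D :- con (+ 1)) :* P₃)
                := con (+ 6) :* (D :* P₃) :- con (+ 2) :* (D :* (y :* β)) :+ (D :* (y :* y) :- Q)) refl D y β P₃ Q₁)
              (trans (cong (λ w → + 6 * (D * P₃) - + 2 * (D * (y * β)) + (w - Q₁)) yEq)
                (solve 2 (λ a Q → a :+ (Q :- Q) := a) refl (+ 6 * (D * P₃) - + 2 * (D * (y * β))) Q₁))
    0≤g = ≤-trans 0≤e e≤g
    E = g * e * (+ 6 * (D * P₃) - + 2 * (D * (y * β))) + D * (e * e) * (+ 4 * P₃ - Q₁) + D * (e * e) * (+ 2 * P₃ - β * β) + + 6 * (D * (e * (g - e) * P₃))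
    0≤E : + 0 ≤ E
    0≤E = nonneg-+ (nonneg-+ (nonneg-+ (nonneg-* (nonneg-* 0≤g 0≤e) cross)
            (nonneg-* (nonneg-* 0≤D (nonneg-sq e)) Q₁≤)) (nonneg-* (nonneg-* 0≤D (nonneg-sq e)) β²≤))
            (nonneg-scale 6 (nonneg-* 0≤D (nonneg-* (nonneg-* 0≤e (≤⇒nonneg e≤g)) 0≤P₃)))
    eq : (g * g - D * (e * e)) * Q₁ + + 12 * (D * (g * e * P₃)) - D * ((g * y + e * β) * (g * y + e * β)) ≡ E
    eq = trans (solve 7 (λ D g e y β P₃ Q →
          (g :* g :- D :* (e :* e)) :* Q :+ con (+ 12) :* (D :* (g :* e :* P₃)) :- D :* ((g :* y :+ e :* β) :* (g :* y :+ e :* β))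
          := (g :* e :* (con (+ 6) :* (D :* P₃) :- con (+ 2) :* (D :* (y :* β))) :+ D :* (e :* e) :* (con (+ 4) :* P₃ :- Q) :+ D :* (e :* e) :* (con (+ 2) :* P₃ :- β :* β) :+ con (+ 6) :* (D :* (e :* (g :- e) :* P₃)))
             :+ g :* g :* (Q :- D :* (y :* y))) refl D g e y β P₃ Q₁)
        (trans (cong (λ w → E + g * g * (Q₁ - w)) yEq) (solve 3 (λ a g Q → a :+ g :* g :* (Q :- Q) := a) refl E g Q₁))

-- The bound on `p² + 3A` for an approximately reduced basis

module ReducedBound where

  open import Data.Nat as ℕ using (z≤n; s≤s)
  open import Data.Integer hiding (suc)
  open import Data.Integer.Properties
  open import Data.Integer.Solver
  open import Data.Empty using (⊥-elim)
  open import Relation.Nullary using (yes; no)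
  open import Relation.Binary.PropositionalEquality
  open IntegerOrder
  open Reduction
  open +-*-Solver

  -- `e * M ≤ g` and `g² ≤ 2N³` turn the error `12DgeP³` into `24DN³P³/M`. Then a factor `P²` on the
  -- right is replaced by the larger `N²D`, which cancels against the left.
  scaled-bound : ∀ {D P v g e N p M} → + 1 ≤ D → + 0 ≤ P → + 0 ≤ P - + 3 * v → + 1 ≤ N → + 0 ≤ e → + 0 ≤ g →
    + 0 ≤ M → e * M ≤ g → P * P ≤ N * N * D → g * g ≤ + 2 * (N * N * N) →
    D * ((N * N * N * p) * (N * N * N * p)) ≤ N * N * N * (P * P * (P - + 3 * v)) + + 12 * (D * (g * e * (P * P * P))) →
    M * (N * (p * p)) ≤ M * (P - + 3 * v) + + 24 * D * P
  scaled-bound {D} {P} {v} {g} {e} {N} {p} {M} 1≤D 0≤P 0≤w 1≤N 0≤e 0≤g 0≤M eM≤g P²≤ g²≤ h =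
    *-cancel-≤′ {c = N₃ * (N * N * D)} (pos-*′ 1≤N₃ (pos-*′ (pos-*′ 1≤N 1≤N) 1≤D)) (≤-trans (≤-reflexive lhs) (≤-trans first second))
    where
    N₃ = N * N * N
    w = P - + 3 * v
    P₃ = P * P * P
    1≤N₃ : + 1 ≤ N₃
    1≤N₃ = pos-*′ (pos-*′ 1≤N 1≤N) 1≤N
    0≤D = 1≤⇒0≤ 1≤D
    0≤P₃ = nonneg-* (nonneg-* 0≤P 0≤P) 0≤P
    lhs : N₃ * (N * N * D) * (M * (N * (p * p))) ≡ M * (D * ((N₃ * p) * (N₃ * p)))
    lhs = solve 4 (λ N D M p → N :* N :* N :* (N :* N :* D) :* (M :* (N :* (p :* p))) := M :* (D :* ((N :* N :* N :* p) :* (N :* N :* N :* p)))) refl N D M p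
    first : M * (D * ((N₃ * p) * (N₃ * p))) ≤ N₃ * (M * (P * P * w) + + 24 * (D * P₃))
    first = ≤-trans (*-mono-≤′ 0≤M (nonneg-+ (nonneg-* (1≤⇒0≤ 1≤N₃) (nonneg-* (nonneg-* 0≤P 0≤P) 0≤w)) (nonneg-scale 12 (nonneg-* 0≤D (nonneg-* (nonneg-* 0≤g 0≤e) 0≤P₃)))) ≤-refl h)
      (≤-by-diff (+ 12 * (D * (g * (g - e * M) * P₃)) + + 12 * (D * ((+ 2 * N₃ - g * g) * P₃)))
         (nonneg-+ (nonneg-scale 12 (nonneg-* 0≤D (nonneg-* (nonneg-* 0≤g (≤⇒nonneg eM≤g)) 0≤P₃)))
                   (nonneg-scale 12 (nonneg-* 0≤D (nonneg-* (≤⇒nonneg g²≤) 0≤P₃))))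
         (solve 7 (λ M D N₃ Q P₃ g e → N₃ :* (M :* Q :+ con (+ 24) :* (D :* P₃)) :- M :* (N₃ :* Q :+ con (+ 12) :* (D :* (g :* e :* P₃)))
            := con (+ 12) :* (D :* (g :* (g :- e :* M) :* P₃)) :+ con (+ 12) :* (D :* ((con (+ 2) :* N₃ :- g :* g) :* P₃))) refl M D N₃ (P * P * w) P₃ g e))
    second : N₃ * (M * (P * P * w) + + 24 * (D * P₃)) ≤ N₃ * (N * N * D) * (M * w + + 24 * D * P)
    second = ≤-by-diff (N₃ * ((N * N * D - P * P) * (M * w + + 24 * D * P)))
      (nonneg-* (1≤⇒0≤ 1≤N₃) (nonneg-* (≤⇒nonneg P²≤) (nonneg-+ (nonneg-* 0≤M 0≤w) (nonneg-* (nonneg-scale 24 0≤D) 0≤P))))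
      (solve 6 (λ N₃ n D M w P → N₃ :* (n :* D) :* (M :* w :+ con (+ 24) :* D :* P) :- N₃ :* (M :* (P :* P :* w) :+ con (+ 24) :* (D :* (P :* P :* P)))
        := N₃ :* ((n :* D :- P :* P) :* (M :* w :+ con (+ 24) :* D :* P))) refl N₃ (N * N) D M w P)

  -- `(3D + 1)²D/(3D)²` exceeds `D` by `2/3 + 1/(9D)`, which is less than 1, so the integer `j²`
  -- cannot notice the approximation error.
  rounding : ∀ {D j} → + 1 ≤ D → (+ 3 * D) * (+ 3 * D) * (j * j) ≤ (+ 3 * D + + 1) * (+ 3 * D + + 1) * D → j * j ≤ D
  rounding {D} {j} 1≤D h with j * j ≤? D
  ... | yes p = p
  ... | no ¬p = ⊥-elim (<⇒≱ (<-by-diff (+ 2 * (D * D) + E) (≤-trans (pos-*′ {+ 2} (+≤+ (s≤s z≤n)) (pos-*′ 1≤D 1≤D))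
          (≤-by-diff E 0≤E (solve 2 (λ a E → a :+ E :- a := E) refl (+ 2 * (D * D)) E)))
          (solve 2 (λ D J → (con (+ 3) :* D) :* (con (+ 3) :* D) :* J :- (con (+ 3) :* D :+ con (+ 1)) :* (con (+ 3) :* D :+ con (+ 1)) :* D
             := con (+ 2) :* (D :* D) :+ (con (+ 9) :* (D :* D) :* (J :- D :- con (+ 1)) :+ D :* (D :- con (+ 1)))) refl D (j * j))) h)
    where
    0≤D = 1≤⇒0≤ 1≤D
    E = + 9 * (D * D) * (j * j - D - + 1) + D * (D - + 1)
    0≤E : + 0 ≤ E
    0≤E = nonneg-+ (nonneg-* (nonneg-scale 9 (nonneg-sq D)) (≤⇒nonneg (<⇒1≤diff (≰⇒> ¬p)))) (nonneg-* 0≤D (≤⇒nonneg 1≤D))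
  -- In the ideal case `e = 0` one has `g² = N³` and `Np² = P²(P - 3NA)/(N²D) ≤ P - 3NA`, so that
  -- `N(p² + 3A) ≤ P ≤ N√D`. An approximation of quality `24D · 3D` loses only the factor
  -- `1 + 1/(3D)`, and `rounding` recovers the exact bound.
  reduced-bound : ∀ D {P A N g e p G α₀ α₁} → + 1 ≤ D → + 0 ≤ P → + 1 ≤ N → + 0 ≤ e → + 0 ≤ g →
    e * (+ 24 * D * (+ 3 * D)) ≤ g → P * P ≤ N * N * D →
    g * p - e * G ≡ α₁ * P → g * G - e * (D * p) ≡ α₀ * (P - + 2 * (N * A)) →
    g * g - D * (e * e) ≡ N * N * N → α₀ * α₀ ≡ P + N * A → D * (α₁ * α₁) ≡ P - + 3 * (N * A) →
    + 0 ≤ p * p + + 3 * A → (p * p + + 3 * A) * (p * p + + 3 * A) ≤ D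
  reduced-bound D {P} {A} {N} {g} {e} {p} {G} {α₀} {α₁} 1≤D 0≤P 1≤N 0≤e 0≤g eM≤g P²≤ E₁ E₂ E₃ E₄ E₅ 0≤j =
    rounding {D} {j} 1≤D (*-cancel-≤′ {c = N * N} (pos-*′ 1≤N 1≤N) squared)
    where
    M = + 24 * D * (+ 3 * D)
    v = N * A
    j = p * p + + 3 * A
    y = α₁ * P
    β = α₀ * (P - + 2 * v)
    0≤D = 1≤⇒0≤ 1≤D
    0≤N = 1≤⇒0≤ 1≤N
    1≤M : + 1 ≤ M
    1≤M = pos-*′ (pos-*′ {+ 24} (+≤+ (s≤s z≤n)) 1≤D) (pos-*′ {+ 3} (+≤+ (s≤s z≤n)) 1≤D)
    D≤M : + 0 ≤ M - + 2 * D
    D≤M = subst (+ 0 ≤_) (solve 1 (λ D → con (+ 2) :* (D :* (D :- con (+ 1))) :+ con (+ 70) :* (D :* D) := con (+ 24) :* D :* (con (+ 3) :* D) :- con (+ 2) :* D) refl D)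
           (nonneg-+ (nonneg-scale 2 (nonneg-* 0≤D (≤⇒nonneg 1≤D))) (nonneg-scale 70 (nonneg-sq D)))
    0≤P+v = subst (+ 0 ≤_) E₄ (nonneg-sq α₀)
    0≤w = subst (+ 0 ≤_) E₅ (nonneg-* 0≤D (nonneg-sq α₁))
    e≤g : e ≤ g
    e≤g = ≤-trans (≤-by-diff (e * (M - + 1)) (nonneg-* 0≤e (≤⇒nonneg 1≤M)) (solve 2 (λ e M → e :* M :- e := e :* (M :- con (+ 1))) refl e M)) eM≤g
    g²≤ : g * g ≤ + 2 * (N * N * N)
    g²≤ = ≤-by-diff (g * (g - e * M) + e * M * (g - e) + e * e * (M - + 2 * D))
      (nonneg-+ (nonneg-+ (nonneg-* 0≤g (≤⇒nonneg eM≤g)) (nonneg-* (nonneg-* 0≤e (1≤⇒0≤ 1≤M)) (≤⇒nonneg e≤g))) (nonneg-* (nonneg-sq e) D≤M))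
      (trans (cong (λ n → + 2 * n - g * g) (sym E₃))
        (solve 4 (λ g D e M → con (+ 2) :* (g :* g :- D :* (e :* e)) :- g :* g := g :* (g :- e :* M) :+ e :* M :* (g :- e) :+ e :* e :* (M :- con (+ 2) :* D)) refl g D e M))
    -- The hypotheses `E₁` and `E₂` are linear equations in `p` and `G`. Eliminating `G` leaves the
    -- determinant `g² - De² = N³`.
    lin : N * N * N * p ≡ g * y + e * β
    lin = trans (cong (_* p) (sym E₃)) (trans
      (solve 5 (λ g e D p G → (g :* g :- D :* (e :* e)) :* p := g :* (g :* p :- e :* G) :+ e :* (g :* G :- e :* (D :* p))) refl g e D p G)
      (cong₂ (λ a b → g * a + e * b) E₁ E₂))
    yEq : D * (y * y) ≡ P * P * (P - + 3 * v)
    yEq = trans (solve 3 (λ D α P → D :* (α :* P :* (α :* P)) := P :* P :* (D :* (α :* α))) refl D α₁ P) (cong (P * P *_) E₅)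
    βEq : β * β ≡ (P + v) * ((P - + 2 * v) * (P - + 2 * v))
    βEq = trans (solve 2 (λ α b → α :* b :* (α :* b) := α :* α :* (b :* b)) refl α₀ (P - + 2 * v)) (cong (_* ((P - + 2 * v) * (P - + 2 * v))) E₄)
    bound : M * (N * (p * p)) ≤ M * (P - + 3 * v) + + 24 * D * P
    bound = scaled-bound 1≤D 0≤P 0≤w 1≤N 0≤e 0≤g (1≤⇒0≤ 1≤M) eM≤g P²≤ g²≤
      (subst (λ n → D * (n * n) ≤ N * N * N * (P * P * (P - + 3 * v)) + + 12 * (D * (g * e * (P * P * P)))) (sym lin)
        (square-sum-bound {D} {P} {v} {y} {β} {g} {e} 1≤D 0≤P 0≤P+v 0≤w 0≤e e≤g yEq βEq E₃))
    c = + 24 * D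
    linear : + 3 * D * (N * j) ≤ (+ 3 * D + + 1) * P
    linear = *-cancel-≤′ {c = c} (pos-*′ {+ 24} (+≤+ (s≤s z≤n)) 1≤D) (≤-by-diff _ (≤⇒nonneg bound)
       (solve 6 (λ N p A D P c → c :* ((con (+ 3) :* D :+ con (+ 1)) :* P) :- c :* (con (+ 3) :* D :* (N :* (p :* p :+ con (+ 3) :* A)))
       := c :* (con (+ 3) :* D) :* (P :- con (+ 3) :* (N :* A)) :+ c :* P :- c :* (con (+ 3) :* D) :* (N :* (p :* p))) refl N p A D P c))
    0≤MNj = nonneg-* (nonneg-scale 3 0≤D) (nonneg-* 0≤N 0≤j)
    T = + 3 * D
    squared : N * N * (T * T * (j * j)) ≤ N * N * ((T + + 1) * (T + + 1) * D)
    squared = ≤-trans (≤-reflexive (solve 3 (λ N M j → N :* N :* (M :* M :* (j :* j)) := M :* (N :* j) :* (M :* (N :* j))) refl N T j))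
      (≤-trans (*-mono-≤′ 0≤MNj (≤-trans 0≤MNj linear) linear linear)
        (≤-by-diff ((T + + 1) * (T + + 1) * (N * N * D - P * P))
          (nonneg-* (nonneg-sq (T + + 1)) (≤⇒nonneg P²≤))
          (solve 4 (λ n P c D → n :* (c :* c :* D) :- c :* P :* (c :* P) := c :* c :* (n :* D :- P :* P)) refl (N * N) P (T + + 1) D)))

-- Rational approximation to the cube root of a Pell unit

module Approximation where

  open import Data.Nat as ℕ using (ℕ; zero; suc; z≤n; s≤s)
  open import Data.Integer hiding (suc)
  open import Data.Integer.Properties
  open import Data.Integer.Solver
  open import Data.Product using (∃-syntax; _×_; _,_)
  open import Data.Empty using (⊥-elim)
  open import Relation.Nullary using (yes; no)
  open import Relation.Binary.PropositionalEquality
  open IntegerOrder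
  open +-*-Solver

  sign-change : (f : ℕ → ℤ) (H : ℕ) → f 0 < + 0 → + 0 ≤ f H → ∃[ h ] (f h < + 0 × + 0 ≤ f (suc h))
  sign-change f zero f0<0 0≤fH = ⊥-elim (<⇒≱ f0<0 0≤fH)
  sign-change f (suc H) f0<0 0≤fH with + 0 ≤? f H
  ... | yes p = sign-change f H f0<0 p
  ... | no ¬p = H , ≰⇒> ¬p , 0≤fH

  cubeRat cubeIrr : (D h k : ℤ) → ℤ
  cubeRat D h k = h * h * h + + 3 * (D * (h * (k * k)))
  cubeIrr D h k = + 3 * (h * h * k) + D * (k * k * k)

  -- (h + k√D)³ (t - u√D) = rationalPart - irrationalPart √D.
  rationalPart irrationalPart : (D t u h k : ℤ) → ℤ
  rationalPart D t u h k = t * cubeRat D h k - D * (u * cubeIrr D h k)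
  irrationalPart D t u h k = u * cubeRat D h k - t * cubeIrr D h k

  module _ (D t u : ℤ) (1≤D : + 1 ≤ D) (1≤t : + 1 ≤ t) (1≤u : + 1 ≤ u) (pell : t * t - D * (u * u) ≡ + 1) where

    private
      0≤D = 1≤⇒0≤ 1≤D
      0≤t = 1≤⇒0≤ 1≤t
      0≤u = 1≤⇒0≤ 1≤u

    irrationalPart-at-0 : ∀ k → + 1 ≤ k → irrationalPart D t u (+ 0) k < + 0
    irrationalPart-at-0 k 1≤k = <-by-diff (t * (D * (k * k * k))) (pos-*′ 1≤t (pos-*′ 1≤D (pos-*′ (pos-*′ 1≤k 1≤k) 1≤k)))
      (solve 4 (λ D t u k → con (+ 0) :- (u :* (con (+ 0) :* con (+ 0) :* con (+ 0) :+ con (+ 3) :* (D :* (con (+ 0) :* (k :* k)))) :- t :* (con (+ 3) :* (con (+ 0) :* con (+ 0) :* k) :+ D :* (k :* k :* k)))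
         := t :* (D :* (k :* k :* k))) refl D t u k)

    irrationalPart-large : ∀ k H → + 1 ≤ k → H ≡ t * k * (+ 3 + D) → + 0 ≤ H → k ≤ H → + 0 ≤ irrationalPart D t u H k
    irrationalPart-large k H 1≤k eq 0≤H k≤H = subst (+ 0 ≤_)
      (trans (solve 5 (λ D t u k H →
         (u :- con (+ 1)) :* (H :* H :* H) :+ con (+ 3) :* (u :* (D :* (H :* (k :* k)))) :+ t :* k :* D :* (H :* H :- k :* k)
         := u :* (H :* H :* H :+ con (+ 3) :* (D :* (H :* (k :* k)))) :- t :* (con (+ 3) :* (H :* H :* k) :+ D :* (k :* k :* k)) :+ H :* H :* (t :* k :* (con (+ 3) :+ D) :- H)) refl D t u k H)
       (trans (cong (λ w → irrationalPart D t u H k + H * H * (w - H)) (sym eq)) (solve 2 (λ x H → x :+ H :* H :* (H :- H) := x) refl (irrationalPart D t u H k) H)))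
      (nonneg-+ (nonneg-+ (nonneg-* (≤⇒nonneg 1≤u) (nonneg-* (nonneg-sq H) 0≤H)) (nonneg-scale 3 (nonneg-* 0≤u (nonneg-* 0≤D (nonneg-* 0≤H (nonneg-sq k))))))
        (nonneg-* (nonneg-* (nonneg-* 0≤t 0≤k) 0≤D) (≤⇒nonneg (*-mono-≤′ 0≤k 0≤H k≤H k≤H))))
      where
      0≤k = 1≤⇒0≤ 1≤k

    starting-point : ∀ k → + 1 ≤ k → + 0 ≤ t * k * (+ 3 + D) × k ≤ t * k * (+ 3 + D)
    starting-point k 1≤k = nonneg-* (nonneg-* 0≤t 0≤k) (nonneg-+ {+ 3} (+≤+ z≤n) 0≤D) ,
      ≤-by-diff (k * (t - + 1) + t * k * (+ 2 + D)) (nonneg-+ (nonneg-* 0≤k (≤⇒nonneg 1≤t)) (nonneg-* (nonneg-* 0≤t 0≤k) (nonneg-+ {+ 2} (+≤+ z≤n) 0≤D)))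
        (solve 3 (λ t k D → t :* k :* (con (+ 3) :+ D) :- k := k :* (t :- con (+ 1)) :+ t :* k :* (con (+ 2) :+ D)) refl t k D)
      where
      0≤k = 1≤⇒0≤ 1≤k

    -- Multiplication by `t + u√D` undoes multiplication by its inverse `t - u√D`.
    product-inverse : ∀ a b {g e} → g ≡ t * a - D * (u * b) → e ≡ u * a - t * b →
      g * t - D * (e * u) ≡ a × g * u - e * t ≡ b × g * g - D * (e * e) ≡ a * a - D * (b * b)
    product-inverse a b refl refl =
      trans (solve 5 (λ D t u a b → (t :* a :- D :* (u :* b)) :* t :- D :* ((u :* a :- t :* b) :* u) := (t :* t :- D :* (u :* u)) :* a) refl D t u a b) (unit a) ,
      trans (solve 5 (λ D t u a b → (t :* a :- D :* (u :* b)) :* u :- (u :* a :- t :* b) :* t := (t :* t :- D :* (u :* u)) :* b) refl D t u a b) (unit b) ,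
      trans (solve 5 (λ D t u a b → (t :* a :- D :* (u :* b)) :* (t :* a :- D :* (u :* b)) :- D :* ((u :* a :- t :* b) :* (u :* a :- t :* b)) := (t :* t :- D :* (u :* u)) :* (a :* a :- D :* (b :* b))) refl D t u a b)
        (unit (a * a - D * (b * b)))
      where
      unit : ∀ x → (t * t - D * (u * u)) * x ≡ x
      unit x = trans (cong (_* x) pell) (*-identityˡ x)

    norm-of-cube : ∀ h k → cubeRat D h k * cubeRat D h k - D * (cubeIrr D h k * cubeIrr D h k)
      ≡ (h * h - D * (k * k)) * (h * h - D * (k * k)) * (h * h - D * (k * k))
    norm-of-cube h k = solve 3 (λ D h k → let a = h :* h :* h :+ con (+ 3) :* (D :* (h :* (k :* k))) ; b = con (+ 3) :* (h :* h :* k) :+ D :* (k :* k :* k) ; N = h :* h :- D :* (k :* k) in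
          a :* a :- D :* (b :* b) := N :* N :* N) refl D h k

    rationalPart-pos : ∀ {b g e} → + 1 ≤ b → + 0 ≤ e → g * u - e * t ≡ b → + 1 ≤ g
    rationalPart-pos {b} {g} {e} 1≤b 0≤e refl with + 1 ≤? g
    ... | yes p = p
    ... | no ¬p = ⊥-elim (<⇒≱ (1≤⇒0< 1≤b) (≤-by-diff ((+ 0 - g) * u + e * t) (nonneg-+ (nonneg-* (≤⇒nonneg (i<j⇒i≤pred[j] (≰⇒> ¬p))) 0≤u) (nonneg-* 0≤e 0≤t))
          (solve 4 (λ g u e t → con (+ 0) :- (g :* u :- e :* t) := (con (+ 0) :- g) :* u :+ e :* t) refl g u e t)))

    -- Pell's equation gives `u²N³ = b(b + 2et) + e²`, which is positive; hence so is `N`.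
    norm-pos : ∀ {b g e N} → + 1 ≤ b → + 0 ≤ e → g * u - e * t ≡ b → g * g - D * (e * e) ≡ N * N * N → + 1 ≤ N
    norm-pos {b} {g} {e} {N} 1≤b 0≤e bEq NEq with + 1 ≤? N
    ... | yes p = p
    ... | no ¬p = ⊥-elim (<⇒≱ (1≤⇒0< 1≤u²N³) (≤-by-diff (u * u * (N * N * (+ 0 - N))) (nonneg-* (nonneg-sq u) (nonneg-* (nonneg-sq N) (≤⇒nonneg (i<j⇒i≤pred[j] (≰⇒> ¬p)))))
             (solve 2 (λ u N → con (+ 0) :- u :* u :* (N :* N :* N) := u :* u :* (N :* N :* (con (+ 0) :- N))) refl u N)))
      where
      1≤sum : + 1 ≤ b + + 2 * (e * t)
      1≤sum = ≤-trans 1≤b (≤-by-diff (+ 2 * (e * t)) (nonneg-scale 2 (nonneg-* 0≤e 0≤t)) (solve 2 (λ x y → x :+ con (+ 2) :* y :- x := con (+ 2) :* y) refl b (e * t)))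
      1≤u²N³ : + 1 ≤ u * u * (N * N * N)
      1≤u²N³ = ≤-trans (pos-*′ 1≤b 1≤sum) (≤-by-diff (e * e) (nonneg-sq e)
              (trans (cong₂ (λ x y → u * u * x - y * (y + + 2 * (e * t))) (sym NEq) (sym bEq))
                (trans (solve 5 (λ D t u g e → u :* u :* (g :* g :- D :* (e :* e)) :- (g :* u :- e :* t) :* (g :* u :- e :* t :+ con (+ 2) :* (e :* t)) := (t :* t :- D :* (u :* u)) :* (e :* e)) refl D t u g e)
                   (trans (cong (_* (e * e)) pell) (*-identityˡ (e * e))))))

    k≤h : ∀ {h k} → + 0 ≤ h → + 1 ≤ h * h - D * (k * k) → k ≤ h
    k≤h {h} {k} 0≤h 1≤N = sq-≤⇒≤ 0≤h (≤-by-diff (h * h - D * (k * k) + (D - + 1) * (k * k)) (nonneg-+ (1≤⇒0≤ 1≤N) (nonneg-* (≤⇒nonneg 1≤D) (nonneg-sq k)))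
          (solve 3 (λ h D k → h :* h :- k :* k := h :* h :- D :* (k :* k) :+ (D :- con (+ 1)) :* (k :* k)) refl h D k))

    -- At a sign change the value at `h - 1` is negative, so the value at `h` is at most the
    -- increment of a cubic polynomial. This is `O(uh²)`, and 7 is a sufficient constant.
    irrationalPart-increment : ∀ h k → + 7 * (u * (h * h)) - irrationalPart D t u h k
      ≡ u * (+ 3 * (h * h - D * (k * k)) + (h * h - + 1) + + 3 * h) + t * k * (+ 6 * (h - + 1) + + 3) + (+ 0 - irrationalPart D t u (h - + 1) k)
    irrationalPart-increment h k = solve 5 (λ D t u h k → let ir : Polynomial 5 → Polynomial 5
                                                              ir = λ h → u :* (h :* h :* h :+ con (+ 3) :* (D :* (h :* (k :* k)))) :- t :* (con (+ 3) :* (h :* h :* k) :+ D :* (k :* k :* k)) in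
               con (+ 7) :* (u :* (h :* h)) :- ir h
               := u :* (con (+ 3) :* (h :* h :- D :* (k :* k)) :+ (h :* h :- con (+ 1)) :+ con (+ 3) :* h) :+ t :* k :* (con (+ 6) :* (h :- con (+ 1)) :+ con (+ 3)) :+ (con (+ 0) :- ir (h :- con (+ 1)))) refl D t u h k

    -- The chain is `teM ≤ 7utM · h² ≤ kh² ≤ h³ ≤ a ≤ gt`. It explains why `k` is chosen as large as
    -- `7utM`.
    irrationalPart-small : ∀ {h k a g e e′ M N} → + 1 ≤ h → + 1 ≤ k → + 0 ≤ e → + 1 ≤ N → + 0 ≤ M → e′ < + 0 → + 7 * (u * t * M) ≤ k → k ≤ h → h * h * h ≤ a →
      g * t - D * (e * u) ≡ a →
      + 7 * (u * (h * h)) - e ≡ u * (+ 3 * N + (h * h - + 1) + + 3 * h) + t * k * (+ 6 * (h - + 1) + + 3) + (+ 0 - e′) → e * M ≤ g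
    irrationalPart-small {h} {k} {a} {g} {e} {e′} {M} {N} 1≤h 1≤k 0≤e 1≤N 0≤M e′<0 kM k≤h h³≤a aEq inc = *-cancel-≤′ {c = t} 1≤t
          (≤-trans (≤-by-diff _ (nonneg-* (nonneg-* 0≤t 0≤M) (≤⇒nonneg e≤)) (solve 4 (λ t e M x → t :* (x :* M) :- t :* (e :* M) := t :* M :* (x :- e)) refl t e M (+ 7 * (u * (h * h)))))
          (≤-trans (≤-by-diff _ (nonneg-+ (nonneg-* (nonneg-sq h) (≤⇒nonneg kM)) (nonneg-* (nonneg-sq h) (≤⇒nonneg k≤h)))
             (solve 5 (λ t u h M k → h :* h :* h :- t :* (con (+ 7) :* (u :* (h :* h)) :* M) := h :* h :* (k :- con (+ 7) :* (u :* t :* M)) :+ h :* h :* (h :- k)) refl t u h M k))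
          (≤-trans h³≤a
           (≤-by-diff (D * (e * u)) (nonneg-* 0≤D (nonneg-* 0≤e 0≤u))
             (trans (cong (λ w → t * g - w) (sym aEq)) (solve 3 (λ t g x → t :* g :- (g :* t :- x) := x) refl t g (D * (e * u))))))))
          where
          0≤h = 1≤⇒0≤ 1≤h
          e≤ : e ≤ + 7 * (u * (h * h))
          e≤ = ≤-by-diff (u * (+ 3 * N + (h * h - + 1) + + 3 * h) + t * k * (+ 6 * (h - + 1) + + 3) + (+ 0 - e′))
            (nonneg-+ (nonneg-+ (nonneg-* 0≤u (nonneg-+ (nonneg-+ (nonneg-scale 3 (1≤⇒0≤ 1≤N)) (≤⇒nonneg (pos-*′ 1≤h 1≤h))) (nonneg-scale 3 0≤h)))
              (nonneg-* (nonneg-* 0≤t (1≤⇒0≤ 1≤k)) (nonneg-+ (nonneg-scale 6 (≤⇒nonneg 1≤h)) (+≤+ z≤n))))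
              (≤⇒nonneg (<⇒≤ e′<0)))
            inc

    cubeIrr-pos : ∀ {h k} → + 1 ≤ h → + 1 ≤ k → + 1 ≤ cubeIrr D h k
    cubeIrr-pos {h} {k} 1≤h 1≤k = ≤-trans (pos-*′ {+ 3} (+≤+ (s≤s z≤n)) (pos-*′ (pos-*′ 1≤h 1≤h) 1≤k))
            (≤-by-diff (D * (k * k * k)) (nonneg-* 0≤D (nonneg-* (nonneg-sq k) (1≤⇒0≤ 1≤k))) (solve 2 (λ x y → x :+ y :- x := y) refl (+ 3 * (h * h * k)) (D * (k * k * k))))

    cube≤cubeRat : ∀ {h k} → + 0 ≤ h → h * h * h ≤ cubeRat D h k
    cube≤cubeRat {h} {k} 0≤h = ≤-by-diff (+ 3 * (D * (h * (k * k)))) (nonneg-scale 3 (nonneg-* 0≤D (nonneg-* 0≤h (nonneg-sq k))))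
      (solve 2 (λ x y → x :+ y :- x := y) refl (h * h * h) (+ 3 * (D * (h * (k * k)))))

    IsApproximation : (M h k g e N : ℤ) → Set
    IsApproximation M h k g e N = + 1 ≤ N × + 0 ≤ e × + 1 ≤ g × e * M ≤ g × g * g - D * (e * e) ≡ N * N * N

    approximation : ∀ {M h k a b g e e′ N} → + 1 ≤ h → + 1 ≤ k → + 0 ≤ M → + 7 * (u * t * M) ≤ k → + 0 ≤ e → e′ < + 0 →
      h * h * h ≤ a → + 1 ≤ b → N ≡ h * h - D * (k * k) →
      g * t - D * (e * u) ≡ a → g * u - e * t ≡ b → g * g - D * (e * e) ≡ N * N * N →
      + 7 * (u * (h * h)) - e ≡ u * (+ 3 * N + (h * h - + 1) + + 3 * h) + t * k * (+ 6 * (h - + 1) + + 3) + (+ 0 - e′) →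
      IsApproximation M h k g e N
    approximation {M} {h} {k} {a} {b} {g} {e} {e′} {N} 1≤h 1≤k 0≤M kM 0≤e e′<0 h³≤a 1≤b N≡ aEq bEq NEq inc =
      1≤N , 0≤e , rationalPart-pos 1≤b 0≤e bEq , irrationalPart-small {h} {k} 1≤h 1≤k 0≤e 1≤N 0≤M e′<0 kM (k≤h (1≤⇒0≤ 1≤h) (subst (+ 1 ≤_) N≡ 1≤N)) h³≤a aEq inc , NEq
      where
      1≤N : + 1 ≤ N
      1≤N = norm-pos {b} {g} {e} {N} 1≤b 0≤e bEq NEq

    Approximates : (M h k : ℤ) → Set
    Approximates M h k = IsApproximation M h k (rationalPart D t u h k) (irrationalPart D t u h k) (h * h - D * (k * k)) × + 1 ≤ h × + 1 ≤ k

    approximates : ∀ {M h k} → + 1 ≤ M → + 1 ≤ h → + 1 ≤ k → + 7 * (u * t * M) ≤ k → + 0 ≤ irrationalPart D t u h k → irrationalPart D t u (h - + 1) k < + 0 → Approximates M h k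
    approximates {M} {h} {k} 1≤M 1≤h 1≤k kM 0≤e e′<0 = conclude (product-inverse (cubeRat D h k) (cubeIrr D h k) {rationalPart D t u h k} {irrationalPart D t u h k} refl refl) , 1≤h , 1≤k
      where
      conclude : _ → IsApproximation M h k (rationalPart D t u h k) (irrationalPart D t u h k) (h * h - D * (k * k))
      conclude (aEq , bEq , NEq) = approximation {M} {h} {k} {cubeRat D h k} {cubeIrr D h k} {rationalPart D t u h k} {irrationalPart D t u h k} {irrationalPart D t u (h - + 1) k} {h * h - D * (k * k)}
              1≤h 1≤k (1≤⇒0≤ 1≤M) kM 0≤e e′<0 (cube≤cubeRat {h} {k} (1≤⇒0≤ 1≤h)) (cubeIrr-pos {h} {k} 1≤h 1≤k) refl aEq bEq
              (trans NEq (norm-of-cube h k)) (irrationalPart-increment h k)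

    approximates-at-sign-change : ∀ {M k} → + 1 ≤ M → + 1 ≤ k → + 7 * (u * t * M) ≤ k →
      (∃[ n ] (irrationalPart D t u (+ n) k < + 0 × + 0 ≤ irrationalPart D t u (+ suc n) k)) → ∃[ h ] ∃[ k ] Approximates M h k
    approximates-at-sign-change {M} {k} 1≤M 1≤k kM (n , f<0 , 0≤f) = + suc n , k ,
      approximates {M} {+ suc n} {k} 1≤M (+≤+ (s≤s z≤n)) 1≤k kM 0≤f (subst (λ x → irrationalPart D t u x k < + 0) predecessor f<0)
      where
      predecessor : + n ≡ + suc n - + 1
      predecessor = refl

    -- (h + k√D)/(h - k√D) approximates the cube root of (t + u√D)/(t - u√D).
    approximate-cube-root : ∀ M → + 1 ≤ M → ∃[ h ] ∃[ k ] Approximates M h k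
    approximate-cube-root M 1≤M = choose (+ 7 * (u * t * M)) ≤-refl (pos-*′ {+ 7} (+≤+ (s≤s z≤n)) (pos-*′ (pos-*′ 1≤u 1≤t) 1≤M))
      where
      from : ∀ k → + 7 * (u * t * M) ≤ k → + 1 ≤ k → ∀ H → H ≡ t * k * (+ 3 + D) → + 0 ≤ H × k ≤ H → ∃[ h ] ∃[ k ] Approximates M h k
      from k kM 1≤k (+ H) eq (0≤H , k≤H) = approximates-at-sign-change {M} {k} 1≤M 1≤k kM
        (sign-change (λ n → irrationalPart D t u (+ n) k) H (irrationalPart-at-0 k 1≤k) (irrationalPart-large k (+ H) 1≤k eq 0≤H k≤H))
      choose : ∀ k → + 7 * (u * t * M) ≤ k → + 1 ≤ k → ∃[ h ] ∃[ k ] Approximates M h k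
      choose k kM 1≤k = from k kM 1≤k (t * k * (+ 3 + D)) refl (starting-point k 1≤k)

-- Arithmetic of the ring of integers for `D = 4m + 1`

module OrderArithmetic where

  open import Data.Integer hiding (suc)
  open import Data.Integer.Properties
  open import Data.Integer.Solver
  open import Data.Product using (_×_; _,_; proj₁; proj₂)
  open import Relation.Binary.PropositionalEquality
  open Approximation using (cubeRat; cubeIrr)
  open +-*-Solver

  -- (x , y) stands for x + yω with ω² = ω + m, so that ω = (1 + √D)/2 for D = 4m + 1.
  mul : ℤ → ℤ × ℤ → ℤ × ℤ → ℤ × ℤ
  mul m (a , b) (c , d) = a * c + m * (b * d) , a * d + b * c + b * d

  norm : ℤ → ℤ × ℤ → ℤ
  norm m (a , b) = a * a + a * b - m * (b * b)

  trace : ℤ × ℤ → ℤ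
  trace (a , b) = + 2 * a + b

  det : ℤ × ℤ → ℤ × ℤ → ℤ
  det (a , b) (c , d) = a * d - c * b

  -- The coefficient of √D in 2δabc.
  triple : ℤ → (δ a b c : ℤ × ℤ) → ℤ
  triple m δ a b c = proj₂ (mul m δ (mul m a (mul m b c)))

  mulₚ : ∀ {n} → Polynomial n → Polynomial n × Polynomial n → Polynomial n × Polynomial n → Polynomial n × Polynomial n
  mulₚ m (a , b) (c , d) = a :* c :+ m :* (b :* d) , a :* d :+ b :* c :+ b :* d

  private
    normₚ : ∀ {n} → Polynomial n → Polynomial n × Polynomial n → Polynomial n
    normₚ m (a , b) = a :* a :+ a :* b :- m :* (b :* b)

    tripleₚ : ∀ {n} → Polynomial n → (δ a b c : Polynomial n × Polynomial n) → Polynomial n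
    tripleₚ m δ a b c = proj₂ (mulₚ m δ (mulₚ m a (mulₚ m b c)))

    2ₚ 3ₚ 4ₚ : ∀ {n} → Polynomial n
    2ₚ = con (+ 2)
    3ₚ = con (+ 3)
    4ₚ = con (+ 4)

  module _ (m : ℤ) where

    -- For fixed `ξ`, the `ω`-coefficient of `ξz²` is a binary quadratic form in `z`, and its Gram
    -- determinant is minus the norm of `ξ`.
    polarised-norm : ∀ c₁ c₂ x₀ y₀ x₁ y₁ → let ξ = (c₁ , c₂) ; a = (x₀ , y₀) ; b = (x₁ , y₁) in
      proj₂ (mul m ξ (mul m a b)) * proj₂ (mul m ξ (mul m a b)) - proj₂ (mul m ξ (mul m a a)) * proj₂ (mul m ξ (mul m b b))
      ≡ norm m ξ * (det a b * det a b)
    polarised-norm = solve 7 (λ m c₁ c₂ x₀ y₀ x₁ y₁ → let ξ = (c₁ , c₂) ; a = (x₀ , y₀) ; b = (x₁ , y₁) in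
      proj₂ (mulₚ m ξ (mulₚ m a b)) :* proj₂ (mulₚ m ξ (mulₚ m a b)) :- proj₂ (mulₚ m ξ (mulₚ m a a)) :* proj₂ (mulₚ m ξ (mulₚ m b b))
      := normₚ m ξ :* ((x₀ :* y₁ :- x₁ :* y₀) :* (x₀ :* y₁ :- x₁ :* y₀))) refl m

    norm-mul : ∀ a b c d → norm m (mul m (a , b) (c , d)) ≡ norm m (a , b) * norm m (c , d)
    norm-mul = solve 5 (λ m a b c d → normₚ m (mulₚ m (a , b) (c , d)) := normₚ m (a , b) :* normₚ m (c , d)) refl m

    mul-assoc : ∀ a b c d e f → mul m (a , b) (mul m (c , d) (e , f)) ≡ mul m (mul m (a , b) (c , d)) (e , f)
    mul-assoc a b c d e f = cong₂ _,_
      (solve 7 (λ m a b c d e f → proj₁ (mulₚ m (a , b) (mulₚ m (c , d) (e , f))) := proj₁ (mulₚ m (mulₚ m (a , b) (c , d)) (e , f))) refl m a b c d e f)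
      (solve 7 (λ m a b c d e f → proj₂ (mulₚ m (a , b) (mulₚ m (c , d) (e , f))) := proj₂ (mulₚ m (mulₚ m (a , b) (c , d)) (e , f))) refl m a b c d e f)

    mul-comm : ∀ a b c d → mul m (a , b) (c , d) ≡ mul m (c , d) (a , b)
    mul-comm a b c d = cong₂ _,_
      (solve 5 (λ m a b c d → proj₁ (mulₚ m (a , b) (c , d)) := proj₁ (mulₚ m (c , d) (a , b))) refl m a b c d)
      (solve 5 (λ m a b c d → proj₂ (mulₚ m (a , b) (c , d)) := proj₂ (mulₚ m (c , d) (a , b))) refl m a b c d)

    triple-regroup : ∀ δ a b c → triple m δ a b c ≡ proj₂ (mul m (mul m δ a) (mul m b c))
    triple-regroup (d₁ , d₂) (a₁ , a₂) b c = cong proj₂ (mul-assoc d₁ d₂ a₁ a₂ (proj₁ (mul m b c)) (proj₂ (mul m b c)))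

    mul-rotate : ∀ a b c → mul m a (mul m b c) ≡ mul m c (mul m b a)
    mul-rotate (a , b) (c , d) (e , f) = cong₂ _,_
      (solve 7 (λ m a b c d e f → proj₁ (mulₚ m (a , b) (mulₚ m (c , d) (e , f))) := proj₁ (mulₚ m (e , f) (mulₚ m (c , d) (a , b)))) refl m a b c d e f)
      (solve 7 (λ m a b c d e f → proj₂ (mulₚ m (a , b) (mulₚ m (c , d) (e , f))) := proj₂ (mulₚ m (e , f) (mulₚ m (c , d) (a , b)))) refl m a b c d e f)

    triple-rotate : ∀ δ a b c → triple m δ a b c ≡ triple m δ c b a
    triple-rotate δ a b c = cong (λ w → proj₂ (mul m δ w)) (mul-rotate a b c)

    norm-mul′ : ∀ z w → norm m (mul m z w) ≡ norm m z * norm m w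
    norm-mul′ (a , b) (c , d) = norm-mul a b c d

    -- Taking `ξ = δa` in `polarised-norm` shows that the Hessian of the cubic form is the norm form
    -- when δ has norm 1 and the basis has determinant ±1.
    hessian₁ : ∀ δ a b → triple m δ a a b * triple m δ a a b - triple m δ a a a * triple m δ a b b ≡ norm m δ * norm m a * (det a b * det a b)
    hessian₁ δ a@(x₀ , y₀) b@(x₁ , y₁) = trans (cong₂ _-_ (cong₂ _*_ e₁ e₁) (cong₂ _*_ (triple-regroup δ a a a) (triple-regroup δ a b b)))
      (trans (polarised-norm (proj₁ (mul m δ a)) (proj₂ (mul m δ a)) x₀ y₀ x₁ y₁) (cong (_* (det a b * det a b)) (norm-mul′ δ a)))
      where
      e₁ = triple-regroup δ a a b

    hessian₂ : ∀ δ a b → triple m δ a b b * triple m δ a b b - triple m δ a a b * triple m δ b b b ≡ norm m δ * norm m b * (det a b * det a b)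
    hessian₂ δ a@(x₀ , y₀) b@(x₁ , y₁) = trans (cong₂ _-_ (cong₂ _*_ e₁ e₁) (cong₂ _*_ e₂ (triple-regroup δ b b b)))
      (trans (polarised-norm (proj₁ (mul m δ b)) (proj₂ (mul m δ b)) x₀ y₀ x₁ y₁) (cong (_* (det a b * det a b)) (norm-mul′ δ b)))
      where
      e₁ : triple m δ a b b ≡ proj₂ (mul m (mul m δ b) (mul m a b))
      e₁ = trans (cong (λ w → proj₂ (mul m δ w)) (trans (mul-rotate a b b) (cong (mul m b) (mul-comm x₁ y₁ x₀ y₀)))) (triple-regroup δ b a b)
      e₂ : triple m δ a a b ≡ proj₂ (mul m (mul m δ b) (mul m a a))
      e₂ = trans (triple-rotate δ a a b) (triple-regroup δ b a a)

    -- The trace of one argument times the conjugate of the other, that is, the polar form of the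
    -- norm.
    mixed-trace : ℤ × ℤ → ℤ × ℤ → ℤ
    mixed-trace (x₀ , y₀) (x₁ , y₁) = + 2 * (x₀ * x₁) + x₀ * y₁ + x₁ * y₀ - + 2 * (m * (y₀ * y₁))

    hessian-mixed : ∀ d₁ d₂ x₀ y₀ x₁ y₁ → let δ = (d₁ , d₂) ; a = (x₀ , y₀) ; b = (x₁ , y₁) in
      triple m δ a a a * triple m δ b b b - triple m δ a a b * triple m δ a b b ≡ - (norm m δ * mixed-trace a b * (det a b * det a b))
    hessian-mixed = solve 7 (λ m d₁ d₂ x₀ y₀ x₁ y₁ → let δ = (d₁ , d₂) ; a = (x₀ , y₀) ; b = (x₁ , y₁) in
      tripleₚ m δ a a a :* tripleₚ m δ b b b :- tripleₚ m δ a a b :* tripleₚ m δ a b b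
      := :- (normₚ m δ :* (2ₚ :* (x₀ :* x₁) :+ x₀ :* y₁ :+ x₁ :* y₀ :- 2ₚ :* (m :* (y₀ :* y₁))) :* ((x₀ :* y₁ :- x₁ :* y₀) :* (x₀ :* y₁ :- x₁ :* y₀)))) refl m

    mixed-trace-disc : ∀ x₀ y₀ x₁ y₁ → mixed-trace (x₀ , y₀) (x₁ , y₁) * mixed-trace (x₀ , y₀) (x₁ , y₁)
      - + 4 * (norm m (x₀ , y₀) * norm m (x₁ , y₁)) ≡ (+ 4 * m + + 1) * (det (x₀ , y₀) (x₁ , y₁) * det (x₀ , y₀) (x₁ , y₁))
    mixed-trace-disc = solve 5 (λ m x₀ y₀ x₁ y₁ → let t = 2ₚ :* (x₀ :* x₁) :+ x₀ :* y₁ :+ x₁ :* y₀ :- 2ₚ :* (m :* (y₀ :* y₁)) in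
      t :* t :- 4ₚ :* (normₚ m (x₀ , y₀) :* normₚ m (x₁ , y₁)) := (4ₚ :* m :+ con (+ 1)) :* ((x₀ :* y₁ :- x₁ :* y₀) :* (x₀ :* y₁ :- x₁ :* y₀))) refl m

    -- This is `a³ - b³ = (a - b)(a² + ab + b²)` for `a = (h + k√D)z` and its conjugate `b`.
    cube-irr : ∀ h k x y → let D = + 4 * m + + 1 ; z = (x , y) ; z³ = mul m z (mul m z z) in
      cubeRat D h k * proj₂ z³ + cubeIrr D h k * trace z³
      ≡ (h * y + k * (+ 2 * x + y)) * ((h * (+ 2 * x + y) + k * (D * y)) * (h * (+ 2 * x + y) + k * (D * y)) - (h * h - D * (k * k)) * norm m z)
    cube-irr = solve 5 (λ m h k x y → let D = 4ₚ :* m :+ con (+ 1) ; z = (x , y) ; z³ = mulₚ m z (mulₚ m z z) ; α₀ = h :* (2ₚ :* x :+ y) :+ k :* (D :* y) in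
      (h :* h :* h :+ 3ₚ :* (D :* (h :* (k :* k)))) :* proj₂ z³ :+ (3ₚ :* (h :* h :* k) :+ D :* (k :* k :* k)) :* (2ₚ :* proj₁ z³ :+ proj₂ z³)
      := (h :* y :+ k :* (2ₚ :* x :+ y)) :* (α₀ :* α₀ :- (h :* h :- D :* (k :* k)) :* normₚ m z)) refl m

    -- The companion `a³ + b³ = (a + b)((a + b)² - 3ab)`.
    cube-rat : ∀ h k x y → let D = + 4 * m + + 1 ; z = (x , y) ; z³ = mul m z (mul m z z) in
      cubeRat D h k * trace z³ + cubeIrr D h k * (D * proj₂ z³)
      ≡ (h * (+ 2 * x + y) + k * (D * y)) * ((h * (+ 2 * x + y) + k * (D * y)) * (h * (+ 2 * x + y) + k * (D * y)) - + 3 * ((h * h - D * (k * k)) * norm m z))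
    cube-rat = solve 5 (λ m h k x y → let D = 4ₚ :* m :+ con (+ 1) ; z = (x , y) ; z³ = mulₚ m z (mulₚ m z z) ; α₀ = h :* (2ₚ :* x :+ y) :+ k :* (D :* y) in
      (h :* h :* h :+ 3ₚ :* (D :* (h :* (k :* k)))) :* (2ₚ :* proj₁ z³ :+ proj₂ z³) :+ (3ₚ :* (h :* h :* k) :+ D :* (k :* k :* k)) :* (D :* proj₂ z³)
      := α₀ :* (α₀ :* α₀ :- 3ₚ :* ((h :* h :- D :* (k :* k)) :* normₚ m z))) refl m

    norm-scaled : ∀ h k x y → let D = + 4 * m + + 1 in
      (h * (+ 2 * x + y) + k * (D * y)) * (h * (+ 2 * x + y) + k * (D * y)) - D * ((h * y + k * (+ 2 * x + y)) * (h * y + k * (+ 2 * x + y)))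
      ≡ + 4 * ((h * h - D * (k * k)) * norm m (x , y))
    norm-scaled = solve 5 (λ m h k x y → let D = 4ₚ :* m :+ con (+ 1) ; α₀ = h :* (2ₚ :* x :+ y) :+ k :* (D :* y) ; α₁ = h :* y :+ k :* (2ₚ :* x :+ y) in
      α₀ :* α₀ :- D :* (α₁ :* α₁) := 4ₚ :* ((h :* h :- D :* (k :* k)) :* normₚ m (x , y))) refl m

-- The integral cubic form and the parities of its coefficients

module CubicForm where

  open import Data.Nat as ℕ using (ℕ; zero; suc)
  import Data.Nat.Properties as ℕ
  open import Data.Integer hiding (suc)
  open import Data.Integer.Properties
  open import Data.Integer.Solver
  open import Data.Product using (∃-syntax; _×_; _,_; proj₁; proj₂)
  open import Data.Sum using (_⊎_; inj₁; inj₂)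
  open import Relation.Binary.PropositionalEquality
  open IntegerOrder
  open Reduction
  open ReducedBound
  open Approximation
  open OrderArithmetic
  open +-*-Solver

  hess : ℤ → ℤ → ℤ → ℤ
  hess p q r = q * q - p * r

  -- -1/27 of the discriminant of px³ + 3qx²y + 3rxy² + sy³.
  disc : ℤ → ℤ → ℤ → ℤ → ℤ
  disc p q r s = (p * s - q * r) * (p * s - q * r) - + 4 * (hess p q r * hess q r s)

  Even Odd : ℤ → Set
  Even i = ∃[ k ] i ≡ + 2 * k
  Odd i = ∃[ k ] i ≡ + 2 * k + + 1

  -- The size condition is `p² + 3A ≤ √D` with the root cleared, so it constrains nothing when the
  -- left side is negative.
  IsReducedForm : ℤ → ℤ → ℤ → ℤ → ℤ → Set
  IsReducedForm D p q r s = disc p q r s ≡ D × Even p × Odd q × Odd r × Even s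
    × (+ 0 ≤ p * p + + 3 * hess p q r → (p * p + + 3 * hess p q r) * (p * p + + 3 * hess p q r) ≤ D) × p ≢ + 0

  parity : ∀ i → Even i ⊎ Odd i
  parity (+ n) = nat n
    where
    nat : ∀ n → Even (+ n) ⊎ Odd (+ n)
    nat zero = inj₁ (+ 0 , refl)
    nat (suc n) with nat n
    ... | inj₁ (k , eq) = inj₂ (k , trans (cong (λ w → + 1 + w) eq) (+-comm (+ 1) (+ 2 * k)))
    ... | inj₂ (k , eq) = inj₁ (k + + 1 , trans (cong (λ w → + 1 + w) eq) (solve 1 (λ k → con (+ 1) :+ (con (+ 2) :* k :+ con (+ 1)) := con (+ 2) :* (k :+ con (+ 1))) refl k))
  parity -[1+ n ] with parity (+ suc n)
  ... | inj₁ (k , eq) = inj₁ (- k , trans (cong -_ eq) (solve 1 (λ k → :- (con (+ 2) :* k) := con (+ 2) :* (:- k)) refl k))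
  ... | inj₂ (k , eq) = inj₂ (- k - + 1 , trans (cong -_ eq) (solve 1 (λ k → :- (con (+ 2) :* k :+ con (+ 1)) := con (+ 2) :* (:- k :- con (+ 1)) :+ con (+ 1)) refl k))

  square-mod-2 : ∀ i → ∃[ k ] i * i ≡ i + + 2 * k
  square-mod-2 i with parity i
  ... | inj₁ (k , refl) = + 2 * (k * k) - k , solve 1 (λ k → con (+ 2) :* k :* (con (+ 2) :* k) := con (+ 2) :* k :+ con (+ 2) :* (con (+ 2) :* (k :* k) :- k)) refl k
  ... | inj₂ (k , refl) = + 2 * (k * k) + k , solve 1 (λ k → (con (+ 2) :* k :+ con (+ 1)) :* (con (+ 2) :* k :+ con (+ 1)) := con (+ 2) :* k :+ con (+ 1) :+ con (+ 2) :* (con (+ 2) :* (k :* k) :+ k)) refl k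

  2*k≢1 : ∀ k → + 2 * k ≢ + 1
  2*k≢1 (+ suc n) eq with +-injective eq
  ... | eq′ = ℕ.m+1+n≢0 n (ℕ.suc-injective eq′)

  -- How hypotheses enter ring identities: the solver proves the claim with explicit multiples
  -- `c * (a - b)` of the hypotheses added, and these are then removed one by one.
  diff-zero : ∀ {a b} → a ≡ b → ∀ x c → x + c * (a - b) ≡ x
  diff-zero {a} refl x c = solve 3 (λ x c a → x :+ c :* (a :- a) := x) refl x c a

  -- In the field 𝔽₄ = 𝒪/2 every non-zero cube is 1, while a²b = b/a is not 1 for independent a, b.
  triple-cube-even : ∀ m′ d u x y → Even (triple (+ 2 * m′ + + 1) (d , + 2 * u) (x , y) (x , y) (x , y))
  triple-cube-even m′ d u x y with square-mod-2 x | square-mod-2 y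
  ... | k , xx | l , yy = K ,
    trans (solve 7 (λ m′ d u x y k l → let m = con (+ 2) :* m′ :+ con (+ 1) ; z³ = mulₚ m (x , y) (mulₚ m (x , y) (x , y)) ; c₁ = proj₁ z³ ; c₂ = proj₂ z³ in
        d :* c₂ :+ con (+ 2) :* u :* c₁ :+ con (+ 2) :* u :* c₂
        := con (+ 2) :* (d :* (con (+ 3) :* (x :* y :+ k :* y :+ l :* x) :+ (m′ :+ con (+ 1)) :* (y :* y :* y)) :+ u :* (c₁ :+ c₂))
           :+ con (+ 3) :* d :* y :* (x :* x :- (x :+ con (+ 2) :* k)) :+ con (+ 3) :* d :* x :* (y :* y :- (y :+ con (+ 2) :* l))) refl m′ d u x y k l)
      (trans (diff-zero yy (+ 2 * K + + 3 * d * y * (x * x - (x + + 2 * k))) (+ 3 * d * x)) (diff-zero xx (+ 2 * K) (+ 3 * d * y)))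
    where
    m = + 2 * m′ + + 1
    z³ = mul m (x , y) (mul m (x , y) (x , y))
    K = d * (+ 3 * (x * y + k * y + l * x) + (m′ + + 1) * (y * y * y)) + u * (proj₁ z³ + proj₂ z³)

  triple-mixed-odd : ∀ m′ d′ u x₀ y₀ x₁ y₁ → x₀ * y₁ - x₁ * y₀ ≡ + 1 ⊎ x₀ * y₁ - x₁ * y₀ ≡ - + 1 →
    Odd (triple (+ 2 * m′ + + 1) (+ 2 * d′ + + 1 , + 2 * u) (x₀ , y₀) (x₀ , y₀) (x₁ , y₁))
  triple-mixed-odd m′ d′ u x₀ y₀ x₁ y₁ det with square-mod-2 x₀ | square-mod-2 y₀
  ... | k , xx | l , yy = from det
    where
    m = + 2 * m′ + + 1
    d = + 2 * d′ + + 1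
    w = mul m (x₀ , y₀) (mul m (x₀ , y₀) (x₁ , y₁))
    F = x₁ * y₀ + k * y₁ + l * x₁ + (m′ + + 1) * (y₀ * y₀ * y₁) + x₀ * y₀ * (x₁ + y₁)
    expand : proj₂ w ≡ x₀ * y₁ - x₁ * y₀ + + 2 * F
    expand = trans (solve 7 (λ m′ x y x₁ y₁ k l → let m = con (+ 2) :* m′ :+ con (+ 1) ; v₁ = x :* x₁ :+ m :* (y :* y₁) ; v₂ = x :* y₁ :+ y :* x₁ :+ y :* y₁ in
        x :* v₂ :+ y :* v₁ :+ y :* v₂
        := (x :* y₁ :- x₁ :* y :+ con (+ 2) :* (x₁ :* y :+ k :* y₁ :+ l :* x₁ :+ (m′ :+ con (+ 1)) :* (y :* y :* y₁) :+ x :* y :* (x₁ :+ y₁)))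
           :+ y₁ :* (x :* x :- (x :+ con (+ 2) :* k)) :+ x₁ :* (y :* y :- (y :+ con (+ 2) :* l))) refl m′ x₀ y₀ x₁ y₁ k l)
      (trans (diff-zero yy (x₀ * y₁ - x₁ * y₀ + + 2 * F + y₁ * (x₀ * x₀ - (x₀ + + 2 * k))) x₁) (diff-zero xx (x₀ * y₁ - x₁ * y₀ + + 2 * F) y₁))
    expand′ : ∀ e → x₀ * y₁ - x₁ * y₀ ≡ e → triple m (d , + 2 * u) (x₀ , y₀) (x₀ , y₀) (x₁ , y₁) ≡ d * (e + + 2 * F) + + 2 * u * (proj₁ w) + + 2 * u * (e + + 2 * F)
    expand′ e refl = cong (λ c → d * c + + 2 * u * (proj₁ w) + + 2 * u * c) expand
    from : x₀ * y₁ - x₁ * y₀ ≡ + 1 ⊎ x₀ * y₁ - x₁ * y₀ ≡ - + 1 → Odd (triple m (d , + 2 * u) (x₀ , y₀) (x₀ , y₀) (x₁ , y₁))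
    from (inj₁ eq) = d * F + d′ + u * (proj₁ w) + u * (+ 1 + + 2 * F) , trans (expand′ (+ 1) eq)
      (solve 4 (λ d′ F u w → let d = con (+ 2) :* d′ :+ con (+ 1) in d :* (con (+ 1) :+ con (+ 2) :* F) :+ con (+ 2) :* u :* w :+ con (+ 2) :* u :* (con (+ 1) :+ con (+ 2) :* F)
        := con (+ 2) :* (d :* F :+ d′ :+ u :* w :+ u :* (con (+ 1) :+ con (+ 2) :* F)) :+ con (+ 1)) refl d′ F u (proj₁ w))
    from (inj₂ eq) = d * F - d′ - + 1 + u * (proj₁ w) + u * (- + 1 + + 2 * F) , trans (expand′ (- + 1) eq)
      (solve 4 (λ d′ F u w → let d = con (+ 2) :* d′ :+ con (+ 1) in d :* (con (- + 1) :+ con (+ 2) :* F) :+ con (+ 2) :* u :* w :+ con (+ 2) :* u :* (con (- + 1) :+ con (+ 2) :* F)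
        := con (+ 2) :* (d :* F :- d′ :- con (+ 1) :+ u :* w :+ u :* (con (- + 1) :+ con (+ 2) :* F)) :+ con (+ 1)) refl d′ F u (proj₁ w))

-- Existence of a reduced cubic form

module ReducedForm where

  open import Data.Nat as ℕ using (z≤n; s≤s)
  open import Data.Integer hiding (suc)
  open import Data.Integer.Properties
  open import Data.Integer.Solver
  open import Data.Product using (∃-syntax; _×_; _,_; proj₁; proj₂)
  open import Data.Sum using (_⊎_; inj₁; inj₂)
  open import Data.Empty using (⊥-elim)
  open import Relation.Binary.PropositionalEquality
  open IntegerOrder
  open Reduction
  open ReducedBound
  open Approximation
  open OrderArithmetic
  open CubicForm
  open +-*-Solver

  -- The quadratic form a² + ab + b² in a = wz and its conjugate b, where w = h + k√D.
  wA wB wC : (m h k N : ℤ) → ℤ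
  wA m h k N = + 4 * (h * h) - N
  wB m h k N = + 4 * (h * (h + k * (+ 4 * m + + 1))) - N
  wC m h k N = (h + k * (+ 4 * m + + 1)) * (h + k * (+ 4 * m + + 1)) + N * m

  -- The 3 belongs to `a² + ab + b²`. The substitution of `wz` and its conjugate has determinant
  -- `-N√D`, whose square is `N²D`.
  weighted-negDisc : ∀ m h k N → let D = + 4 * m + + 1 in N ≡ h * h - D * (k * k) → negDisc (wA m h k N) (wB m h k N) (wC m h k N) ≡ + 3 * (N * N * D)
  weighted-negDisc m h k N refl = solve 3 (λ m h k → let D = con (+ 4) :* m :+ con (+ 1) ; N = h :* h :- D :* (k :* k) ; H = h :+ k :* D ; b = con (+ 4) :* (h :* H) :- N in
      con (+ 4) :* ((con (+ 4) :* (h :* h) :- N) :* (H :* H :+ N :* m)) :- b :* b := con (+ 3) :* (N :* N :* D)) refl m h k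

  weighted-value : ∀ m h k N x y → let α = h * (+ 2 * x + y) + k * ((+ 4 * m + + 1) * y) in
    α * α ≡ quadForm (wA m h k N) (wB m h k N) (wC m h k N) x y + N * norm m (x , y)
  weighted-value = solve 6 (λ m h k N x y → let D = con (+ 4) :* m :+ con (+ 1) ; H = h :+ k :* D ; α = h :* (con (+ 2) :* x :+ y) :+ k :* (D :* y) in
      α :* α := (con (+ 4) :* (h :* h) :- N) :* (x :* x) :+ (con (+ 4) :* (h :* H) :- N) :* (x :* y) :+ (H :* H :+ N :* m) :* (y :* y) :+ N :* (x :* x :+ x :* y :- m :* (y :* y))) refl

  wA-pos : ∀ m h k N → let D = + 4 * m + + 1 in + 1 ≤ h → + 1 ≤ D → N ≡ h * h - D * (k * k) → + 1 ≤ wA m h k N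
  wA-pos m h k N 1≤h 1≤D refl = ≤-trans (pos-*′ 1≤h 1≤h) (≤-by-diff (+ 2 * (h * h) + D * (k * k)) (nonneg-+ (nonneg-scale 2 (nonneg-sq h)) (nonneg-* (1≤⇒0≤ 1≤D) (nonneg-sq k)))
      (solve 2 (λ a b → con (+ 4) :* a :- (a :- b) :- a := con (+ 2) :* a :+ b) refl (h * h) (D * (k * k))))
    where
    D = + 4 * m + + 1

  small-vector : ∀ {m h k N} → let D = + 4 * m + + 1 in + 1 ≤ h → + 1 ≤ D → + 1 ≤ N → N ≡ h * h - D * (k * k) → SmallBasis (wA m h k N) (wB m h k N) (wC m h k N)
  small-vector {m} {h} {k} {N} 1≤h 1≤D 1≤N eq = smallBasis ∣ wA m h k N ∣ (wA m h k N) (wB m h k N) (wC m h k N)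
    (≤-reflexive (sym (0≤i⇒+∣i∣≡i (1≤⇒0≤ 1≤a)))) 1≤a
    (subst (+ 1 ≤_) (sym (weighted-negDisc m h k N eq)) (pos-*′ {+ 3} (+≤+ (s≤s z≤n)) (pos-*′ (pos-*′ 1≤N 1≤N) 1≤D)))
    where
    1≤a = wA-pos m h k N 1≤h 1≤D eq

  -- δz³ = (G + p√D)/2 with z³ = (T + c√D)/2.
  product-components : ∀ {D t u a b c T g e} → t * t - D * (u * u) ≡ + 1 → g ≡ t * a - D * (u * b) → e ≡ u * a - t * b →
    g * (t * c + u * T) - e * (t * T + D * (u * c)) ≡ a * c + b * T ×
    g * (t * T + D * (u * c)) - e * (D * (t * c + u * T)) ≡ a * T + b * (D * c)
  product-components {D} {t} {u} {a} {b} {c} {T} pell refl refl =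
    trans (solve 7 (λ D t u a b c T → (t :* a :- D :* (u :* b)) :* (t :* c :+ u :* T) :- (u :* a :- t :* b) :* (t :* T :+ D :* (u :* c)) := (t :* t :- D :* (u :* u)) :* (a :* c :+ b :* T)) refl D t u a b c T)
      (trans (cong (_* (a * c + b * T)) pell) (*-identityˡ _)) ,
    trans (solve 7 (λ D t u a b c T → (t :* a :- D :* (u :* b)) :* (t :* T :+ D :* (u :* c)) :- (u :* a :- t :* b) :* (D :* (t :* c :+ u :* T)) := (t :* t :- D :* (u :* u)) :* (a :* T :+ b :* (D :* c))) refl D t u a b c T)
      (trans (cong (_* (a * T + b * (D * c))) pell) (*-identityˡ _))

  irr-of-product : ∀ m t u z → proj₂ (mul m (t - u , + 2 * u) z) ≡ t * proj₂ z + u * trace z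
  irr-of-product m t u (c₁ , c₂) = solve 4 (λ t u c₁ c₂ → (t :- u) :* c₂ :+ con (+ 2) :* u :* c₁ :+ con (+ 2) :* u :* c₂ := t :* c₂ :+ u :* (con (+ 2) :* c₁ :+ c₂)) refl t u c₁ c₂

  unit-norm : ∀ m t u → t * t - (+ 4 * m + + 1) * (u * u) ≡ + 1 → norm m (t - u , + 2 * u) ≡ + 1
  unit-norm m t u pell = trans (solve 3 (λ m t u → (t :- u) :* (t :- u) :+ (t :- u) :* (con (+ 2) :* u) :- m :* (con (+ 2) :* u :* (con (+ 2) :* u)) := t :* t :- (con (+ 4) :* m :+ con (+ 1)) :* (u :* u)) refl m t u) pell

  -- If `t` and `u` had the same parity, `t² - Du²` would be even, because `D` is odd. Thus δ is
  -- congruent to 1 modulo 2.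
  t-u-odd : ∀ m t u → t * t - (+ 4 * m + + 1) * (u * u) ≡ + 1 → Odd (t - u)
  t-u-odd m t u pell with parity (t - u)
  ... | inj₂ odd = odd
  ... | inj₁ (k , eq) = ⊥-elim (2*k≢1 (+ 2 * (k * u + k * k - m * (u * u))) (trans
    (solve 3 (λ m u k → con (+ 2) :* (con (+ 2) :* (k :* u :+ k :* k :- m :* (u :* u))) := (u :+ con (+ 2) :* k) :* (u :+ con (+ 2) :* k) :- (con (+ 4) :* m :+ con (+ 1)) :* (u :* u)) refl m u k)
    (trans (cong (λ w → w * w - (+ 4 * m + + 1) * (u * u)) (trans (cong (λ w → u + w) (sym eq)) (solve 2 (λ t u → u :+ (t :- u) := t) refl t u))) pell)))

  basis-bound : ∀ {m t u h k x y P} → let D = + 4 * m + + 1 ; N = h * h - D * (k * k) ; z = (x , y) in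
    + 1 ≤ D → (pell : t * t - D * (u * u) ≡ + 1) →
    + 1 ≤ N → + 0 ≤ irrationalPart D t u h k → + 1 ≤ rationalPart D t u h k →
    irrationalPart D t u h k * (+ 24 * D * (+ 3 * D)) ≤ rationalPart D t u h k →
    rationalPart D t u h k * rationalPart D t u h k - D * (irrationalPart D t u h k * irrationalPart D t u h k) ≡ N * N * N →
    P ≡ quadForm (wA m h k N) (wB m h k N) (wC m h k N) x y → + 1 ≤ P → P * P ≤ N * N * D →
    ∀ {p A} → p ≡ triple m (t - u , + 2 * u) z z z → A ≡ norm m z → + 0 ≤ p * p + + 3 * A → (p * p + + 3 * A) * (p * p + + 3 * A) ≤ D
  basis-bound {m} {t} {u} {h} {k} {x} {y} {P} 1≤D pell 1≤N 0≤e 1≤g eM≤g norm-eq P≡ 1≤P P²≤ {p} {A} p≡ A≡ =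
    reduced-bound D {P} {A} {N} {g} {e} {p} {G} {α₀} {α₁} 1≤D (1≤⇒0≤ 1≤P) 1≤N 0≤e (1≤⇒0≤ 1≤g) eM≤g P²≤ E₁ E₂ norm-eq E₄ E₅
    where
    D = + 4 * m + + 1
    N = h * h - D * (k * k)
    z = (x , y)
    z³ = mul m z (mul m z z)
    c = proj₂ z³
    T = trace z³
    a = cubeRat D h k
    b = cubeIrr D h k
    g = rationalPart D t u h k
    e = irrationalPart D t u h k
    G = t * T + D * (u * c)
    α₀ = h * (+ 2 * x + y) + k * (D * y)
    α₁ = h * y + k * (+ 2 * x + y)
    p≡′ : p ≡ t * c + u * T
    p≡′ = trans p≡ (irr-of-product m t u z³)
    E₄ : α₀ * α₀ ≡ P + N * A
    E₄ = trans (weighted-value m h k N x y) (cong₂ (λ v w → v + N * w) (sym P≡) (sym A≡))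
    P≡′ : P ≡ α₀ * α₀ - N * norm m z
    P≡′ = trans P≡ (trans (solve 2 (λ P v → P := P :+ v :- v) refl _ (N * norm m z)) (cong (_- N * norm m z) (sym (weighted-value m h k N x y))))
    E₅ : D * (α₁ * α₁) ≡ P - + 3 * (N * A)
    E₅ = trans (solve 2 (λ a d → d := a :- (a :- d)) refl (α₀ * α₀) (D * (α₁ * α₁)))
      (trans (cong₂ _-_ E₄ (trans (norm-scaled m h k x y) (cong (λ w → + 4 * (N * w)) (sym A≡)))) (solve 2 (λ P v → P :+ v :- con (+ 4) :* v := P :- con (+ 3) :* v) refl P (N * A)))
    comps = product-components {D} {t} {u} {a} {b} {c} {T} {g} {e} pell refl refl
    E₁ : g * p - e * G ≡ α₁ * P
    E₁ = trans (cong (λ w → g * w - e * G) p≡′) (trans (proj₁ comps) (trans (cube-irr m h k x y) (cong (α₁ *_) (sym P≡′))))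
    E₂ : g * G - e * (D * p) ≡ α₀ * (P - + 2 * (N * A))
    E₂ = trans (cong (λ w → g * G - e * (D * w)) p≡′) (trans (proj₂ comps) (trans (cube-rat m h k x y) (cong (α₀ *_)
          (trans (solve 2 (λ a v → a :- con (+ 3) :* v := a :- v :- con (+ 2) :* v) refl (α₀ * α₀) (N * norm m z)) (cong₂ (λ v w → v - + 2 * (N * w)) (sym P≡′) (sym A≡))))))

  -- If p = 0 then D = q²(4qs - 3r²), so q² = 1 for square-free D and the first basis vector is a unit.
  zero-lead-disc : ∀ q r s → disc (+ 0) q r s ≡ q * q * (+ 4 * (q * s) - + 3 * (r * r))
  zero-lead-disc = solve 3 (λ q r s → let b = con (+ 0) :* s :- q :* r in b :* b :- con (+ 4) :* ((q :* q :- con (+ 0) :* r) :* (r :* r :- q :* s)) := q :* q :* (con (+ 4) :* (q :* s) :- con (+ 3) :* (r :* r))) refl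

  form-of-basis : ∀ m′ t u x₀ y₀ x₁ y₁ → let m = + 2 * m′ + + 1 ; D = + 4 * m + + 1 ; δ = (t - u , + 2 * u) ; z₀ = (x₀ , y₀) ; z₁ = (x₁ , y₁) in
    t * t - D * (u * u) ≡ + 1 → x₀ * y₁ - x₁ * y₀ ≡ + 1 →
    (∀ q c → D ≡ q * q * c → q * q ≡ + 1) → (∀ z → norm m z ≡ + 1 → triple m δ z z z ≢ + 0) →
    (∀ {p A} → p ≡ triple m δ z₀ z₀ z₀ → A ≡ norm m z₀ → + 0 ≤ p * p + + 3 * A → (p * p + + 3 * A) * (p * p + + 3 * A) ≤ D) →
    ∀ {p q r s} → p ≡ triple m δ z₀ z₀ z₀ → q ≡ triple m δ z₀ z₀ z₁ → r ≡ triple m δ z₀ z₁ z₁ → s ≡ triple m δ z₁ z₁ z₁ → IsReducedForm D p q r s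
  form-of-basis m′ t u x₀ y₀ x₁ y₁ pell det≡1 sf notCube bound {p} {q} {r} {s} p≡ q≡ r≡ s≡ =
      disc≡ ,
      subst Even (sym p≡) (triple-cube-even m′ (t - u) u x₀ y₀) ,
      subst Odd (sym q≡) (odd (t-u-odd m t u pell) x₀ y₀ x₁ y₁ (inj₁ det≡1)) ,
      subst Odd (sym (trans r≡ (triple-rotate m δ z₀ z₁ z₁))) (odd (t-u-odd m t u pell) x₁ y₁ x₀ y₀ (inj₂ (trans (solve 4 (λ a b c d → a :* b :- c :* d := :- (c :* d :- a :* b)) refl x₁ y₀ x₀ y₁) (cong -_ det≡1)))) ,
      subst Even (sym s≡) (triple-cube-even m′ (t - u) u x₁ y₁) ,
      bound p≡ A≡ ,
      λ p≡0 → notCube z₀ (trans (sym A≡) (trans (cong (λ w → hess w q r) p≡0) (trans (solve 2 (λ q r → q :* q :- con (+ 0) :* r := q :* q) refl q r)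
         (sf q _ (trans (sym disc≡) (trans (cong (λ w → disc w q r s) p≡0) (zero-lead-disc q r s))))))) (trans (sym p≡) p≡0)
    where
    m = + 2 * m′ + + 1
    δ = (t - u , + 2 * u)
    z₀ = (x₀ , y₀)
    z₁ = (x₁ , y₁)
    det² : det z₀ z₁ * det z₀ z₁ ≡ + 1
    det² = cong (λ w → w * w) det≡1
    one : ∀ {d v w} → d ≡ + 1 → w ≡ + 1 → d * v * w ≡ v
    one {v = v} refl refl = solve 1 (λ v → con (+ 1) :* v :* con (+ 1) := v) refl v
    odd : Odd (t - u) → ∀ x₀ y₀ x₁ y₁ → x₀ * y₁ - x₁ * y₀ ≡ + 1 ⊎ x₀ * y₁ - x₁ * y₀ ≡ - + 1 → Odd (triple m δ (x₀ , y₀) (x₀ , y₀) (x₁ , y₁))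
    odd (d′ , eq) x₀ y₀ x₁ y₁ det = subst (λ d → Odd (triple m (d , + 2 * u) (x₀ , y₀) (x₀ , y₀) (x₁ , y₁))) (sym eq) (triple-mixed-odd m′ d′ u x₀ y₀ x₁ y₁ det)
    Nδ = unit-norm m t u pell
    A≡ : hess p q r ≡ norm m z₀
    A≡ = trans (cong₂ _-_ (cong₂ _*_ q≡ q≡) (cong₂ _*_ p≡ r≡)) (trans (hessian₁ m δ z₀ z₁) (one {norm m δ} {norm m z₀} {det z₀ z₁ * det z₀ z₁} Nδ det²))
    C≡ : hess q r s ≡ norm m z₁
    C≡ = trans (cong₂ _-_ (cong₂ _*_ r≡ r≡) (cong₂ _*_ q≡ s≡)) (trans (hessian₂ m δ z₀ z₁) (one {norm m δ} {norm m z₁} {det z₀ z₁ * det z₀ z₁} Nδ det²))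
    B≡ : p * s - q * r ≡ - mixed-trace m z₀ z₁
    B≡ = trans (cong₂ _-_ (cong₂ _*_ p≡ s≡) (cong₂ _*_ q≡ r≡)) (trans (hessian-mixed m (t - u) (+ 2 * u) x₀ y₀ x₁ y₁)
          (cong -_ (one {norm m δ} {mixed-trace m z₀ z₁} {det z₀ z₁ * det z₀ z₁} Nδ det²)))
    disc≡ : disc p q r s ≡ + 4 * m + + 1
    disc≡ = trans (cong₂ (λ b ac → b * b - + 4 * ac) B≡ (cong₂ _*_ A≡ C≡))
      (trans (solve 2 (λ b x → (:- b) :* (:- b) :- x := b :* b :- x) refl (mixed-trace m z₀ z₁) (+ 4 * (norm m z₀ * norm m z₁)))
        (trans (mixed-trace-disc m x₀ y₀ x₁ y₁) (trans (cong ((+ 4 * m + + 1) *_) det²) (*-identityʳ (+ 4 * m + + 1)))))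

  cancel-3 : ∀ {a b c} → c ≡ + 3 * b → + 3 * a ≤ c → a ≤ b
  cancel-3 {a} {b} refl h = *-cancel-≤′ {a} {b} {+ 3} (+≤+ (s≤s z≤n)) h

  reducedForm : ∀ m′ t u → let m = + 2 * m′ + + 1 ; D = + 4 * m + + 1 ; δ = (t - u , + 2 * u) in
    + 1 ≤ D → + 1 ≤ t → + 1 ≤ u → t * t - D * (u * u) ≡ + 1 →
    (∀ q c → D ≡ q * q * c → q * q ≡ + 1) → (∀ z → norm m z ≡ + 1 → triple m δ z z z ≢ + 0) →
    ∃[ p ] ∃[ q ] ∃[ r ] ∃[ s ] IsReducedForm D p q r s
  reducedForm m′ t u 1≤D 1≤t 1≤u pell sf notCube = from-approx (approximate-cube-root D t u 1≤D 1≤t 1≤u pell (+ 24 * D * (+ 3 * D))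
        (pos-*′ (pos-*′ {+ 24} (+≤+ (s≤s z≤n)) 1≤D) (pos-*′ {+ 3} (+≤+ (s≤s z≤n)) 1≤D)))
    where
    m = + 2 * m′ + + 1
    D = + 4 * m + + 1
    from-basis : ∀ {h k} → Approximates D t u 1≤D 1≤t 1≤u pell (+ 24 * D * (+ 3 * D)) h k →
      let N = h * h - D * (k * k) in SmallBasis (wA m h k N) (wB m h k N) (wC m h k N) → ∃[ p ] ∃[ q ] ∃[ r ] ∃[ s ] IsReducedForm D p q r s
    from-basis {h} {k} ((1≤N , 0≤e , 1≤g , eM≤g , norm-eq) , 1≤h , 1≤k) (x₀ , y₀ , x₁ , y₁ , det≡1 , 1≤P , small) = _ , _ , _ , _ ,
      form-of-basis m′ t u x₀ y₀ x₁ y₁ pell det≡1 sf notCube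
        (basis-bound {m} {t} {u} {h} {k} {x₀} {y₀} {quadForm (wA m h k N) (wB m h k N) (wC m h k N) x₀ y₀} 1≤D pell 1≤N 0≤e 1≤g eM≤g norm-eq refl 1≤P
          (cancel-3 {quadForm (wA m h k N) (wB m h k N) (wC m h k N) x₀ y₀ * quadForm (wA m h k N) (wB m h k N) (wC m h k N) x₀ y₀} {N * N * D} {negDisc (wA m h k N) (wB m h k N) (wC m h k N)} (weighted-negDisc m h k N refl) small)) refl refl refl refl
      where
      N = h * h - D * (k * k)
    from-approx : (∃[ h ] ∃[ k ] Approximates D t u 1≤D 1≤t 1≤u pell (+ 24 * D * (+ 3 * D)) h k) → ∃[ p ] ∃[ q ] ∃[ r ] ∃[ s ] IsReducedForm D p q r s
    from-approx (h , k , ap@((1≤N , _) , 1≤h , _)) = from-basis {h} {k} ap (small-vector {m} {h} {k} 1≤h 1≤D 1≤N refl)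

-- Parity and comparison of units

module Units where

  open import Data.Nat as ℕ using (ℕ; z≤n; s≤s)
  import Data.Nat.Properties as ℕ
  import Data.Nat.Divisibility as ℕ
  open import Data.Bool using (Bool; true; false; _∧_; _xor_)
  open import Data.Integer hiding (suc)
  open import Data.Integer.Properties
  open import Data.Integer.Divisibility using (_∣_)
  open import Data.Integer.Solver
  open import Data.Product using (∃-syntax; _,_)
  open import Data.Sum using (_⊎_; inj₁; inj₂; [_,_]′)
  open import Data.Empty using (⊥-elim)
  open import Relation.Nullary using (yes; no)
  open import Relation.Binary.PropositionalEquality
  open import Defs
  open IntegerOrder
  open CubicForm
  open +-*-Solver

  bit : Bool → ℤ
  bit false = + 0
  bit true = + 1

  -- Parity as a ring homomorphism to `Bool` with `xor` and `∧`, which turns parity claims into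
  -- finite truth tables.
  odd? : ℤ → Bool
  odd? i = [ (λ _ → false) , (λ _ → true) ]′ (parity i)

  odd?-unique : ∀ i k b → i ≡ + 2 * k + bit b → odd? i ≡ b
  odd?-unique i k b eq with parity i
  odd?-unique i k true eq | inj₁ (l , eq′) = ⊥-elim (2*k≢1 (l - k) (trans (solve 2 (λ k l → con (+ 2) :* (l :- k) := con (+ 2) :* l :- con (+ 2) :* k) refl k l)
    (trans (cong (_- + 2 * k) (trans (sym eq′) eq)) (solve 1 (λ k → con (+ 2) :* k :+ con (+ 1) :- con (+ 2) :* k := con (+ 1)) refl k))))
  odd?-unique i k false eq | inj₁ _ = refl
  odd?-unique i k true eq | inj₂ _ = refl
  odd?-unique i k false eq | inj₂ (l , eq′) = ⊥-elim (2*k≢1 (k - l) (trans (solve 2 (λ k l → con (+ 2) :* (k :- l) := con (+ 2) :* k :+ con (+ 0) :- con (+ 2) :* l) refl k l)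
    (trans (cong (_- + 2 * l) (trans (sym eq) eq′)) (solve 1 (λ k → con (+ 2) :* k :+ con (+ 1) :- con (+ 2) :* k := con (+ 1)) refl l))))

  odd?-witness : ∀ i → ∃[ k ] i ≡ + 2 * k + bit (odd? i)
  odd?-witness i with parity i
  ... | inj₁ (k , eq) = k , trans eq (sym (+-identityʳ _))
  ... | inj₂ (k , eq) = k , eq

  odd?-- : ∀ i j → odd? (i - j) ≡ odd? i xor odd? j
  odd?-- i j = go (odd?-witness i) (odd?-witness j)
    where
    table : ∀ k l b c → ∃[ n ] (+ 2 * k + bit b - (+ 2 * l + bit c) ≡ + 2 * n + bit (b xor c))
    table k l false false = k - l , solve 2 (λ k l → con (+ 2) :* k :+ con (+ 0) :- (con (+ 2) :* l :+ con (+ 0)) := con (+ 2) :* (k :- l) :+ con (+ 0)) refl k l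
    table k l false true = k - l - + 1 , solve 2 (λ k l → con (+ 2) :* k :+ con (+ 0) :- (con (+ 2) :* l :+ con (+ 1)) := con (+ 2) :* (k :- l :- con (+ 1)) :+ con (+ 1)) refl k l
    table k l true false = k - l , solve 2 (λ k l → con (+ 2) :* k :+ con (+ 1) :- (con (+ 2) :* l :+ con (+ 0)) := con (+ 2) :* (k :- l) :+ con (+ 1)) refl k l
    table k l true true = k - l , solve 2 (λ k l → con (+ 2) :* k :+ con (+ 1) :- (con (+ 2) :* l :+ con (+ 1)) := con (+ 2) :* (k :- l) :+ con (+ 0)) refl k l
    go : (∃[ k ] i ≡ + 2 * k + bit (odd? i)) → (∃[ l ] j ≡ + 2 * l + bit (odd? j)) → odd? (i - j) ≡ odd? i xor odd? j
    go (k , i≡) (l , j≡) with table k l (odd? i) (odd? j)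
    ... | n , eq = odd?-unique (i - j) n _ (trans (cong₂ _-_ i≡ j≡) eq)

  odd?-* : ∀ i j → odd? (i * j) ≡ odd? i ∧ odd? j
  odd?-* i j = go (odd?-witness i) (odd?-witness j)
    where
    table : ∀ k l b c → ∃[ n ] ((+ 2 * k + bit b) * (+ 2 * l + bit c) ≡ + 2 * n + bit (b ∧ c))
    table k l false c = k * (+ 2 * l + bit c) , solve 2 (λ k y → (con (+ 2) :* k :+ con (+ 0)) :* y := con (+ 2) :* (k :* y) :+ con (+ 0)) refl k (+ 2 * l + bit c)
    table k l true false = (+ 2 * k + + 1) * l , solve 2 (λ k l → (con (+ 2) :* k :+ con (+ 1)) :* (con (+ 2) :* l :+ con (+ 0)) := con (+ 2) :* ((con (+ 2) :* k :+ con (+ 1)) :* l) :+ con (+ 0)) refl k l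
    table k l true true = + 2 * (k * l) + k + l , solve 2 (λ k l → (con (+ 2) :* k :+ con (+ 1)) :* (con (+ 2) :* l :+ con (+ 1)) := con (+ 2) :* (con (+ 2) :* (k :* l) :+ k :+ l) :+ con (+ 1)) refl k l
    go : (∃[ k ] i ≡ + 2 * k + bit (odd? i)) → (∃[ l ] j ≡ + 2 * l + bit (odd? j)) → odd? (i * j) ≡ odd? i ∧ odd? j
    go (k , i≡) (l , j≡) with table k l (odd? i) (odd? j)
    ... | n , eq = odd?-unique (i * j) n _ (trans (cong₂ _*_ i≡ j≡) eq)

  even⇒2∣ : ∀ i → odd? i ≡ false → + 2 ∣ i
  even⇒2∣ i e with odd?-witness i
  ... | k , eq rewrite e = ℕ.divides ∣ k ∣ (trans (cong ∣_∣ (trans eq (+-identityʳ (+ 2 * k)))) (trans (abs-* (+ 2) k) (ℕ.*-comm 2 ∣ k ∣)))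

  2∣⇒even : ∀ i → + 2 ∣ i → odd? i ≡ false
  2∣⇒even i (ℕ.divides q eq) with +∣i∣≡i⊎+∣i∣≡-i i
  ... | inj₁ pos = odd?-unique i (+ q) false (trans (sym pos) (trans (cong +_ eq) (trans (pos-* q 2) (trans (*-comm (+ q) (+ 2)) (sym (+-identityʳ _))))))
  ... | inj₂ neg = odd?-unique i (- + q) false (trans (solve 1 (λ i → i := :- (:- i)) refl i) (trans (cong -_ (trans (sym neg) (trans (cong +_ eq) (pos-* q 2))))
        (solve 1 (λ q → :- (q :* con (+ 2)) := con (+ 2) :* (:- q) :+ con (+ 0)) refl (+ q))))

  OddZ⇒odd? : ∀ {i} → OddZ i → odd? i ≡ true
  OddZ⇒odd? {i} h with odd? i in eq
  ... | true = refl
  ... | false = ⊥-elim (h (even⇒2∣ i eq))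

  odd?⇒OddZ : ∀ {i} → odd? i ≡ true → OddZ i
  odd?⇒OddZ {i} o d with trans (sym o) (2∣⇒even i d)
  ... | ()

  UnitNorm : ℤ → ℤ → ℤ → Set
  UnitNorm D a b = a * a - D * (b * b) ≡ + 4 ⊎ a * a - D * (b * b) ≡ - + 4

  unit-even-norm : ∀ D a b → UnitNorm D a b → odd? (a * a - D * (b * b)) ≡ false
  unit-even-norm D a b (inj₁ eq) = cong odd? eq
  unit-even-norm D a b (inj₂ eq) = cong odd? eq

  -- Squaring preserves parity, so `a² - Db²` has the parity of `a - Db`, and ±4 is even.
  norm-parity : ∀ D a b → UnitNorm D a b → odd? a ≡ odd? D ∧ odd? b
  norm-parity D a b h = cases (odd? a) (odd? D) (odd? b) (trans (sym homs) (unit-even-norm D a b h))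
    where
    homs : odd? (a * a - D * (b * b)) ≡ (odd? a ∧ odd? a) xor (odd? D ∧ (odd? b ∧ odd? b))
    homs = trans (odd?-- (a * a) (D * (b * b))) (cong₂ _xor_ (odd?-* a a) (trans (odd?-* D (b * b)) (cong (odd? D ∧_) (odd?-* b b))))
    cases : ∀ x y z → (x ∧ x) xor (y ∧ (z ∧ z)) ≡ false → x ≡ y ∧ z
    cases false false z eq = refl
    cases false true false eq = refl
    cases true false z ()
    cases true true true eq = refl

  InOK-automatic : ∀ D a b → UnitNorm (+ D) a b → InOK D a b
  InOK-automatic D a b h = even⇒2∣ (a - b * + D) (trans (odd?-- a (b * + D)) (trans (cong₂ _xor_ (norm-parity (+ D) a b h) (odd?-* b (+ D))) (cases (odd? (+ D)) (odd? b))))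
    where
    cases : ∀ y z → (y ∧ z) xor (z ∧ y) ≡ false
    cases false false = refl
    cases false true = refl
    cases true false = refl
    cases true true = refl

  norm≥-4 : ∀ {D a b} → UnitNorm D a b → - + 4 ≤ a * a - D * (b * b)
  norm≥-4 (inj₁ eq) = ≤-trans -≤+ (≤-reflexive (sym eq))
  norm≥-4 (inj₂ eq) = ≤-reflexive (sym eq)

  norm≤4 : ∀ {D a b} → UnitNorm D a b → a * a - D * (b * b) ≤ + 4
  norm≤4 (inj₁ eq) = ≤-reflexive eq
  norm≤4 (inj₂ eq) = ≤-trans (≤-reflexive eq) -≤+

  record PosUnit (D a b : ℤ) : Set where
    constructor posUnit
    field
      1≤a : + 1 ≤ a
      1≤b : + 1 ≤ b
      unit : UnitNorm D a b
  open PosUnit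

  sq-<⇒< : ∀ {a b} → + 0 ≤ b → a * a < b * b → a < b
  sq-<⇒< {a} {b} 0≤b h with b ≤? a
  ... | yes b≤a = ⊥-elim (<⇒≱ h (*-mono-≤′ 0≤b (≤-trans 0≤b b≤a) b≤a b≤a))
  ... | no b≰a = ≰⇒> b≰a

  cancel-<-pos : ∀ {a b c} → + 0 ≤ c → c * a < c * b → a < b
  cancel-<-pos {a} {b} {c} 0≤c h with b ≤? a
  ... | yes b≤a = ⊥-elim (<⇒≱ h (*-mono-≤′ {c} {c} {b} {a} 0≤c′ 0≤a ≤-refl b≤a))
    where
    0≤c′ = 0≤c
    0≤a : + 0 ≤ a
    0≤a with + 0 ≤? a
    ... | yes p = p
    ... | no ¬p = ⊥-elim (<⇒≱ h (≤-by-diff (c * (a - b)) (nonneg-* 0≤c (≤⇒nonneg b≤a)) (solve 3 (λ a b c → c :* a :- c :* b := c :* (a :- b)) refl a b c)))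
  ... | no b≰a = ≰⇒> b≰a

  module _ {D : ℤ} (5≤D : + 5 ≤ D) where
    private
      1≤D : + 1 ≤ D
      1≤D = ≤-trans (+≤+ (s≤s z≤n)) 5≤D
      0≤D = 1≤⇒0≤ 1≤D

    -- The norms differ by at most 8, whereas `D(b² - b′²) ≥ 5 · 3`, since `b > b′ ≥ 1`. This leaves
    -- `a² - a′² ≥ 7`.
    second<⇒first< : ∀ {a b a′ b′} → PosUnit D a b → PosUnit D a′ b′ → b′ < b → a′ < a
    second<⇒first< {a} {b} {a′} {b′} u u′ b′<b = sq-<⇒< (1≤⇒0≤ (1≤a u)) (<-by-diff (+ 7 + E) (≤-by-diff (+ 6 + E) (nonneg-+ {+ 6} (+≤+ z≤n) 0≤E) (solve 1 (λ E → con (+ 7) :+ E :- con (+ 1) := con (+ 6) :+ E) refl E))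
        (solve 5 (λ D a b a′ b′ → a :* a :- a′ :* a′ := con (+ 7) :+ ((a :* a :- D :* (b :* b) :- (con (- + 4))) :+ (con (+ 4) :- (a′ :* a′ :- D :* (b′ :* b′)))
          :+ (D :* ((b :- b′ :- con (+ 1)) :* (b :+ b′)) :+ D :* (b :- b′ :- con (+ 1)) :+ con (+ 2) :* (D :* (b′ :- con (+ 1))) :+ con (+ 3) :* (D :- con (+ 5))))) refl D a b a′ b′))
      where
      g = ≤⇒nonneg (<⇒1≤diff b′<b)
      E = (a * a - D * (b * b) - - + 4) + (+ 4 - (a′ * a′ - D * (b′ * b′)))
          + (D * ((b - b′ - + 1) * (b + b′)) + D * (b - b′ - + 1) + + 2 * (D * (b′ - + 1)) + + 3 * (D - + 5))
      0≤E : + 0 ≤ E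
      0≤E = nonneg-+ (nonneg-+ (≤⇒nonneg (norm≥-4 {D} {a} {b} (unit u))) (≤⇒nonneg (norm≤4 {D} {a′} {b′} (unit u′))))
        (nonneg-+ (nonneg-+ (nonneg-+ (nonneg-* 0≤D (nonneg-* g (nonneg-+ (1≤⇒0≤ (1≤b u)) (1≤⇒0≤ (1≤b u′))))) (nonneg-* 0≤D g)) (nonneg-scale 2 (nonneg-* 0≤D (≤⇒nonneg (1≤b u′))))) (nonneg-scale 3 (≤⇒nonneg 5≤D)))

    first≤⇒second≤ : ∀ {a b a′ b′} → PosUnit D a b → PosUnit D a′ b′ → a ≤ a′ → b ≤ b′
    first≤⇒second≤ {a} {b} {a′} {b′} u u′ a≤a′ with b ≤? b′
    ... | yes p = p
    ... | no ¬p = ⊥-elim (<⇒≱ (second<⇒first< u u′ (≰⇒> ¬p)) a≤a′)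

-- Fundamental and totally positive fundamental units

module FundamentalUnit where

  open import Data.Nat as ℕ using (ℕ; z≤n; s≤s)
  open import Data.Bool using (true; false; _∧_; _xor_)
  open import Data.Integer hiding (suc)
  open import Data.Integer.Properties
  open import Data.Integer.Solver
  open import Data.Product using (∃-syntax; _×_; _,_; proj₁; proj₂)
  open import Data.Sum using (inj₁; inj₂)
  open import Data.Empty using (⊥; ⊥-elim)
  open import Relation.Nullary using (yes; no)
  open import Relation.Binary.PropositionalEquality
  open import Defs
  open IntegerOrder
  open CubicForm
  open Units
  open PosUnit
  open +-*-Solver

  private
    not-negative : ∀ {x} → x ≤ + 0 → + 1 ≤ x → ⊥
    not-negative x≤0 1≤x = <⇒≱ (1≤⇒0< 1≤x) x≤0

  module _ (D′ : ℕ) (5≤D : + 5 ≤ + D′) where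
    private
      D = + D′
      1≤D : + 1 ≤ D
      1≤D = ≤-trans (+≤+ (s≤s z≤n)) 5≤D
      0≤D = 1≤⇒0≤ 1≤D

    GtOne⇒PosUnit : ∀ {a b} → UnitNorm D a b → GtOne D′ a b → PosUnit D a b
    GtOne⇒PosUnit {a} {b} u (inj₁ (p≥0 , q≥0 , inj₂ q>0)) = posUnit (≤-trans (+≤+ (s≤s z≤n)) (0≤i-j⇒j≤i {a} {+ 2} p≥0)) (0<⇒1≤ q>0) u
    GtOne⇒PosUnit {a} {b} u (inj₁ (p≥0 , q≥0 , inj₁ p>0)) = posUnit (≤-trans (+≤+ (s≤s z≤n)) 2≤a) 1≤b′ u
      where
      2≤a = 0≤i-j⇒j≤i {a} {+ 2} p≥0
      1≤b′ : + 1 ≤ b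
      1≤b′ with + 1 ≤? b
      ... | yes p = p
      ... | no ¬p = ⊥-elim (not-negative (≤-by-diff E 0≤E (solve 3 (λ a D b → con (+ 0) :- con (+ 1) := (con (+ 4) :- (a :* a :- D :* (b :* b))) :+ ((a :- con (+ 2)) :- con (+ 1)) :* (a :+ con (+ 2)) :+ ((a :- con (+ 2)) :- con (+ 1)) :+ (con (+ 0) :- D :* (b :* b)) :+ con (+ 4)) refl a D b)) ≤-refl)
        where
        b≡0 : b ≡ + 0
        b≡0 = ≤-antisym (i<j⇒i≤pred[j] (≰⇒> ¬p)) q≥0
        E = (+ 4 - (a * a - D * (b * b))) + ((a - + 2) - + 1) * (a + + 2) + ((a - + 2) - + 1) + (+ 0 - D * (b * b)) + + 4
        0≤E : + 0 ≤ E
        0≤E = nonneg-+ (nonneg-+ (nonneg-+ (nonneg-+ (≤⇒nonneg (norm≤4 {D} {a} {b} u)) (nonneg-* (≤⇒nonneg (0<⇒1≤ p>0)) (nonneg-+ (≤-trans (+≤+ z≤n) 2≤a) (+≤+ z≤n)))) (≤⇒nonneg (0<⇒1≤ p>0)))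
          (≤-reflexive (trans (sym (solve 1 (λ D → con (+ 0) :- D :* (con (+ 0) :* con (+ 0)) := con (+ 0)) refl D)) (cong (λ w → + 0 - D * (w * w)) (sym b≡0))))) (+≤+ z≤n)
    -- Here `a ≥ 3` and `Db² < (a - 2)²`, so `a² - Db²` would exceed `4a - 4 ≥ 8`.
    GtOne⇒PosUnit {a} {b} u (inj₂ (inj₁ (p>0 , q<0 , h))) = ⊥-elim (not-negative (≤-by-diff ((+ 4 - (a * a - D * (b * b))) + ((a - + 2) * (a - + 2) - D * (b * b) - + 1) + + 4 * ((a - + 2) - + 1) + + 4)
        (nonneg-+ (nonneg-+ (nonneg-+ (≤⇒nonneg (norm≤4 {D} {a} {b} u)) (≤⇒nonneg (<⇒1≤diff h))) (nonneg-scale 4 (≤⇒nonneg (0<⇒1≤ p>0)))) (+≤+ z≤n))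
        (solve 3 (λ a D b → con (+ 0) :- con (+ 1) := (con (+ 4) :- (a :* a :- D :* (b :* b))) :+ ((a :- con (+ 2)) :* (a :- con (+ 2)) :- D :* (b :* b) :- con (+ 1)) :+ con (+ 4) :* ((a :- con (+ 2)) :- con (+ 1)) :+ con (+ 4)) refl a D b)) ≤-refl)
    GtOne⇒PosUnit {a} {b} u (inj₂ (inj₂ (p<0 , q>0 , h))) = posUnit 1≤a′ (0<⇒1≤ q>0) u
      where
      -- If `a ≤ 0`, then `Db² > (a - 2)² ≥ a² + 4`, and `a² - Db²` would be below -4.
      1≤a′ : + 1 ≤ a
      1≤a′ with + 1 ≤? a
      ... | yes p = p
      ... | no ¬p = ⊥-elim (not-negative (≤-by-diff ((a * a - D * (b * b) - - + 4) + (D * (b * b) - (a - + 2) * (a - + 2) - + 1) + + 4 * (+ 0 - a))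
        (nonneg-+ (nonneg-+ (≤⇒nonneg (norm≥-4 {D} {a} {b} u)) (≤⇒nonneg (<⇒1≤diff h))) (nonneg-scale 4 (≤⇒nonneg (i<j⇒i≤pred[j] (≰⇒> ¬p)))))
        (solve 3 (λ a D b → con (+ 0) :- con (+ 1) := (a :* a :- D :* (b :* b) :- con (- + 4)) :+ (D :* (b :* b) :- (a :- con (+ 2)) :* (a :- con (+ 2)) :- con (+ 1)) :+ con (+ 4) :* (con (+ 0) :- a)) refl a D b)) ≤-refl)

    PosUnit⇒GtOne : ∀ {a b} → PosUnit D a b → GtOne D′ a b
    PosUnit⇒GtOne {a} {b} u with + 2 ≤? a
    ... | yes 2≤a = inj₁ (≤⇒nonneg 2≤a , 1≤⇒0≤ (1≤b u) , inj₂ (1≤⇒0< (1≤b u)))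
    ... | no 2≰a = inj₂ (inj₂ (subst (λ w → w - + 2 < + 0) (sym a≡1) -<+ , 1≤⇒0< (1≤b u) , subst (λ w → D * (b * b) > (w - + 2) * (w - + 2)) (sym a≡1)
          (<-by-diff {+ 1} {D * (b * b)} ((D - + 2) + D * (b * b - + 1) + + 1) (≤-by-diff ((D - + 2) + D * (b * b - + 1)) (nonneg-+ (≤⇒nonneg (≤-trans (+≤+ (s≤s (s≤s z≤n))) 5≤D)) (nonneg-* 0≤D (≤⇒nonneg (pos-*′ (1≤b u) (1≤b u))))) (solve 1 (λ x → x :+ con (+ 1) :- con (+ 1) := x) refl ((D - + 2) + D * (b * b - + 1))))
            (solve 2 (λ D B → D :* B :- con (+ 1) := (D :- con (+ 2)) :+ D :* (B :- con (+ 1)) :+ con (+ 1)) refl D (b * b)))))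
      where
      a≡1 : a ≡ + 1
      a≡1 = ≤-antisym (i<j⇒i≤pred[j] (≰⇒> 2≰a)) (1≤a u)

    LeRe-intro : ∀ {a b a′ b′} → a ≤ a′ → b ≤ b′ → LeRe D′ a b a′ b′
    LeRe-intro {a} {b} {a′} {b′} a≤a′ b≤b′ with a ≟ a′ | b ≟ b′
    ... | yes refl | yes refl = inj₂ (+-inverseʳ a , +-inverseʳ b)
    ... | no a≢a′ | _ = inj₁ (inj₁ (≤⇒nonneg a≤a′ , ≤⇒nonneg b≤b′ , inj₁ (1≤⇒0< (<⇒1≤diff (≤∧≢⇒< a≤a′ a≢a′)))))
    ... | yes _ | no b≢b′ = inj₁ (inj₁ (≤⇒nonneg a≤a′ , ≤⇒nonneg b≤b′ , inj₂ (1≤⇒0< (<⇒1≤diff (≤∧≢⇒< b≤b′ b≢b′)))))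

    private
      diff<0⇒< : ∀ {x y} → y - x < + 0 → y < x
      diff<0⇒< {x} {y} h = <-by-diff {y} {x} (+ 0 - (y - x)) (<⇒1≤diff h) (solve 2 (λ x y → x :- y := con (+ 0) :- (y :- x)) refl x y)
      0<diff⇒< : ∀ {x y} → + 0 < y - x → x < y
      0<diff⇒< h = 1≤diff⇒< (0<⇒1≤ h)

    LeRe-elim : ∀ {a b a′ b′} → PosUnit D a b → PosUnit D a′ b′ → LeRe D′ a b a′ b′ → a ≤ a′
    LeRe-elim {a} {b} {a′} {b′} u u′ (inj₁ (inj₁ (p≥0 , _))) = 0≤i-j⇒j≤i {a′} {a} p≥0
    LeRe-elim {a} {b} {a′} {b′} u u′ (inj₁ (inj₂ (inj₁ (p>0 , _)))) = <⇒≤ (0<diff⇒< {a} {a′} p>0)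
    LeRe-elim {a} {b} {a′} {b′} u u′ (inj₁ (inj₂ (inj₂ (p<0 , q>0 , _)))) = ⊥-elim (<-asym (diff<0⇒< {a} {a′} p<0) (second<⇒first< 5≤D u′ u (0<diff⇒< {b} {b′} q>0)))
    LeRe-elim {a} {b} {a′} {b′} u u′ (inj₂ (p≡0 , _)) = ≤-reflexive (sym (i-j≡0⇒i≡j a′ a p≡0))


    fundamental-elim : ∀ {a b} → IsFundUnit D′ a b → PosUnit D a b × (∀ a′ b′ → PosUnit D a′ b′ → a ≤ a′)
    fundamental-elim {a} {b} ((_ , u) , gt , least) = pu , λ a′ b′ u′ → LeRe-elim pu u′ (least a′ b′ (InOK-automatic D′ a′ b′ (unit u′) , unit u′) (PosUnit⇒GtOne u′))
      where
      pu : PosUnit D a b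
      pu = GtOne⇒PosUnit u gt

    fundamental-intro : ∀ {a b} → PosUnit D a b → (∀ a′ b′ → PosUnit D a′ b′ → a ≤ a′) → IsFundUnit D′ a b
    fundamental-intro {a} {b} u least = (InOK-automatic D′ a b (unit u) , unit u) , PosUnit⇒GtOne u ,
      λ a′ b′ u′ gt′ → let pu′ = GtOne⇒PosUnit (proj₂ u′) gt′ in LeRe-intro (least a′ b′ pu′) (first≤⇒second≤ 5≤D u pu′ (least a′ b′ pu′))

    totallyPositive-intro : ∀ {a b} → PosUnit D a b → a * a - D * (b * b) ≡ + 4 → (∀ a′ b′ → PosUnit D a′ b′ → a′ * a′ - D * (b′ * b′) ≡ + 4 → a ≤ a′) → IsTotPosFundUnit D′ a b
    totallyPositive-intro {a} {b} u eq least = (InOK-automatic D′ a b (unit u) , eq) , PosUnit⇒GtOne u ,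
      λ a′ b′ u′ gt′ → let pu′ = GtOne⇒PosUnit (inj₁ (proj₂ u′)) gt′ in LeRe-intro (least a′ b′ pu′ (proj₂ u′)) (first≤⇒second≤ 5≤D u pu′ (least a′ b′ pu′ (proj₂ u′)))

    -- The quotient of a unit c + d√D of norm 1 by a unit a + b√D of norm -1 has norm -1, so it is again at least a + b√D.
    quotient-pos : ∀ {a b c d} → PosUnit D a b → PosUnit D c d → b ≤ d → a * a - D * (b * b) ≡ - + 4 → c * c - D * (d * d) ≡ + 4 →
      a * c < D * (b * d) × a * d < b * c
    quotient-pos {a} {b} {c} {d} u v b≤d eqa eqc =
      sq-<⇒< (nonneg-* 0≤D (nonneg-* 0≤b 0≤d)) (<-by-diff (+ 16 + + 4 * (D * (d * d - b * b))) (≤-by-diff (+ 15 + + 4 * (D * (d * d - b * b))) (nonneg-+ {+ 15} (+≤+ z≤n) (nonneg-scale 4 (nonneg-* 0≤D (≤⇒nonneg (*-mono-≤′ 0≤b 0≤d b≤d b≤d))))) (solve 1 (λ x → con (+ 16) :+ x :- con (+ 1) := con (+ 15) :+ x) refl (+ 4 * (D * (d * d - b * b)))))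
        (trans (solve 5 (λ D a b c d → D :* (b :* d) :* (D :* (b :* d)) :- a :* c :* (a :* c) := con (+ 16) :+ con (+ 4) :* (D :* (d :* d :- b :* b)) :+ (:- (D :* (d :* d) :+ con (+ 4))) :* (a :* a :- D :* (b :* b) :- (con (- + 4))) :+ (:- (a :* a)) :* (c :* c :- D :* (d :* d) :- con (+ 4))) refl D a b c d)
          (trans (diff-zero eqc _ (- (a * a))) (diff-zero eqa _ (- (D * (d * d) + + 4)))))) ,
      sq-<⇒< (nonneg-* 0≤b 0≤c) (<-by-diff (+ 4 * (d * d) + + 4 * (b * b)) (≤-trans (pos-*′ {+ 4} (+≤+ (s≤s z≤n)) (pos-*′ (1≤b v) (1≤b v))) (≤-by-diff (+ 4 * (b * b)) (nonneg-scale 4 (nonneg-sq b)) (solve 2 (λ x y → x :+ y :- x := y) refl (+ 4 * (d * d)) (+ 4 * (b * b)))))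
        (trans (solve 5 (λ D a b c d → b :* c :* (b :* c) :- a :* d :* (a :* d) := con (+ 4) :* (d :* d) :+ con (+ 4) :* (b :* b) :+ (:- (d :* d)) :* (a :* a :- D :* (b :* b) :- con (- + 4)) :+ (b :* b) :* (c :* c :- D :* (d :* d) :- con (+ 4))) refl D a b c d)
          (trans (diff-zero eqc _ (b * b)) (diff-zero eqa _ (- (d * d))))))
      where
      0≤b = 1≤⇒0≤ (1≤b u)
      0≤d = 1≤⇒0≤ (1≤b v)
      0≤c = 1≤⇒0≤ (1≤a v)

    half : ∀ i → odd? i ≡ false → ∃[ k ] i ≡ + 2 * k
    half i e with odd?-witness i
    ... | k , eq rewrite e = k , trans eq (+-identityʳ _)

    half-pos : ∀ {x y k} → x < y → y - x ≡ + 2 * k → + 1 ≤ k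
    half-pos {x} {y} {k} h eq with + 1 ≤? k
    ... | yes p = p
    ... | no ¬p = ⊥-elim (not-negative (≤-by-diff (+ 2 * (+ 0 - k)) (nonneg-scale 2 (≤⇒nonneg (i<j⇒i≤pred[j] (≰⇒> ¬p)))) (solve 1 (λ k → con (+ 0) :- con (+ 2) :* k := con (+ 2) :* (con (+ 0) :- k)) refl k)) (subst (+ 1 ≤_) eq (<⇒1≤diff h)))

    -- The quotient `(A + B√D)/2` satisfies `A ≥ a` and `B ≥ b` by minimality. Multiplying back
    -- gives `c = (aA + DbB)/2 ≥ (a² + Db²)/2 = a² + 2`, the trace of the square of the least unit.
    square-least : ∀ {a b c d} → PosUnit D a b → (∀ a′ b′ → PosUnit D a′ b′ → a ≤ a′) → a * a - D * (b * b) ≡ - + 4 →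
      PosUnit D c d → c * c - D * (d * d) ≡ + 4 → a * a + + 2 ≤ c
    square-least {a} {b} {c} {d} u least eqa v eqc = go (half (D * (b * d) - a * c) even₁) (half (b * c - a * d) even₂)
      where
      pa = norm-parity D a b (unit u)
      pc = norm-parity D c d (unit v)
      even₁ : odd? (D * (b * d) - a * c) ≡ false
      even₁ = trans (odd?-- (D * (b * d)) (a * c)) (trans (cong₂ _xor_ (trans (odd?-* D (b * d)) (cong (odd? D ∧_) (odd?-* b d))) (trans (odd?-* a c) (cong₂ _∧_ pa pc))) (table (odd? D) (odd? b) (odd? d)))
        where
        table : ∀ x y z → (x ∧ (y ∧ z)) xor ((x ∧ y) ∧ (x ∧ z)) ≡ false
        table false y z = refl
        table true false z = refl
        table true true false = refl
        table true true true = refl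
      even₂ : odd? (b * c - a * d) ≡ false
      even₂ = trans (odd?-- (b * c) (a * d)) (trans (cong₂ _xor_ (trans (odd?-* b c) (cong (odd? b ∧_) pc)) (trans (odd?-* a d) (cong (_∧ odd? d) pa))) (table (odd? D) (odd? b) (odd? d)))
        where
        table : ∀ x y z → (y ∧ (x ∧ z)) xor ((x ∧ y) ∧ z) ≡ false
        table false false z = refl
        table false true z = refl
        table true false z = refl
        table true true false = refl
        table true true true = refl
      b≤d = first≤⇒second≤ 5≤D u v (least c d v)
      both = quotient-pos u v b≤d eqa eqc
      go : (∃[ A ] D * (b * d) - a * c ≡ + 2 * A) → (∃[ B ] b * c - a * d ≡ + 2 * B) → a * a + + 2 ≤ c
      go (A , Aeq) (B , Beq) = *-cancel-≤′ {a * a + + 2} {c} {+ 4} (+≤+ (s≤s z≤n)) (≤-by-diff (+ 2 * (a * (A - a)) + + 2 * (D * (b * (B - b))))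
          (nonneg-+ (nonneg-scale 2 (nonneg-* (1≤⇒0≤ (1≤a u)) (≤⇒nonneg a≤A))) (nonneg-scale 2 (nonneg-* 0≤D (nonneg-* (1≤⇒0≤ (1≤b u)) (≤⇒nonneg b≤B)))))
          (trans (solve 7 (λ D a b c d A B → con (+ 4) :* c :- con (+ 4) :* (a :* a :+ con (+ 2)) := con (+ 2) :* (a :* (A :- a)) :+ con (+ 2) :* (D :* (b :* (B :- b)))
               :+ a :* (D :* (b :* d) :- a :* c :- con (+ 2) :* A) :+ (D :* b) :* (b :* c :- a :* d :- con (+ 2) :* B) :+ (c :- con (+ 2)) :* (a :* a :- D :* (b :* b) :- (con (- + 4)))) refl D a b c d A B)
            (trans (diff-zero eqa _ (c - + 2)) (trans (diff-zero Beq _ (D * b)) (diff-zero Aeq _ a)))))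
        where
        normAB : A * A - D * (B * B) ≡ - + 4
        normAB = *-cancelˡ-≡ (+ 4) (A * A - D * (B * B)) (- + 4) (trans (solve 3 (λ D A B → con (+ 4) :* (A :* A :- D :* (B :* B)) := con (+ 2) :* A :* (con (+ 2) :* A) :- D :* (con (+ 2) :* B :* (con (+ 2) :* B))) refl D A B)
          (trans (cong₂ (λ x y → x * x - D * (y * y)) (sym Aeq) (sym Beq)) (trans (solve 5 (λ D a b c d → let x = D :* (b :* d) :- a :* c ; y = b :* c :- a :* d in x :* x :- D :* (y :* y) := (a :* a :- D :* (b :* b)) :* (c :* c :- D :* (d :* d))) refl D a b c d)
            (cong₂ _*_ eqa eqc))))
        AB : PosUnit D A B
        AB = posUnit (half-pos {a * c} (proj₁ both) Aeq) (half-pos {a * d} (proj₂ both) Beq) (inj₂ normAB)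
        a≤A = least A B AB
        b≤B = first≤⇒second≤ 5≤D u AB a≤A

    square-posUnit : ∀ {a b} → PosUnit D a b → a * a - D * (b * b) ≡ - + 4 → (a * a + + 2) * (a * a + + 2) - D * (a * b * (a * b)) ≡ + 4
    square-posUnit {a} {b} u eq = trans (solve 3 (λ D a b → (a :* a :+ con (+ 2)) :* (a :* a :+ con (+ 2)) :- D :* (a :* b :* (a :* b)) := con (+ 4) :+ (a :* a) :* (a :* a :- D :* (b :* b) :- con (- + 4))) refl D a b) (diff-zero eq (+ 4) (a * a))

    fundamental-odd⇒totallyPositive-odd : ∀ {a b} → IsFundUnit D′ a b → OddZ a → ∃[ a′ ] ∃[ b′ ] (IsTotPosFundUnit D′ a′ b′ × OddZ a′)
    fundamental-odd⇒totallyPositive-odd {a} {b} fund odd with fundamental-elim fund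
    ... | u , least with unit u
    ... | inj₁ eq = a , b , totallyPositive-intro u eq (λ a′ b′ u′ _ → least a′ b′ u′) , odd
    ... | inj₂ eq = a * a + + 2 , a * b , totallyPositive-intro sq (square-posUnit u eq) (λ a′ b′ u′ eq′ → square-least u least eq u′ eq′) , odd?⇒OddZ {a * a + + 2} odd′
      where
      sq : PosUnit D (a * a + + 2) (a * b)
      sq = posUnit (≤-trans {+ 1} {+ 2} (+≤+ (s≤s z≤n)) (≤-by-diff (a * a) (nonneg-sq a) (solve 1 (λ x → x :+ con (+ 2) :- con (+ 2) := x) refl (a * a)))) (pos-*′ (1≤a u) (1≤b u)) (inj₁ (square-posUnit u eq))
      odd′ : odd? (a * a + + 2) ≡ true
      odd′ = trans (cong odd? {a * a + + 2} {a * a - - + 2} refl) (trans (odd?-- (a * a) (- + 2)) (trans (cong (_xor false) (trans (odd?-* a a) (cong (λ x → x ∧ x) (OddZ⇒odd? {a} odd)))) refl))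

-- Descent from a unit of odd trace

module OddUnits where

  open import Data.Nat as ℕ using (ℕ; zero; suc; z≤n; s≤s)
  import Data.Nat.Properties as ℕ
  open import Data.Nat.Induction using (<-rec)
  open import Data.Bool using (true; false; _∧_; _xor_)
  open import Data.Integer hiding (suc)
  open import Data.Integer.Properties
  open import Data.Integer.Solver
  open import Data.Product using (∃-syntax; _×_; _,_; proj₁; proj₂)
  open import Data.Sum using (_⊎_; inj₁; inj₂; [_,_]′)
  open import Data.Empty using (⊥; ⊥-elim)
  open import Relation.Binary.PropositionalEquality
  open import Defs
  open IntegerOrder
  open CubicForm
  open Units
  open FundamentalUnit
  open PosUnit
  open +-*-Solver

  abs-sq : ∀ x → + ∣ x ∣ * + ∣ x ∣ ≡ x * x
  abs-sq x with +∣i∣≡i⊎+∣i∣≡-i x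
  ... | inj₁ eq = cong₂ _*_ eq eq
  ... | inj₂ eq = trans (cong₂ _*_ eq eq) (solve 1 (λ x → (:- x) :* (:- x) := x :* x) refl x)

  odd?-abs : ∀ x → odd? (+ ∣ x ∣) ≡ odd? x
  odd?-abs x with +∣i∣≡i⊎+∣i∣≡-i x
  ... | inj₁ eq = cong odd? eq
  ... | inj₂ eq = trans (cong odd? (trans eq (solve 1 (λ x → :- x := con (+ 0) :- x) refl x))) (odd?-- (+ 0) x)

  abs-< : ∀ {x n} → x < + n → - x < + n → ∣ x ∣ ℕ.< n
  abs-< {x} {n} h h′ with +∣i∣≡i⊎+∣i∣≡-i x
  ... | inj₁ eq = drop‿+<+ (subst (_< + n) (sym eq) h)
  ... | inj₂ eq = drop‿+<+ (subst (_< + n) (sym eq) h′)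

  1≤abs : ∀ x → x ≢ + 0 → + 1 ≤ + ∣ x ∣
  1≤abs (+ zero) h = ⊥-elim (h refl)
  1≤abs (+ suc n) h = +≤+ (s≤s z≤n)
  1≤abs -[1+ n ] h = +≤+ (s≤s z≤n)

  odd⇒≢0 : ∀ x → odd? x ≡ true → x ≢ + 0
  odd⇒≢0 x o refl with o
  ... | ()

  ∧-true : ∀ {x y} → x ∧ y ≡ true → x ≡ true × y ≡ true
  ∧-true {true} {true} _ = refl , refl

  odd-unit⇒posUnit : ∀ {D a b} → UnitNorm D a b → odd? a ≡ true → PosUnit D (+ ∣ a ∣) (+ ∣ b ∣)
  odd-unit⇒posUnit {D} {a} {b} u o = posUnit (1≤abs a (odd⇒≢0 a o)) (1≤abs b (odd⇒≢0 b (proj₂ (∧-true {odd? D} (trans (sym (norm-parity D a b u)) o)))))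
    (subst₂ (λ x y → x - D * y ≡ + 4 ⊎ x - D * y ≡ - + 4) (sym (abs-sq a)) (sym (abs-sq b)) u)

  -- With S = a₁² - Db₁² and V = c² - Dd², the numbers x = a₁c and v = Db₁d satisfy x² - v² = Va₁² + Sc² - SV.
  quotient-smaller : ∀ {D a₁ b₁ c d} → + 5 ≤ D → + 2 ≤ a₁ → + 1 ≤ b₁ → + 1 ≤ d → + 1 ≤ c → + 2 * a₁ ≤ c →
    - + 1 ≤ a₁ * a₁ - D * (b₁ * b₁) → a₁ * a₁ - D * (b₁ * b₁) ≤ + 1 → - + 4 ≤ c * c - D * (d * d) → c * c - D * (d * d) ≤ + 4 →
    a₁ * c - D * (b₁ * d) < c × - (a₁ * c - D * (b₁ * d)) < c
  quotient-smaller {D} {a₁} {b₁} {c} {d} 5≤D 2≤a₁ 1≤b₁ 1≤d 1≤c 2a₁≤c S≥ S≤ V≥ V≤ =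
      cancel-<-pos {a₁ * c - D * (b₁ * d)} {c} {w} 0≤w (<-by-diff (+ 1 + (E + F⁻)) (1≤1+ (nonneg-+ 0≤E 0≤F⁻)) id₁) ,
      cancel-<-pos { - (a₁ * c - D * (b₁ * d))} {c} {w} 0≤w (<-by-diff (+ 1 + (E + F⁺)) (1≤1+ (nonneg-+ 0≤E 0≤F⁺)) id₂)
    where
    v = D * (b₁ * d)
    w = a₁ * c + v
    0≤a₁ = ≤-trans (+≤+ z≤n) 2≤a₁
    0≤c = 1≤⇒0≤ 1≤c
    S = a₁ * a₁ - D * (b₁ * b₁)
    V = c * c - D * (d * d)
    5≤v : + 5 ≤ v
    5≤v = ≤-trans 5≤D (≤-by-diff (D * (b₁ * d - + 1)) (nonneg-* (≤-trans (+≤+ z≤n) 5≤D) (≤⇒nonneg (pos-*′ 1≤b₁ 1≤d))) (solve 2 (λ D x → D :* x :- D := D :* (x :- con (+ 1))) refl D (b₁ * d)))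
    0≤w : + 0 ≤ w
    0≤w = nonneg-+ (nonneg-* 0≤a₁ 0≤c) (≤-trans (+≤+ z≤n) 5≤v)
    1≤1+ : ∀ {x} → + 0 ≤ x → + 1 ≤ + 1 + x
    1≤1+ {x} h = ≤-by-diff x h (solve 1 (λ x → con (+ 1) :+ x :- con (+ 1) := x) refl x)
    p = ≤⇒nonneg S≤
    q = ≤⇒nonneg S≥
    p′ = ≤⇒nonneg V≤
    q′ = ≤⇒nonneg V≥
    half-≥0 : ∀ {x} → + 0 ≤ + 2 * x → + 0 ≤ x
    half-≥0 {x} h = *-cancel-≤′ {+ 0} {x} {+ 2} (+≤+ (s≤s z≤n)) h
    sv⁻ : + 0 ≤ + 4 + S * V
    sv⁻ = half-≥0 (subst (+ 0 ≤_) (solve 2 (λ S V → (con (+ 1) :- S) :* (con (+ 4) :- V) :+ (S :- con (- + 1)) :* (V :- con (- + 4)) := con (+ 2) :* (con (+ 4) :+ S :* V)) refl S V) (nonneg-+ (nonneg-* p p′) (nonneg-* q q′)))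
    sv⁺ : + 0 ≤ + 4 - S * V
    sv⁺ = half-≥0 (subst (+ 0 ≤_) (solve 2 (λ S V → (S :- con (- + 1)) :* (con (+ 4) :- V) :+ (con (+ 1) :- S) :* (V :- con (- + 4)) := con (+ 2) :* (con (+ 4) :- S :* V)) refl S V) (nonneg-+ (nonneg-* q p′) (nonneg-* p q′)))
    E = (a₁ - + 2) * (c * c) + (c - + 2 * a₁) * (c + + 2 * a₁) + (c - + 1) * v + (v - + 5)
    0≤E : + 0 ≤ E
    0≤E = nonneg-+ (nonneg-+ (nonneg-+ (nonneg-* (≤⇒nonneg 2≤a₁) (nonneg-sq c)) (nonneg-* (≤⇒nonneg 2a₁≤c) (nonneg-+ 0≤c (nonneg-scale 2 0≤a₁)))) (nonneg-* (≤⇒nonneg 1≤c) (≤-trans (+≤+ z≤n) 5≤v))) (≤⇒nonneg 5≤v)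
    F⁻ = (+ 4 - V) * (a₁ * a₁) + (+ 1 - S) * (c * c) + (+ 4 + S * V)
    0≤F⁻ : + 0 ≤ F⁻
    0≤F⁻ = nonneg-+ (nonneg-+ (nonneg-* p′ (nonneg-sq a₁)) (nonneg-* p (nonneg-sq c))) sv⁻
    F⁺ = (V - - + 4) * (a₁ * a₁) + (S - - + 1) * (c * c) + (+ 4 - S * V)
    0≤F⁺ : + 0 ≤ F⁺
    0≤F⁺ = nonneg-+ (nonneg-+ (nonneg-* q′ (nonneg-sq a₁)) (nonneg-* q (nonneg-sq c))) sv⁺
    id₁ : w * c - w * (a₁ * c - D * (b₁ * d)) ≡ + 1 + (E + F⁻)
    id₁ = solve 5 (λ D a b c d → let v = D :* (b :* d) ; S = a :* a :- D :* (b :* b) ; V = c :* c :- D :* (d :* d) in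
      (a :* c :+ v) :* c :- (a :* c :+ v) :* (a :* c :- v) := con (+ 1) :+ ((a :- con (+ 2)) :* (c :* c) :+ (c :- con (+ 2) :* a) :* (c :+ con (+ 2) :* a) :+ (c :- con (+ 1)) :* v :+ (v :- con (+ 5)) :+ ((con (+ 4) :- V) :* (a :* a) :+ (con (+ 1) :- S) :* (c :* c) :+ (con (+ 4) :+ S :* V)))) refl D a₁ b₁ c d
    id₂ : w * c - w * - (a₁ * c - D * (b₁ * d)) ≡ + 1 + (E + F⁺)
    id₂ = solve 5 (λ D a b c d → let v = D :* (b :* d) ; S = a :* a :- D :* (b :* b) ; V = c :* c :- D :* (d :* d) in
      (a :* c :+ v) :* c :- (a :* c :+ v) :* (:- (a :* c :- v)) := con (+ 1) :+ ((a :- con (+ 2)) :* (c :* c) :+ (c :- con (+ 2) :* a) :* (c :+ con (+ 2) :* a) :+ (c :- con (+ 1)) :* v :+ (v :- con (+ 5)) :+ ((V :- con (- + 4)) :* (a :* a) :+ (S :- con (- + 1)) :* (c :* c) :+ (con (+ 4) :- S :* V)))) refl D a₁ b₁ c d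

  module _ (D′ : ℕ) (5≤D : + 5 ≤ + D′) where
    private
      D = + D′

    module _ {a₁ b₁ : ℤ} (1≤a₁ : + 1 ≤ a₁) (1≤b₁ : + 1 ≤ b₁) (S : a₁ * a₁ - D * (b₁ * b₁) ≡ + 1 ⊎ a₁ * a₁ - D * (b₁ * b₁) ≡ - + 1)
             (D-odd : odd? D ≡ true) (least : ∀ c d → PosUnit D c d → + 2 * a₁ ≤ c) where
      private
        S≥ : - + 1 ≤ a₁ * a₁ - D * (b₁ * b₁)
        S≥ = [ (λ e → ≤-trans -≤+ (≤-reflexive (sym e))) , (λ e → ≤-reflexive (sym e)) ]′ S
        S≤ : a₁ * a₁ - D * (b₁ * b₁) ≤ + 1
        S≤ = [ ≤-reflexive , (λ e → ≤-trans (≤-reflexive e) -≤+) ]′ S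
        2≤a₁ : + 2 ≤ a₁
        2≤a₁ = sq-≤⇒≤ (1≤⇒0≤ 1≤a₁) (≤-by-diff ((a₁ * a₁ - D * (b₁ * b₁) - - + 1) + (D - + 5) * (b₁ * b₁) + + 5 * (b₁ * b₁ - + 1)) (nonneg-+ (nonneg-+ (≤⇒nonneg S≥) (nonneg-* (≤⇒nonneg 5≤D) (nonneg-sq b₁))) (nonneg-scale 5 (≤⇒nonneg (pos-*′ 1≤b₁ 1≤b₁))))
          (solve 3 (λ a B D → a :* a :- con (+ 2) :* con (+ 2) := (a :* a :- D :* B :- con (- + 1)) :+ (D :- con (+ 5)) :* B :+ con (+ 5) :* (B :- con (+ 1))) refl a₁ (b₁ * b₁) D))
        S-odd : odd? (a₁ * a₁ - D * (b₁ * b₁)) ≡ true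
        S-odd = [ cong odd? , cong odd? ]′ S
        ab-parity : odd? a₁ xor odd? b₁ ≡ true
        ab-parity = trans (sym (table (odd? a₁) (odd? b₁))) (trans (sym (trans (odd?-- (a₁ * a₁) (D * (b₁ * b₁))) (cong₂ _xor_ (odd?-* a₁ a₁) (trans (odd?-* D (b₁ * b₁)) (cong₂ _∧_ D-odd (odd?-* b₁ b₁)))))) S-odd)
          where
          table : ∀ x y → (x ∧ x) xor (y ∧ y) ≡ x xor y
          table false false = refl
          table false true = refl
          table true false = refl
          table true true = refl

      -- Multiplying by the conjugate of the even unit `a₁ + b₁√D`, which is its inverse up to sign,
      -- keeps the trace odd, because exactly one of `a₁` and `b₁` is odd, and makes it smaller in
      -- absolute value.
      descend : ∀ {c d} → PosUnit D c d → odd? c ≡ true → ∃[ x ] ∃[ y ] (UnitNorm D x y × odd? x ≡ true × x < c × - x < c)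
      descend {c} {d} u o = x , y , norm-xy , odd-x , proj₁ small , proj₂ small
        where
        x = a₁ * c - D * (b₁ * d)
        y = b₁ * c - a₁ * d
        norm-product : x * x - D * (y * y) ≡ (a₁ * a₁ - D * (b₁ * b₁)) * (c * c - D * (d * d))
        norm-product = solve 5 (λ D a b c d → let x = a :* c :- D :* (b :* d) ; y = b :* c :- a :* d in x :* x :- D :* (y :* y) := (a :* a :- D :* (b :* b)) :* (c :* c :- D :* (d :* d))) refl D a₁ b₁ c d
        norm-xy : UnitNorm D x y
        norm-xy = signs S (unit u) norm-product
          where
          signs : ∀ {s v} → s ≡ + 1 ⊎ s ≡ - + 1 → v ≡ + 4 ⊎ v ≡ - + 4 → x * x - D * (y * y) ≡ s * v → UnitNorm D x y
          signs (inj₁ s) (inj₁ v) e = inj₁ (trans e (cong₂ _*_ s v))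
          signs (inj₁ s) (inj₂ v) e = inj₂ (trans e (cong₂ _*_ s v))
          signs (inj₂ s) (inj₁ v) e = inj₂ (trans e (cong₂ _*_ s v))
          signs (inj₂ s) (inj₂ v) e = inj₁ (trans e (cong₂ _*_ s v))
        d-odd : odd? d ≡ true
        d-odd = proj₂ (∧-true {odd? D} (trans (sym (norm-parity D c d (unit u))) o))
        odd-x : odd? x ≡ true
        odd-x = trans (odd?-- (a₁ * c) (D * (b₁ * d))) (trans (cong₂ _xor_ (trans (odd?-* a₁ c) (cong (odd? a₁ ∧_) o)) (trans (odd?-* D (b₁ * d)) (cong₂ _∧_ D-odd (trans (odd?-* b₁ d) (cong (odd? b₁ ∧_) d-odd)))))
          (trans (table (odd? a₁) (odd? b₁)) ab-parity))
          where
          table : ∀ p q → (p ∧ true) xor (true ∧ (q ∧ true)) ≡ p xor q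
          table false false = refl
          table false true = refl
          table true false = refl
          table true true = refl
        small = quotient-smaller {D} {a₁} {b₁} {c} {d} 5≤D 2≤a₁ 1≤b₁ (1≤b u) (1≤a u) (least c d u) S≥ S≤ (norm≥-4 {D} {c} {d} (unit u)) (norm≤4 {D} {c} {d} (unit u))

      no-odd-unit : ∀ n d → PosUnit D (+ n) d → odd? (+ n) ≡ true → ⊥
      no-odd-unit = <-rec _ λ n rec d u o → go n rec (descend u o)
        where
        go : ∀ n → (∀ {m} → m ℕ.< n → ∀ d → PosUnit D (+ m) d → odd? (+ m) ≡ true → ⊥) → (∃[ x ] ∃[ y ] (UnitNorm D x y × odd? x ≡ true × x < + n × - x < + n)) → ⊥
        go n rec (x , y , nu , ox , x<n , -x<n) = rec (abs-< {x} x<n -x<n) (+ ∣ y ∣) (odd-unit⇒posUnit {D} {x} {y} nu ox) (trans (odd?-abs x) ox)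

    quarter : ∀ {x} → + 4 * x ≡ + 4 ⊎ + 4 * x ≡ - + 4 → x ≡ + 1 ⊎ x ≡ - + 1
    quarter {x} (inj₁ e) = inj₁ (*-cancelˡ-≡ (+ 4) x (+ 1) e)
    quarter {x} (inj₂ e) = inj₂ (*-cancelˡ-≡ (+ 4) x (- + 1) e)

    -- The descent does the work of the power structure of the unit group. A unit of odd trace
    -- forces `D` to be odd, so if `a` were even, `b` would be even too, and half of the pair `a`,
    -- `b` would be the even unit by which `descend` divides.
    odd-unit⇒least-odd : ∀ {a b c d} → PosUnit D a b → (∀ a′ b′ → PosUnit D a′ b′ → a ≤ a′) → UnitNorm D c d → odd? c ≡ true → odd? a ≡ true
    odd-unit⇒least-odd {a} {b} {c} {d} u least v o with odd? a in eq
    ... | true = refl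
    ... | false = ⊥-elim (go (half D′ 5≤D a eq) (half D′ 5≤D b b-even))
      where
      D-odd : odd? D ≡ true
      D-odd = proj₁ (∧-true {odd? D} (trans (sym (norm-parity D c d v)) o))
      b-even : odd? b ≡ false
      b-even = trans (cong (_∧ odd? b) (sym D-odd)) (trans (sym (norm-parity D a b (unit u))) eq)
      go : (∃[ a₁ ] a ≡ + 2 * a₁) → (∃[ b₁ ] b ≡ + 2 * b₁) → ⊥
      go (a₁ , refl) (b₁ , refl) = no-odd-unit {a₁} {b₁} (half-pos D′ 5≤D {+ 0} {+ 2 * a₁} (1≤⇒0< (1≤a u)) (+-identityʳ _)) (half-pos D′ 5≤D {+ 0} {+ 2 * b₁} (1≤⇒0< (1≤b u)) (+-identityʳ _))
         (quarter (subst (λ w → w ≡ + 4 ⊎ w ≡ - + 4) (solve 3 (λ D a b → con (+ 2) :* a :* (con (+ 2) :* a) :- D :* (con (+ 2) :* b :* (con (+ 2) :* b)) := con (+ 4) :* (a :* a :- D :* (b :* b))) refl D a₁ b₁) (unit u))) D-odd least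
         ∣ c ∣ (+ ∣ d ∣) (odd-unit⇒posUnit {D} {c} {d} v o) (trans (odd?-abs c) o)

-- Solvability of Pell's equation

module Pell where

  open import Data.Nat as ℕ using (ℕ; zero; suc; z≤n; s≤s; _%_; _/_)
  import Data.Nat.Properties as ℕ
  open import Data.Nat.DivMod using (m%n<n; m≡m%n+[m/n]*n)
  open import Data.Fin using (Fin; toℕ; fromℕ<; combine) renaming (_<_ to _<ᶠ_)
  open import Data.Fin.Properties using (pigeonhole; toℕ-fromℕ<; combine-injective; toℕ≤pred[n])
  open import Data.Integer hiding (suc; _%_; _/_)
  open import Data.Integer.Properties
  open import Data.Integer.Solver
  open import Data.Product using (∃-syntax; _×_; _,_; proj₁; proj₂)
  open import Data.Sum using (inj₁; inj₂; [_,_]′)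
  open import Relation.Nullary using (yes; no)
  open import Relation.Binary.PropositionalEquality
  open IntegerOrder
  open CubicForm
  open Units
  open OddUnits
  open +-*-Solver

  isqrt : ∀ n → ∃[ m ] (+ m * + m ≤ + n × + n < + suc m * + suc m)
  isqrt zero = 0 , +≤+ z≤n , +<+ (s≤s z≤n)
  isqrt (suc n) with isqrt n
  ... | m , lo , hi with + suc m * + suc m ≤? + suc n
  ... | yes p = suc m , p , ≤-<-trans (i<j⇒suc[i]≤j hi) (<-by-diff (+ 2 * + m + + 3) (≤-by-diff (+ 2 * + m + + 2) (nonneg-+ (nonneg-scale 2 {+ m} (+≤+ z≤n)) (+≤+ z≤n)) (solve 1 (λ m → con (+ 2) :* m :+ con (+ 3) :- con (+ 1) := con (+ 2) :* m :+ con (+ 2)) refl (+ m)))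
        (solve 1 (λ m → (con (+ 2) :+ m) :* (con (+ 2) :+ m) :- (con (+ 1) :+ m) :* (con (+ 1) :+ m) := con (+ 2) :* m :+ con (+ 3)) refl (+ m)))
  ... | no ¬p = m , ≤-trans lo (+≤+ (ℕ.n≤1+n n)) , ≰⇒> ¬p

  -- s√D and r√D have integer parts a and c, so (s + r)√D has integer part a + c or a + c + 1.
  floor-additive : ∀ {D s r a b c} → + 0 ≤ D → + 0 ≤ s → + 0 ≤ r → + 0 ≤ a → + 0 ≤ b → + 0 ≤ c →
    a * a ≤ s * s * D → s * s * D < (+ 1 + a) * (+ 1 + a) → c * c ≤ r * r * D → r * r * D < (+ 1 + c) * (+ 1 + c) →
    b * b ≤ (s + r) * (s + r) * D → (s + r) * (s + r) * D < (+ 1 + b) * (+ 1 + b) → a + c ≤ b × b ≤ a + c + + 1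
  floor-additive {D} {s} {r} {a} {b} {c} 0≤D 0≤s 0≤r 0≤a 0≤b 0≤c a≤ <a c≤ <c b≤ <b = lower , upper
    where
    0≤1+ : ∀ {x} → + 0 ≤ x → + 0 ≤ + 1 + x
    0≤1+ = nonneg-+ {+ 1} (+≤+ z≤n)
    ac≤ : a * c ≤ s * r * D
    ac≤ = sq-≤⇒≤ (nonneg-* (nonneg-* 0≤s 0≤r) 0≤D) (≤-trans (≤-reflexive (solve 2 (λ a c → a :* c :* (a :* c) := a :* a :* (c :* c)) refl a c))
      (≤-trans (*-mono-≤′ (nonneg-sq a) (nonneg-* (nonneg-sq r) 0≤D) a≤ c≤) (≤-reflexive (solve 3 (λ s r D → s :* s :* D :* (r :* r :* D) := s :* r :* D :* (s :* r :* D)) refl s r D))))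
    ≤ac : s * r * D ≤ (+ 1 + a) * (+ 1 + c)
    ≤ac = sq-≤⇒≤ (nonneg-* (0≤1+ 0≤a) (0≤1+ 0≤c)) (≤-trans (≤-reflexive (solve 3 (λ s r D → s :* r :* D :* (s :* r :* D) := s :* s :* D :* (r :* r :* D)) refl s r D))
      (≤-trans (*-mono-≤′ (nonneg-* (nonneg-sq s) 0≤D) (nonneg-sq (+ 1 + c)) (<⇒≤ <a) (<⇒≤ <c)) (≤-reflexive (solve 2 (λ a c → a :* a :* (c :* c) := a :* c :* (a :* c)) refl (+ 1 + a) (+ 1 + c)))))
    pred-≤ : ∀ {x y} → x < + 1 + y → x ≤ y
    pred-≤ {x} {y} h = ≤-by-diff (+ 1 + y - x - + 1) (≤⇒nonneg (<⇒1≤diff h)) (solve 2 (λ x y → y :- x := con (+ 1) :+ y :- x :- con (+ 1)) refl x y)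
    lower : a + c ≤ b
    lower = pred-≤ (sq-<⇒< (0≤1+ 0≤b) (≤-<-trans (≤-by-diff ((s * s * D - a * a) + (r * r * D - c * c) + + 2 * (s * r * D - a * c))
        (nonneg-+ (nonneg-+ (≤⇒nonneg a≤) (≤⇒nonneg c≤)) (nonneg-scale 2 (≤⇒nonneg ac≤)))
        (solve 5 (λ s r D a c → (s :+ r) :* (s :+ r) :* D :- (a :+ c) :* (a :+ c) := (s :* s :* D :- a :* a) :+ (r :* r :* D :- c :* c) :+ con (+ 2) :* (s :* r :* D :- a :* c)) refl s r D a c)) <b))
    upper : b ≤ a + c + + 1
    upper = pred-≤ (sq-<⇒< (0≤1+ (nonneg-+ (nonneg-+ 0≤a 0≤c) (+≤+ z≤n))) (≤-<-trans b≤ (<-by-diff (+ 1 + ((((+ 1 + a) * (+ 1 + a) - s * s * D) - + 1) + ((+ 1 + c) * (+ 1 + c) - r * r * D) + + 2 * ((+ 1 + a) * (+ 1 + c) - s * r * D)))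
        (≤-by-diff _ (nonneg-+ (nonneg-+ (≤⇒nonneg (<⇒1≤diff <a)) (≤⇒nonneg (<⇒≤ <c))) (nonneg-scale 2 (≤⇒nonneg ≤ac))) (solve 1 (λ x → con (+ 1) :+ x :- con (+ 1) := x) refl ((((+ 1 + a) * (+ 1 + a) - s * s * D) - + 1) + ((+ 1 + c) * (+ 1 + c) - r * r * D) + + 2 * ((+ 1 + a) * (+ 1 + c) - s * r * D))))
        (solve 5 (λ s r D a c → (con (+ 1) :+ (a :+ c :+ con (+ 1))) :* (con (+ 1) :+ (a :+ c :+ con (+ 1))) :- (s :+ r) :* (s :+ r) :* D
          := con (+ 1) :+ ((((con (+ 1) :+ a) :* (con (+ 1) :+ a) :- s :* s :* D) :- con (+ 1)) :+ ((con (+ 1) :+ c) :* (con (+ 1) :+ c) :- r :* r :* D) :+ con (+ 2) :* ((con (+ 1) :+ a) :* (con (+ 1) :+ c) :- s :* r :* D))) refl s r D a c))))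

  -- c is the integer part of R√D with R = NY, and Nx is c or c + 1.
  approximation-norm : ∀ {D N x Y c} → + 1 ≤ D → + 1 ≤ N → + 0 ≤ Y → + 0 ≤ c → c ≤ N * x → N * x ≤ c + + 1 →
    c * c ≤ N * Y * (N * Y) * D → N * Y * (N * Y) * D < (+ 1 + c) * (+ 1 + c) →
    N * (x * x - D * (Y * Y)) ≤ + 2 * (Y * D) + + 1 × N * - (x * x - D * (Y * Y)) ≤ + 2 * (Y * D) + + 1
  approximation-norm {D} {N} {x} {Y} {c} 1≤D 1≤N 0≤Y 0≤c lo hi c≤ <c =
      *-cancel-≤′ {c = N} 1≤N (≤-by-diff _ (nonneg-+ (nonneg-+ (nonneg-+ (nonneg-scale 2 (≤⇒nonneg c≤NYD)) (≤⇒nonneg 1≤N)) (nonneg-* (≤⇒nonneg hi) (nonneg-+ (nonneg-+ 0≤c (+≤+ z≤n)) 0≤Nx))) (≤⇒nonneg c≤))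
        (solve 5 (λ D N x Y c → N :* (con (+ 2) :* (Y :* D) :+ con (+ 1)) :- N :* (N :* (x :* x :- D :* (Y :* Y))) := con (+ 2) :* (N :* Y :* D :- c) :+ (N :- con (+ 1)) :+ (c :+ con (+ 1) :- N :* x) :* (c :+ con (+ 1) :+ N :* x) :+ (N :* Y :* (N :* Y) :* D :- c :* c)) refl D N x Y c)) ,
      *-cancel-≤′ {c = N} 1≤N (≤-by-diff _ (nonneg-+ (nonneg-+ (nonneg-+ (nonneg-scale 2 (≤⇒nonneg c≤NYD)) (1≤⇒0≤ 1≤N)) (nonneg-* (≤⇒nonneg lo) (nonneg-+ 0≤c 0≤Nx))) (≤⇒nonneg (<⇒1≤diff <c)))
        (solve 5 (λ D N x Y c → N :* (con (+ 2) :* (Y :* D) :+ con (+ 1)) :- N :* (N :* (:- (x :* x :- D :* (Y :* Y)))) := con (+ 2) :* (N :* Y :* D :- c) :+ N :+ (N :* x :- c) :* (c :+ N :* x) :+ ((con (+ 1) :+ c) :* (con (+ 1) :+ c) :- N :* Y :* (N :* Y) :* D :- con (+ 1))) refl D N x Y c))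
    where
    0≤D = 1≤⇒0≤ 1≤D
    0≤N = 1≤⇒0≤ 1≤N
    0≤Nx = ≤-trans 0≤c lo
    c≤NYD : c ≤ N * Y * D
    c≤NYD = sq-≤⇒≤ (nonneg-* (nonneg-* 0≤N 0≤Y) 0≤D) (≤-trans c≤ (≤-by-diff (N * Y * (N * Y) * (D * (D - + 1))) (nonneg-* (nonneg-sq (N * Y)) (nonneg-* 0≤D (≤⇒nonneg 1≤D)))
      (solve 2 (λ r D → r :* D :* (r :* D) :- r :* r :* D := r :* r :* (D :* (D :- con (+ 1)))) refl (N * Y) D)))

  record NearSquare (D B : ℕ) : Set where
    constructor nearSquare
    field
      x y : ℕ
      B<y : B ℕ.< y
      norm≤ : ∣ + x * + x - + D * (+ y * + y) ∣ ℕ.≤ 2 ℕ.* D ℕ.+ 1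
  open NearSquare

  abs-≤ : ∀ {x n} → x ≤ + n → - x ≤ + n → ∣ x ∣ ℕ.≤ n
  abs-≤ {x} {n} h h′ with +∣i∣≡i⊎+∣i∣≡-i x
  ... | inj₁ eq = drop‿+≤+ (subst (_≤ + n) (sym eq) h)
  ... | inj₂ eq = drop‿+≤+ (subst (_≤ + n) (sym eq) h′)

  same-residue : ∀ {a b} n .{{_ : ℕ.NonZero n}} → a % n ≡ b % n → ∃[ k ] + b ≡ + a + + n * k
  same-residue {a} {b} n eq = + (b / n) - + (a / n) , trans (expand b) (trans (cong (λ r → + r + + (b / n) * + n) (sym eq))
      (trans (solve 4 (λ r p q n → r :+ q :* n := r :+ p :* n :+ n :* (q :- p)) refl (+ (a % n)) (+ (a / n)) (+ (b / n)) (+ n)) (cong (λ w → w + + n * (+ (b / n) - + (a / n))) (sym (expand a)))))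
    where
    expand : ∀ x → + x ≡ + (x % n) + + (x / n) * + n
    expand x = trans (cong +_ (m≡m%n+[m/n]*n x n)) (cong (λ w → + (x % n) + w) (pos-* (x / n) n))

  module _ (D : ℕ) (1≤D : 1 ℕ.≤ D) (irrational : ∀ x y → 1 ℕ.≤ y → + x * + x - + D * (+ y * + y) ≢ + 0) where
    private
      1≤D′ : + 1 ≤ + D
      1≤D′ = +≤+ 1≤D

      Floor : ℕ → Set
      Floor r = ∃[ m ] (+ m * + m ≤ + r * + r * + D × + r * + r * + D < (+ 1 + + m) * (+ 1 + + m))

      Approximant : ℕ → Set
      Approximant N = ∃[ x ] ∃[ y ] (1 ℕ.≤ y × y ℕ.≤ N × + N * (+ x * + x - + D * (+ y * + y)) ≤ + 2 * (+ y * + D) + + 1 × + N * - (+ x * + x - + D * (+ y * + y)) ≤ + 2 * (+ y * + D) + + 1)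

      floor : ∀ r → Floor r
      floor r with isqrt (r ℕ.* r ℕ.* D)
      ... | m , lo , hi = m , subst (+ m * + m ≤_) eq lo , subst (_< (+ 1 + + m) * (+ 1 + + m)) eq hi
        where
        eq : + (r ℕ.* r ℕ.* D) ≡ + r * + r * + D
        eq = trans (pos-* (r ℕ.* r) D) (cong (_* + D) (pos-* r r))

      -- If `i√D` and `(i + suc o)√D` have fractional parts in the same bin of width `1/N`, then
      -- `(suc o)√D` is close to an integer. That integer is `k`, the quotient of the difference of
      -- the two floors by `N`.
      same-bin : ∀ n i o → suc i ℕ.+ o ℕ.≤ suc n → (fa : Floor (suc n ℕ.* i)) (fb : Floor (suc n ℕ.* (suc i ℕ.+ o))) → Floor (suc n ℕ.* suc o) → proj₁ fa % suc n ≡ proj₁ fb % suc n → Approximant (suc n)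
      same-bin n i o j≤N (a , a≤ , <a) (b , b≤ , <b) (c , c≤ , <c) eq′ = quotient (same-residue {a} {b} N eq′)
          where
          N = suc n
          step : + (N ℕ.* (suc i ℕ.+ o)) ≡ + (N ℕ.* i) + + (N ℕ.* suc o)
          step = cong +_ (trans (cong (N ℕ.*_) (sym (ℕ.+-suc i o))) (ℕ.*-distribˡ-+ N i (suc o)))
          near : + a + + c ≤ + b × + b ≤ + a + + c + + 1
          near = floor-additive {+ D} {+ (N ℕ.* i)} {+ (N ℕ.* suc o)} {+ a} {+ b} {+ c} (+≤+ z≤n) (+≤+ z≤n) (+≤+ z≤n) (+≤+ z≤n) (+≤+ z≤n) (+≤+ z≤n) a≤ <a c≤ <c
            (subst (λ w → + b * + b ≤ w * w * + D) step b≤) (subst (λ w → w * w * + D < (+ 1 + + b) * (+ 1 + + b)) step <b)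
          NY : + (N ℕ.* suc o) ≡ + N * + suc o
          NY = pos-* N (suc o)
          quotient : (∃[ k ] + b ≡ + a + + N * k) → Approximant N
          quotient (k , b≡) = natural k lo hi
            where
            lo : + c ≤ + N * k
            lo = ≤-by-diff (+ b - (+ a + + c)) (≤⇒nonneg (proj₁ near)) (trans (solve 3 (λ a c y → y :- c := a :+ y :- (a :+ c)) refl (+ a) (+ c) (+ N * k)) (cong (_- (+ a + + c)) (sym b≡)))
            hi : + N * k ≤ + c + + 1
            hi = ≤-by-diff (+ a + + c + + 1 - + b) (≤⇒nonneg (proj₂ near)) (trans (solve 3 (λ a c y → c :+ con (+ 1) :- y := a :+ c :+ con (+ 1) :- (a :+ y)) refl (+ a) (+ c) (+ N * k)) (cong (λ w → + a + + c + + 1 - w) (sym b≡)))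
            natural : ∀ k → + c ≤ + N * k → + N * k ≤ + c + + 1 → Approximant N
            natural (+ k) lo hi = k , suc o , s≤s z≤n , ℕ.≤-trans (ℕ.≤-trans (ℕ.m≤n+m (suc o) i) (ℕ.≤-reflexive (ℕ.+-suc i o))) j≤N ,
              approximation-norm {+ D} {+ N} {+ k} {+ suc o} {+ c} 1≤D′ (+≤+ (s≤s z≤n)) (+≤+ z≤n) (+≤+ z≤n) lo hi
                (subst (λ w → + c * + c ≤ w * w * + D) NY c≤) (subst (λ w → w * w * + D < (+ 1 + + c) * (+ 1 + + c)) NY <c)
            natural -[1+ k ] (() ) hi

    -- The floor of `N · i√D` reduced modulo `N` is the index of the bin containing the fractional
    -- part of `i√D`. The `N + 1` values of `i` share `N` bins.
    dirichlet : ∀ n → Approximant (suc n)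
    dirichlet n with pigeonhole {suc n} {suc (suc n)} (ℕ.n<1+n (suc n)) (λ i → fromℕ< (m%n<n (proj₁ (floor (suc n ℕ.* toℕ i))) (suc n)))
    ... | i , j , i<j , eq = go (ℕ.m≤n⇒∃[o]m+o≡n i<j) (toℕ≤pred[n] j)
      (trans (sym (toℕ-fromℕ< (m%n<n (proj₁ (floor (suc n ℕ.* toℕ i))) (suc n)))) (trans (cong toℕ eq) (toℕ-fromℕ< (m%n<n (proj₁ (floor (suc n ℕ.* toℕ j))) (suc n)))))
      where
      go : ∀ {i j} → (∃[ o ] suc i ℕ.+ o ≡ j) → j ℕ.≤ suc n → proj₁ (floor (suc n ℕ.* i)) % suc n ≡ proj₁ (floor (suc n ℕ.* j)) % suc n → Approximant (suc n)
      go {i} (o , refl) j≤N eq = same-bin n i o j≤N (floor (suc n ℕ.* i)) (floor (suc n ℕ.* (suc i ℕ.+ o))) (floor (suc n ℕ.* suc o)) eq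

    near-square : ∀ B → NearSquare D B
    near-square B = from (dirichlet (2 ℕ.* (B ℕ.* D) ℕ.+ 1))
      where
      -- With `N = 2BD + 2`, a nonzero norm `K` satisfies `N ≤ N|K| ≤ 2yD + 1`, which is impossible
      -- for `y ≤ B`. So `y` can be made arbitrarily large.
      n = 2 ℕ.* (B ℕ.* D) ℕ.+ 1
      bounded : ∀ {k y : ℕ} → 1 ℕ.≤ k → suc n ℕ.* k ℕ.≤ 2 ℕ.* (y ℕ.* D) ℕ.+ 1 → B ℕ.< y
      bounded {k} {y} 1≤k h = ℕ.≰⇒> λ y≤B → ℕ.1+n≰n (ℕ.≤-trans (ℕ.m≤m*n (suc n) k {{ℕ.>-nonZero 1≤k}}) (ℕ.≤-trans h (ℕ.+-monoˡ-≤ 1 (ℕ.*-monoʳ-≤ 2 (ℕ.*-monoˡ-≤ D y≤B)))))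
      from : Approximant (suc n) → NearSquare D B
      from (x , y , 1≤y , y≤ , up , down) = nearSquare x y (bounded {∣ K ∣} 1≤∣K∣ NK≤)
          (ℕ.*-cancelˡ-≤ (suc n) (ℕ.≤-trans NK≤ (ℕ.≤-trans (ℕ.+-mono-≤ (ℕ.≤-trans (ℕ.≤-reflexive (sym (ℕ.*-assoc 2 y D))) (ℕ.≤-trans (ℕ.*-monoˡ-≤ D (ℕ.*-monoʳ-≤ 2 y≤)) (ℕ.≤-reflexive (trans (cong (ℕ._* D) (ℕ.*-comm 2 (suc n))) (ℕ.*-assoc (suc n) 2 D))))) (s≤s (z≤n {n})))
            (ℕ.≤-reflexive (trans (cong (suc n ℕ.* (2 ℕ.* D) ℕ.+_) (sym (ℕ.*-identityʳ (suc n)))) (sym (ℕ.*-distribˡ-+ (suc n) (2 ℕ.* D) 1)))))))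
        where
        K = + x * + x - + D * (+ y * + y)
        1≤∣K∣ : 1 ℕ.≤ ∣ K ∣
        1≤∣K∣ = drop‿+≤+ (1≤abs K (irrational x y 1≤y))
        bound≡ : + 2 * (+ y * + D) + + 1 ≡ + (2 ℕ.* (y ℕ.* D) ℕ.+ 1)
        bound≡ = cong (_+ + 1) (trans (cong (λ w → + 2 * w) (sym (pos-* y D))) (sym (pos-* 2 (y ℕ.* D))))
        NK≤ : suc n ℕ.* ∣ K ∣ ℕ.≤ 2 ℕ.* (y ℕ.* D) ℕ.+ 1
        NK≤ = subst (ℕ._≤ 2 ℕ.* (y ℕ.* D) ℕ.+ 1) (abs-* (+ suc n) K) (abs-≤ {+ suc n * K} (subst (+ suc n * K ≤_) bound≡ up) (subst₂ _≤_ (sym (neg-distribʳ-* (+ suc n) K)) bound≡ down))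

    -- Two approximations of the same norm K that are congruent modulo K have a unit as quotient.
    unit-from-pair : ∀ {x₁ y₁ x₂ y₂ K a b} → K ≢ + 0 → x₁ * x₁ - + D * (y₁ * y₁) ≡ K → x₂ * x₂ - + D * (y₂ * y₂) ≡ K → x₂ ≡ x₁ + K * a → y₂ ≡ y₁ + K * b →
      + 0 ≤ y₁ → y₁ < y₂ → ∃[ t ] ∃[ u ] (t * t - + D * (u * u) ≡ + 1 × u ≢ + 0)
    unit-from-pair {x₁} {y₁} {x₂} {y₂} {K} {a} {b} K≢0 n₁ n₂ x≡ y≡ 0≤y₁ y₁<y₂ = T , U , *-cancelˡ-≡ (K * K) _ _ {{i*j≢0 K K {{≢-nonZero K≢0}} {{≢-nonZero K≢0}}}} normTU , U≢0
      where
      E = + D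
      T = + 1 + x₁ * a - E * (y₁ * b)
      U = x₁ * b - y₁ * a
      KT : K * T ≡ x₁ * x₂ - E * (y₁ * y₂)
      KT = trans (solve 6 (λ D x y K a b → K :* (con (+ 1) :+ x :* a :- D :* (y :* b)) := x :* (x :+ K :* a) :- D :* (y :* (y :+ K :* b)) :+ (:- con (+ 1)) :* (x :* x :- D :* (y :* y) :- K)) refl E x₁ y₁ K a b)
        (trans (diff-zero n₁ _ (- + 1)) (cong₂ (λ v w → x₁ * v - E * (y₁ * w)) (sym x≡) (sym y≡)))
      KU : K * U ≡ x₁ * y₂ - x₂ * y₁
      KU = trans (solve 5 (λ x y K a b → K :* (x :* b :- y :* a) := x :* (y :+ K :* b) :- (x :+ K :* a) :* y) refl x₁ y₁ K a b) (cong₂ (λ v w → x₁ * w - v * y₁) (sym x≡) (sym y≡))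
      normTU : K * K * (T * T - E * (U * U)) ≡ K * K * + 1
      normTU = trans (solve 4 (λ K T U D → K :* K :* (T :* T :- D :* (U :* U)) := K :* T :* (K :* T) :- D :* (K :* U :* (K :* U))) refl K T U E)
        (trans (cong₂ (λ v w → v * v - E * (w * w)) KT KU) (trans (solve 5 (λ D x y z w → (x :* z :- D :* (y :* w)) :* (x :* z :- D :* (y :* w)) :- D :* ((x :* w :- z :* y) :* (x :* w :- z :* y)) := (x :* x :- D :* (y :* y)) :* (z :* z :- D :* (w :* w))) refl E x₁ y₁ x₂ y₂)
          (trans (cong₂ _*_ n₁ n₂) (sym (*-identityʳ _)))))
      U≢0 : U ≢ + 0
      -- If `U = 0`, then `x₁y₂ = x₂y₁`, and the equal norms yield `Ky₁² = Ky₂²`, against `y₁ < y₂`.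
      U≢0 U≡0 = <⇒≢ (<-≤-trans (≤-<-trans (≤-refl {y₁ * y₁}) sq<) ≤-refl) (*-cancelˡ-≡ K _ _ {{≢-nonZero K≢0}} same)
        where
        cross : x₁ * y₂ ≡ x₂ * y₁
        cross = i-j≡0⇒i≡j (x₁ * y₂) (x₂ * y₁) (trans (sym KU) (trans (cong (K *_) U≡0) (*-zeroʳ K)))
        same : K * (y₁ * y₁) ≡ K * (y₂ * y₂)
        same = trans (cong (_* (y₁ * y₁)) (sym n₂)) (trans (solve 4 (λ D z w y → (z :* z :- D :* (w :* w)) :* (y :* y) := z :* y :* (z :* y) :- D :* (w :* w :* (y :* y))) refl E x₂ y₂ y₁)
          (trans (cong (λ v → v * v - E * (y₂ * y₂ * (y₁ * y₁))) (sym cross)) (trans (solve 4 (λ D x y w → x :* w :* (x :* w) :- D :* (w :* w :* (y :* y)) := (x :* x :- D :* (y :* y)) :* (w :* w)) refl E x₁ y₁ y₂) (cong (_* (y₂ * y₂)) n₁))))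
        sq< : y₁ * y₁ < y₂ * y₂
        sq< = <-by-diff {y₁ * y₁} {y₂ * y₂} ((y₂ - y₁) * (y₂ + y₁)) (pos-*′ (<⇒1≤diff y₁<y₂) (≤-trans (<⇒1≤diff y₁<y₂) (≤-by-diff (+ 2 * y₁) (nonneg-scale 2 0≤y₁) (solve 2 (λ y w → w :+ y :- (w :- y) := con (+ 2) :* y) refl y₁ y₂))))
          (solve 2 (λ y w → w :* w :- y :* y := (w :- y) :* (w :+ y)) refl y₁ y₂)

    private
      C = 2 ℕ.* D ℕ.+ 1

    module _ (xₙ yₙ : ℕ → ℕ) (1≤y₀ : 1 ℕ.≤ yₙ 0) (yₙ-step : ∀ n → yₙ n ℕ.< yₙ (suc n))
             (bounded : ∀ n → ∣ + xₙ n * + xₙ n - + D * (+ yₙ n * + yₙ n) ∣ ℕ.≤ 2 ℕ.* D ℕ.+ 1) where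
     private
      Kₙ : ℕ → ℤ
      Kₙ n = + xₙ n * + xₙ n - + D * (+ yₙ n * + yₙ n)

      yₙ-mono : ∀ {i j} → i ℕ.< j → yₙ i ℕ.< yₙ j
      yₙ-mono {i} {suc j} (s≤s i≤j) with ℕ.m≤n⇒m<n∨m≡n i≤j
      ... | inj₁ i<j = ℕ.<-trans (yₙ-mono i<j) (yₙ-step j)
      ... | inj₂ refl = yₙ-step j

      1≤yₙ : ∀ n → 1 ℕ.≤ yₙ n
      1≤yₙ zero = 1≤y₀
      1≤yₙ (suc n) = ℕ.≤-trans (1≤yₙ n) (ℕ.<⇒≤ (yₙ-step n))

      Kₙ≢0 : ∀ n → Kₙ n ≢ + 0
      Kₙ≢0 n = irrational (xₙ n) (yₙ n) (1≤yₙ n)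

      -- `suc (ℕ.pred ∣ K ∣)` is `∣ K ∣` for `K ≠ 0`, written so that the modulus is nonzero by its
      -- form.
      residue : ℕ → ℤ → ℕ
      residue a K = a % suc (ℕ.pred ∣ K ∣)

      residue< : ∀ a n → residue a (Kₙ n) ℕ.< suc C
      residue< a n = ℕ.<-≤-trans (m%n<n a (suc (ℕ.pred ∣ Kₙ n ∣))) (s≤s (ℕ.≤-trans ℕ.pred[n]≤n (bounded n)))

      shifted< : ∀ n → ∣ Kₙ n + + C ∣ ℕ.< suc (C ℕ.+ C)
      shifted< n = s≤s (ℕ.≤-trans (∣i+j∣≤∣i∣+∣j∣ (Kₙ n) (+ C)) (ℕ.+-monoˡ-≤ C (bounded n)))

      -- The norm, shifted by `C` to be nonnegative, together with both coordinates modulo the norm: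
      -- the data on which two approximations must agree for their quotient to be integral.
      code : ℕ → Fin (suc (C ℕ.+ C) ℕ.* (suc C ℕ.* suc C))
      code n = combine (fromℕ< (shifted< n)) (combine (fromℕ< (residue< (xₙ n) n)) (fromℕ< (residue< (yₙ n) n)))

      fromℕ<-injective′ : ∀ {a b n} (p : a ℕ.< n) (q : b ℕ.< n) → fromℕ< p ≡ fromℕ< q → a ≡ b
      fromℕ<-injective′ p q eq = trans (sym (toℕ-fromℕ< p)) (trans (cong toℕ eq) (toℕ-fromℕ< q))

      neg-bound : ∀ n → + 0 ≤ Kₙ n + + C
      neg-bound n = ≤-trans (≤-by-diff (+ C - + ∣ Kₙ n ∣) (≤⇒nonneg (+≤+ (bounded n))) (solve 2 (λ c k → c :- k :- con (+ 0) := c :- k) refl (+ C) (+ ∣ Kₙ n ∣)))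
        ([ (λ e → ≤-by-diff (+ ∣ Kₙ n ∣ + + ∣ Kₙ n ∣) (+≤+ z≤n) (trans (cong (λ w → w + + C - (+ C - + ∣ Kₙ n ∣)) (sym e)) (solve 2 (λ c k → k :+ c :- (c :- k) := k :+ k) refl (+ C) (+ ∣ Kₙ n ∣)))) ,
           (λ e → ≤-reflexive (trans (cong (λ w → + C - w) e) (solve 2 (λ c k → c :- (:- k) := k :+ c) refl (+ C) (Kₙ n)))) ]′ (+∣i∣≡i⊎+∣i∣≡-i (Kₙ n)))

      same-K : ∀ {i j} → ∣ Kₙ i + + C ∣ ≡ ∣ Kₙ j + + C ∣ → Kₙ i ≡ Kₙ j
      same-K {i} {j} eq = trans (solve 2 (λ k c → k := k :+ c :- c) refl (Kₙ i) (+ C)) (trans (cong (_- + C) (trans (sym (0≤i⇒+∣i∣≡i (neg-bound i))) (trans (cong +_ eq) (0≤i⇒+∣i∣≡i (neg-bound j))))) (solve 2 (λ k c → k :+ c :- c := k) refl (Kₙ j) (+ C)))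

      multiple : ∀ {a b} K → K ≢ + 0 → residue a K ≡ residue b K → ∃[ c ] + b ≡ + a + K * c
      multiple {a} {b} K K≢0 eq with same-residue {a} {b} (suc (ℕ.pred ∣ K ∣)) eq
      ... | k , b≡ with +∣i∣≡i⊎+∣i∣≡-i K
      ... | inj₁ e = k , trans b≡ (cong (λ w → + a + w * k) (trans (cong +_ (ℕ.suc-pred ∣ K ∣ {{ℕ.≢-nonZero (λ z → K≢0 (∣i∣≡0⇒i≡0 z))}})) e))
      ... | inj₂ e = - k , trans b≡ (trans (cong (λ w → + a + w * k) (trans (cong +_ (ℕ.suc-pred ∣ K ∣ {{ℕ.≢-nonZero (λ z → K≢0 (∣i∣≡0⇒i≡0 z))}})) e)) (solve 3 (λ a K k → a :+ (:- K) :* k := a :+ K :* (:- k)) refl (+ a) K k))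

      collision : ∀ {i j} → i ℕ.< j → code i ≡ code j → ∃[ t ] ∃[ u ] (t * t - + D * (u * u) ≡ + 1 × u ≢ + 0)
      collision {i} {j} i<j eq with combine-injective (fromℕ< (shifted< i)) _ (fromℕ< (shifted< j)) _ eq
      ... | e₁ , e₂₃ with combine-injective (fromℕ< (residue< (xₙ i) i)) (fromℕ< (residue< (yₙ i) i)) (fromℕ< (residue< (xₙ j) j)) (fromℕ< (residue< (yₙ j) j)) e₂₃
      ... | e₂ , e₃ = pair (multiple {xₙ i} {xₙ j} (Kₙ i) (Kₙ≢0 i) (trans (fromℕ<-injective′ (residue< (xₙ i) i) (residue< (xₙ j) j) e₂) (cong (residue (xₙ j)) (sym K≡))))
                           (multiple {yₙ i} {yₙ j} (Kₙ i) (Kₙ≢0 i) (trans (fromℕ<-injective′ (residue< (yₙ i) i) (residue< (yₙ j) j) e₃) (cong (residue (yₙ j)) (sym K≡))))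
        where
        K≡ : Kₙ i ≡ Kₙ j
        K≡ = same-K {i} {j} (fromℕ<-injective′ (shifted< i) (shifted< j) e₁)
        pair : (∃[ a ] + xₙ j ≡ + xₙ i + Kₙ i * a) → (∃[ b ] + yₙ j ≡ + yₙ i + Kₙ i * b) → _
        pair (a , x≡) (b , y≡) = unit-from-pair {+ xₙ i} {+ yₙ i} {+ xₙ j} {+ yₙ j} {Kₙ i} {a} {b} (Kₙ≢0 i) refl (sym K≡) x≡ y≡ (+≤+ z≤n) (+<+ (yₙ-mono i<j))

     unit-from-sequence : ∃[ t ] ∃[ u ] (t * t - + D * (u * u) ≡ + 1 × u ≢ + 0)
     unit-from-sequence with pigeonhole {suc (C ℕ.+ C) ℕ.* (suc C ℕ.* suc C)} {suc (suc (C ℕ.+ C) ℕ.* (suc C ℕ.* suc C))} (ℕ.n<1+n _) (λ i → code (toℕ i))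
     ... | i , j , i<j , eq = collision {toℕ i} {toℕ j} i<j eq

    private
      sequence : ℕ → ∃[ B ] NearSquare D B
      sequence zero = 0 , near-square 0
      sequence (suc n) = y (proj₂ (sequence n)) , near-square (y (proj₂ (sequence n)))

    pell-solution : ∃[ t ] ∃[ u ] (t * t - + D * (u * u) ≡ + 1 × u ≢ + 0)
    pell-solution = unit-from-sequence (λ n → x (proj₂ (sequence n))) (λ n → y (proj₂ (sequence n))) (B<y (proj₂ (sequence zero))) (λ n → B<y (proj₂ (sequence (suc n)))) (λ n → norm≤ (proj₂ (sequence n)))

-- Discriminants without a unit of odd trace

module EvenUnits where

  open import Data.Nat as ℕ using (ℕ; zero; suc; z≤n; s≤s; _%_)
  import Data.Nat.Properties as ℕ
  open import Data.Nat.DivMod using ([m+kn]%n≡m%n)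
  open import Data.Nat.Divisibility as ℕD using (divides)
  open import Data.Nat.Primality using (Prime)
  open import Data.Nat.Primality.Factorisation using (factorise)
  open import Data.Nat.Induction using (<-rec)
  open import Data.List using ([]; _∷_)
  open import Data.Nat.ListAction using (product)
  open import Data.List.Relation.Unary.All using (_∷_)
  open import Data.Bool using (true; false; _∧_)
  open import Data.Integer hiding (suc; _%_; _/_)
  open import Data.Integer.Properties
  open import Data.Integer.Solver
  open import Data.Product using (∃-syntax; _×_; _,_; proj₁; proj₂)
  open import Data.Sum using (inj₁; [_,_]′)
  open import Data.Empty using (⊥; ⊥-elim)
  open import Relation.Nullary using (¬_; yes; no)
  open import Relation.Binary.PropositionalEquality
  open import Defs
  open IntegerOrder
  open OrderArithmetic
  open CubicForm
  open ReducedForm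
  open Units
  open PosUnit
  open FundamentalUnit
  open OddUnits
  open Pell
  open +-*-Solver

  odd-square : ∀ {x} → odd? x ≡ true → ∃[ k ] x * x ≡ + 8 * k + + 1
  odd-square {x} o with odd?-witness x
  ... | i , eq rewrite o with square-mod-2 i
  ... | k , ii = i + k , trans (cong (λ w → w * w) eq) (trans (solve 2 (λ i k → (con (+ 2) :* i :+ con (+ 1)) :* (con (+ 2) :* i :+ con (+ 1)) := con (+ 8) :* (i :+ k) :+ con (+ 1) :+ con (+ 4) :* (i :* i :- (i :+ con (+ 2) :* k))) refl i k) (diff-zero ii _ (+ 4)))

  half′ : ∀ i → odd? i ≡ false → ∃[ k ] i ≡ + 2 * k
  half′ i e with odd?-witness i
  ... | k , eq rewrite e = k , trans eq (+-identityʳ _)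

  -- Descent on `∣ y ∣`: for odd `y` the two sides are 1 and 5 modulo 8, and for even `y` both
  -- numbers can be halved.
  irrational-sqrt : ∀ D e → D ≡ + 8 * e + + 5 → ∀ n x y → ∣ y ∣ ≡ n → y ≢ + 0 → x * x ≢ D * (y * y)
  irrational-sqrt D e refl = <-rec _ step
    where
    D-odd : odd? D ≡ true
    D-odd = odd?-unique D (+ 4 * e + + 2) true (solve 1 (λ e → con (+ 8) :* e :+ con (+ 5) := con (+ 2) :* (con (+ 4) :* e :+ con (+ 2)) :+ con (+ 1)) refl e)
    step : ∀ n → (∀ {m} → m ℕ.< n → ∀ x y → ∣ y ∣ ≡ m → y ≢ + 0 → x * x ≢ D * (y * y)) → ∀ x y → ∣ y ∣ ≡ n → y ≢ + 0 → x * x ≢ D * (y * y)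
    step n rec x y refl y≢0 eq = case (odd? y) refl
      where
      same : odd? x ≡ odd? y
      same = trans (sym (idem (odd? x))) (trans (sym (odd?-* x x)) (trans (cong odd? eq) (trans (odd?-* D (y * y)) (trans (cong₂ _∧_ D-odd (odd?-* y y)) (idem (odd? y))))))
        where
        idem : ∀ b → b ∧ b ≡ b
        idem true = refl
        idem false = refl
      case : ∀ b → odd? y ≡ b → ⊥
      case true oy = oddcase (odd-square {x} (trans same oy)) (odd-square {y} oy)
        where
        oddcase : (∃[ k ] x * x ≡ + 8 * k + + 1) → (∃[ k ] y * y ≡ + 8 * k + + 1) → ⊥
        oddcase (i , xx) (j , yy) = 2*k≢1 (i - e * (+ 8 * j + + 1) - + 5 * j) (*-cancelˡ-≡ (+ 4) _ (+ 1)
          (trans (solve 3 (λ e i j → con (+ 4) :* (con (+ 2) :* (i :- e :* (con (+ 8) :* j :+ con (+ 1)) :- con (+ 5) :* j)) := con (+ 8) :* i :+ con (+ 1) :- (con (+ 8) :* e :+ con (+ 5)) :* (con (+ 8) :* j :+ con (+ 1)) :+ con (+ 4)) refl e i j)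
            (cong (_+ + 4) (i≡j⇒i-j≡0 (trans (sym xx) (trans eq (cong (D *_) yy)))))))
      case false oy = evencase (half′ x (trans same oy)) (half′ y oy)
        where
        evencase : (∃[ k ] x ≡ + 2 * k) → (∃[ k ] y ≡ + 2 * k) → ⊥
        evencase (x₁ , x≡) (y₁ , y≡) = rec {∣ y₁ ∣} smaller x₁ y₁ refl y₁≢0 (*-cancelˡ-≡ (+ 4) _ _
            (trans (solve 1 (λ x → con (+ 4) :* (x :* x) := con (+ 2) :* x :* (con (+ 2) :* x)) refl x₁) (trans (cong (λ w → w * w) (sym x≡)) (trans eq (trans (cong (λ w → D * (w * w)) y≡) (solve 2 (λ D y → D :* (con (+ 2) :* y :* (con (+ 2) :* y)) := con (+ 4) :* (D :* (y :* y))) refl D y₁))))))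
          where
          y₁≢0 : y₁ ≢ + 0
          y₁≢0 refl = y≢0 y≡
          smaller : ∣ y₁ ∣ ℕ.< ∣ y ∣
          smaller = subst (∣ y₁ ∣ ℕ.<_) (sym (trans (cong ∣_∣ y≡) (trans (abs-* (+ 2) y₁) (ℕ.*-comm 2 ∣ y₁ ∣)))) (ℕ.m<m*n ∣ y₁ ∣ 2 {{ℕ.≢-nonZero (λ z → y₁≢0 (∣i∣≡0⇒i≡0 z))}} (s≤s (s≤s z≤n)))

  -- Odd squares are 1 modulo 8, so `c² - Dd² = ±4` reads `1 - D ≡ 4` modulo 8.
  odd-unit⇒5mod8 : ∀ D c d → UnitNorm (+ D) c d → odd? c ≡ true → D % 8 ≡ 5
  odd-unit⇒5mod8 D c d u o = squares (odd-square {c} o) (odd-square {d} (proj₂ (∧-true {odd? (+ D)} (trans (sym (norm-parity (+ D) c d u)) o))))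
    where
    residue : ∀ e → + D ≡ + 8 * e + + 5 → D % 8 ≡ 5
    residue (+ n) eq = trans (cong (_% 8) (+-injective (trans eq (trans (cong (_+ + 5) (sym (pos-* 8 n))) (cong +_ (trans (ℕ.+-comm (8 ℕ.* n) 5) (cong (5 ℕ.+_) (ℕ.*-comm 8 n)))))))) ([m+kn]%n≡m%n 5 n 8)
    residue -[1+ n ] eq = ⊥-elim (<⇒≱ (1≤⇒0< {(+ 8 * + n + + 3)} (≤-by-diff (+ 8 * + n + + 2) (nonneg-+ (nonneg-scale 8 {+ n} (+≤+ z≤n)) (+≤+ z≤n)) (solve 1 (λ n → con (+ 8) :* n :+ con (+ 3) :- con (+ 1) := con (+ 8) :* n :+ con (+ 2)) refl (+ n))))
       (≤-by-diff (+ D) (+≤+ z≤n) (trans (solve 1 (λ n → con (+ 0) :- (con (+ 8) :* n :+ con (+ 3)) := con (+ 8) :* (:- (con (+ 1) :+ n)) :+ con (+ 5)) refl (+ n)) (sym eq))))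
    squares : (∃[ k ] c * c ≡ + 8 * k + + 1) → (∃[ k ] d * d ≡ + 8 * k + + 1) → D % 8 ≡ 5
    squares (i , cc) (j , dd) = [ (λ n → residue (i - + D * j - + 1) (trans (solve 4 (λ D i j x → D := con (+ 8) :* (i :- D :* j :- con (+ 1)) :+ con (+ 5) :+ (:- con (+ 1)) :* (con (+ 8) :* i :+ con (+ 1) :- D :* (con (+ 8) :* j :+ con (+ 1)) :- con (+ 4))) refl (+ D) i j (+ 0)) (diff-zero (trans (cong₂ (λ v w → v - + D * w) (sym cc) (sym dd)) n) _ (- + 1)))) ,
      (λ n → residue (i - + D * j) (trans (solve 4 (λ D i j x → D := con (+ 8) :* (i :- D :* j) :+ con (+ 5) :+ (:- con (+ 1)) :* (con (+ 8) :* i :+ con (+ 1) :- D :* (con (+ 8) :* j :+ con (+ 1)) :- (con (- + 4)))) refl (+ D) i j (+ 0)) (diff-zero (trans (cong₂ (λ v w → v - + D * w) (sym cc) (sym dd)) n) _ (- + 1)))) ]′ u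

  -- `P` comes without a decision procedure, so well-foundedness yields a least element only up to
  -- double negation.
  least-¬¬ : (P : ℕ → Set) → ∀ n → P n → ¬ ¬ (∃[ m ] (P m × (∀ k → P k → m ℕ.≤ k)))
  least-¬¬ P n Pn none = <-rec (λ n → ¬ P n) (λ n rec Pn → none (n , Pn , λ k Pk → ℕ.≮⇒≥ (λ k<n → rec k<n Pk))) n Pn

  prime-divisor : ∀ n → 2 ℕ.≤ n → ∃[ p ] (Prime p × p ℕD.∣ n)
  prime-divisor n@(suc _) 2≤n with factorise n
  ... | record { factors = [] ; isFactorisation = eq } = ⊥-elim (ℕ.<⇒≢ 2≤n (sym eq))
  ... | record { factors = p ∷ ps ; isFactorisation = eq ; factorsPrime = pr ∷ _ } = p , pr , divides (product ps) (trans eq (ℕ.*-comm p (product ps)))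

  squarefree-square : ∀ D → 1 ℕ.≤ D → SquareFree D → ∀ q c → + D ≡ q * q * c → q * q ≡ + 1
  squarefree-square D 1≤D sf q c eq = trans (sym (abs-sq q)) (size ∣ q ∣ refl)
    where
    eqℕ : D ≡ ∣ q ∣ ℕ.* ∣ q ∣ ℕ.* ∣ c ∣
    eqℕ = trans (cong ∣_∣ eq) (trans (abs-* (q * q) c) (cong (ℕ._* ∣ c ∣) (abs-* q q)))
    size : ∀ n → n ≡ ∣ q ∣ → + n * + n ≡ + 1
    size zero e = ⊥-elim (ℕ.<⇒≢ 1≤D (sym (trans eqℕ (cong (λ w → w ℕ.* w ℕ.* ∣ c ∣) (sym e)))))
    size (suc zero) e = refl
    size (suc (suc n)) e with prime-divisor (suc (suc n)) (s≤s (s≤s z≤n))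
    ... | p , pr , divides k n≡ = ⊥-elim (sf p pr (divides (k ℕ.* k ℕ.* ∣ c ∣) (trans eqℕ (trans (cong (λ w → w ℕ.* w ℕ.* ∣ c ∣) (trans (sym e) n≡)) (rearrange k p ∣ c ∣)))))
      where
      open import Data.Nat.Tactic.RingSolver using (solve-∀)
      rearrange : ∀ k p c → k ℕ.* p ℕ.* (k ℕ.* p) ℕ.* c ≡ k ℕ.* k ℕ.* c ℕ.* (p ℕ.* p)
      rearrange = solve-∀

  trace-of-cube : ∀ m x y → trace (mul m (x , y) (mul m (x , y) (x , y))) ≡ trace (x , y) * trace (x , y) * trace (x , y) - + 3 * (norm m (x , y) * trace (x , y))
  trace-of-cube = solve 3 (λ m x y → let z³ = mulₚ m (x , y) (mulₚ m (x , y) (x , y)) ; t = con (+ 2) :* x :+ y in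
    con (+ 2) :* proj₁ z³ :+ proj₂ z³ := t :* t :* t :- con (+ 3) :* ((x :* x :+ x :* y :- m :* (y :* y)) :* t)) refl

  trace-norm : ∀ m z → trace z * trace z - (+ 4 * m + + 1) * (proj₂ z * proj₂ z) ≡ + 4 * norm m z
  trace-norm m (x , y) = solve 3 (λ m x y → (con (+ 2) :* x :+ y) :* (con (+ 2) :* x :+ y) :- (con (+ 4) :* m :+ con (+ 1)) :* (y :* y) := con (+ 4) :* (x :* x :+ x :* y :- m :* (y :* y))) refl m x y

  -- If the irrational part of δz³ vanishes for a unit z of norm 1, then δz³ = ±1, so that Tr(z³)² = 4t².
  trace-cube-square : ∀ {D t u c T} → t * t - D * (u * u) ≡ + 1 → T * T - D * (c * c) ≡ + 4 → t * c + u * T ≡ + 0 → T * T ≡ + 4 * (t * t)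
  trace-cube-square {D} {t} {u} {c} {T} pell n p = trans (solve 5 (λ D t u c T → T :* T := con (+ 4) :* (t :* t) :+ (t :* t) :* (T :* T :- D :* (c :* c) :- con (+ 4)) :+ (:- (T :* T)) :* (t :* t :- D :* (u :* u) :- con (+ 1)) :+ (D :* (t :* c :- u :* T)) :* (t :* c :+ u :* T :- con (+ 0))) refl D t u c T)
    (trans (diff-zero p _ (D * (t * c - u * T))) (trans (diff-zero pell _ (- (T * T))) (diff-zero n _ (t * t))))

  module _ (D′ : ℕ) (m′ : ℤ) (D≡ : + D′ ≡ + 4 * (+ 2 * m′ + + 1) + + 1) (5≤D : + 5 ≤ + D′) where
    private
      m = + 2 * m′ + + 1
      D = + 4 * m + + 1
      5≤D′ : + 5 ≤ D
      5≤D′ = subst (+ 5 ≤_) D≡ 5≤D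
      0≤D : + 0 ≤ D
      0≤D = ≤-trans (+≤+ z≤n) 5≤D′

    PellSolution : ℤ → ℤ → Set
    PellSolution t u = + 1 ≤ t × + 1 ≤ u × t * t - D * (u * u) ≡ + 1

    -- For `d = 0` one gets `c² = 1` and `t² = 1`, against `u ≥ 1`. Otherwise minimality gives
    -- `t ≤ ∣ c ∣`, whereas `4t² = (8c³ - 6c)²` exceeds `4c²` by `4c²(2c² - 2)(8c² - 4)`.
    cube-root-too-small : ∀ {t u c d T₃} → PellSolution t u → (∀ t′ u′ → PellSolution t′ u′ → t ≤ t′) → c * c - D * (d * d) ≡ + 1 →
      T₃ ≡ + 2 * c * (+ 2 * c) * (+ 2 * c) - + 3 * (+ 1 * (+ 2 * c)) → T₃ * T₃ ≡ + 4 * (t * t) → ⊥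
    cube-root-too-small {t} {u} {c} {d} (1≤t , 1≤u , pell) least n refl eq with d ≟ + 0
    ... | yes refl = <⇒≱ {+ 1} {t * t} (<-by-diff ((D - + 5) * (u * u) + + 5 * (u * u - + 1) + + 5) (≤-by-diff ((D - + 5) * (u * u) + + 5 * (u * u - + 1) + + 4) (nonneg-+ (nonneg-+ (nonneg-* (≤⇒nonneg 5≤D′) (nonneg-sq u)) (nonneg-scale 5 (≤⇒nonneg (pos-*′ 1≤u 1≤u)))) (+≤+ z≤n)) (solve 1 (λ x → x :+ con (+ 5) :- con (+ 1) := x :+ con (+ 4)) refl ((D - + 5) * (u * u) + + 5 * (u * u - + 1))))
          (trans (solve 3 (λ t u D → t :* t :- con (+ 1) := (D :- con (+ 5)) :* (u :* u) :+ con (+ 5) :* (u :* u :- con (+ 1)) :+ con (+ 5) :+ con (+ 1) :* (t :* t :- D :* (u :* u) :- con (+ 1))) refl t u D) (diff-zero pell _ (+ 1))))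
          (≤-reflexive (*-cancelˡ-≡ (+ 4) (t * t) (+ 1) (trans (sym eq) (trans (solve 2 (λ c D → let T = con (+ 2) :* c :* (con (+ 2) :* c) :* (con (+ 2) :* c) :- con (+ 3) :* (con (+ 1) :* (con (+ 2) :* c)) in
            T :* T := con (+ 4) :+ (con (+ 4) :* ((con (+ 4) :* (c :* c) :- con (+ 1)) :* (con (+ 4) :* (c :* c) :- con (+ 1)))) :* (c :* c :- D :* (con (+ 0) :* con (+ 0)) :- con (+ 1))) refl c D) (diff-zero n (+ 4) (+ 4 * ((+ 4 * (c * c) - + 1) * (+ 4 * (c * c) - + 1))))))))
    ... | no d≢0 = <⇒≱ {c * c} {t * t} (<-by-diff ((c * c) * (+ 2 * (c * c) - + 2) * (+ 8 * (c * c) - + 4)) (pos-*′ (pos-*′ 1≤c² (≤-by-diff (+ 2 * (D * (d * d)) - + 1) (≤⇒nonneg (≤-trans {+ 1} {+ 2} (+≤+ (s≤s z≤n)) 2≤)) (trans (solve 2 (λ c x → con (+ 2) :* (c :* c) :- con (+ 2) :- con (+ 1) := con (+ 2) :* x :- con (+ 1) :+ con (+ 2) :* (c :* c :- x :- con (+ 1))) refl c (D * (d * d))) (diff-zero n _ (+ 2))))) (≤-by-diff (+ 8 * (c * c - + 1) + + 3) (nonneg-+ (nonneg-scale 8 (≤⇒nonneg 1≤c²)) (+≤+ z≤n)) (solve 1 (λ x → con (+ 8) :* x :- con (+ 4) :- con (+ 1) := con (+ 8) :* (x :- con (+ 1)) :+ con (+ 3)) refl (c * c))))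
          (*-cancelˡ-≡ (+ 4) _ _ (trans (solve 2 (λ c t → con (+ 4) :* (t :* t :- c :* c) := con (+ 4) :* (t :* t) :- con (+ 4) :* (c :* c)) refl c t) (trans (cong (_- + 4 * (c * c)) (sym eq)) (solve 1 (λ c → let T = con (+ 2) :* c :* (con (+ 2) :* c) :* (con (+ 2) :* c) :- con (+ 3) :* (con (+ 1) :* (con (+ 2) :* c)) in
            T :* T :- con (+ 4) :* (c :* c) := con (+ 4) :* (c :* c :* (con (+ 2) :* (c :* c) :- con (+ 2)) :* (con (+ 8) :* (c :* c) :- con (+ 4)))) refl c)))))
          (subst (t * t ≤_) (abs-sq c) (*-mono-≤′ (1≤⇒0≤ 1≤t) (≤-trans (1≤⇒0≤ 1≤t) t≤) t≤ t≤))
      where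
      1≤dd : + 1 ≤ d * d
      1≤dd = subst (+ 1 ≤_) (abs-sq d) (pos-*′ (1≤abs d d≢0) (1≤abs d d≢0))
      2≤ : + 2 ≤ + 2 * (D * (d * d))
      2≤ = *-mono-≤′ {+ 2} {+ 2} {+ 1} (+≤+ z≤n) (nonneg-* 0≤D (nonneg-sq d)) ≤-refl (pos-*′ (≤-trans (+≤+ (s≤s z≤n)) 5≤D′) 1≤dd)
      1≤c² : + 1 ≤ c * c
      1≤c² = ≤-by-diff (D * (d * d)) (nonneg-* 0≤D (nonneg-sq d)) (trans (solve 2 (λ c x → c :- con (+ 1) := x :+ con (+ 1) :* (c :- x :- con (+ 1))) refl (c * c) (D * (d * d))) (diff-zero n _ (+ 1)))
      c≢0 : c ≢ + 0
      c≢0 refl = <⇒≱ (1≤⇒0< 1≤c²) ≤-refl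
      t≤ : t ≤ + ∣ c ∣
      t≤ = least (+ ∣ c ∣) (+ ∣ d ∣) (1≤abs c c≢0 , 1≤abs d d≢0 , trans (cong₂ (λ v w → v - D * w) (abs-sq c) (abs-sq d)) n)

    least-pell-not-cube : ∀ {t u} → PellSolution t u → (∀ t′ u′ → PellSolution t′ u′ → t ≤ t′) → (∀ c d → UnitNorm D c d → odd? c ≡ false) →
      ∀ z → norm m z ≡ + 1 → triple m (t - u , + 2 * u) z z z ≢ + 0
    least-pell-not-cube {t} {u} sol@(1≤t , 1≤u , pell) least even (x , y) n p≡0 = halves (half′ (trace z) (even (trace z) y (inj₁ unit-z)))
      where
      z = (x , y)
      z³ = mul m z (mul m z z)
      unit-z : trace z * trace z - D * (y * y) ≡ + 4
      unit-z = trans (trace-norm m z) (cong (λ w → + 4 * w) n)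
      norm-z³ : norm m z³ ≡ + 1
      norm-z³ = trans (norm-mul′ m z (mul m z z)) (trans (cong₂ _*_ n (norm-mul′ m z z)) (cong (λ w → + 1 * (w * w)) n))
      T² : trace z³ * trace z³ ≡ + 4 * (t * t)
      T² = trace-cube-square {D} {t} {u} {proj₂ z³} {trace z³} pell (trans (trace-norm m z³) (cong (λ w → + 4 * w) norm-z³)) (trans (sym (irr-of-product m t u z³)) p≡0)
      halves : (∃[ c ] trace z ≡ + 2 * c) → ⊥
      -- Since `2x + y = 2c`, the unit `z` equals `c + (c - x)√D` with integer components. It solves
      -- Pell's equation, possibly trivially.
      halves (c , T≡) = cube-root-too-small {t} {u} {c} {c - x} sol least
          (*-cancelˡ-≡ (+ 4) _ (+ 1) (trans (solve 3 (λ D c x → con (+ 4) :* (c :* c :- D :* ((c :- x) :* (c :- x))) := con (+ 2) :* c :* (con (+ 2) :* c) :- D :* ((con (+ 2) :* c :- con (+ 2) :* x) :* (con (+ 2) :* c :- con (+ 2) :* x))) refl D c x)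
            (trans (cong (λ w → w * w - D * ((w - + 2 * x) * (w - + 2 * x))) (sym T≡)) (trans (cong (λ w → trace z * trace z - D * (w * w)) (solve 2 (λ x y → con (+ 2) :* x :+ y :- con (+ 2) :* x := y) refl x y)) unit-z))))
          (trans (trace-of-cube m x y) (cong₂ (λ w v → w * w * w - + 3 * (v * w)) T≡ n)) T²

    least-¬¬-ℤ : (P : ℤ → ℤ → Set) → (∀ {a b} → P a b → + 1 ≤ a) → ∀ {a b} → P a b → ¬ ¬ (∃[ a ] ∃[ b ] (P a b × (∀ a′ b′ → P a′ b′ → a ≤ a′)))
    least-¬¬-ℤ P pos {a} {b} Pab none = least-¬¬ (λ n → ∃[ b ] P (+ n) b) ∣ a ∣ (b , subst (λ w → P w b) (sym (0≤i⇒+∣i∣≡i (1≤⇒0≤ (pos Pab)))) Pab)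
      λ { (n , (b , Pnb) , least) → none (+ n , b , Pnb , λ a′ b′ P′ → ≤-trans (+≤+ (least ∣ a′ ∣ (b′ , subst (λ w → P w b′) (sym (0≤i⇒+∣i∣≡i (1≤⇒0≤ (pos P′)))) P′))) (≤-reflexive (0≤i⇒+∣i∣≡i (1≤⇒0≤ (pos P′))))) }

    pell-exists : ∃[ t ] ∃[ u ] PellSolution t u
    pell-exists = from (pell-solution D′ (ℕ.≤-trans (s≤s z≤n) (drop‿+≤+ 5≤D)) irr)
      where
      irr : ∀ x y → 1 ℕ.≤ y → + x * + x - + D′ * (+ y * + y) ≢ + 0
      irr x y 1≤y e = irrational-sqrt (+ D′) m′ (trans D≡ (solve 1 (λ m′ → con (+ 4) :* (con (+ 2) :* m′ :+ con (+ 1)) :+ con (+ 1) := con (+ 8) :* m′ :+ con (+ 5)) refl m′)) y (+ x) (+ y) refl (λ y≡0 → ℕ.<⇒≢ 1≤y (sym (+-injective y≡0))) (i-j≡0⇒i≡j (+ x * + x) (+ D′ * (+ y * + y)) e)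
      from : (∃[ t ] ∃[ u ] (t * t - + D′ * (u * u) ≡ + 1 × u ≢ + 0)) → ∃[ t ] ∃[ u ] PellSolution t u
      from (t , u , eq , u≢0) = + ∣ t ∣ , + ∣ u ∣ , 1≤abs t t≢0 , 1≤abs u u≢0 , trans (cong₂ (λ v w → v - D * w) (abs-sq t) (abs-sq u)) eq′
        where
        eq′ : t * t - D * (u * u) ≡ + 1
        eq′ = trans (cong (λ w → t * t - w * (u * u)) (sym D≡)) eq
        t≢0 : t ≢ + 0
        t≢0 refl = <⇒≱ (1≤⇒0< {+ 0 * + 0 - D * (u * u)} (≤-reflexive (sym eq′))) (≤-by-diff (D * (u * u)) (nonneg-* 0≤D (nonneg-sq u)) (solve 1 (λ x → con (+ 0) :- (con (+ 0) :* con (+ 0) :- x) := x) refl (D * (u * u))))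

    no-odd-unit⇒reducedForm : SquareFree D′ → ¬ FundUnitTraceOdd D′ → ¬ ¬ (∃[ p ] ∃[ q ] ∃[ r ] ∃[ s ] IsReducedForm (+ D′) p q r s)
    no-odd-unit⇒reducedForm sf noOdd none = withUnit pell-exists
      where
      withLeast : (∀ c d → UnitNorm D c d → odd? c ≡ false) → (∃[ t ] ∃[ u ] (PellSolution t u × (∀ t′ u′ → PellSolution t′ u′ → t ≤ t′))) → ⊥
      withLeast even (t , u , sol@(1≤t , 1≤u , pell) , least) = none (subst (λ E → ∃[ p ] ∃[ q ] ∃[ r ] ∃[ s ] IsReducedForm E p q r s) (sym D≡)
        (reducedForm m′ t u (≤-trans (+≤+ (s≤s z≤n)) 5≤D′) 1≤t 1≤u pell
          (λ q c e → squarefree-square D′ (ℕ.≤-trans (s≤s z≤n) (drop‿+≤+ 5≤D)) sf q c (trans D≡ e)) (least-pell-not-cube sol least even)))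
      withFundamental : (∃[ t ] ∃[ u ] PellSolution t u) → (∃[ a ] ∃[ b ] (PosUnit (+ D′) a b × (∀ a′ b′ → PosUnit (+ D′) a′ b′ → a ≤ a′))) → ⊥
      withFundamental (t , u , sol) (a , b , pu , least) = least-¬¬-ℤ PellSolution proj₁ sol (withLeast even)
        where
        a-even : odd? a ≢ true
        a-even o = noOdd (a , b , fundamental-intro D′ 5≤D pu least , odd?⇒OddZ {a} o)
        even : ∀ c d → UnitNorm D c d → odd? c ≡ false
        even c d v with odd? c in o
        ... | false = refl
        ... | true = ⊥-elim (a-even (odd-unit⇒least-odd D′ 5≤D {a} {b} {c} {d} pu least (subst (λ E → UnitNorm E c d) (sym D≡) v) o))
      withUnit : (∃[ t ] ∃[ u ] PellSolution t u) → ⊥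
      -- The minimisation over units starts from the Pell solution itself, doubled because units are
      -- written with denominator 2.
      withUnit pe@(t , u , 1≤t , 1≤u , pell) = least-¬¬-ℤ (PosUnit (+ D′)) 1≤a {+ 2 * t} {+ 2 * u}
        (posUnit (pos-*′ {+ 2} (+≤+ (s≤s z≤n)) 1≤t) (pos-*′ {+ 2} (+≤+ (s≤s z≤n)) 1≤u)
          (inj₁ (trans (solve 3 (λ D t u → con (+ 2) :* t :* (con (+ 2) :* t) :- D :* (con (+ 2) :* u :* (con (+ 2) :* u)) := con (+ 4) :* (t :* t :- D :* (u :* u))) refl (+ D′) t u)
            (cong (λ w → + 4 * w) (trans (cong (λ E → t * t - E * (u * u)) D≡) pell))))) (withFundamental pe)

-- Counting functions and injections

module Counting where

  open import Data.Nat
  open import Data.Nat.Properties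
  open import Data.Nat.Divisibility using (_∣_; _∣?_; divides)
  open import Data.Bool using (Bool; true; false; _∧_; not)
  open import Data.Fin using (Fin; fromℕ<)
  open import Data.Fin.Properties using (injective⇒≤; toℕ-fromℕ<)
  open import Data.List using (List; []; _∷_; length; lookup; map)
  open import Data.List.Relation.Unary.All as All using (All; []; _∷_)
  open import Data.List.Relation.Unary.Any as Any using (here; there; index)
  open import Data.List.Relation.Unary.Any.Properties using (lookup-index)
  open import Data.List.Relation.Unary.AllPairs using ([]; _∷_)
  open import Data.List.Relation.Unary.Unique.Propositional using (Unique)
  open import Data.List.Membership.Propositional using (_∈_)
  open import Data.List.Membership.Propositional.Properties using (∈-lookup)
  open import Data.Product using (_×_; _,_; proj₁; proj₂)
  open import Data.Sum using (inj₁; inj₂)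
  open import Data.Empty using (⊥-elim)
  open import Relation.Nullary using (yes; no; does)
  open import Relation.Binary.PropositionalEquality
  open import Data.Nat.Tactic.RingSolver using (solve-∀)

  ι : Bool → ℕ
  ι true = 1
  ι false = 0

  cnt : (ℕ → Bool) → ℕ → ℕ
  cnt f zero = 0
  cnt f (suc X) = ι (f X) + cnt f X

  els : (ℕ → Bool) → ℕ → List ℕ
  els f zero = []
  els f (suc X) with f X
  ... | true = X ∷ els f X
  ... | false = els f X

  length-els : ∀ f X → length (els f X) ≡ cnt f X
  length-els f zero = refl
  length-els f (suc X) with f X
  ... | true = cong suc (length-els f X)
  ... | false = length-els f X

  els-sound : ∀ f X → All (λ n → n < X × f n ≡ true) (els f X)
  els-sound f zero = []
  els-sound f (suc X) with f X in eq
  ... | true = (n<1+n X , eq) ∷ All.map (λ (n<X , t) → m<n⇒m<1+n n<X , t) (els-sound f X)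
  ... | false = All.map (λ (n<X , t) → m<n⇒m<1+n n<X , t) (els-sound f X)

  els-complete : ∀ f X {n} → n < X → f n ≡ true → n ∈ els f X
  els-complete f (suc X) {n} n<X t with f X in eq | m≤n⇒m<n∨m≡n (s≤s⁻¹ n<X)
  ... | true | inj₁ n<X′ = there (els-complete f X n<X′ t)
  ... | true | inj₂ refl = here refl
  ... | false | inj₁ n<X′ = els-complete f X n<X′ t
  ... | false | inj₂ refl with trans (sym t) eq
  ... | ()

  els-unique : ∀ f X → Unique (els f X)
  els-unique f zero = []
  els-unique f (suc X) with f X
  ... | true = All.map (λ (n<X , _) → ≢-sym (<⇒≢ n<X)) (els-sound f X) ∷ els-unique f X
  ... | false = els-unique f X

  lookup-injective : ∀ {A : Set} {xs : List A} → Unique xs → ∀ i j → lookup xs i ≡ lookup xs j → i ≡ j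
  lookup-injective (x∉ ∷ u) Fin.zero Fin.zero eq = refl
  lookup-injective {xs = x ∷ xs} (x∉ ∷ u) Fin.zero (Fin.suc j) eq = ⊥-elim (All.lookup x∉ (∈-lookup {xs = xs} j) eq)
  lookup-injective {xs = x ∷ xs} (x∉ ∷ u) (Fin.suc i) Fin.zero eq = ⊥-elim (All.lookup x∉ (∈-lookup {xs = xs} i) (sym eq))
  lookup-injective (x∉ ∷ u) (Fin.suc i) (Fin.suc j) eq = cong Fin.suc (lookup-injective u i j eq)

  length-≤-by-code : ∀ {A : Set} {xs : List A} {B} → Unique xs → (code : ∀ {x} → x ∈ xs → Fin B) →
    (∀ {x y} (p : x ∈ xs) (q : y ∈ xs) → code p ≡ code q → x ≡ y) → length xs ≤ B
  length-≤-by-code {xs = xs} u code inj = injective⇒≤ {f = λ i → code (∈-lookup {xs = xs} i)} (λ {i} {j} eq → lookup-injective u i j (inj (∈-lookup {xs = xs} i) (∈-lookup {xs = xs} j) eq))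

  subset-length : ∀ {A : Set} {xs ys : List A} → Unique xs → (∀ {x} → x ∈ xs → x ∈ ys) → length xs ≤ length ys
  subset-length {ys = ys} u sub = length-≤-by-code u (λ p → index (sub p)) (λ p q eq → trans (lookup-index (sub p)) (trans (cong (lookup ys) eq) (sym (lookup-index (sub q)))))

  unique-below : ∀ {xs : List ℕ} {s} → Unique xs → All (_< s) xs → length xs ≤ s
  unique-below u below = length-≤-by-code u (λ p → fromℕ< (All.lookup below p)) (λ p q eq → trans (sym (toℕ-fromℕ< _)) (trans (cong Data.Fin.toℕ eq) (toℕ-fromℕ< _)))

  cnt-mono : ∀ f {X Y} → X ≤ Y → cnt f X ≤ cnt f Y
  cnt-mono f {X} {zero} z≤n = z≤n
  cnt-mono f {X} {suc Y} X≤ with m≤n⇒m<n∨m≡n X≤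
  ... | inj₁ (s≤s X≤Y) = ≤-trans (cnt-mono f X≤Y) (m≤n+m (cnt f Y) (ι (f Y)))
  ... | inj₂ refl = ≤-refl

  cnt-ext : ∀ {f g : ℕ → Bool} → (∀ n → f n ≡ g n) → ∀ X → cnt f X ≡ cnt g X
  cnt-ext e zero = refl
  cnt-ext e (suc X) = cong₂ _+_ (cong ι (e X)) (cnt-ext e X)

  cnt-≤ : ∀ {f g : ℕ → Bool} → (∀ n → f n ≡ true → g n ≡ true) → ∀ X → cnt f X ≤ cnt g X
  cnt-≤ {f} {g} h zero = z≤n
  cnt-≤ {f} {g} h (suc X) = +-mono-≤ (le (f X) (g X) (h X)) (cnt-≤ h X)
    where
    le : ∀ a b → (a ≡ true → b ≡ true) → ι a ≤ ι b
    le false b h = z≤n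
    le true b h rewrite h refl = ≤-refl

  cnt-append : ∀ (f : ℕ → Bool) i M → cnt f (i + M) ≡ cnt (λ n → f (n + M)) i + cnt f M
  cnt-append f zero M = refl
  cnt-append f (suc i) M = trans (cong (ι (f (i + M)) +_) (cnt-append f i M)) (sym (+-assoc (ι (f (i + M))) (cnt (λ n → f (n + M)) i) (cnt f M)))

  cnt-split : ∀ (f g : ℕ → Bool) X → cnt (λ n → f n ∧ not (g n)) X + cnt (λ n → f n ∧ g n) X ≡ cnt f X
  cnt-split f g zero = refl
  cnt-split f g (suc X) = trans (interchange (ι (f X ∧ not (g X))) (cnt (λ n → f n ∧ not (g n)) X) (ι (f X ∧ g X)) (cnt (λ n → f n ∧ g n) X)) (cong₂ _+_ (bit (f X) (g X)) (cnt-split f g X))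
    where
    interchange : ∀ a b c d → a + b + (c + d) ≡ a + c + (b + d)
    interchange = solve-∀
    bit : ∀ a b → ι (a ∧ not b) + ι (a ∧ b) ≡ ι a
    bit false b = refl
    bit true false = refl
    bit true true = refl

  _∣ᵇ_ : ℕ → ℕ → Bool
  d ∣ᵇ n = does (d ∣? n)

  -- That is, X/d rounded up.
  multiplesBelow : ℕ → ℕ → ℕ
  multiplesBelow d X = cnt (d ∣ᵇ_) X

  exact-quotient : ∀ {d c X} .{{_ : NonZero d}} → X ≤ c * d → c * d < X + d → d ∣ X → c * d ≡ X
  exact-quotient {d} {c} {X} lo hi (divides q eq) = trans (cong (_* d) (≤-antisym c≤q q≤c)) (sym eq)
    where
    c≤q : c ≤ q
    c≤q = s≤s⁻¹ (*-cancelʳ-< d c (suc q) (<-≤-trans hi (≤-reflexive (trans (cong (_+ d) eq) (+-comm (q * d) d)))))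
    q≤c : q ≤ c
    q≤c = *-cancelʳ-≤ q c d (≤-trans (≤-reflexive (sym eq)) lo)

  multiplesBelow-bounds : ∀ d .{{_ : NonZero d}} X → X ≤ multiplesBelow d X * d × multiplesBelow d X * d < X + d
  multiplesBelow-bounds d zero = z≤n , >-nonZero⁻¹ d
  multiplesBelow-bounds d (suc X) with multiplesBelow-bounds d X | d ∣? X
  ... | lo , hi | yes d∣X = step
    where
    exact : multiplesBelow d X * d ≡ X
    exact = exact-quotient {c = multiplesBelow d X} lo hi d∣X
    step : suc X ≤ d + multiplesBelow d X * d × d + multiplesBelow d X * d < suc X + d
    step rewrite exact = +-monoˡ-≤ X (>-nonZero⁻¹ d) , s≤s (≤-reflexive (+-comm d X))
  ... | lo , hi | no d∤X = ≤∧≢⇒< lo (λ eq → d∤X (divides (multiplesBelow d X) eq)) , m<n⇒m<1+n hi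

  multiplesBelow-exact : ∀ d .{{_ : NonZero d}} X → d ∣ X → multiplesBelow d X * d ≡ X
  multiplesBelow-exact d X = exact-quotient {c = multiplesBelow d X} (proj₁ (multiplesBelow-bounds d X)) (proj₂ (multiplesBelow-bounds d X))

  <multiplesBelow⇒ : ∀ d .{{_ : NonZero d}} X {e} → e < multiplesBelow d X → e * d < X
  <multiplesBelow⇒ d X {e} e< = +-cancelˡ-< d (e * d) X (≤-<-trans (*-monoˡ-≤ d e<) (<-≤-trans (proj₂ (multiplesBelow-bounds d X)) (≤-reflexive (+-comm X d))))

  cnt-multiples : ∀ (f : ℕ → Bool) d .{{_ : NonZero d}} X → cnt (λ n → f n ∧ d ∣ᵇ n) X ≡ cnt (λ j → f (j * d)) (multiplesBelow d X)
  cnt-multiples f d zero = refl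
  cnt-multiples f d (suc X) with d ∣? X
  ... | yes d∣X = cong₂ _+_ (cong ι (trans (∧-t (f X)) (cong f (sym (multiplesBelow-exact d X d∣X))))) (cnt-multiples f d X)
    where
    ∧-t : ∀ b → b ∧ true ≡ b
    ∧-t true = refl
    ∧-t false = refl
  ... | no _ = trans (cong (λ b → ι b + cnt (λ n → f n ∧ d ∣ᵇ n) X) (∧-f (f X))) (cnt-multiples f d X)
    where
    ∧-f : ∀ b → b ∧ false ≡ false
    ∧-f true = refl
    ∧-f false = refl

-- Sieving residue classes by odd squares

module Sieve where

  open import Data.Nat
  open import Data.Nat.Properties
  open import Data.Nat.DivMod
  open import Data.Nat.Divisibility
  open import Data.Nat.Primality using (Prime; euclidsLemma; prime⇒nonZero; prime⇒irreducible; ¬prime[1])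
  open import Data.Bool using (Bool; true; false; _∧_; _∨_; not)
  import Data.Bool.Properties as Bool
  open import Data.List using (List; []; _∷_; length; filter; map; _++_)
  open import Data.List.Properties using (length-++; filter-++)
  open import Data.List.Relation.Unary.All as All using (All; []; _∷_)
  import Data.List.Relation.Unary.All.Properties as All
  open import Data.List.Relation.Unary.AllPairs using ([]; _∷_)
  open import Data.List.Relation.Unary.Unique.Propositional using (Unique)
  open import Data.List.Relation.Unary.Unique.Propositional.Properties using (map⁺; ++⁺; filter⁺)
  open import Data.List.Membership.Propositional.Properties using (∈-map⁻)
  open import Data.Product using (_×_; _,_; proj₁; proj₂)
  open import Data.Sum using (_⊎_; inj₁; inj₂)
  open import Data.Empty using (⊥-elim)
  open import Relation.Nullary using (¬_; yes; no; Dec)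
  open import Relation.Nullary.Decidable using (dec-false; from-yes; _→-dec_; _×-dec_; _⊎-dec_; does-⇔)
  open import Relation.Binary.PropositionalEquality
  open import Data.Nat.Tactic.RingSolver using (solve-∀)
  open import Function.Bundles using (mk⇔)
  open Counting

  sieve : (ℕ → Bool) → List ℕ → ℕ → Bool
  sieve c [] n = c n
  sieve c (q ∷ ps) n = sieve c ps n ∧ not ((q * q) ∣ᵇ n)

  OddPrime : ℕ → Set
  OddPrime q = Prime q × q % 2 ≡ 1

  prime-square-cancel : ∀ {r q} a → Prime r → ¬ (r ∣ q) → r * r ∣ a * q → r * r ∣ a
  prime-square-cancel {r} {q} a pr r∤q d with euclidsLemma a q pr (∣-trans (m∣m*n r) d)
  ... | inj₂ r∣q = ⊥-elim (r∤q r∣q)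
  ... | inj₁ (divides a′ refl) with euclidsLemma a′ q pr (*-cancelˡ-∣ r {{prime⇒nonZero pr}} (∣-trans d (∣-reflexive (rearrange a′ r q))))
    where
    rearrange : ∀ a r q → a * r * q ≡ r * (a * q)
    rearrange = solve-∀
  ... | inj₁ (divides k refl) = divides k (*-assoc k r r)
  ... | inj₂ r∣q = ⊥-elim (r∤q r∣q)

  prime-∤-prime : ∀ {r q} → Prime r → Prime q → r ≢ q → ¬ (r ∣ q)
  prime-∤-prime pr pq r≢q r∣q with prime⇒irreducible pq r∣q
  ... | inj₁ refl = ¬prime[1] pr
  ... | inj₂ r≡q = r≢q r≡q

  ∣ᵇ-scale : ∀ {r q} j → Prime r → Prime q → r ≢ q → ((r * r) ∣ᵇ (j * (q * q))) ≡ ((r * r) ∣ᵇ j)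
  ∣ᵇ-scale {r} {q} j pr pq r≢q = does-⇔ (mk⇔
     (λ d → prime-square-cancel j pr r∤q (prime-square-cancel (j * q) pr r∤q (∣-trans d (∣-reflexive (sym (*-assoc j q q))))))
     (λ d → ∣-trans d (m∣m*n (q * q)))) (r * r ∣? j * (q * q)) (r * r ∣? j)
    where
    r∤q = prime-∤-prime pr pq r≢q

  Invariant : (ℕ → Bool) → Set
  Invariant c = ∀ q → q % 2 ≡ 1 → ∀ j → c (j * (q * q)) ≡ c j

  sieve-scale : ∀ {c q} ps → Invariant c → OddPrime q → All Prime ps → All (_≢ q) ps → ∀ j → sieve c ps (j * (q * q)) ≡ sieve c ps j
  sieve-scale {q = q} [] inv (_ , odd) _ _ j = inv q odd j
  sieve-scale (r ∷ ps) inv oq (pr ∷ prs) (r≢q ∷ ≢q) j = cong₂ (λ a b → a ∧ not b) (sieve-scale ps inv oq prs ≢q j) (∣ᵇ-scale j pr (proj₁ oq) r≢q)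

  sq-nonZero : ∀ {q} → Prime q → NonZero (q * q)
  sq-nonZero {q} p = m*n≢0 q q {{prime⇒nonZero p}} {{prime⇒nonZero p}}

  reduced : ℕ → ℕ → ℕ
  reduced q X = multiplesBelow (q * q) X

  -- The survivors of `ps` that `q` removes are the `q²j` with `j` a survivor of `ps`: neither the
  -- residue class nor divisibility by the other squares changes under multiplication by `q²`.
  sieve-step : ∀ {c q} ps → Invariant c → OddPrime q → All Prime ps → All (_≢ q) ps → ∀ X →
    cnt (sieve c (q ∷ ps)) X + cnt (sieve c ps) (reduced q X) ≡ cnt (sieve c ps) X
  sieve-step {c} {q} ps inv oq prs ≢q X = trans (cong (cnt (sieve c (q ∷ ps)) X +_) (sym (trans (cnt-multiples (sieve c ps) (q * q) {{sq-nonZero (proj₁ oq)}} X) (cnt-ext (sieve-scale ps inv oq prs ≢q) (reduced q X)))))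
    (cnt-split (sieve c ps) ((q * q) ∣ᵇ_) X)

  OddPrimes : List ℕ → Set
  OddPrimes ps = All OddPrime ps × Unique ps

  private
    tail-primes : ∀ {q ps} → OddPrimes (q ∷ ps) → OddPrimes ps × OddPrime q × All Prime ps × All (_≢ q) ps
    tail-primes (oq ∷ ops , q∉ ∷ u) = (ops , u) , oq , All.map proj₁ ops , All.map ≢-sym q∉

  squareFreeProducts : List ℕ → List ℕ
  squareFreeProducts [] = 1 ∷ []
  squareFreeProducts (q ∷ ps) = squareFreeProducts ps ++ map (q *_) (squareFreeProducts ps)

  squareFreeProducts-∤ : ∀ {q} ps → Prime q → All Prime ps → All (_≢ q) ps → All (λ d → ¬ (q ∣ d)) (squareFreeProducts ps)
  squareFreeProducts-∤ [] pq _ _ = (λ q∣1 → ¬prime[1] (subst Prime (∣1⇒≡1 q∣1) pq)) ∷ []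
  squareFreeProducts-∤ {q} (r ∷ ps) pq (pr ∷ prs) (r≢q ∷ ≢q) = All.++⁺ rest (All.map⁺ (All.map step rest))
    where
    rest = squareFreeProducts-∤ ps pq prs ≢q
    step : ∀ {d} → ¬ (q ∣ d) → ¬ (q ∣ r * d)
    step {d} q∤d h with euclidsLemma r d pq h
    ... | inj₁ q∣r = prime-∤-prime pq pr (≢-sym r≢q) q∣r
    ... | inj₂ q∣d = q∤d q∣d

  squareFreeProducts-unique : ∀ ps → OddPrimes ps → Unique (squareFreeProducts ps)
  squareFreeProducts-unique [] _ = [] ∷ []
  squareFreeProducts-unique (q ∷ ps) ops with tail-primes ops
  ... | ops′ , (pq , _) , prs , ≢q = ++⁺ (squareFreeProducts-unique ps ops′) (map⁺ (*-cancelˡ-≡ _ _ q {{prime⇒nonZero pq}}) (squareFreeProducts-unique ps ops′))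
    λ { (d∈ , d∈′) → let (e , _ , eq) = ∈-map⁻ (q *_) d∈′ in All.lookup (squareFreeProducts-∤ ps pq prs ≢q) d∈ (divides e (trans eq (*-comm q e))) }

  -- The number of terms of the inclusion-exclusion that can contribute an error. These are
  -- square-free `d` with `d² < X`, so there are at most `√X` of them, however many primes are
  -- sieved.
  terms : List ℕ → ℕ → ℕ
  terms ps X = length (filter (λ d → d * d <? X) (squareFreeProducts ps))

  filter-map-≤ : ∀ {P Q : ℕ → Set} (P? : ∀ d → Dec (P d)) (Q? : ∀ d → Dec (Q d)) (f : ℕ → ℕ) → (∀ d → P d → Q (f d)) → ∀ xs →
    length (filter P? xs) ≤ length (filter Q? (map f xs))
  filter-map-≤ P? Q? f h [] = z≤n
  filter-map-≤ P? Q? f h (d ∷ xs) with P? d | Q? (f d)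
  ... | yes _ | yes _ = s≤s (filter-map-≤ P? Q? f h xs)
  ... | yes y | no n = ⊥-elim (n (h d y))
  ... | no _ | yes _ = m≤n⇒m≤1+n (filter-map-≤ P? Q? f h xs)
  ... | no _ | no _ = filter-map-≤ P? Q? f h xs

  terms-step : ∀ {q} ps → Prime q → ∀ X → terms ps X + terms ps (reduced q X) ≤ terms (q ∷ ps) X
  terms-step {q} ps pq X = ≤-trans (+-monoʳ-≤ (terms ps X) (filter-map-≤ (λ d → d * d <? reduced q X) (λ d → d * d <? X) (q *_) (λ d h → subst (_< X) (rearrange d q) (<multiplesBelow⇒ (q * q) {{sq-nonZero pq}} X h)) (squareFreeProducts ps)))
    (≤-reflexive (sym (trans (cong length (filter-++ (λ d → d * d <? X) (squareFreeProducts ps) _)) (length-++ (filter (λ d → d * d <? X) (squareFreeProducts ps))))))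
    where
    rearrange : ∀ d q → d * d * (q * q) ≡ (q * d) * (q * d)
    rearrange = solve-∀

  terms-bound : ∀ {ps X s} → OddPrimes ps → X ≤ s * s → terms ps X ≤ s
  terms-bound {ps} {X} {s} ops X≤ = unique-below (filter⁺ (λ d → d * d <? X) (squareFreeProducts-unique ps ops))
    (All.map (λ {d} h → ≰⇒> λ s≤d → <⇒≱ (<-≤-trans h X≤) (*-mono-≤ s≤d s≤d)) (All.all-filter (λ d → d * d <? X) (squareFreeProducts ps)))

  -- `terms [] X` is 1 for `X > 1` and 0 otherwise. Below 1 no error is tolerated, so that a term
  -- with `d² ≥ X`, where only the number 0 is counted, costs nothing.
  CloseCounts : (c c′ : ℕ → Bool) → Set
  CloseCounts c c′ = ∀ X → cnt c X ≤ cnt c′ X + 4 * terms [] X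

  -- Each sieving step subtracts a count, so the recursion uses the comparison in the opposite
  -- direction for the subtracted part and exchanges the two classes.
  sieve-close : ∀ {c c′} → Invariant c → Invariant c′ → CloseCounts c c′ → CloseCounts c′ c → ∀ ps → OddPrimes ps → ∀ X →
    cnt (sieve c ps) X ≤ cnt (sieve c′ ps) X + 4 * terms ps X
  sieve-close inv inv′ cl cl′ [] _ X = cl X
  sieve-close {c} {c′} inv inv′ cl cl′ (q ∷ ps) ops X with tail-primes ops
  ... | ops′ , oq , prs , ≢q = combine {cnt (sieve c (q ∷ ps)) X} {cnt (sieve c ps) (reduced q X)} {cnt (sieve c ps) X} {cnt (sieve c′ (q ∷ ps)) X} {cnt (sieve c′ ps) (reduced q X)} {cnt (sieve c′ ps) X} {terms ps X} {terms ps (reduced q X)} {terms (q ∷ ps) X} (sieve-step ps inv oq prs ≢q X) (sieve-step ps inv′ oq prs ≢q X)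
      (sieve-close inv inv′ cl cl′ ps ops′ X) (sieve-close inv′ inv cl′ cl ps ops′ (reduced q X)) (terms-step ps (proj₁ oq) X)
    where
    combine : ∀ {a b f a′ b′ f′ t u v} → a + b ≡ f → a′ + b′ ≡ f′ → f ≤ f′ + 4 * t → b′ ≤ b + 4 * u → t + u ≤ v → a ≤ a′ + 4 * v
    combine {a} {b} {f} {a′} {b′} {f′} {t} {u} {v} refl refl h₁ h₂ h₃ = +-cancelʳ-≤ b a (a′ + 4 * v) (≤-trans h₁ (≤-trans (+-monoˡ-≤ (4 * t) (+-monoʳ-≤ a′ h₂))
      (≤-trans (≤-reflexive (shuffle a′ b u t)) (+-monoˡ-≤ b (+-monoʳ-≤ a′ (*-monoʳ-≤ 4 h₃))))))
      where
      shuffle : ∀ a b u t → a + (b + 4 * u) + 4 * t ≡ a + 4 * (t + u) + b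
      shuffle = solve-∀

  sumOver : (ℕ → ℕ) → List ℕ → ℕ
  sumOver g [] = 0
  sumOver g (q ∷ ps) = g q + sumOver g ps

  cnt-sieve-≤ : ∀ c ps X → cnt (sieve c ps) X ≤ cnt c X
  cnt-sieve-≤ c [] X = ≤-refl
  cnt-sieve-≤ c (q ∷ ps) X = ≤-trans (cnt-≤ (λ n → proj₁′ (sieve c ps n)) X) (cnt-sieve-≤ c ps X)
    where
    proj₁′ : ∀ a {b} → a ∧ b ≡ true → a ≡ true
    proj₁′ true _ = refl

  -- The union bound: what a further prime removes is at most what it would remove from the unsifted
  -- class.
  sieve-lower : ∀ {c} → Invariant c → ∀ ps → OddPrimes ps → ∀ X → cnt c X ≤ cnt (sieve c ps) X + sumOver (λ q → cnt c (reduced q X)) ps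
  sieve-lower inv [] _ X = m≤m+n _ _
  sieve-lower {c} inv (q ∷ ps) ops X with tail-primes ops
  ... | ops′ , oq , prs , ≢q = ≤-trans (sieve-lower inv ps ops′ X) (≤-trans (+-monoˡ-≤ S (≤-trans (≤-reflexive (sym (sieve-step ps inv oq prs ≢q X))) (+-monoʳ-≤ (cnt (sieve c (q ∷ ps)) X) (cnt-sieve-≤ c ps (reduced q X)))))
       (≤-reflexive (+-assoc (cnt (sieve c (q ∷ ps)) X) (cnt c (reduced q X)) S)))
    where
    S = sumOver (λ q → cnt c (reduced q X)) ps

  sieve-sound : ∀ c ps n → sieve c ps n ≡ true → c n ≡ true × All (λ q → ¬ (q * q ∣ n)) ps
  sieve-sound c [] n h = h , []
  sieve-sound c (q ∷ ps) n h with sieve c ps n in eq | q * q ∣? n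
  ... | true | no ¬d = proj₁ (sieve-sound c ps n eq) , ¬d ∷ proj₂ (sieve-sound c ps n eq)

  sieve-complete : ∀ c ps n → c n ≡ true → All (λ q → ¬ (q * q ∣ n)) ps → sieve c ps n ≡ true
  sieve-complete c [] n h [] = h
  sieve-complete c (q ∷ ps) n h (¬d ∷ rest) rewrite sieve-complete c ps n h rest | dec-false (q * q ∣? n) ¬d = refl

  class : (ℕ → Bool) → ℕ → Bool
  class χ n = χ (n % 16)

  χ₁ χ₅ χ₈ : ℕ → Bool
  χ₁ r = (r ≡ᵇ 1) ∨ (r ≡ᵇ 9)
  χ₅ r = (r ≡ᵇ 5) ∨ (r ≡ᵇ 13)
  χ₈ r = (r ≡ᵇ 8) ∨ (r ≡ᵇ 12)

  -- Odd squares are 1 or 9 modulo 16, and every class consists of two residues, so all have density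
  -- 1/8. The condition at 0 provides the vanishing error demanded by `CloseCounts`.
  Admissible : (ℕ → Bool) → Set
  Admissible χ = (∀ {r} → r < 16 → χ (r * 1 % 16) ≡ χ r × χ (r * 9 % 16) ≡ χ r) × cnt χ 16 ≡ 2 × χ 0 ≡ false

  private
    scaling? : ∀ (χ : ℕ → Bool) → Dec (∀ {r} → r < 16 → χ (r * 1 % 16) ≡ χ r × χ (r * 9 % 16) ≡ χ r)
    scaling? χ = allUpTo? (λ r → (χ (r * 1 % 16) Bool.≟ χ r) ×-dec (χ (r * 9 % 16) Bool.≟ χ r)) 16

  admissible₁ : Admissible χ₁
  admissible₁ = (λ {r} → from-yes (scaling? χ₁) {r}) , refl , refl

  admissible₅ : Admissible χ₅
  admissible₅ = (λ {r} → from-yes (scaling? χ₅) {r}) , refl , refl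

  admissible₈ : Admissible χ₈
  admissible₈ = (λ {r} → from-yes (scaling? χ₈) {r}) , refl , refl

  odd-square-mod-16 : ∀ q → q % 2 ≡ 1 → (q * q) % 16 ≡ 1 ⊎ (q * q) % 16 ≡ 9
  odd-square-mod-16 q odd = subst (λ w → w ≡ 1 ⊎ w ≡ 9) (sym (%-distribˡ-* q q 16)) (table (m%n<n q 16) (trans (m∣n⇒o%n%m≡o%m 2 16 q (divides 8 refl)) odd))
    where
    table : ∀ {r} → r < 16 → r % 2 ≡ 1 → r * r % 16 ≡ 1 ⊎ r * r % 16 ≡ 9
    table = from-yes (allUpTo? (λ r → (r % 2 ≟ 1) →-dec ((r * r % 16 ≟ 1) ⊎-dec (r * r % 16 ≟ 9))) 16)

  class-invariant : ∀ {χ} → Admissible χ → Invariant (class χ)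
  class-invariant {χ} (scale , _) q odd j = trans (cong χ (%-distribˡ-* j (q * q) 16)) (by (odd-square-mod-16 q odd))
    where
    by : (q * q) % 16 ≡ 1 ⊎ (q * q) % 16 ≡ 9 → χ (j % 16 * (q * q % 16) % 16) ≡ χ (j % 16)
    by (inj₁ eq) = trans (cong (λ w → χ (j % 16 * w % 16)) eq) (proj₁ (scale (m%n<n j 16)))
    by (inj₂ eq) = trans (cong (λ w → χ (j % 16 * w % 16)) eq) (proj₂ (scale (m%n<n j 16)))

  cnt-class-period : ∀ {χ : ℕ → Bool} → cnt χ 16 ≡ 2 → ∀ k r → r ≤ 16 → cnt (class χ) (r + k * 16) ≡ cnt χ r + k * 2
  cnt-class-period {χ} two k r r≤ = trans (cnt-append (class χ) r (k * 16)) (cong₂ _+_ (low {k} r r≤) (blocks k))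
    where
    low : ∀ {k} r → r ≤ 16 → cnt (λ n → class χ (n + k * 16)) r ≡ cnt χ r
    low zero _ = refl
    low {k} (suc r) r< = cong₂ _+_ (cong (λ w → ι (χ w)) (trans ([m+kn]%n≡m%n r k 16) (m<n⇒m%n≡m r<))) (low {k} r (<⇒≤ r<))
    blocks : ∀ k → cnt (class χ) (k * 16) ≡ k * 2
    blocks zero = refl
    blocks (suc k) = trans (cnt-append (class χ) 16 (k * 16)) (cong₂ _+_ (trans (low {k} 16 ≤-refl) two) (blocks k))

  cnt-class-bounds : ∀ {χ} → Admissible χ → ∀ X → 8 * cnt (class χ) X ≤ X + 16 × X ≤ 8 * cnt (class χ) X + 16
  cnt-class-bounds {χ} (_ , two , _) X = subst₂ (λ x y → 8 * y ≤ x + 16 × x ≤ 8 * y + 16) (sym (m≡m%n+[m/n]*n X 16)) (sym eq)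
      (≤-trans (≤-reflexive (distrib (cnt χ r) k)) (≤-trans (+-monoˡ-≤ (k * 16) (≤-trans (*-monoʳ-≤ 8 (≤-trans (cnt-mono χ r≤) (≤-reflexive two))) (m≤n+m 16 r))) (≤-reflexive (swap r 16 (k * 16)))) ,
       ≤-trans (+-monoˡ-≤ (k * 16) (≤-trans r≤ (m≤n+m 16 (8 * cnt χ r)))) (≤-reflexive (trans (swap (8 * cnt χ r) 16 (k * 16)) (cong (_+ 16) (sym (distrib (cnt χ r) k))))))
    where
    r = X % 16
    k = X / 16
    r≤ : r ≤ 16
    r≤ = <⇒≤ (m%n<n X 16)
    eq : cnt (class χ) X ≡ cnt χ r + k * 2
    eq = trans (cong (cnt (class χ)) (m≡m%n+[m/n]*n X 16)) (cnt-class-period two k r r≤)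
    distrib : ∀ a k → 8 * (a + k * 2) ≡ 8 * a + k * 16
    distrib = solve-∀
    swap : ∀ a b c → a + b + c ≡ a + c + b
    swap = solve-∀

  close-from-bounds : ∀ {a b X} → 8 * a ≤ X + 16 → X ≤ 8 * b + 16 → a ≤ b + 4
  close-from-bounds {a} {b} {X} up down = *-cancelˡ-≤ 8 (≤-trans up (≤-trans (+-monoˡ-≤ 16 down) (≤-reflexive (distrib b))))
    where
    distrib : ∀ b → 8 * b + 16 + 16 ≡ 8 * (b + 4)
    distrib = solve-∀

  class-close : ∀ {χ χ′} → Admissible χ → Admissible χ′ → CloseCounts (class χ) (class χ′)
  class-close ad ad′ zero = z≤n
  class-close {χ} {χ′} (_ , _ , z) ad′ (suc zero) = ≤-trans (≤-reflexive (cong (λ b → ι b + 0) z)) z≤n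
  class-close {χ} {χ′} ad ad′ (suc (suc X)) = close-from-bounds {cnt (class χ) (suc (suc X))} {cnt (class χ′) (suc (suc X))} {suc (suc X)} (proj₁ (cnt-class-bounds ad (suc (suc X)))) (proj₂ (cnt-class-bounds ad′ (suc (suc X))))

-- The three classes of real quadratic discriminants

module Discriminants where

  open import Data.Nat
  open import Data.Nat.Properties
  open import Data.Nat.DivMod
  open import Data.Nat.Divisibility
  open import Data.Nat.Primality using (Prime; prime?; prime⇒nonZero; prime⇒irreducible; ¬prime[1])
  open import Data.Bool using (Bool; true; false; _∨_; T)
  import Data.Bool.Properties as Bool
  open import Data.List using (List; []; _∷_; length; filter; _++_)
  open import Data.List.Properties using (length-++)
  open import Data.List.Relation.Unary.All as All using (All; []; _∷_)
  import Data.List.Relation.Unary.All.Properties as All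
  open import Data.List.Relation.Unary.Any using (here; there)
  open import Data.List.Relation.Unary.AllPairs using ([]; _∷_)
  open import Data.List.Relation.Unary.Unique.Propositional using (Unique)
  open import Data.List.Relation.Unary.Unique.Propositional.Properties using (filter⁺; ++⁺)
  open import Data.List.Membership.Propositional using (_∈_)
  open import Data.List.Membership.Propositional.Properties using (∈-filter⁺; ∈-++⁺ˡ; ∈-++⁺ʳ; ∈-++⁻)
  open import Data.Product using (∃-syntax; _×_; _,_; proj₁; proj₂)
  open import Data.Sum using (_⊎_; inj₁; inj₂)
  open import Data.Empty using (⊥; ⊥-elim)
  open import Data.Unit using (tt)
  open import Relation.Nullary using (¬_; Dec)
  open import Relation.Nullary.Decidable using (from-yes; _→-dec_; _×-dec_; _⊎-dec_; ¬?)
  open import Relation.Binary.PropositionalEquality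
  open import Data.Nat.Tactic.RingSolver using (solve-∀)
  open import Function.Bundles using (Equivalence)
  open import Defs
  open Counting
  open Sieve

  odds : ℕ → List ℕ
  odds zero = []
  odds (suc j) = suc (2 * suc j) ∷ odds j

  odds-bounded : ∀ k → All (_≤ suc (2 * k)) (odds k)
  odds-bounded zero = []
  odds-bounded (suc k) = ≤-refl ∷ All.map (λ h → ≤-trans h (s≤s (*-monoʳ-≤ 2 (n≤1+n k)))) (odds-bounded k)

  odds-unique : ∀ k → Unique (odds k)
  odds-unique zero = []
  odds-unique (suc k) = All.map (λ {x} h eq → <⇒≢ (<-≤-trans (s≤s h) (s≤s (≤-trans (s≤s (n≤1+n (2 * k))) (≤-reflexive (sym (*-suc 2 k)))))) (sym eq)) (odds-bounded k) ∷ odds-unique k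

  odds-complete : ∀ k j → 1 ≤ j → j ≤ k → suc (2 * j) ∈ odds k
  odds-complete zero (suc j) _ ()
  odds-complete (suc k) j 1≤j j≤ with m≤n⇒m<n∨m≡n j≤
  ... | inj₁ j< = there (odds-complete k j 1≤j (s≤s⁻¹ j<))
  ... | inj₂ refl = here refl

  oddPrime? : ∀ q → Dec (OddPrime q)
  oddPrime? q = prime? q ×-dec (q % 2 ≟ 1)

  primesUpTo : ℕ → List ℕ
  primesUpTo k = filter oddPrime? (odds k)

  primesUpTo-ok : ∀ k → OddPrimes (primesUpTo k)
  primesUpTo-ok k = All.all-filter oddPrime? (odds k) , filter⁺ oddPrime? (odds-unique k)

  primesUpTo-complete : ∀ k q → OddPrime q → q ≤ k → q ∈ primesUpTo k
  primesUpTo-complete k q op@(p , odd) q≤k = ∈-filter⁺ oddPrime? (subst (_∈ odds k) (sym q≡) (odds-complete k (q / 2) 1≤h (≤-trans (m/n≤m q 2) q≤k))) op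
    where
    q≡ : q ≡ suc (2 * (q / 2))
    q≡ = trans (m≡m%n+[m/n]*n q 2) (cong₂ _+_ odd (*-comm (q / 2) 2))
    1≤h : 1 ≤ q / 2
    1≤h with q / 2 in eq
    ... | zero = ⊥-elim (¬prime[1] (subst Prime (trans q≡ (cong (λ w → suc (2 * w)) eq)) p))
    ... | suc _ = s≤s z≤n

  -- The power of 2 is governed by the residue modulo 16, so each of the three classes requires only
  -- that no odd prime square divides `D`.
  OddSquareFree : ℕ → Set
  OddSquareFree n = ∀ q → OddPrime q → ¬ (q * q ∣ n)

  prime-parity : ∀ {q} → Prime q → q ≡ 2 ⊎ q % 2 ≡ 1
  prime-parity {q} p with q % 2 in eq | m%n<n q 2
  ... | 0 | _ with prime⇒irreducible p (m%n≡0⇒n∣m q 2 eq)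
  ...   | inj₁ ()
  ...   | inj₂ e = inj₁ (sym e)
  prime-parity {q} p | 1 | _ = inj₂ refl
  prime-parity {q} p | suc (suc _) | s≤s (s≤s ())

  ∨-cases : ∀ {r} a b → ((r ≡ᵇ a) ∨ (r ≡ᵇ b)) ≡ true → r ≡ a ⊎ r ≡ b
  ∨-cases {r} a b h with r ≡ᵇ a in e | r ≡ᵇ b in f
  ... | true | _ = inj₁ (≡ᵇ⇒≡ r a (subst T (sym e) tt))
  ... | false | true = inj₂ (≡ᵇ⇒≡ r b (subst T (sym f) tt))

  mod-4-of-16 : ∀ D → D % 16 % 4 ≡ D % 4
  mod-4-of-16 D = m∣n⇒o%n%m≡o%m 4 16 D (divides 4 refl)

  module _ {D : ℕ} where
    odd-class⇒disc : 1 < D → D % 4 ≡ 1 → OddSquareFree D → RealQuadDisc D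
    odd-class⇒disc 1<D r sf = 1<D , inj₁ (r , λ q pq d → free q pq d (prime-parity pq))
      where
      free : ∀ q → Prime q → q * q ∣ D → q ≡ 2 ⊎ q % 2 ≡ 1 → ⊥
      free q pq d (inj₁ refl) with trans (sym r) (n∣m⇒m%n≡0 D 4 d)
      ... | ()
      free q pq d (inj₂ odd) = sf q (pq , odd) d

    even-class⇒disc : 1 < D → D % 16 ≡ 8 ⊎ D % 16 ≡ 12 → OddSquareFree D → RealQuadDisc D
    even-class⇒disc 1<D r sf = 1<D , inj₂ (m , D≡ , m%4 r , λ q pq d → free q pq d (prime-parity pq))
      where
      value : D % 16 ≡ 8 ⊎ D % 16 ≡ 12 → ∃[ i ] (D % 16 ≡ 4 * i × (i % 4 ≡ 2 ⊎ i % 4 ≡ 3))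
      value (inj₁ e) = 2 , e , inj₁ refl
      value (inj₂ e) = 3 , e , inj₂ refl
      i = proj₁ (value r)
      m = i + D / 16 * 4
      D≡ : D ≡ 4 * m
      D≡ = trans (m≡m%n+[m/n]*n D 16) (trans (cong (_+ D / 16 * 16) (proj₁ (proj₂ (value r)))) (distrib i (D / 16)))
        where
        distrib : ∀ i k → 4 * i + k * 16 ≡ 4 * (i + k * 4)
        distrib = solve-∀
      m%4 : D % 16 ≡ 8 ⊎ D % 16 ≡ 12 → m % 4 ≡ 2 ⊎ m % 4 ≡ 3
      m%4 _ = subst (λ w → w ≡ 2 ⊎ w ≡ 3) (sym ([m+kn]%n≡m%n i (D / 16) 4)) (proj₂ (proj₂ (value r)))
      free : ∀ q → Prime q → q * q ∣ m → q ≡ 2 ⊎ q % 2 ≡ 1 → ⊥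
      free q pq d (inj₁ refl) with m%4 r | n∣m⇒m%n≡0 m 4 d
      ... | inj₁ e | z with trans (sym e) z
      ...   | ()
      free q pq d (inj₁ refl) | inj₂ e | z with trans (sym e) z
      ...   | ()
      free q pq d (inj₂ odd) = sf q (pq , odd) (∣-trans d (divides 4 D≡))

    disc⇒oddSquareFree : RealQuadDisc D → OddSquareFree D
    disc⇒oddSquareFree (_ , inj₁ (_ , sf)) q (pq , _) d = sf q pq d
    disc⇒oddSquareFree (_ , inj₂ (m , D≡ , _ , sf)) q (pq , odd) d = sf q pq (prime-square-cancel m pq q∤2 (prime-square-cancel (m * 2) pq q∤2 (∣-trans d (∣-reflexive (trans D≡ (rearrange m))))))
      where
      rearrange : ∀ m → 4 * m ≡ m * 2 * 2
      rearrange = solve-∀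
      q∤2 : ¬ (q ∣ 2)
      q∤2 h with prime⇒irreducible (from-yes (prime? 2)) h
      ... | inj₁ e = ¬prime[1] (subst Prime e pq)
      ... | inj₂ e with trans (sym (cong (_% 2) e)) odd
      ...   | ()

    disc-class : RealQuadDisc D → class χ₁ D ≡ true ⊎ class χ₅ D ≡ true ⊎ class χ₈ D ≡ true
    disc-class (_ , inj₁ (r , _)) = by (m%n<n D 16) (trans (mod-4-of-16 D) r)
      where
      by : ∀ {r} → r < 16 → r % 4 ≡ 1 → χ₁ r ≡ true ⊎ χ₅ r ≡ true ⊎ χ₈ r ≡ true
      by = from-yes (allUpTo? (λ r → (r % 4 ≟ 1) →-dec ((χ₁ r Bool.≟ true) ⊎-dec ((χ₅ r Bool.≟ true) ⊎-dec (χ₈ r Bool.≟ true)))) 16)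
    disc-class (_ , inj₂ (m , D≡ , r , _)) = inj₂ (inj₂ (trans (cong χ₈ residue) (by r)))
      where
      distrib : ∀ a k → 4 * (a + k * 4) ≡ 4 * a + k * 16
      distrib = solve-∀
      residue : D % 16 ≡ 4 * (m % 4) % 16
      residue = trans (cong (_% 16) (trans D≡ (trans (cong (4 *_) (m≡m%n+[m/n]*n m 4)) (distrib (m % 4) (m / 4))))) ([m+kn]%n≡m%n (4 * (m % 4)) (m / 4) 16)
      by : m % 4 ≡ 2 ⊎ m % 4 ≡ 3 → χ₈ (4 * (m % 4) % 16) ≡ true
      by (inj₁ e) = cong (λ w → χ₈ (4 * w % 16)) e
      by (inj₂ e) = cong (λ w → χ₈ (4 * w % 16)) e

    χ₁⇒mod4 : class χ₁ D ≡ true → D % 4 ≡ 1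
    χ₁⇒mod4 h with ∨-cases {D % 16} 1 9 h
    ... | inj₁ e = trans (sym (mod-4-of-16 D)) (cong (_% 4) e)
    ... | inj₂ e = trans (sym (mod-4-of-16 D)) (cong (_% 4) e)

    χ₅⇒mod8 : class χ₅ D ≡ true → D % 8 ≡ 5
    χ₅⇒mod8 h with ∨-cases {D % 16} 5 13 h
    ... | inj₁ e = trans (sym (m∣n⇒o%n%m≡o%m 8 16 D (divides 2 refl))) (cong (_% 8) e)
    ... | inj₂ e = trans (sym (m∣n⇒o%n%m≡o%m 8 16 D (divides 2 refl))) (cong (_% 8) e)

    mod8⇒χ₅ : D % 8 ≡ 5 → class χ₅ D ≡ true
    mod8⇒χ₅ h = by (m%n<n D 16) (trans (m∣n⇒o%n%m≡o%m 8 16 D (divides 2 refl)) h)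
      where
      by : ∀ {r} → r < 16 → r % 8 ≡ 5 → χ₅ r ≡ true
      by = from-yes (allUpTo? (λ r → (r % 8 ≟ 5) →-dec (χ₅ r Bool.≟ true)) 16)

    mod8⇒mod4 : D % 8 ≡ 5 → D % 4 ≡ 1
    mod8⇒mod4 h = trans (sym (m∣n⇒o%n%m≡o%m 4 8 D (divides 2 refl))) (cong (_% 4) h)

  module _ (X : ℕ) where
    f₁ f₅ f₈ : ℕ → Bool
    f₁ = sieve (class χ₁) (primesUpTo X)
    f₅ = sieve (class χ₅) (primesUpTo X)
    f₈ = sieve (class χ₈) (primesUpTo X)

    M₁ M₅ M₈ : ℕ
    M₁ = cnt f₁ X
    M₅ = cnt f₅ X
    M₈ = cnt f₈ X

    sieve⇒oddSquareFree : ∀ {c n} → 1 ≤ n → n < X → sieve c (primesUpTo X) n ≡ true → OddSquareFree n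
    sieve⇒oddSquareFree {c} {n} 1≤n n<X h q op d = All.lookup (proj₂ (sieve-sound c (primesUpTo X) n h)) (primesUpTo-complete X q op (≤-trans (≤-trans (m≤m*n q q {{prime⇒nonZero (proj₁ op)}}) (∣⇒≤ {{>-nonZero 1≤n}} d)) (<⇒≤ n<X))) d

    oddSquareFree⇒sieve : ∀ {c n} → c n ≡ true → OddSquareFree n → sieve c (primesUpTo X) n ≡ true
    oddSquareFree⇒sieve {c} {n} h sf = sieve-complete c (primesUpTo X) n h (All.map (λ {q} op → sf q op) (proj₁ (primesUpTo-ok X)))

    close : ∀ {χ χ′ s} → Admissible χ → Admissible χ′ → X ≤ s * s → cnt (sieve (class χ) (primesUpTo X)) X ≤ cnt (sieve (class χ′) (primesUpTo X)) X + 4 * s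
    close {χ} {χ′} {s} ad ad′ X≤ = ≤-trans (sieve-close (class-invariant ad) (class-invariant ad′) (class-close ad ad′) (class-close ad′ ad) (primesUpTo X) (primesUpTo-ok X) X)
      (+-monoʳ-≤ (cnt (sieve (class χ′) (primesUpTo X)) X) (*-monoʳ-≤ 4 (terms-bound {primesUpTo X} {X} {s} (primesUpTo-ok X) X≤)))

    f₅⇒mod8 : ∀ {D} → f₅ D ≡ true → D % 8 ≡ 5
    f₅⇒mod8 {D} h = χ₅⇒mod8 {D} (proj₁ (sieve-sound (class χ₅) (primesUpTo X) D h))

    f₅⇒disc : ∀ {D} → 1 < D → D < X → f₅ D ≡ true → RealQuadDisc D
    f₅⇒disc {D} 1<D D<X h = odd-class⇒disc 1<D (mod8⇒mod4 {D} (f₅⇒mod8 h)) (sieve⇒oddSquareFree (<⇒≤ 1<D) D<X h)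

    mod8⇒f₅ : ∀ {D} → D % 8 ≡ 5 → RealQuadDisc D → f₅ D ≡ true
    mod8⇒f₅ {D} r disc = oddSquareFree⇒sieve (mod8⇒χ₅ {D} r) (disc⇒oddSquareFree disc)

    private
      allEls : List ℕ
      allEls = els f₁ X ++ (els f₅ X ++ els f₈ X)

      length-allEls : length allEls ≡ M₁ + (M₅ + M₈)
      length-allEls = trans (length-++ (els f₁ X)) (cong₂ _+_ (length-els f₁ X) (trans (length-++ (els f₅ X)) (cong₂ _+_ (length-els f₅ X) (length-els f₈ X))))

      class-of : ∀ {χ D} → D ∈ els (sieve (class χ) (primesUpTo X)) X → χ (D % 16) ≡ true × D < X × sieve (class χ) (primesUpTo X) D ≡ true
      class-of {χ} {D} d∈ with All.lookup (els-sound (sieve (class χ) (primesUpTo X)) X) d∈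
      ... | D<X , h = proj₁ (sieve-sound (class χ) (primesUpTo X) D h) , D<X , h

      disjoint : ∀ {χ χ′ : ℕ → Bool} → (∀ {r} → r < 16 → χ r ≡ true → ¬ (χ′ r ≡ true)) → ∀ D → χ (D % 16) ≡ true → ¬ (χ′ (D % 16) ≡ true)
      disjoint h D = h (m%n<n D 16)

      apart : ∀ (χ χ′ : ℕ → Bool) → Dec (∀ {r} → r < 16 → χ r ≡ true → ¬ (χ′ r ≡ true))
      apart χ χ′ = allUpTo? (λ r → (χ r Bool.≟ true) →-dec ¬? (χ′ r Bool.≟ true)) 16

      allEls-unique : Unique allEls
      allEls-unique = ++⁺ (els-unique f₁ X) (++⁺ (els-unique f₅ X) (els-unique f₈ X) λ {D} (a , b) → disjoint (λ {r} → from-yes (apart χ₅ χ₈) {r}) D (proj₁ (class-of {χ₅} a)) (proj₁ (class-of {χ₈} b)))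
        λ {D} (a , b) → both D a (∈-++⁻ (els f₅ X) b)
        where
        both : ∀ D → D ∈ els f₁ X → D ∈ els f₅ X ⊎ D ∈ els f₈ X → ⊥
        both D a (inj₁ b) = disjoint (λ {r} → from-yes (apart χ₁ χ₅) {r}) D (proj₁ (class-of {χ₁} a)) (proj₁ (class-of {χ₅} b))
        both D a (inj₂ b) = disjoint (λ {r} → from-yes (apart χ₁ χ₈) {r}) D (proj₁ (class-of {χ₁} a)) (proj₁ (class-of {χ₈} b))

      disc∈allEls : ∀ {D} → D < X → RealQuadDisc D → D ∈ allEls
      disc∈allEls {D} D<X disc with disc-class disc
      ... | inj₁ c = ∈-++⁺ˡ (els-complete f₁ X D<X (oddSquareFree⇒sieve {class χ₁} c (disc⇒oddSquareFree disc)))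
      ... | inj₂ (inj₁ c) = ∈-++⁺ʳ (els f₁ X) (∈-++⁺ˡ (els-complete f₅ X D<X (oddSquareFree⇒sieve {class χ₅} c (disc⇒oddSquareFree disc))))
      ... | inj₂ (inj₂ c) = ∈-++⁺ʳ (els f₁ X) (∈-++⁺ʳ (els f₅ X) (els-complete f₈ X D<X (oddSquareFree⇒sieve {class χ₈} c (disc⇒oddSquareFree disc))))

      allEls⇒disc : ∀ {D} → 1 < D → D ∈ allEls → RealQuadDisc D × D < X
      allEls⇒disc {D} 1<D d∈ with ∈-++⁻ (els f₁ X) d∈
      ... | inj₁ a with class-of {χ₁} a
      ...   | c , D<X , h = odd-class⇒disc 1<D (χ₁⇒mod4 {D} c) (sieve⇒oddSquareFree (<⇒≤ 1<D) D<X h) , D<X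
      allEls⇒disc {D} 1<D d∈ | inj₂ b with ∈-++⁻ (els f₅ X) b
      ... | inj₁ a with class-of {χ₅} a
      ...   | _ , D<X , h = f₅⇒disc 1<D D<X h , D<X
      allEls⇒disc {D} 1<D d∈ | inj₂ b | inj₂ a with class-of {χ₈} a
      ...   | c , D<X , h = even-class⇒disc 1<D (∨-cases {D % 16} 8 12 c) (sieve⇒oddSquareFree (<⇒≤ 1<D) D<X h) , D<X

      allEls-positive : ∀ {D} → D ∈ allEls → D ≢ 0
      allEls-positive d∈ refl with ∈-++⁻ (els f₁ X) d∈
      ... | inj₁ a with class-of {χ₁} a
      ...   | () , _
      allEls-positive d∈ refl | inj₂ b with ∈-++⁻ (els f₅ X) b
      ... | inj₁ a with class-of {χ₅} a
      ...   | () , _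
      allEls-positive d∈ refl | inj₂ b | inj₂ a with class-of {χ₈} a
      ...   | () , _

    total-≤ : ∀ {m} → CountsTo Always X m → m ≤ M₁ + (M₅ + M₈)
    total-≤ (L , u , mem , refl) = ≤-trans (subset-length u (λ {D} d∈ → let (_ , D<X , disc , _) = Equivalence.to (mem D) d∈ in disc∈allEls D<X disc)) (≤-reflexive length-allEls)

    -- The extra 1 accounts for the number 1, which survives the sieve in the class of `χ₁` but is
    -- not the discriminant of a quadratic field.
    total-≥ : ∀ {m} → CountsTo Always X m → M₁ + (M₅ + M₈) ≤ suc m
    total-≥ (L , u , mem , refl) = ≤-trans (≤-reflexive (sym length-allEls)) (subset-length {ys = 1 ∷ L} allEls-unique member)
      where
      member : ∀ {D} → D ∈ allEls → D ∈ 1 ∷ L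
      member {zero} d∈ = ⊥-elim (allEls-positive d∈ refl)
      member {suc zero} d∈ = here refl
      member {suc (suc D)} d∈ with allEls⇒disc (s≤s (s≤s z≤n)) d∈
      ... | disc , D<X = there (Equivalence.from (mem (suc (suc D))) (s≤s z≤n , D<X , disc , tt))

-- A lower bound for the discriminants that are 5 modulo 8

module Density where

  open import Data.Nat
  open import Data.Nat.Properties
  open import Data.Nat.DivMod
  open import Data.List using ([]; _∷_; filter)
  open import Data.Bool using (Bool; true; false)
  open import Data.Product using (_×_; _,_; proj₁; proj₂)
  open import Relation.Nullary using (yes; no; Dec)
  open import Relation.Binary.PropositionalEquality
  open import Data.Nat.Tactic.RingSolver using (solve-∀)
  open Counting
  open Sieve
  open Discriminants

  sumTo : (ℕ → ℕ) → ℕ → ℕ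
  sumTo h zero = 0
  sumTo h (suc k) = h (suc k) + sumTo h k

  sumOver-filter : ∀ {P : ℕ → Set} (P? : ∀ q → Dec (P q)) g xs → sumOver g (filter P? xs) ≤ sumOver g xs
  sumOver-filter P? g [] = z≤n
  sumOver-filter P? g (q ∷ xs) with P? q
  ... | yes _ = +-monoʳ-≤ (g q) (sumOver-filter P? g xs)
  ... | no _ = ≤-trans (sumOver-filter P? g xs) (m≤n+m _ (g q))

  sumOver-odds : ∀ g k → sumOver g (odds k) ≡ sumTo (λ j → g (suc (2 * j))) k
  sumOver-odds g zero = refl
  sumOver-odds g (suc k) = cong (g (suc (2 * suc k)) +_) (sumOver-odds g k)

  sumTo-≤ : ∀ {f g : ℕ → ℕ} → (∀ j → f j ≤ g j) → ∀ k → sumTo f k ≤ sumTo g k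
  sumTo-≤ h zero = z≤n
  sumTo-≤ h (suc k) = +-mono-≤ (h (suc k)) (sumTo-≤ h k)

  sumTo-+ : ∀ (f g : ℕ → ℕ) k → sumTo (λ j → f j + g j) k ≡ sumTo f k + sumTo g k
  sumTo-+ f g zero = refl
  sumTo-+ f g (suc k) = trans (cong (f (suc k) + g (suc k) +_) (sumTo-+ f g k)) (interchange (f (suc k)) (g (suc k)) (sumTo f k) (sumTo g k))
    where
    interchange : ∀ a b c d → a + b + (c + d) ≡ a + c + (b + d)
    interchange = solve-∀

  sumTo-* : ∀ c (f : ℕ → ℕ) k → sumTo (λ j → c * f j) k ≡ c * sumTo f k
  sumTo-* c f zero = sym (*-zeroʳ c)
  sumTo-* c f (suc k) = trans (cong (c * f (suc k) +_) (sumTo-* c f k)) (sym (*-distribˡ-+ c (f (suc k)) (sumTo f k)))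

  below : ℕ → ℕ → ℕ
  below s j = ι (j <ᵇ s)

  sumTo-below : ∀ s k → sumTo (below s) k ≤ s × sumTo (below s) k ≤ k
  sumTo-below s zero = z≤n , z≤n
  sumTo-below s (suc k) with suc k <ᵇ s in eq | sumTo-below s k
  ... | true | _ , b = ≤-trans (s≤s b) (<⇒≤ (<ᵇ⇒< (suc k) s (subst Data.Bool.T (sym eq) _))) , s≤s b
  ... | false | a , b = a , m≤n⇒m≤1+n b

  module _ (X : ℕ) where
    inverseSquare : ℕ → ℕ
    inverseSquare j = X / (suc (2 * j) * suc (2 * j))

    -- Telescoping: 1/(2j+1)² < 1/(4j) - 1/(4(j+1)).
    telescope : ∀ j → inverseSquare (suc j) + X / (4 * suc (suc j)) ≤ X / (4 * suc j)
    telescope j = ≤-trans (≤-reflexive (sym (m*n/n≡m t (4 * suc j)))) (/-monoˡ-≤ {t * (4 * suc j)} {X} (4 * suc j) product)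
      where
      a = inverseSquare (suc j)
      c = X / (4 * suc (suc j))
      t = a + c
      expand : ∀ a c j → suc (suc j) * ((a + c) * (4 * suc j)) ≡ a * (4 * suc j * suc (suc j)) + suc j * (c * (4 * suc (suc j)))
      expand = solve-∀
      sq : ∀ j → 1 + 4 * suc j * suc (suc j) ≡ suc (2 * suc j) * suc (2 * suc j)
      sq = solve-∀
      product : t * (4 * suc j) ≤ X
      product = *-cancelˡ-≤ {t * (4 * suc j)} {X} (suc (suc j)) (≤-trans (≤-reflexive (expand a c j)) (+-mono-≤ (≤-trans (*-monoʳ-≤ a (≤-trans (m≤n+m (4 * suc j * suc (suc j)) 1) (≤-reflexive (sq j)))) (m/n*n≤m X (suc (2 * suc j) * suc (2 * suc j)))) (*-monoʳ-≤ (suc j) (m/n*n≤m X (4 * suc (suc j))))))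

    -- The terms for 3 and 5 are kept exactly, and telescoping bounds the tail from 7 onwards by
    -- `X/12`.
    inverseSquares-sum : ∀ k → sumTo inverseSquare k ≤ X / 9 + (X / 25 + X / 12)
    inverseSquares-sum zero = z≤n
    inverseSquares-sum (suc zero) = ≤-trans (≤-reflexive (+-identityʳ (X / 9))) (m≤m+n (X / 9) _)
    inverseSquares-sum (suc (suc i)) = ≤-trans (m≤m+n _ (X / (4 * suc (suc (suc i))))) (tail i)
      where
      tail : ∀ i → sumTo inverseSquare (suc (suc i)) + X / (4 * suc (suc (suc i))) ≤ X / 9 + (X / 25 + X / 12)
      tail zero = ≤-reflexive (shuffle (X / 9) (X / 25) (X / 12))
        where
        shuffle : ∀ a b c → b + (a + 0) + c ≡ a + (b + c)
        shuffle = solve-∀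
      tail (suc i) = ≤-trans (≤-reflexive (shuffle (inverseSquare (suc (suc (suc i)))) (sumTo inverseSquare (suc (suc i))) (X / (4 * suc (suc (suc (suc i)))))))
        (≤-trans (+-monoʳ-≤ (sumTo inverseSquare (suc (suc i))) (telescope (suc (suc i)))) (tail i))
        where
        shuffle : ∀ a b c → a + b + c ≡ b + (a + c)
        shuffle = solve-∀

    T₅ : ℕ → ℕ
    T₅ Y = cnt (class χ₅) Y

    multiplesBelow-≤ : ∀ d .{{_ : NonZero d}} → multiplesBelow d X ≤ suc (X / d)
    multiplesBelow-≤ d with multiplesBelow d X in eq
    ... | zero = z≤n
    ... | suc Y = s≤s (≤-trans (≤-reflexive (sym (m*n/n≡m Y d))) (/-monoˡ-≤ d (<⇒≤ (<multiplesBelow⇒ d X (≤-reflexive (sym eq))))))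

    -- Of the error 17, rounding `X/q²` up accounts for 1 and the incomplete period modulo 16 for
    -- 16. It arises only for `q² < X`, hence `j < s`; otherwise at most the number 0 is counted.
    term-bound : ∀ {s} → X ≤ s * s → ∀ j → 8 * T₅ (reduced (suc (2 * j)) X) ≤ inverseSquare j + 17 * below s j
    term-bound {s} X≤ j with reduced (suc (2 * j)) X in eq
    ... | zero = z≤n
    ... | suc zero = z≤n
    ... | suc (suc Y) = ≤-trans (proj₁ (cnt-class-bounds admissible₅ (suc (suc Y)))) (≤-trans (+-monoˡ-≤ 16 (≤-trans (≤-reflexive (sym eq)) (multiplesBelow-≤ (suc (2 * j) * suc (2 * j))))) (≤-reflexive (trans (shift (inverseSquare j)) (cong (λ b → inverseSquare j + 17 * ι b) (sym j<s)))))
      where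
      shift : ∀ a → suc a + 16 ≡ a + 17 * 1
      shift = solve-∀
      small : suc (2 * j) * suc (2 * j) < X
      small = subst (_< X) (+-identityʳ _) (<multiplesBelow⇒ (suc (2 * j) * suc (2 * j)) X {1} (subst (1 <_) (sym eq) (s≤s (s≤s z≤n))))
      j<s : (j <ᵇ s) ≡ true
      j<s = T⇒≡true (<⇒<ᵇ {j} {s} (≰⇒> λ s≤j → <⇒≱ (<-≤-trans small X≤) (*-mono-≤ (≤-trans s≤j (≤-trans (m≤n*m j 2) (n≤1+n _))) (≤-trans s≤j (≤-trans (m≤n*m j 2) (n≤1+n _))))))
        where
        T⇒≡true : ∀ {b} → Data.Bool.T b → b ≡ true
        T⇒≡true {true} _ = refl

    -- The constant is `(1 - 1/9 - 1/25 - 1/12)/8 = 689/7200`. Summing over all odd `q ≥ 3` instead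
    -- of primes costs little and makes the sum telescope.
    M₅-lower : ∀ {s} → X ≤ s * s → 689 * X ≤ 7200 * M₅ X + (15300 * s + 14400)
    M₅-lower {s} X≤ = +-cancelʳ-≤ (211 * X) (689 * X) _ (≤-trans (≤-reflexive (nine X)) (≤-trans (*-monoʳ-≤ 900 main) (≤-trans (≤-reflexive (expand (M₅ X) (X / 9) (X / 25) (X / 12) s))
       (≤-trans (+-monoʳ-≤ (7200 * M₅ X + (15300 * s + 14400)) (+-mono-≤ (*-monoʳ-≤ 100 (m/n*n≤m X 9)) (+-mono-≤ (*-monoʳ-≤ 36 (m/n*n≤m X 25)) (*-monoʳ-≤ 75 (m/n*n≤m X 12))))) (≤-reflexive (collect (7200 * M₅ X + (15300 * s + 14400)) X))))))
      where
      nine : ∀ X → 689 * X + 211 * X ≡ 900 * X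
      nine = solve-∀
      expand : ∀ M a b c s → 900 * (8 * M + (a + (b + c) + 17 * s) + 16) ≡ 7200 * M + (15300 * s + 14400) + (100 * (a * 9) + (36 * (b * 25) + 75 * (c * 12)))
      expand = solve-∀
      collect : ∀ a X → a + (100 * X + (36 * X + 75 * X)) ≡ a + 211 * X
      collect = solve-∀
      g : ℕ → ℕ
      g q = T₅ (reduced q X)
      sums : 8 * sumOver g (primesUpTo X) ≤ X / 9 + (X / 25 + X / 12) + 17 * s
      sums = ≤-trans (*-monoʳ-≤ 8 (≤-trans (sumOver-filter oddPrime? g (odds X)) (≤-reflexive (sumOver-odds g X))))
        (≤-trans (≤-reflexive (sym (sumTo-* 8 (λ j → g (suc (2 * j))) X))) (≤-trans (sumTo-≤ (term-bound {s} X≤) X)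
          (≤-trans (≤-reflexive (trans (sumTo-+ inverseSquare (λ j → 17 * below s j) X) (cong (sumTo inverseSquare X +_) (sumTo-* 17 (below s) X))))
            (+-mono-≤ (inverseSquares-sum X) (*-monoʳ-≤ 17 (proj₁ (sumTo-below s X)))))))
      main : X ≤ 8 * M₅ X + (X / 9 + (X / 25 + X / 12) + 17 * s) + 16
      main = ≤-trans (proj₂ (cnt-class-bounds admissible₅ X)) (+-monoˡ-≤ 16 (≤-trans (*-monoʳ-≤ 8 (sieve-lower (class-invariant admissible₅) (primesUpTo X) (primesUpTo-ok X) X))
        (≤-trans (≤-reflexive (*-distribˡ-+ 8 (M₅ X) (sumOver g (primesUpTo X)))) (+-monoʳ-≤ (8 * M₅ X) sums))))

-- Counting cubic forms in a cell

module Cells where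

  open import Data.Nat as ℕ using (ℕ; suc; z≤n)
  import Data.Nat.Properties as ℕ
  open import Data.Integer hiding (suc)
  open import Data.Integer.Properties
  open import Data.Integer.DivMod using (n%ℕd<d; a≡a%ℕn+[a/ℕn]*n)
  open import Data.Integer.Solver
  open import Data.Fin using (Fin; fromℕ<; combine; toℕ)
  open import Data.Fin.Properties using (combine-injective; toℕ-fromℕ<)
  open import Data.List using (List; []; _∷_; length)
  open import Data.List.Relation.Unary.All as All using (All; []; _∷_)
  open import Data.List.Relation.Unary.Any using (here; there)
  open import Data.List.Relation.Unary.AllPairs using ([]; _∷_)
  open import Data.List.Relation.Unary.Unique.Propositional using (Unique)
  open import Data.List.Membership.Propositional using (_∈_)
  open import Data.Product using (∃-syntax; _×_; _,_)
  open import Data.Sum using (_⊎_; inj₁; inj₂)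
  open import Data.Empty using (⊥-elim)
  open import Relation.Nullary using (¬_; yes; no)
  open import Relation.Nullary.Decidable using (decidable-stable)
  open import Relation.Binary.PropositionalEquality
  open IntegerOrder
  open CubicForm
  open Units using (cancel-<-pos)
  open Counting
  open +-*-Solver hiding (Normal)

  -- Existence is only needed up to double negation, because length L ≤ B is decidable.
  AtMost : (ℕ → Set) → ℕ → Set
  AtMost P B = ∀ L → Unique L → All (λ D → ¬ ¬ P D) L → length L ℕ.≤ B

  ¬¬-All : ∀ {P : ℕ → Set} {L} → All (λ D → ¬ ¬ P D) L → ¬ ¬ All P L
  ¬¬-All [] k = k []
  ¬¬-All (p ∷ ps) k = p λ x → ¬¬-All ps λ xs → k (x ∷ xs)

  atMost-intro : ∀ {P : ℕ → Set} {B} → (∀ L → Unique L → All P L → length L ℕ.≤ B) → AtMost P B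
  atMost-intro {B = B} h L u ps = decidable-stable (length L ℕ.≤? B) λ k → ¬¬-All ps λ xs → k (h L u xs)

  atMost-⊎ : ∀ {P Q : ℕ → Set} {a b} → AtMost P a → AtMost Q b → AtMost (λ D → P D ⊎ Q D) (a ℕ.+ b)
  atMost-⊎ {P} {Q} {a} {b} hP hQ = atMost-intro λ L u ps → let (L₁ , L₂ , p , q , u₁ , u₂ , _ , _ , len) = split L u ps in
      ℕ.≤-trans (ℕ.≤-reflexive len) (ℕ.+-mono-≤ (hP L₁ u₁ (All.map (λ x k → k x) p)) (hQ L₂ u₂ (All.map (λ x k → k x) q)))
    where
    split : ∀ L → Unique L → All (λ D → P D ⊎ Q D) L → ∃[ L₁ ] ∃[ L₂ ] (All P L₁ × All Q L₂ × Unique L₁ × Unique L₂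
      × (∀ {x} → x ∈ L₁ → x ∈ L) × (∀ {x} → x ∈ L₂ → x ∈ L) × length L ≡ length L₁ ℕ.+ length L₂)
    split [] _ [] = [] , [] , [] , [] , [] , [] , (λ ()) , (λ ()) , refl
    split (x ∷ L) (x∉ ∷ u) (inj₁ px ∷ ps) with split L u ps
    ... | L₁ , L₂ , p , q , u₁ , u₂ , s₁ , s₂ , len = x ∷ L₁ , L₂ , px ∷ p , q , All.tabulate (λ y∈ → All.lookup x∉ (s₁ y∈)) ∷ u₁ , u₂ ,
      (λ { (here e) → here e ; (there y∈) → there (s₁ y∈) }) , (λ y∈ → there (s₂ y∈)) , cong suc len
    split (x ∷ L) (x∉ ∷ u) (inj₂ qx ∷ ps) with split L u ps
    ... | L₁ , L₂ , p , q , u₁ , u₂ , s₁ , s₂ , len = L₁ , x ∷ L₂ , p , qx ∷ q , u₁ , All.tabulate (λ y∈ → All.lookup x∉ (s₂ y∈)) ∷ u₂ ,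
      (λ y∈ → there (s₁ y∈)) , (λ { (here e) → here e ; (there y∈) → there (s₂ y∈) }) , trans (cong suc len) (sym (ℕ.+-suc (length L₁) (length L₂)))

  atMost-map : ∀ {P Q : ℕ → Set} {a b} → (∀ {D} → P D → Q D) → a ℕ.≤ b → AtMost Q a → AtMost P b
  atMost-map f a≤b h L u ps = ℕ.≤-trans (h L u (All.map (λ ¬¬p k → ¬¬p λ p → k (f p)) ps)) a≤b

  atMost-∅ : ∀ {P : ℕ → Set} → (∀ {D} → ¬ P D) → AtMost P 0
  atMost-∅ f [] _ _ = z≤n
  atMost-∅ f (x ∷ L) _ (p ∷ _) = ⊥-elim (p f)

  atMost-family : ∀ {I : Set} {P : I → ℕ → Set} {b} (is : List I) → (∀ i → AtMost (P i) b) → AtMost (λ D → ∃[ i ] (i ∈ is × P i D)) (length is ℕ.* b)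
  atMost-family [] h = atMost-∅ λ { (_ , () , _) }
  atMost-family {I} {P} (i ∷ is) h = atMost-map {Q = λ D → P i D ⊎ ∃[ j ] (j ∈ is × P j D)} (λ { (_ , here refl , p) → inj₁ p ; (j , there j∈ , p) → inj₂ (j , j∈ , p) }) ℕ.≤-refl (atMost-⊎ (h i) (atMost-family is h))

  -- The leading coefficient of the cubic covariant. It is also half the derivative of `disc` with
  -- respect to `s`, so it measures how fast the discriminant moves with `s`.
  gForm : ℤ → ℤ → ℤ → ℤ → ℤ
  gForm p q r s = p * p * s - + 3 * (p * q * r) + + 2 * (q * q * q)

  syzygy : ∀ p q r s → gForm p q r s * gForm p q r s ≡ + 4 * (hess p q r * hess p q r * hess p q r) + p * p * disc p q r s
  syzygy = solve 4 (λ p q r s → let G = p :* p :* s :- con (+ 3) :* (p :* q :* r) :+ con (+ 2) :* (q :* q :* q) ; A = q :* q :- p :* r ; C = r :* r :- q :* s ; B = p :* s :- q :* r in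
    G :* G := con (+ 4) :* (A :* A :* A) :+ p :* p :* (B :* B :- con (+ 4) :* (A :* C))) refl

  -- The coefficients of the form are 2p, 2q + 1, 2r + 1, 2s in terms of the parameters p, q, r, s.
  record Normal (D p q r s : ℤ) : Set where
    constructor normal
    field
      disc≡ : disc (+ 2 * p) (+ 2 * q + + 1) (+ 2 * r + + 1) (+ 2 * s) ≡ D
      1≤p : + 1 ≤ + 2 * p
      0≤q : + 0 ≤ + 2 * q + + 1
      q<p : + 2 * q + + 1 < + 2 * p
      0≤G : + 0 ≤ gForm (+ 2 * p) (+ 2 * q + + 1) (+ 2 * r + + 1) (+ 2 * s)
      bound : + 0 ≤ + 2 * p * (+ 2 * p) + + 3 * hess (+ 2 * p) (+ 2 * q + + 1) (+ 2 * r + + 1) →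
        (+ 2 * p * (+ 2 * p) + + 3 * hess (+ 2 * p) (+ 2 * q + + 1) (+ 2 * r + + 1)) * (+ 2 * p * (+ 2 * p) + + 3 * hess (+ 2 * p) (+ 2 * q + + 1) (+ 2 * r + + 1)) ≤ D
  open Normal public


  -- The quotient by `a`, reduced modulo `n`. Together with the residue modulo `a` it determines `x`
  -- among numbers differing by less than `a · n`.
  code : ∀ (x : ℤ) a n .{{_ : ℕ.NonZero a}} .{{_ : ℕ.NonZero n}} → Fin n
  code x a n = fromℕ< (n%ℕd<d (x /ℕ a) n)

  multiple-zero : ∀ {M k} → + 1 ≤ M → M * k < M → - (M * k) < M → k ≡ + 0
  multiple-zero {M} {k} 1≤M h h′ = ≤-antisym (i<j⇒i≤pred[j] (cancel-<-pos {k} {+ 1} {M} (1≤⇒0≤ 1≤M) (subst (M * k <_) (sym (*-identityʳ M)) h)))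
    (≤-by-diff (+ 0 - (- k)) (≤⇒nonneg (i<j⇒i≤pred[j] (cancel-<-pos { - k} {+ 1} {M} (1≤⇒0≤ 1≤M) (subst₂ _<_ (neg-distribʳ-* M k) (sym (*-identityʳ M)) h′)))) (solve 1 (λ k → k :- con (+ 0) := con (+ 0) :- (:- k)) refl k))

  code-injective : ∀ x y a n .{{_ : ℕ.NonZero a}} .{{_ : ℕ.NonZero n}} → x %ℕ a ≡ y %ℕ a → code x a n ≡ code y a n → y - x < + a * + n → - (y - x) < + a * + n → x ≡ y
  code-injective x y a n res eq h h′ = trans (sym (+-identityʳ x)) (trans (cong (λ w → x + w) (sym diff≡0)) (solve 2 (λ x y → x :+ (y :- x) := y) refl x y))
    where
    qx = x /ℕ a
    qy = y /ℕ a
    eq′ : qx %ℕ n ≡ qy %ℕ n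
    eq′ = trans (sym (toℕ-fromℕ< (n%ℕd<d qx n))) (trans (cong toℕ eq) (toℕ-fromℕ< (n%ℕd<d qy n)))
    k = qy /ℕ n - qx /ℕ n
    qdiff : qy - qx ≡ k * + n
    qdiff = trans (cong₂ _-_ (a≡a%ℕn+[a/ℕn]*n qy n) (a≡a%ℕn+[a/ℕn]*n qx n)) (trans (cong (λ w → + (qy %ℕ n) + qy /ℕ n * + n - (+ w + qx /ℕ n * + n)) eq′) (solve 4 (λ r u v n → r :+ u :* n :- (r :+ v :* n) := (u :- v) :* n) refl (+ (qy %ℕ n)) (qy /ℕ n) (qx /ℕ n) (+ n)))
    diff : y - x ≡ + a * + n * k
    diff = trans (cong₂ _-_ (a≡a%ℕn+[a/ℕn]*n y a) (a≡a%ℕn+[a/ℕn]*n x a)) (trans (cong (λ w → + (y %ℕ a) + qy * + a - (+ w + qx * + a)) res)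
      (trans (solve 4 (λ r u v a → r :+ u :* a :- (r :+ v :* a) := (u :- v) :* a) refl (+ (y %ℕ a)) qy qx (+ a)) (trans (cong (_* + a) qdiff) (solve 3 (λ k n a → k :* n :* a := a :* n :* k) refl k (+ n) (+ a)))))
    1≤an : + 1 ≤ + a * + n
    1≤an = pos-*′ (+≤+ (ℕ.>-nonZero⁻¹ a)) (+≤+ (ℕ.>-nonZero⁻¹ n))
    diff≡0 : y - x ≡ + 0
    diff≡0 = trans diff (trans (cong (λ w → + a * + n * w) (multiple-zero {+ a * + n} {k} 1≤an (subst (_< + a * + n) diff h) (subst (λ w → - w < + a * + n) diff h′))) (*-zeroʳ (+ a * + n)))

  Class : Set
  Class = ℕ × ℕ × ℕ × ℕ

  InClass : ∀ (a b : ℕ) .{{_ : ℕ.NonZero a}} .{{_ : ℕ.NonZero b}} → Class → (p q r s : ℤ) → Set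
  InClass a b (i , j , k , l) p q r s = p %ℕ a ≡ i × q %ℕ b ≡ j × r %ℕ b ≡ k × s %ℕ a ≡ l

  record Cell : Set where
    field
      P₀ P₁ A₀ A₁ Δ γ X : ℤ

  record InCell (c : Cell) (D p q r s : ℤ) : Set where
    open Cell c
    field
      D<X : D < X
      P₀≤p : P₀ ≤ + 2 * p
      p<P₁ : + 2 * p < P₁
      A₀≤A : A₀ ≤ hess (+ 2 * p) (+ 2 * q + + 1) (+ 2 * r + + 1)
      A<A₁ : hess (+ 2 * p) (+ 2 * q + + 1) (+ 2 * r + + 1) < A₁
      Δ≤D : Δ ≤ D
      γ≤G : γ ≤ gForm (+ 2 * p) (+ 2 * q + + 1) (+ 2 * r + + 1) (+ 2 * s)

  -- Two members with the same p, q, r have (s' - s)(2G + p²(s' - s)) = D' - D < X - Δ.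
  s-spread : ∀ {D D′ p q r s s′ X Δ γ P₀ W} → disc p q r s ≡ D → disc p q r s′ ≡ D′ → + 1 ≤ P₀ → P₀ ≤ p → + 0 ≤ γ → + 0 ≤ W →
    γ ≤ gForm p q r s → Δ ≤ D → D′ < X → X - Δ ≤ W * (+ 2 * γ + P₀ * P₀ * W) → s′ - s < W
  s-spread {D} {D′} {p} {q} {r} {s} {s′} {X} {Δ} {γ} {P₀} {W} refl refl 1≤P₀ P₀≤p 0≤γ 0≤W γ≤G Δ≤D D′<X hW with W ≤? s′ - s
  ... | no ¬h = ≰⇒> ¬h
  ... | yes W≤ = ⊥-elim (<⇒≱ (1≤⇒0< {X - Δ - (disc p q r s′ - disc p q r s)} (≤-trans (<⇒1≤diff D′<X) (≤-by-diff (disc p q r s - Δ) (≤⇒nonneg Δ≤D) (solve 4 (λ X Δ d e → X :- Δ :- (e :- d) :- (X :- e) := d :- Δ) refl X Δ (disc p q r s) (disc p q r s′)))))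
        (≤-trans (≤-by-diff (T * (+ 2 * G + p * p * T) - W * (+ 2 * γ + P₀ * P₀ * W) + (W * (+ 2 * γ + P₀ * P₀ * W) - (X - Δ)))
            (nonneg-+ (≤⇒nonneg mono) (≤⇒nonneg hW)) (trans (solve 3 (λ x d w → con (+ 0) :- (x :- d) := d :- w :+ (w :- x)) refl (X - Δ) (disc p q r s′ - disc p q r s) (W * (+ 2 * γ + P₀ * P₀ * W))) (cong (λ z → z - W * (+ 2 * γ + P₀ * P₀ * W) + (W * (+ 2 * γ + P₀ * P₀ * W) - (X - Δ))) difference))) ≤-refl))
    where
    T = s′ - s
    G = gForm p q r s
    0≤P₀ = 1≤⇒0≤ 1≤P₀
    0≤p = ≤-trans 0≤P₀ P₀≤p
    0≤T = ≤-trans 0≤W W≤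
    difference : disc p q r s′ - disc p q r s ≡ T * (+ 2 * G + p * p * T)
    difference = solve 5 (λ p q r s s′ → let d : Polynomial 5 → Polynomial 5
                                             d = λ s → (p :* s :- q :* r) :* (p :* s :- q :* r) :- con (+ 4) :* ((q :* q :- p :* r) :* (r :* r :- q :* s)) in
        d s′ :- d s := (s′ :- s) :* (con (+ 2) :* (p :* p :* s :- con (+ 3) :* (p :* q :* r) :+ con (+ 2) :* (q :* q :* q)) :+ p :* p :* (s′ :- s))) refl p q r s s′
    mono : W * (+ 2 * γ + P₀ * P₀ * W) ≤ T * (+ 2 * G + p * p * T)
    mono = *-mono-≤′ 0≤W (nonneg-+ (nonneg-scale 2 (≤-trans 0≤γ γ≤G)) (nonneg-* (nonneg-* 0≤p 0≤p) 0≤T)) W≤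
      (+-mono-≤ (*-mono-≤′ {+ 2} {+ 2} (+≤+ z≤n) (≤-trans 0≤γ γ≤G) ≤-refl γ≤G) (*-mono-≤′ (nonneg-* 0≤P₀ 0≤P₀) 0≤T (*-mono-≤′ 0≤P₀ 0≤p P₀≤p P₀≤p) W≤))

  double-< : ∀ {x y B M} → + 2 * y - + 2 * x < B → B ≤ + 2 * M → y - x < M
  double-< {x} {y} {B} {M} h h′ = cancel-<-pos {y - x} {M} {+ 2} (+≤+ z≤n) (<-≤-trans (subst (_< B) (solve 2 (λ x y → con (+ 2) :* y :- con (+ 2) :* x := con (+ 2) :* (y :- x)) refl x y) h) h′)

  difference-< : ∀ {x y lo hi} → lo ≤ x → y < hi → y - x < hi - lo
  difference-< {x} {y} {lo} {hi} h h′ = <-by-diff _ (≤-trans (<⇒1≤diff h′) (≤-by-diff (x - lo) (≤⇒nonneg h) (solve 2 (λ a b → a :+ b :- a := b) refl (hi - y) (x - lo)))) (solve 4 (λ x y lo hi → hi :- lo :- (y :- x) := hi :- y :+ (x :- lo)) refl x y lo hi)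

  r-spread : ∀ {p q r r′ P₀ A₀ A₁ M} → + 1 ≤ P₀ → P₀ ≤ p → A₀ ≤ hess p q r′ → hess p q r < A₁ → A₁ - A₀ ≤ P₀ * M → + 0 ≤ M → r′ - r < M
  r-spread {p} {q} {r} {r′} {P₀} {A₀} {A₁} {M} 1≤P₀ P₀≤p A₀≤ <A₁ h 0≤M = cancel-<-pos {r′ - r} {M} {p} 0≤p (<-≤-trans
      (subst (_< A₁ - A₀) (solve 4 (λ p q r r′ → q :* q :- p :* r :- (q :* q :- p :* r′) := p :* (r′ :- r)) refl p q r r′) (difference-< {hess p q r′} {hess p q r} A₀≤ <A₁))
      (≤-trans h (*-mono-≤′ (1≤⇒0≤ 1≤P₀) 0≤M P₀≤p ≤-refl)))
    where
    0≤p = ≤-trans (1≤⇒0≤ 1≤P₀) P₀≤p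

  swap-< : ∀ {x y M} → x - y < M → - (y - x) < M
  swap-< {x} {y} {M} h = subst (_< M) (solve 2 (λ x y → x :- y := :- (y :- x)) refl x y) h

  module _ (c : Cell) (a b : ℕ) .{{_ : ℕ.NonZero a}} .{{_ : ℕ.NonZero b}} where
    open Cell c

    Members : Class → ℕ → Set
    Members κ D = ∃[ p ] ∃[ q ] ∃[ r ] ∃[ s ] (Normal (+ D) p q r s × InCell c (+ D) p q r s × InClass a b κ p q r s)

    -- The parameters are recovered in turn: `p` from its interval, `q` from `0 ≤ q < P₁`, then `r`
    -- because `A = q² - pr` lies in an interval, and finally `s` by `s-spread`. A form determines
    -- `D`, so counting codes bounds the number of discriminants.
    cell-count : ∀ κ np nq nr ns W .{{_ : ℕ.NonZero np}} .{{_ : ℕ.NonZero nq}} .{{_ : ℕ.NonZero nr}} .{{_ : ℕ.NonZero ns}} →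
      + 1 ≤ P₀ → + 0 ≤ γ → + 0 ≤ W →
      P₁ - P₀ ≤ + 2 * (+ a * + np) → P₁ ≤ + 2 * (+ b * + nq) → A₁ - A₀ ≤ P₀ * (+ 2 * (+ b * + nr)) →
      X - Δ ≤ W * (+ 2 * γ + P₀ * P₀ * W) → W ≤ + 2 * (+ a * + ns) → AtMost (Members κ) (np ℕ.* (nq ℕ.* (nr ℕ.* ns)))
    cell-count κ np nq nr ns W 1≤P₀ 0≤γ 0≤W hp hq hr hs hW = atMost-intro λ L u ms →
        length-≤-by-code u (λ d∈ → codeOf (All.lookup ms d∈)) (λ d∈ e∈ → injective (All.lookup ms d∈) (All.lookup ms e∈))
      where
      codeOf : ∀ {D} → Members κ D → Fin (np ℕ.* (nq ℕ.* (nr ℕ.* ns)))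
      codeOf (p , q , r , s , _) = combine (code p a np) (combine (code q b nq) (combine (code r b nr) (code s a ns)))
      open InCell
      injective : ∀ {D E} (m : Members κ D) (n : Members κ E) → codeOf m ≡ codeOf n → D ≡ E
      injective {D} {E} (p , q , r , s , N , I , (cp , cq , cr , cs)) (p′ , q′ , r′ , s′ , N′ , I′ , (cp′ , cq′ , cr′ , cs′)) eq
        with combine-injective (code p a np) _ (code p′ a np) _ eq
      ... | ep , eq₁ with combine-injective (code q b nq) _ (code q′ b nq) _ eq₁
      ... | eq′ , eq₂ with combine-injective (code r b nr) (code s a ns) (code r′ b nr) (code s′ a ns) eq₂
      ... | er , es = same p≡
        where
        p≡ : p ≡ p′
        p≡ = code-injective p p′ a np (trans cp (sym cp′)) ep (double-< {p} {p′} (difference-< (P₀≤p I) (p<P₁ I′)) hp) (swap-< {p} {p′} (double-< {p′} {p} (difference-< (P₀≤p I′) (p<P₁ I)) hp))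
        odd-< : ∀ {x y M} → (+ 2 * y + + 1) - (+ 2 * x + + 1) < + 2 * M → y - x < M
        odd-< {x} {y} {M} h = double-< {x} {y} {+ 2 * M} (subst (_< + 2 * M) (solve 2 (λ x y → con (+ 2) :* y :+ con (+ 1) :- (con (+ 2) :* x :+ con (+ 1)) := con (+ 2) :* y :- con (+ 2) :* x) refl x y) h) ≤-refl
        q-< : ∀ {x y z} → + 0 ≤ + 2 * x + + 1 → + 2 * y + + 1 < + 2 * z → + 2 * z < P₁ → y - x < + b * + nq
        q-< {x} {y} {z} 0≤x y<z z< = odd-< {x} {y} (<-≤-trans (subst ((+ 2 * y + + 1) - (+ 2 * x + + 1) <_) (+-identityʳ P₁) (difference-< {+ 2 * x + + 1} {+ 2 * y + + 1} {+ 0} {P₁} 0≤x (<-trans y<z z<))) hq)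
        q≡ : q ≡ q′
        q≡ = code-injective q q′ b nq (trans cq (sym cq′)) eq′ (q-< {q} {q′} {p′} (0≤q N) (q<p N′) (p<P₁ I′)) (swap-< {q} {q′} (q-< {q′} {q} {p} (0≤q N′) (q<p N) (p<P₁ I)))
        same : p ≡ p′ → D ≡ E
        same refl = same₂ q≡
          where
          0≤bn : ∀ n → + 0 ≤ + 2 * (+ b * + n)
          0≤bn n = nonneg-scale 2 (nonneg-* {+ b} {+ n} (+≤+ z≤n) (+≤+ z≤n))
          same₂ : q ≡ q′ → D ≡ E
          same₂ refl = same₃ r≡
            where
            r≡ : r ≡ r′
            r≡ = code-injective r r′ b nr (trans cr (sym cr′)) er
              (odd-< {r} {r′} (r-spread {+ 2 * p} {+ 2 * q + + 1} {+ 2 * r + + 1} {+ 2 * r′ + + 1} {P₀} {A₀} {A₁} {+ 2 * (+ b * + nr)} 1≤P₀ (P₀≤p I) (A₀≤A I′) (A<A₁ I) hr (0≤bn nr)))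
              (swap-< {r} {r′} (odd-< {r′} {r} (r-spread {+ 2 * p} {+ 2 * q + + 1} {+ 2 * r′ + + 1} {+ 2 * r + + 1} {P₀} {A₀} {A₁} {+ 2 * (+ b * + nr)} 1≤P₀ (P₀≤p I) (A₀≤A I) (A<A₁ I′) hr (0≤bn nr))))
            same₃ : r ≡ r′ → D ≡ E
            same₃ refl = same₄ s≡
              where
              s≡ : s ≡ s′
              s≡ = code-injective s s′ a ns (trans cs (sym cs′)) es
                (double-< {s} {s′} {W} (s-spread {+ D} {+ E} {+ 2 * p} {+ 2 * q + + 1} {+ 2 * r + + 1} {+ 2 * s} {+ 2 * s′} {X} {Δ} {γ} {P₀} {W} (disc≡ N) (disc≡ N′) 1≤P₀ (P₀≤p I) 0≤γ 0≤W (γ≤G I) (Δ≤D I) (D<X I′) hs) hW)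
                (swap-< {s} {s′} (double-< {s′} {s} {W} (s-spread {+ E} {+ D} {+ 2 * p} {+ 2 * q + + 1} {+ 2 * r + + 1} {+ 2 * s′} {+ 2 * s} {X} {Δ} {γ} {P₀} {W} (disc≡ N′) (disc≡ N) 1≤P₀ (P₀≤p I) 0≤γ 0≤W (γ≤G I′) (Δ≤D I′) (D<X I) hs) hW))
              same₄ : s ≡ s′ → D ≡ E
              same₄ refl = +-injective (trans (sym (disc≡ N)) (disc≡ N′))

-- Normal forms and residue classes modulo 9

module NormalForms where

  open import Data.Nat as ℕ using (ℕ; zero; suc; z≤n; s≤s)
  import Data.Nat.Properties as ℕ
  import Data.Nat.Divisibility as ℕD
  open import Data.Integer hiding (suc)
  open import Data.Integer.Properties
  open import Data.Integer.DivMod using (n%ℕd<d; a≡a%ℕn+[a/ℕn]*n)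
  open import Data.Integer.Solver
  open import Data.List using (List; length; filter; upTo; cartesianProduct)
  open import Data.List.Membership.Propositional using (_∈_)
  open import Data.List.Membership.Propositional.Properties using (∈-upTo⁺; ∈-cartesianProduct⁺; ∈-filter⁺)
  open import Data.Product using (∃-syntax; _×_; _,_)
  open import Data.Empty using (⊥; ⊥-elim)
  open import Relation.Nullary using (¬_; yes; no; Dec)
  open import Relation.Nullary.Decidable using (¬?)
  open import Relation.Binary.PropositionalEquality
  open IntegerOrder
  open CubicForm
  open Cells
  open +-*-Solver hiding (Normal; normalise)

  even-neg : ∀ {i} → Even i → Even (- i)
  even-neg (k , refl) = - k , neg-distribʳ-* (+ 2) k

  odd-neg : ∀ {i} → Odd i → Odd (- i)
  odd-neg (k , refl) = - k - + 1 , solve 1 (λ k → :- (con (+ 2) :* k :+ con (+ 1)) := con (+ 2) :* (:- k :- con (+ 1)) :+ con (+ 1)) refl k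

  private
    discₚ : ∀ {n} → (p q r s : Polynomial n) → Polynomial n
    discₚ p q r s = (p :* s :- q :* r) :* (p :* s :- q :* r) :- con (+ 4) :* ((q :* q :- p :* r) :* (r :* r :- q :* s))

    gₚ : ∀ {n} → (p q r s : Polynomial n) → Polynomial n
    gₚ p q r s = p :* p :* s :- con (+ 3) :* (p :* q :* r) :+ con (+ 2) :* (q :* q :* q)

  Bounded : ℤ → ℤ → ℤ → Set
  Bounded D p A = + 0 ≤ p * p + + 3 * A → (p * p + + 3 * A) * (p * p + + 3 * A) ≤ D

  bounded-subst : ∀ {D p A p′ A′} → p * p ≡ p′ * p′ → A ≡ A′ → Bounded D p A → Bounded D p′ A′
  bounded-subst {D} {p} {A} {p′} {A′} e refl b = subst (λ w → + 0 ≤ w + + 3 * A → (w + + 3 * A) * (w + + 3 * A) ≤ D) e b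

  reduced-neg : ∀ {D p q r s} → IsReducedForm D p q r s → IsReducedForm D (- p) (- q) (- r) (- s)
  reduced-neg {D} {p} {q} {r} {s} (d , ep , oq , or , es , b , p≢0) =
    trans (solve 4 (λ p q r s → discₚ (:- p) (:- q) (:- r) (:- s) := discₚ p q r s) refl p q r s) d , even-neg ep , odd-neg oq , odd-neg or , even-neg es ,
    bounded-subst {D} {p} {hess p q r} {(- p)} {hess (- p) (- q) (- r)} (solve 1 (λ p → p :* p := (:- p) :* (:- p)) refl p) (solve 3 (λ p q r → q :* q :- p :* r := (:- q) :* (:- q) :- (:- p) :* (:- r)) refl p q r) b ,
    λ e → p≢0 (trans (sym (neg-involutive p)) (cong -_ e))

  -- The substitution `y ↦ -y`. It fixes `p` and `A` and changes the sign of `G`.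
  reduced-reflect : ∀ {D p q r s} → IsReducedForm D p q r s → IsReducedForm D p (- q) r (- s)
  reduced-reflect {D} {p} {q} {r} {s} (d , ep , oq , or , es , b , p≢0) =
    trans (solve 4 (λ p q r s → discₚ p (:- q) r (:- s) := discₚ p q r s) refl p q r s) d , ep , odd-neg oq , or , even-neg es ,
    bounded-subst {D} {p} {hess p q r} {p} {hess p (- q) r} refl (solve 3 (λ p q r → q :* q :- p :* r := (:- q) :* (:- q) :- p :* r) refl p q r) b , p≢0

  gForm-reflect : ∀ p q r s → gForm p (- q) r (- s) ≡ - gForm p q r s
  gForm-reflect = solve 4 (λ p q r s → gₚ p (:- q) r (:- s) := :- gₚ p q r s) refl

  -- The substitution `x ↦ x + ky`, which fixes `p`, `A` and `G` and moves `q` by multiples of `p`.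
  reduced-translate : ∀ {D p q r s} k → IsReducedForm D p q r s →
    IsReducedForm D p (q + k * p) (r + + 2 * (k * q) + k * k * p) (s + + 3 * (k * r) + + 3 * (k * k * q) + k * k * k * p)
  reduced-translate {D} {p} {q} {r} {s} k (d , (p′ , refl) , (q′ , refl) , (r′ , refl) , (s′ , refl) , b , p≢0) =
    trans (solve 5 (λ p q r s k → discₚ p (q :+ k :* p) (r :+ con (+ 2) :* (k :* q) :+ k :* k :* p) (s :+ con (+ 3) :* (k :* r) :+ con (+ 3) :* (k :* k :* q) :+ k :* k :* k :* p) := discₚ p q r s) refl p q r s k) d ,
    (p′ , refl) ,
    (q′ + k * p′ , solve 3 (λ k p q → con (+ 2) :* q :+ con (+ 1) :+ k :* (con (+ 2) :* p) := con (+ 2) :* (q :+ k :* p) :+ con (+ 1)) refl k p′ q′) ,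
    (r′ + k * q + k * k * p′ , solve 4 (λ k p q r → con (+ 2) :* r :+ con (+ 1) :+ con (+ 2) :* (k :* q) :+ k :* k :* (con (+ 2) :* p) := con (+ 2) :* (r :+ k :* q :+ k :* k :* p) :+ con (+ 1)) refl k p′ q r′) ,
    even-s (square-mod-2 k) ,
    bounded-subst {D} {p} {hess p q r} {p} {hess p (q + k * p) (r + + 2 * (k * q) + k * k * p)} refl (solve 4 (λ p q r k → q :* q :- p :* r := (q :+ k :* p) :* (q :+ k :* p) :- p :* (r :+ con (+ 2) :* (k :* q) :+ k :* k :* p)) refl p q r k) b , p≢0
    where
    -- As `q` and `r` are odd, `3kr + 3k²q` has the parity of `k + k²`, which is even.
    even-s : (∃[ j ] k * k ≡ k + + 2 * j) → Even (s + + 3 * (k * r) + + 3 * (k * k * q) + k * k * k * p)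
    even-s (j , kk) = s′ + + 3 * (k * r′) + + 3 * (k * k * q′) + k * k * k * p′ + + 3 * (k + j) ,
      trans (solve 6 (λ p q r s k j → con (+ 2) :* s :+ con (+ 3) :* (k :* (con (+ 2) :* r :+ con (+ 1))) :+ con (+ 3) :* (k :* k :* (con (+ 2) :* q :+ con (+ 1))) :+ k :* k :* k :* (con (+ 2) :* p)
        := con (+ 2) :* (s :+ con (+ 3) :* (k :* r) :+ con (+ 3) :* (k :* k :* q) :+ k :* k :* k :* p :+ con (+ 3) :* (k :+ j)) :+ con (+ 3) :* (k :* k :- (k :+ con (+ 2) :* j))) refl p′ q′ r′ s′ k j) (diff-zero kk _ (+ 3))

  gForm-translate : ∀ p q r s k → gForm p (q + k * p) (r + + 2 * (k * q) + k * k * p) (s + + 3 * (k * r) + + 3 * (k * k * q) + k * k * k * p) ≡ gForm p q r s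
  gForm-translate = solve 5 (λ p q r s k → gₚ p (q :+ k :* p) (r :+ con (+ 2) :* (k :* q) :+ k :* k :* p) (s :+ con (+ 3) :* (k :* r) :+ con (+ 3) :* (k :* k :* q) :+ k :* k :* k :* p) := gₚ p q r s) refl

  HasNormal : ℤ → Set
  HasNormal D = ∃[ p ] ∃[ q ] ∃[ r ] ∃[ s ] Normal D p q r s

  normal-from : ∀ {D p q r s} → IsReducedForm D p q r s → + 1 ≤ p → + 0 ≤ q → q < p → + 0 ≤ gForm p q r s → HasNormal D
  normal-from (d , (p′ , refl) , (q′ , refl) , (r′ , refl) , (s′ , refl) , b , _) 1≤p 0≤q q<p 0≤G = p′ , q′ , r′ , s′ , normal d 1≤p 0≤q q<p 0≤G b

  normalise-q : ∀ {D p q r s} → IsReducedForm D p q r s → + 1 ≤ p → + 0 ≤ gForm p q r s → HasNormal D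
  normalise-q {D} {+ suc n} {q} {r} {s} f 1≤p 0≤G = normal-from {p = p} (reduced-translate {D} {p} {q} {r} {s} k f) 1≤p (subst (+ 0 ≤_) (sym q≡) (+≤+ z≤n)) (subst (_< p) (sym q≡) (+<+ (n%ℕd<d q (suc n)))) (subst (+ 0 ≤_) (sym (gForm-translate p q r s k)) 0≤G)
    where
    p = + suc n
    k = - (q /ℕ suc n)
    q≡ : q + k * p ≡ + (q %ℕ suc n)
    q≡ = trans (cong (_+ k * p) (a≡a%ℕn+[a/ℕn]*n q (suc n))) (solve 3 (λ r d p → r :+ d :* p :+ (:- d) :* p := r) refl (+ (q %ℕ suc n)) (q /ℕ suc n) p)
  normalise-q {p = + zero} f (+≤+ ())

  normalise-G : ∀ {D p q r s} → IsReducedForm D p q r s → + 1 ≤ p → HasNormal D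
  normalise-G {D} {p} {q} {r} {s} f 1≤p with + 0 ≤? gForm p q r s
  ... | yes 0≤G = normalise-q {D} {p} {q} {r} {s} f 1≤p 0≤G
  ... | no ¬0≤G = normalise-q {D} {p} { - q} {r} { - s} (reduced-reflect {D} {p} {q} {r} {s} f) 1≤p (subst (+ 0 ≤_) (sym (gForm-reflect p q r s)) (neg-mono-≤ (<⇒≤ (≰⇒> ¬0≤G))))

  toNormal : ∀ {D p q r s} → IsReducedForm D p q r s → HasNormal D
  toNormal {D} {+ zero} (_ , _ , _ , _ , _ , _ , p≢0) = ⊥-elim (p≢0 refl)
  toNormal {D} {+ suc n} {q} {r} {s} f = normalise-G {D} {+ suc n} {q} {r} {s} f (+≤+ (s≤s z≤n))
  toNormal {D} { -[1+ n ]} {q} {r} {s} f = normalise-G {D} {+ suc n} { - q} { - r} { - s} (reduced-neg {D} { -[1+ n ]} {q} {r} {s} f) (+≤+ (s≤s z≤n))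

  -- Modulo 9 the discriminant depends on the outer coefficients modulo 9 but on the inner ones only modulo 3.
  disc-shift : ∀ p q r s x y z w → ∃[ k ] disc (p + + 18 * x) (q + + 6 * y) (r + + 6 * z) (s + + 18 * w) ≡ disc p q r s + + 9 * k
  disc-shift p q r s x y z w = k₁ + k₂ + k₃ + k₄ , trans e₁ (trans (cong (_+ + 9 * k₁) e₂) (trans (cong (λ v → v + + 9 * k₂ + + 9 * k₁) e₃) (trans (cong (λ v → v + + 9 * k₃ + + 9 * k₂ + + 9 * k₁) e₄)
      (solve 5 (λ d a b c e → d :+ con (+ 9) :* e :+ con (+ 9) :* c :+ con (+ 9) :* b :+ con (+ 9) :* a := d :+ con (+ 9) :* (a :+ b :+ c :+ e)) refl (disc p q r s) k₁ k₂ k₃ k₄))))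
    where
    q′ = q + + 6 * y
    r′ = r + + 6 * z
    s′ = s + + 18 * w
    k₁ = (+ 4 * (p * x) + + 36 * (x * x)) * (s′ * s′) - + 12 * (x * (q′ * r′ * s′)) + + 8 * (x * (r′ * r′ * r′))
    e₁ : disc (p + + 18 * x) q′ r′ s′ ≡ disc p q′ r′ s′ + + 9 * k₁
    e₁ = solve 5 (λ p q r s x → discₚ (p :+ con (+ 18) :* x) q r s := discₚ p q r s :+ con (+ 9) :* ((con (+ 4) :* (p :* x) :+ con (+ 36) :* (x :* x)) :* (s :* s) :- con (+ 12) :* (x :* (q :* r :* s)) :+ con (+ 8) :* (x :* (r :* r :* r)))) refl p q′ r′ s′ x
    k₂ = (+ 8 * (q * q * y) + + 48 * (q * (y * y)) + + 96 * (y * y * y)) * s′ - + 4 * (p * y * r′ * s′) - (+ 4 * (q * y) + + 12 * (y * y)) * (r′ * r′)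
    e₂ : disc p q′ r′ s′ ≡ disc p q r′ s′ + + 9 * k₂
    e₂ = solve 5 (λ p q r s y → discₚ p (q :+ con (+ 6) :* y) r s := discₚ p q r s :+ con (+ 9) :* ((con (+ 8) :* (q :* q :* y) :+ con (+ 48) :* (q :* (y :* y)) :+ con (+ 96) :* (y :* y :* y)) :* s :- con (+ 4) :* (p :* y :* r :* s) :- (con (+ 4) :* (q :* y) :+ con (+ 12) :* (y :* y)) :* (r :* r))) refl p q r′ s′ y
    k₃ = (+ 8 * (r * r * z) + + 48 * (r * (z * z)) + + 96 * (z * z * z)) * p - + 4 * (p * z * q * s′) - (+ 4 * (r * z) + + 12 * (z * z)) * (q * q)
    e₃ : disc p q r′ s′ ≡ disc p q r s′ + + 9 * k₃
    e₃ = solve 5 (λ p q r s z → discₚ p q (r :+ con (+ 6) :* z) s := discₚ p q r s :+ con (+ 9) :* ((con (+ 8) :* (r :* r :* z) :+ con (+ 48) :* (r :* (z :* z)) :+ con (+ 96) :* (z :* z :* z)) :* p :- con (+ 4) :* (p :* z :* q :* s) :- (con (+ 4) :* (r :* z) :+ con (+ 12) :* (z :* z)) :* (q :* q))) refl p q r s′ z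
    k₄ = (+ 4 * (s * w) + + 36 * (w * w)) * (p * p) - + 12 * (w * (p * q * r)) + + 8 * (w * (q * q * q))
    e₄ : disc p q r s′ ≡ disc p q r s + + 9 * k₄
    e₄ = solve 5 (λ p q r s w → discₚ p q r (s :+ con (+ 18) :* w) := discₚ p q r s :+ con (+ 9) :* ((con (+ 4) :* (s :* w) :+ con (+ 36) :* (w :* w)) :* (p :* p) :- con (+ 12) :* (w :* (p :* q :* r)) :+ con (+ 8) :* (w :* (q :* q :* q)))) refl p q r s w

  classDisc : Class → ℤ
  classDisc (i , j , k , l) = disc (+ 2 * + i) (+ 2 * + j + + 1) (+ 2 * + k + + 1) (+ 2 * + l)

  good? : (κ : Class) → Dec (¬ (classDisc κ %ℕ 9 ≡ 0))
  good? κ = ¬? (classDisc κ %ℕ 9 ℕ.≟ 0)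

  goodClasses : List Class
  goodClasses = filter good? (cartesianProduct (upTo 9) (cartesianProduct (upTo 3) (cartesianProduct (upTo 3) (upTo 9))))

  -- Established by evaluation. It enters the cell count as `1728 = 3 · 576`.
  goodClasses-length : length goodClasses ≡ 576
  goodClasses-length = refl

  class-good : ∀ {D p q r s} → Normal (+ D) p q r s → ¬ (9 ℕD.∣ D) → ∃[ κ ] (κ ∈ goodClasses × InClass 9 3 κ p q r s)
  class-good {D} {p} {q} {r} {s} N 9∤D = κ , ∈-filter⁺ good? (∈-cartesianProduct⁺ (∈-upTo⁺ (n%ℕd<d p 9)) (∈-cartesianProduct⁺ (∈-upTo⁺ (n%ℕd<d q 3)) (∈-cartesianProduct⁺ (∈-upTo⁺ (n%ℕd<d r 3)) (∈-upTo⁺ (n%ℕd<d s 9))))) notZero , refl , refl , refl , refl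
    where
    κ : Class
    κ = p %ℕ 9 , q %ℕ 3 , r %ℕ 3 , s %ℕ 9
    outer : ∀ x → + 2 * x ≡ + 2 * + (x %ℕ 9) + + 18 * (x /ℕ 9)
    outer x = trans (cong (λ v → + 2 * v) (a≡a%ℕn+[a/ℕn]*n x 9)) (solve 2 (λ r d → con (+ 2) :* (r :+ d :* con (+ 9)) := con (+ 2) :* r :+ con (+ 18) :* d) refl (+ (x %ℕ 9)) (x /ℕ 9))
    inner : ∀ x → + 2 * x + + 1 ≡ + 2 * + (x %ℕ 3) + + 1 + + 6 * (x /ℕ 3)
    inner x = trans (cong (λ v → + 2 * v + + 1) (a≡a%ℕn+[a/ℕn]*n x 3)) (solve 2 (λ r d → con (+ 2) :* (r :+ d :* con (+ 3)) :+ con (+ 1) := con (+ 2) :* r :+ con (+ 1) :+ con (+ 6) :* d) refl (+ (x %ℕ 3)) (x /ℕ 3))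
    notZero : ¬ (classDisc κ %ℕ 9 ≡ 0)
    notZero z = shifted (disc-shift (+ 2 * + (p %ℕ 9)) (+ 2 * + (q %ℕ 3) + + 1) (+ 2 * + (r %ℕ 3) + + 1) (+ 2 * + (s %ℕ 9)) (p /ℕ 9) (q /ℕ 3) (r /ℕ 3) (s /ℕ 9))
      where
      shifted : (∃[ k ] _ ≡ classDisc κ + + 9 * k) → ⊥
      shifted (k , eq) = 9∤D (ℕD.divides ∣ m ∣ (trans (cong ∣_∣ D≡) (trans (abs-* m (+ 9)) refl)))
        where
        m = classDisc κ /ℕ 9 + k
        D≡ : + D ≡ m * + 9
        D≡ = trans (sym (disc≡ N)) (trans (trans (cong₂ (λ a d → disc a (+ 2 * q + + 1) (+ 2 * r + + 1) d) (outer p) (outer s)) (cong₂ (λ b c → disc (+ 2 * + (p %ℕ 9) + + 18 * (p /ℕ 9)) b c (+ 2 * + (s %ℕ 9) + + 18 * (s /ℕ 9))) (inner q) (inner r)))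
          (trans eq (trans (cong (_+ + 9 * k) (trans (a≡a%ℕn+[a/ℕn]*n (classDisc κ) 9) (cong (λ v → + v + classDisc κ /ℕ 9 * + 9) z))) (solve 2 (λ c k → con (+ 0) :+ c :* con (+ 9) :+ con (+ 9) :* k := (c :+ k) :* con (+ 9)) refl (classDisc κ /ℕ 9) k))))

-- The computation over an explicit grid of cells

module Grid where

  open import Data.Nat as ℕ using (ℕ; zero; suc; _+_; _*_; _∸_; _^_; _≤ᵇ_; _/_)
  open import Data.Integer as ℤ using (ℤ; +_; -[1+_])
  open import Data.Bool using (Bool; true; false; if_then_else_; _∧_; _∨_)
  open import Data.List using (List; []; _∷_; map; upTo; _++_)
  open import Relation.Binary.PropositionalEquality

  quot : ℕ → ℕ → ℕ
  quot a zero = 0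
  quot a (suc b) = a / suc b

  posPart : ℤ → ℕ
  posPart (+ n) = n
  posPart -[1+ n ] = 0

  max : ℕ → ℕ → ℕ
  max a b = if a ≤ᵇ b then b else a

  -- Newton iterations; every result is checked by cellOK.
  newtonSqrt : ℕ → ℕ → ℕ → ℕ
  newtonSqrt zero v g = g
  newtonSqrt (suc n) v g = newtonSqrt n v (suc (quot (g + quot v g) 2))

  newtonWidth : ℕ → (pp g x W : ℕ) → ℕ
  newtonWidth zero pp g x W = W
  newtonWidth (suc n) pp g x W = newtonWidth n pp g x (suc (quot (pp * (W * W) + x) (2 * (g + pp * W))))

  -- Lengths are measured in units h with X = R²h⁴; the cell is p₀ ≤ p < p₁, A₀ ≤ A < A₁ with D ≥ Δ and G ≥ g,
  -- W bounds the spread of s, and ρ that of r.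
  module _ (X R bound fuel : ℕ) where

    cellOK : (p₀ p₁ : ℕ) (A₀ A₁ : ℤ) (Δ g W ρ : ℕ) → Bool
    cellOK p₀ p₁ A₀ A₁ Δ g W ρ =
      -- Two sources for `D ≥ Δ`: the reduction bound at the corner `p₀, A₀`, or `4(-A)³ ≤ p²D` at
      -- the corner `p₁, A₁`.
      ((Δ ≤ᵇ posPart (+ (p₀ * p₀) ℤ.+ + 3 ℤ.* A₀) * posPart (+ (p₀ * p₀) ℤ.+ + 3 ℤ.* A₀))
        ∨ (Δ * (p₁ * p₁) ≤ᵇ 4 * (posPart (ℤ.- A₁) * posPart (ℤ.- A₁) * posPart (ℤ.- A₁))))
      ∧ (g * g ≤ᵇ posPart (+ 4 ℤ.* (A₀ ℤ.* A₀ ℤ.* A₀) ℤ.+ + Δ ℤ.* + (p₀ * p₀)))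
      -- Two forms in the cell that agree in `p, q, r` then have values of `s` less than `W` apart.
      ∧ (X ≤ᵇ W * (2 * g + p₀ * p₀ * W) + Δ)
      ∧ (posPart (+ 3 ℤ.* (A₁ ℤ.- A₀)) ≤ᵇ ρ * p₀)
      ∧ (1 ≤ᵇ W) ∧ (1 ≤ᵇ ρ)

    -- The stages of a row hand each computed value on as an argument, so that it is shared. `g` and
    -- `W` are starting guesses inherited from the previous cell, and `k` receives the accumulated
    -- cost.
    row : ℕ → (p₀ p₁ st : ℕ) → ℤ → (g W acc : ℕ) → (ℕ → Bool) → Bool
    row-stop : ℕ → (p₀ p₁ st : ℕ) → ℤ → (g W acc : ℕ) → (ℕ → Bool) → ℤ → ℤ → Bool
    row-Δ : ℕ → (p₀ p₁ st : ℕ) → ℤ → (g W acc : ℕ) → (ℕ → Bool) → ℤ → ℕ → Bool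
    row-g : ℕ → (p₀ p₁ st : ℕ) → ℤ → (g W acc : ℕ) → (ℕ → Bool) → ℤ → (Δ v : ℕ) → Bool
    row-W : ℕ → (p₀ p₁ st : ℕ) → ℤ → (g W acc : ℕ) → (ℕ → Bool) → ℤ → (Δ : ℕ) → Bool
    row-ρ : ℕ → (p₀ p₁ st : ℕ) → ℤ → (g W acc : ℕ) → (ℕ → Bool) → ℤ → (Δ : ℕ) → Bool
    row-check : ℕ → (p₀ p₁ st : ℕ) → ℤ → (g W acc : ℕ) → (ℕ → Bool) → ℤ → (Δ ρ : ℕ) → Bool

    row zero p₀ p₁ st A₀ g W acc k = false
    -- The cells widen in proportion to `∣ A₀ ∣`, with width at least `st/24` around `A = 0`.
    row (suc n) p₀ p₁ st A₀ g W acc k = row-stop n p₀ p₁ st A₀ g W acc k (+ (p₀ * p₀) ℤ.+ + 3 ℤ.* A₀) (A₀ ℤ.+ + quot (max st ℤ.∣ A₀ ∣) 24)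
    -- From `p₀² + 3A₀ ≥ R` on, reducedness would force `D ≥ R²h⁴`, so the row ends here.
    row-stop n p₀ p₁ st A₀ g W acc k d A₁ = if (+ R) ℤ.≤ᵇ d then k acc else
      row-Δ n p₀ p₁ st A₀ g W acc k A₁ (max (posPart d * posPart d) (quot (4 * (posPart (ℤ.- A₁) * posPart (ℤ.- A₁) * posPart (ℤ.- A₁))) (p₁ * p₁)))
    row-Δ n p₀ p₁ st A₀ g W acc k A₁ Δ = row-g n p₀ p₁ st A₀ g W acc k A₁ Δ (posPart (+ 4 ℤ.* (A₀ ℤ.* A₀ ℤ.* A₀) ℤ.+ + Δ ℤ.* + (p₀ * p₀)))
    -- The Newton iterates are rounded above the root of `v`, so the quotient is a lower estimate of
    -- it. The initial guess `p₀ * R` is the root of `Xp₀²`.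
    row-g n p₀ p₁ st A₀ g W acc k A₁ Δ v = row-W n p₀ p₁ st A₀ (quot v (newtonSqrt 4 v (if g ≤ᵇ 0 then p₀ * R else g))) W acc k A₁ Δ
    row-W n p₀ p₁ st A₀ g W acc k A₁ Δ = row-ρ n p₀ p₁ st A₀ g (newtonWidth 4 (p₀ * p₀) g (X ∸ Δ) W) acc k A₁ Δ
    row-ρ n p₀ p₁ st A₀ g W acc k A₁ Δ = row-check n p₀ p₁ st A₀ g W acc k A₁ Δ (suc (quot (posPart (+ 3 ℤ.* (A₁ ℤ.- A₀))) p₀))
    row-check n p₀ p₁ st A₀ g W acc k A₁ Δ ρ = if cellOK p₀ p₁ A₀ A₁ Δ g W ρ ∧ (acc ≤ᵇ bound)
      -- The added cost is the number of forms in the cell up to the factor `1728y⁴`: one factor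
      -- each for `p`, `q`, `r` and `s`.
      then row n p₀ p₁ st A₁ g W (acc + (p₁ ∸ p₀) * (p₁ * (ρ * W))) k else false

    rowFrom : (p₀ p₁ st acc : ℕ) → (ℕ → Bool) → Bool
    rowFrom p₀ p₁ st acc k = if (1 ≤ᵇ p₀) ∧ (suc p₀ ≤ᵇ p₁) ∧ (p₁ * p₁ * X ≤ᵇ 4 * (st * st * st))
      then row fuel p₀ p₁ st (ℤ.- (+ st)) 0 (suc (quot R p₀)) acc k else false

    rows : List ℕ → ℕ → (ℕ → Bool) → Bool
    rows [] acc k = false
    rows (c₀ ∷ []) acc k = k acc
    -- The row boundaries are cubes, so that the leftmost `A`, at `-st` with `4st³ = p₁² · 2²⁶⁰`, is
    -- an exact integer.
    rows (c₀ ∷ c₁ ∷ cs) acc k = rowFrom (c₀ * c₀ * c₀) (c₁ * c₁ * c₁) (c₁ * c₁ * 2 ^ 86) acc (λ acc → rows (c₁ ∷ cs) acc k)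

  fifth : ℕ → ℕ
  fifth a = a * a * (a * a) * a

  twentieth : ℕ → ℕ
  twentieth a = fifth a * fifth a * (fifth a * fifth a)

  cubeLast : List ℕ → ℕ
  cubeLast [] = 0
  cubeLast (c ∷ []) = c * c * c
  cubeLast (_ ∷ c ∷ cs) = cubeLast (c ∷ cs)

  -- Abstract, because the type checker would unfold a large literal times a variable.
  abstract
    gridK gridX gridR gridBound gridFuel : ℕ
    gridK = 8192
    gridX = 2 ^ 260
    gridR = 2 ^ 130
    -- This is 71/16 of `gridX`. After multiplication by `1728/18⁴` it becomes the proportion
    -- 71/972.
    gridBound = 71 * 2 ^ 256
    gridFuel = 1000

    gridTail : List ℕ
    -- Dyadic points towards the cusp, then equidistant ones up to `2²²`. The cube of the last is
    -- `2⁶⁶`, twice the fourth root of `gridX`, beyond which no reduced form has its `p`.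
    gridTail = map (λ i → 2 ^ suc i) (upTo 12) ++ map (λ i → suc i * 2 ^ 13) (upTo 512)

    gridK≡ : gridK ≡ 8192
    gridK≡ = refl

    gridX≡ : gridX ≡ twentieth gridK
    gridX≡ = refl

    gridX≡R² : gridX ≡ gridR * gridR
    gridX≡R² = refl

    gridBound≡ : gridBound * 16 ≡ 71 * gridX
    gridBound≡ = refl

    gridTop≡ : cubeLast (1 ∷ gridTail) ≡ 2 * fifth gridK
    gridTop≡ = refl

    grid-check : rows gridX gridR gridBound gridFuel (1 ∷ gridTail) 0 (λ acc → acc ≤ᵇ gridBound) ≡ true
    grid-check = refl

-- Soundness of the grid computation

module GridSound where

  open import Data.Nat as ℕ using (ℕ; suc; z≤n; s≤s; _≤ᵇ_)
  import Data.Nat.Properties as ℕ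
  import Data.Nat.Tactic.RingSolver as ℕRing
  open import Data.Bool using (Bool; true; false; if_then_else_; _∧_; _∨_; T)
  open import Data.Integer hiding (suc; _≤ᵇ_)
  import Data.Integer as ℤ
  open import Data.Integer.Properties
  open import Data.Integer.Solver
  open import Data.List using (List; []; _∷_)
  open import Data.List.Membership.Propositional using (_∈_)
  open import Data.Product using (∃-syntax; _×_; _,_; proj₁; proj₂)
  open import Data.Sum using (_⊎_; inj₁; inj₂; [_,_]′)
  open import Data.Empty using (⊥; ⊥-elim)
  open import Data.Unit using (tt)
  open import Relation.Nullary using (¬_; yes; no)
  open import Relation.Binary.PropositionalEquality
  open IntegerOrder
  open CubicForm
  open OddUnits using (∧-true)
  open Cells
  open NormalForms
  open Grid
  open +-*-Solver hiding (Normal; normalise)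

  cube-mono : ∀ {a b} → a ≤ b → a * a * a ≤ b * b * b
  cube-mono {a} {b} a≤b = *-cancel-≤′ {a * a * a} {b * b * b} {+ 4} (+≤+ (s≤s z≤n)) (≤-by-diff ((b - a) * ((+ 2 * b + a) * (+ 2 * b + a) + + 3 * (a * a))) (nonneg-* (≤⇒nonneg a≤b) (nonneg-+ (nonneg-sq (+ 2 * b + a)) (nonneg-scale 3 (nonneg-sq a))))
    (solve 2 (λ a b → con (+ 4) :* (b :* b :* b) :- con (+ 4) :* (a :* a :* a) := (b :- a) :* ((con (+ 2) :* b :+ a) :* (con (+ 2) :* b :+ a) :+ con (+ 3) :* (a :* a))) refl a b))

  bounded⇒Δ≤D : ∀ {D p A d} → Bounded D p A → + 0 ≤ d → d ≤ p * p + + 3 * A → d * d ≤ D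
  bounded⇒Δ≤D b 0≤d d≤ = ≤-trans (*-mono-≤′ 0≤d (≤-trans 0≤d d≤) d≤ d≤) (b (≤-trans 0≤d d≤))

  -- 4(-A)³ ≤ p²D because G² ≥ 0.
  negative-A⇒ : ∀ {D p A G n} → G * G ≡ + 4 * (A * A * A) + p * p * D → n ≤ - A → + 4 * (n * n * n) ≤ p * p * D
  negative-A⇒ {D} {p} {A} {G} {n} syz n≤ = ≤-trans (*-mono-≤-4 (cube-mono n≤)) (≤-by-diff (G * G) (nonneg-sq G) (trans (solve 2 (λ A x → x :- con (+ 4) :* ((:- A) :* (:- A) :* (:- A)) := con (+ 4) :* (A :* A :* A) :+ x) refl A (p * p * D)) (sym syz)))
    where
    *-mono-≤-4 : ∀ {x y} → x ≤ y → + 4 * x ≤ + 4 * y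
    *-mono-≤-4 {x} {y} h = ≤-by-diff (+ 4 * (y - x)) (nonneg-scale 4 (≤⇒nonneg h)) (solve 2 (λ x y → con (+ 4) :* y :- con (+ 4) :* x := con (+ 4) :* (y :- x)) refl x y)

  negative-A⇒Δ≤D : ∀ {D p A G n P₁ Δ} → G * G ≡ + 4 * (A * A * A) + p * p * D → n ≤ - A → + 0 ≤ D → + 0 ≤ p → p ≤ P₁ → + 1 ≤ P₁ → Δ * (P₁ * P₁) ≤ + 4 * (n * n * n) → Δ ≤ D
  negative-A⇒Δ≤D {D} {p} {A} {G} {n} {P₁} {Δ} syz n≤ 0≤D 0≤p p≤P₁ 1≤P₁ h = *-cancel-≤′ {Δ} {D} {P₁ * P₁} (pos-*′ 1≤P₁ 1≤P₁) (≤-trans (≤-reflexive (*-comm (P₁ * P₁) Δ)) (≤-trans h (≤-trans (negative-A⇒ {D} {p} {A} {G} {n} syz n≤)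
    (*-mono-≤′ (nonneg-sq p) 0≤D (*-mono-≤′ 0≤p (1≤⇒0≤ 1≤P₁) p≤P₁ p≤P₁) ≤-refl))))

  γ-valid : ∀ {D p A G P₀ A₀ Δ γ} → G * G ≡ + 4 * (A * A * A) + p * p * D → + 0 ≤ G → A₀ ≤ A → + 0 ≤ P₀ → P₀ ≤ p → + 0 ≤ Δ → Δ ≤ D → γ * γ ≤ + 4 * (A₀ * A₀ * A₀) + Δ * (P₀ * P₀) → γ ≤ G
  γ-valid {D} {p} {A} {G} {P₀} {A₀} {Δ} {γ} syz 0≤G A₀≤A 0≤P₀ P₀≤p 0≤Δ Δ≤D h = sq-≤⇒≤ 0≤G (≤-trans h (≤-trans
    (≤-by-diff (+ 4 * (A * A * A - A₀ * A₀ * A₀) + (p * p * D - P₀ * P₀ * Δ)) (nonneg-+ (nonneg-scale 4 (≤⇒nonneg (cube-mono A₀≤A))) (≤⇒nonneg (*-mono-≤′ (nonneg-sq P₀) (≤-trans 0≤Δ Δ≤D) (*-mono-≤′ 0≤P₀ (≤-trans 0≤P₀ P₀≤p) P₀≤p P₀≤p) Δ≤D)))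
      (solve 5 (λ a b x P Δ → con (+ 4) :* a :+ x :- (con (+ 4) :* b :+ Δ :* P) := con (+ 4) :* (a :- b) :+ (x :- P :* Δ)) refl (A * A * A) (A₀ * A₀ * A₀) (p * p * D) (P₀ * P₀) Δ)) (≤-reflexive (sym syz))))

  normal-syzygy : ∀ {D p q r s} → Normal D p q r s → let A = hess (+ 2 * p) (+ 2 * q + + 1) (+ 2 * r + + 1) ; G = gForm (+ 2 * p) (+ 2 * q + + 1) (+ 2 * r + + 1) (+ 2 * s) in
    G * G ≡ + 4 * (A * A * A) + + 2 * p * (+ 2 * p) * D
  normal-syzygy {D} {p} {q} {r} {s} N = trans (syzygy (+ 2 * p) (+ 2 * q + + 1) (+ 2 * r + + 1) (+ 2 * s)) (cong (λ w → + 4 * (A * A * A) + + 2 * p * (+ 2 * p) * w) (disc≡ N))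
    where
    A = hess (+ 2 * p) (+ 2 * q + + 1) (+ 2 * r + + 1)

  -- If A ≤ -n, then 4n³ ≤ p²D < P₁²X.
  A-lower : ∀ {D p q r s P₁ X n} → Normal D p q r s → + 0 ≤ D → D < X → + 2 * p ≤ P₁ → + 1 ≤ P₁ → P₁ * P₁ * X ≤ + 4 * (n * n * n) → - n ≤ hess (+ 2 * p) (+ 2 * q + + 1) (+ 2 * r + + 1)
  A-lower {D} {p} {q} {r} {s} {P₁} {X} {n} N 0≤D D<X p≤ 1≤P₁ h with - n ≤? hess (+ 2 * p) (+ 2 * q + + 1) (+ 2 * r + + 1)
  ... | yes le = le
  ... | no ¬le = ⊥-elim (<⇒≱ (<-by-diff {P₁ * P₁ * D} {P₁ * P₁ * X} (P₁ * P₁ * (X - D)) (pos-*′ (pos-*′ 1≤P₁ 1≤P₁) (<⇒1≤diff D<X)) (solve 3 (λ P D X → P :* X :- P :* D := P :* (X :- D)) refl (P₁ * P₁) D X))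
      (≤-trans h (≤-trans (negative-A⇒ {D} {+ 2 * p} {A} {gForm (+ 2 * p) (+ 2 * q + + 1) (+ 2 * r + + 1) (+ 2 * s)} {n} (normal-syzygy N) n≤) (*-mono-≤′ (nonneg-sq (+ 2 * p)) 0≤D (*-mono-≤′ (1≤⇒0≤ (1≤p N)) (1≤⇒0≤ 1≤P₁) p≤ p≤) ≤-refl))))
    where
    A = hess (+ 2 * p) (+ 2 * q + + 1) (+ 2 * r + + 1)
    n≤ : n ≤ - A
    n≤ = subst (_≤ - A) (neg-involutive n) (neg-mono-≤ (<⇒≤ (≰⇒> ¬le)))

  ≤ᵇ-true : ∀ {m n} → (m ≤ᵇ n) ≡ true → m ℕ.≤ n
  ≤ᵇ-true {m} {n} h = ℕ.≤ᵇ⇒≤ m n (subst T (sym h) tt)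

  posPart-≥ : ∀ z {m} → m ℕ.≤ posPart z → m ≡ 0 ⊎ + m ≤ z
  posPart-≥ (+ n) h = inj₂ (+≤+ h)
  posPart-≥ -[1+ n ] z≤n = inj₁ refl

  posPart-cases : ∀ z → posPart z ≡ 0 ⊎ + posPart z ≡ z
  posPart-cases (+ n) = inj₂ refl
  posPart-cases -[1+ n ] = inj₁ refl

  posPart-≤ : ∀ z {m} → posPart z ℕ.≤ m → z ≤ + m
  posPart-≤ (+ n) h = +≤+ h
  posPart-≤ -[1+ n ] h = -≤+

  if-true : ∀ {b x} → (if b then x else false) ≡ true → b ≡ true × x ≡ true
  if-true {true} h = refl , h

  if-cases : ∀ {b x y : Bool} → (if b then x else y) ≡ true → (b ≡ true × x ≡ true) ⊎ y ≡ true
  if-cases {true} h = inj₁ (refl , h)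
  if-cases {false} h = inj₂ h

  ∨-true : ∀ {a b} → a ∨ b ≡ true → a ≡ true ⊎ b ≡ true
  ∨-true {true} h = inj₁ refl
  ∨-true {false} h = inj₂ h

  +-distrib-sq : ∀ n → + (n ℕ.* n) ≡ + n * + n
  +-distrib-sq n = pos-* n n

  module _ (X R bound fuel y : ℕ) .{{_ : ℕ.NonZero y}} where
    private
      Y = + y
      -- The factor `18 = 2 · 9` makes cells split evenly: even coefficients are doubled parameters,
      -- and these are counted in residue classes modulo 9.
      h = + 18 * Y
      h² = h * h
      1≤Y : + 1 ≤ Y
      1≤Y = +≤+ (ℕ.>-nonZero⁻¹ y)
      1≤h : + 1 ≤ h
      1≤h = pos-*′ {+ 18} (+≤+ (s≤s z≤n)) 1≤Y
      0≤h = 1≤⇒0≤ 1≤h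
      1≤h² : + 1 ≤ h²
      1≤h² = pos-*′ 1≤h 1≤h
      0≤h² = 1≤⇒0≤ 1≤h²

    coefA : ℤ → ℤ → ℤ → ℤ
    coefA p q r = hess (+ 2 * p) (+ 2 * q + + 1) (+ 2 * r + + 1)

    lead-scaled : ∀ {p₀ A₀ p q r} → + 0 ≤ + 2 * p → + p₀ * h ≤ + 2 * p → A₀ * h² ≤ coefA p q r → (+ (p₀ ℕ.* p₀) + + 3 * A₀) * h² ≤ + 2 * p * (+ 2 * p) + + 3 * coefA p q r
    lead-scaled {p₀} {A₀} {p} {q} {r} 0≤p lo loA = ≤-trans (≤-reflexive (trans (cong (λ w → (w + + 3 * A₀) * h²) (+-distrib-sq p₀)) (solve 3 (λ p A h → (p :* p :+ con (+ 3) :* A) :* (h :* h) := p :* h :* (p :* h) :+ con (+ 3) :* (A :* (h :* h))) refl (+ p₀) A₀ h)))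
        (+-mono-≤ (*-mono-≤′ (nonneg-* {+ p₀} (+≤+ z≤n) 0≤h) 0≤p lo lo) (*-mono-≤-3 loA))
      where
      *-mono-≤-3 : ∀ {x y} → x ≤ y → + 3 * x ≤ + 3 * y
      *-mono-≤-3 {x} {y} h = ≤-by-diff (+ 3 * (y - x)) (nonneg-scale 3 (≤⇒nonneg h)) (solve 2 (λ x y → con (+ 3) :* y :- con (+ 3) :* x := con (+ 3) :* (y :- x)) refl x y)

    GridForm : ℕ → ℕ → ℤ → ℕ → Set
    GridForm p₀ p₁ A₀ D = ∃[ p ] ∃[ q ] ∃[ r ] ∃[ s ] (Normal (+ D) p q r s × + D < + X * (h² * h²) × + p₀ * h ≤ + 2 * p × + 2 * p < + p₁ * h
      × A₀ * h² ≤ coefA p q r × ∃[ κ ] (κ ∈ goodClasses × InClass 9 3 κ p q r s))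

    GridCell : ℕ → ℕ → ℤ → ℤ → ℕ → Set
    GridCell p₀ p₁ A₀ A₁ D = ∃[ p ] ∃[ q ] ∃[ r ] ∃[ s ] (Normal (+ D) p q r s × + D < + X * (h² * h²) × + p₀ * h ≤ + 2 * p × + 2 * p < + p₁ * h
      × A₀ * h² ≤ coefA p q r × coefA p q r < A₁ * h² × ∃[ κ ] (κ ∈ goodClasses × InClass 9 3 κ p q r s))

    module _ {p₀ p₁ : ℕ} {A₀ A₁ : ℤ} {Δ g W ρ : ℕ} (1≤p₀ : 1 ℕ.≤ p₀) (p₀<p₁ : p₀ ℕ.< p₁) (ok : cellOK X R bound fuel p₀ p₁ A₀ A₁ Δ g W ρ ≡ true) where
      private
        e₁ = ∧-true {(Δ ≤ᵇ posPart (+ (p₀ ℕ.* p₀) + + 3 * A₀) ℕ.* posPart (+ (p₀ ℕ.* p₀) + + 3 * A₀)) ∨ (Δ ℕ.* (p₁ ℕ.* p₁) ≤ᵇ 4 ℕ.* (posPart (- A₁) ℕ.* posPart (- A₁) ℕ.* posPart (- A₁)))} ok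
        e₂ = ∧-true {g ℕ.* g ≤ᵇ posPart (+ 4 * (A₀ * A₀ * A₀) + + Δ * + (p₀ ℕ.* p₀))} (proj₂ e₁)
        e₃ = ∧-true {X ≤ᵇ W ℕ.* (2 ℕ.* g ℕ.+ p₀ ℕ.* p₀ ℕ.* W) ℕ.+ Δ} (proj₂ e₂)
        e₄ = ∧-true {posPart (+ 3 * (A₁ - A₀)) ≤ᵇ ρ ℕ.* p₀} (proj₂ e₃)
        e₅ = ∧-true {1 ≤ᵇ W} (proj₂ e₄)
        1≤W : 1 ℕ.≤ W
        1≤W = ≤ᵇ-true {1} {W} (proj₁ e₅)
        1≤ρ : 1 ℕ.≤ ρ
        1≤ρ = ≤ᵇ-true {1} {ρ} (proj₂ e₅)

        cell : Cell
        cell = record { P₀ = + p₀ * h ; P₁ = + p₁ * h ; A₀ = A₀ * h² ; A₁ = A₁ * h² ; Δ = + Δ * (h² * h²) ; γ = + g * (h * h²) ; X = + X * (h² * h²) }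

        0≤P₀ : + 0 ≤ + p₀ * h
        0≤P₀ = nonneg-* {+ p₀} (+≤+ z≤n) 0≤h

        scale-≤ : ∀ {a b c} → + 0 ≤ c → a ≤ b → a * c ≤ b * c
        scale-≤ {a} {b} {c} 0≤c a≤b = ≤-by-diff ((b - a) * c) (nonneg-* (≤⇒nonneg a≤b) 0≤c) (solve 3 (λ a b c → b :* c :- a :* c := (b :- a) :* c) refl a b c)

        module _ {D : ℕ} {p q r s : ℤ} (N : Normal (+ D) p q r s) (lo : + p₀ * h ≤ + 2 * p) (hi : + 2 * p < + p₁ * h) (loA : A₀ * h² ≤ coefA p q r) (hiA : coefA p q r < A₁ * h²) where
          A = coefA p q r
          G = gForm (+ 2 * p) (+ 2 * q + + 1) (+ 2 * r + + 1) (+ 2 * s)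
          syz : G * G ≡ + 4 * (A * A * A) + + 2 * p * (+ 2 * p) * + D
          syz = normal-syzygy N
          0≤p : + 0 ≤ + 2 * p
          0≤p = 1≤⇒0≤ (1≤p N)
          d-scaled : (+ (p₀ ℕ.* p₀) + + 3 * A₀) * h² ≤ + 2 * p * (+ 2 * p) + + 3 * A
          d-scaled = lead-scaled {p₀} {A₀} {p} {q} {r} 0≤p lo loA
          Δ≡0⇒ : Δ ≡ 0 → + Δ * (h² * h²) ≤ + D
          Δ≡0⇒ Δ≡0 = ≤-trans (≤-reflexive (trans (cong (λ w → + w * (h² * h²)) Δ≡0) (*-zeroˡ (h² * h²)))) (+≤+ z≤n)
          by-bound : Δ ℕ.≤ posPart (+ (p₀ ℕ.* p₀) + + 3 * A₀) ℕ.* posPart (+ (p₀ ℕ.* p₀) + + 3 * A₀) → + Δ * (h² * h²) ≤ + D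
          by-bound le = [ (λ z → Δ≡0⇒ (ℕ.n≤0⇒n≡0 (subst (λ w → Δ ℕ.≤ w ℕ.* w) z le))) , square-case ]′ (posPart-cases (+ (p₀ ℕ.* p₀) + + 3 * A₀))
            where
            d = posPart (+ (p₀ ℕ.* p₀) + + 3 * A₀)
            square-case : + d ≡ + (p₀ ℕ.* p₀) + + 3 * A₀ → + Δ * (h² * h²) ≤ + D
            square-case d≡ = ≤-trans (scale-≤ {+ Δ} {+ d * + d} (nonneg-sq h²) (≤-trans (+≤+ le) (≤-reflexive (pos-* d d)))) (≤-trans (≤-reflexive (solve 2 (λ d h → d :* d :* (h :* h) := d :* h :* (d :* h)) refl (+ d) h²))
              (bounded⇒Δ≤D {+ D} {+ 2 * p} {A} {+ d * h²} (Normal.bound N) (nonneg-* {+ d} (+≤+ z≤n) 0≤h²) (≤-trans (≤-reflexive (cong (_* h²) d≡)) d-scaled)))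
          by-negative : Δ ℕ.* (p₁ ℕ.* p₁) ℕ.≤ 4 ℕ.* (posPart (- A₁) ℕ.* posPart (- A₁) ℕ.* posPart (- A₁)) → + Δ * (h² * h²) ≤ + D
          by-negative le with posPart-cases (- A₁)
          ... | inj₁ z = Δ≡0⇒ Δ≡0
            where
            product≡0 : Δ ℕ.* (p₁ ℕ.* p₁) ≡ 0
            product≡0 = ℕ.n≤0⇒n≡0 (subst (λ w → Δ ℕ.* (p₁ ℕ.* p₁) ℕ.≤ 4 ℕ.* (w ℕ.* w ℕ.* w)) z le)
            1≤p₁ : 1 ℕ.≤ p₁
            1≤p₁ = ℕ.≤-trans (s≤s z≤n) p₀<p₁
            Δ≡0 : Δ ≡ 0
            Δ≡0 = ℕ.m*n≡0⇒m≡0 Δ (p₁ ℕ.* p₁) {{ℕ.m*n≢0 p₁ p₁ {{ℕ.>-nonZero 1≤p₁}} {{ℕ.>-nonZero 1≤p₁}}}} product≡0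
          ... | inj₂ n≡ = negative-A⇒Δ≤D {+ D} {+ 2 * p} {A} {G} {+ n * h²} {+ p₁ * h} {+ Δ * (h² * h²)} syz n≤ (+≤+ z≤n) 0≤p (<⇒≤ hi) (pos-*′ (+≤+ (ℕ.≤-trans (s≤s z≤n) p₀<p₁)) 1≤h) scaled
            where
            n = posPart (- A₁)
            n≤ : + n * h² ≤ - A
            n≤ = ≤-trans (≤-reflexive (trans (cong (_* h²) n≡) (sym (neg-distribˡ-* A₁ h²)))) (neg-mono-≤ (<⇒≤ hiA))
            leℤ : + Δ * (+ p₁ * + p₁) ≤ + 4 * (+ n * + n * + n)
            leℤ = subst₂ _≤_ (trans (pos-* Δ (p₁ ℕ.* p₁)) (cong (λ w → + Δ * w) (pos-* p₁ p₁))) (trans (pos-* 4 (n ℕ.* n ℕ.* n)) (cong (λ w → + 4 * w) (trans (pos-* (n ℕ.* n) n) (cong (_* + n) (pos-* n n))))) (+≤+ le)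
            scaled : + Δ * (h² * h²) * (+ p₁ * h * (+ p₁ * h)) ≤ + 4 * (+ n * h² * (+ n * h²) * (+ n * h²))
            scaled = ≤-trans (≤-reflexive (solve 3 (λ Δ p h → Δ :* (h :* h :* (h :* h)) :* (p :* h :* (p :* h)) := Δ :* (p :* p) :* (h :* h :* (h :* h) :* (h :* h))) refl (+ Δ) (+ p₁) h))
              (≤-trans (scale-≤ (nonneg-* (nonneg-sq h²) 0≤h²) leℤ) (≤-reflexive (solve 2 (λ n h → con (+ 4) :* (n :* n :* n) :* (h :* h :* h) := con (+ 4) :* (n :* h :* (n :* h) :* (n :* h))) refl (+ n) h²)))
          Δ-valid : + Δ * (h² * h²) ≤ + D
          Δ-valid = [ (λ b → by-bound (≤ᵇ-true b)) , (λ b → by-negative (≤ᵇ-true b)) ]′ (∨-true {Δ ≤ᵇ posPart (+ (p₀ ℕ.* p₀) + + 3 * A₀) ℕ.* posPart (+ (p₀ ℕ.* p₀) + + 3 * A₀)} (proj₁ e₁))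
          γ≤G′ : + g * (h * h²) ≤ G
          γ≤G′ = from (posPart-≥ (+ 4 * (A₀ * A₀ * A₀) + + Δ * + (p₀ ℕ.* p₀)) (≤ᵇ-true {g ℕ.* g} (proj₁ e₂)))
            where
            from : g ℕ.* g ≡ 0 ⊎ + (g ℕ.* g) ≤ + 4 * (A₀ * A₀ * A₀) + + Δ * + (p₀ ℕ.* p₀) → + g * (h * h²) ≤ G
            from (inj₁ z) = ≤-trans (≤-reflexive (trans (cong (λ w → + w * (h * h²)) ([ (λ e → e) , (λ e → e) ]′ (ℕ.m*n≡0⇒m≡0∨n≡0 g z))) (*-zeroˡ (h * h²)))) (Normal.0≤G N)
            from (inj₂ le) = γ-valid {+ D} {+ 2 * p} {A} {G} {+ p₀ * h} {A₀ * h²} {+ Δ * (h² * h²)} {+ g * (h * h²)} syz (Normal.0≤G N) loA 0≤P₀ lo (nonneg-* {+ Δ} (+≤+ z≤n) (nonneg-sq h²)) Δ-valid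
              (≤-trans (≤-reflexive (trans (solve 2 (λ g h → g :* (h :* (h :* h)) :* (g :* (h :* (h :* h))) := g :* g :* (h :* h :* (h :* h) :* (h :* h))) refl (+ g) h) (cong (_* (h² * h² * h²)) (sym (pos-* g g)))))
                (≤-trans (scale-≤ (nonneg-* (nonneg-sq h²) 0≤h²) le) (≤-reflexive (trans (cong (λ w → (+ 4 * (A₀ * A₀ * A₀) + + Δ * w) * (h² * h² * h²)) (pos-* p₀ p₀))
                  (solve 4 (λ A Δ p h → (con (+ 4) :* (A :* A :* A) :+ Δ :* (p :* p)) :* (h :* h :* (h :* h) :* (h :* h)) := con (+ 4) :* (A :* (h :* h) :* (A :* (h :* h)) :* (A :* (h :* h))) :+ Δ :* (h :* h :* (h :* h)) :* (p :* h :* (p :* h))) refl A₀ (+ Δ) (+ p₀) h)))))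

        np = (p₁ ℕ.∸ p₀) ℕ.* y
        nq = 3 ℕ.* p₁ ℕ.* y
        nr = ρ ℕ.* y
        ns = W ℕ.* y
        instance
          np≢0 : ℕ.NonZero np
          np≢0 = ℕ.m*n≢0 (p₁ ℕ.∸ p₀) y {{ℕ.>-nonZero (ℕ.m<n⇒0<n∸m p₀<p₁)}}
          nq≢0 : ℕ.NonZero nq
          nq≢0 = ℕ.m*n≢0 (3 ℕ.* p₁) y {{ℕ.m*n≢0 3 p₁ {{_}} {{ℕ.>-nonZero (ℕ.≤-trans (s≤s z≤n) p₀<p₁)}}}}
          nr≢0 : ℕ.NonZero nr
          nr≢0 = ℕ.m*n≢0 ρ y {{ℕ.>-nonZero 1≤ρ}}
          ns≢0 : ℕ.NonZero ns
          ns≢0 = ℕ.m*n≢0 W y {{ℕ.>-nonZero 1≤W}}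

        hp : + p₁ * h - + p₀ * h ≤ + 2 * (+ 9 * + np)
        hp = ≤-reflexive (trans (cong (λ w → w * h - + p₀ * h) (cong +_ (sym (ℕ.m∸n+n≡m (ℕ.<⇒≤ p₀<p₁))))) (trans (solve 3 (λ d p Y → (d :+ p) :* (con (+ 18) :* Y) :- p :* (con (+ 18) :* Y) := con (+ 2) :* (con (+ 9) :* (d :* Y))) refl (+ (p₁ ℕ.∸ p₀)) (+ p₀) Y) (cong (λ w → + 2 * (+ 9 * w)) (sym (pos-* (p₁ ℕ.∸ p₀) y)))))
        hq : + p₁ * h ≤ + 2 * (+ 3 * + nq)
        hq = ≤-reflexive (trans (solve 2 (λ p Y → p :* (con (+ 18) :* Y) := con (+ 2) :* (con (+ 3) :* (con (+ 3) :* p :* Y))) refl (+ p₁) Y) (cong (λ w → + 2 * (+ 3 * w)) (sym (trans (pos-* (3 ℕ.* p₁) y) (cong (_* Y) (pos-* 3 p₁))))))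
        hr : A₁ * h² - A₀ * h² ≤ + p₀ * h * (+ 2 * (+ 3 * + nr))
        hr = ≤-trans (≤-by-diff ((+ ρ * + p₀ - + 3 * (A₁ - A₀)) * (+ 6 * Y * h)) (nonneg-* (≤⇒nonneg leℤ) (nonneg-* (nonneg-scale 6 (1≤⇒0≤ 1≤Y)) 0≤h))
            (solve 5 (λ a b ρ p Y → let h = con (+ 18) :* Y in p :* h :* (con (+ 2) :* (con (+ 3) :* (ρ :* Y))) :- (a :* (h :* h) :- b :* (h :* h)) := (ρ :* p :- con (+ 3) :* (a :- b)) :* (con (+ 6) :* Y :* h)) refl A₁ A₀ (+ ρ) (+ p₀) Y))
            (≤-reflexive (cong (λ w → + p₀ * h * (+ 2 * (+ 3 * w))) (sym (pos-* ρ y))))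
          where
          leℤ : + 3 * (A₁ - A₀) ≤ + ρ * + p₀
          leℤ = ≤-trans (posPart-≤ (+ 3 * (A₁ - A₀)) (≤ᵇ-true (proj₁ e₄))) (≤-reflexive (pos-* ρ p₀))
        hs : + X * (h² * h²) - + Δ * (h² * h²) ≤ + W * h * (+ 2 * (+ g * (h * h²)) + + p₀ * h * (+ p₀ * h) * (+ W * h))
        hs = ≤-by-diff ((+ W * (+ 2 * + g + + p₀ * + p₀ * + W) + + Δ - + X) * (h² * h²)) (nonneg-* (≤⇒nonneg leℤ) (nonneg-sq h²))
            (solve 6 (λ X Δ W g p h → W :* h :* (con (+ 2) :* (g :* (h :* (h :* h))) :+ p :* h :* (p :* h) :* (W :* h)) :- (X :* (h :* h :* (h :* h)) :- Δ :* (h :* h :* (h :* h))) := (W :* (con (+ 2) :* g :+ p :* p :* W) :+ Δ :- X) :* (h :* h :* (h :* h))) refl (+ X) (+ Δ) (+ W) (+ g) (+ p₀) h)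
          where
          leℤ : + X ≤ + W * (+ 2 * + g + + p₀ * + p₀ * + W) + + Δ
          leℤ = ≤-trans (+≤+ (≤ᵇ-true (proj₁ e₃))) (≤-reflexive (cong (_+ + Δ) (trans (pos-* W (2 ℕ.* g ℕ.+ p₀ ℕ.* p₀ ℕ.* W)) (cong (λ w → + W * w) (cong₂ _+_ (pos-* 2 g) (trans (pos-* (p₀ ℕ.* p₀) W) (cong (_* + W) (pos-* p₀ p₀))))))))
        hW : + W * h ≤ + 2 * (+ 9 * + ns)
        hW = ≤-reflexive (trans (solve 2 (λ W Y → W :* (con (+ 18) :* Y) := con (+ 2) :* (con (+ 9) :* (W :* Y))) refl (+ W) Y) (cong (λ w → + 2 * (+ 9 * w)) (sym (pos-* W y))))

      -- Besides the 576 classes, 1728 contains the 3 of `nq`: `q` moves in steps of `2 · 3` within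
      -- a length measured in units of 18. The corresponding 3 for `r` is part of `ρ`.
      cell-sound : AtMost (GridCell p₀ p₁ A₀ A₁) ((p₁ ℕ.∸ p₀) ℕ.* (p₁ ℕ.* (ρ ℕ.* W)) ℕ.* (y ℕ.* y ℕ.* (y ℕ.* y)) ℕ.* 1728)
      cell-sound = atMost-map member (ℕ.≤-reflexive (trans (cong (ℕ._* (np ℕ.* (nq ℕ.* (nr ℕ.* ns)))) goodClasses-length) (count (p₁ ℕ.∸ p₀) p₁ ρ W y)))
        (atMost-family goodClasses (λ κ → cell-count cell 9 3 κ np nq nr ns (+ W * h) (pos-*′ (+≤+ 1≤p₀) 1≤h) (nonneg-* {+ g} (+≤+ z≤n) (nonneg-* 0≤h 0≤h²)) (nonneg-* {+ W} (+≤+ z≤n) 0≤h) hp hq hr hs hW))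
        where
        member : ∀ {D} → GridCell p₀ p₁ A₀ A₁ D → ∃[ κ ] (κ ∈ goodClasses × Members cell 9 3 κ D)
        member (p , q , r , s , N , D<X , lo , hi , loA , hiA , κ , κ∈ , cl) = κ , κ∈ , p , q , r , s , N ,
          record { D<X = D<X ; P₀≤p = lo ; p<P₁ = hi ; A₀≤A = loA ; A<A₁ = hiA ; Δ≤D = Δ-valid N lo hi loA hiA ; γ≤G = γ≤G′ N lo hi loA hiA } , cl
        count : ∀ d p ρ W y → 576 ℕ.* (d ℕ.* y ℕ.* (3 ℕ.* p ℕ.* y ℕ.* (ρ ℕ.* y ℕ.* (W ℕ.* y)))) ≡ d ℕ.* (p ℕ.* (ρ ℕ.* W)) ℕ.* (y ℕ.* y ℕ.* (y ℕ.* y)) ℕ.* 1728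
        count = ℕRing.solve-∀

    y⁴ : ℕ
    y⁴ = y ℕ.* y ℕ.* (y ℕ.* y)

    -- `δ` is the cost that a stretch of the computation adds to `acc` before it calls the
    -- continuation `k`.
    Sound : (ℕ → Set) → ℕ → (ℕ → Bool) → Set
    Sound P acc k = ∃[ δ ] (k (acc ℕ.+ δ) ≡ true × AtMost P (δ ℕ.* y⁴ ℕ.* 1728))

    sound-⊎ : ∀ {P Q S : ℕ → Set} {acc k} δ → (∀ {D} → S D → P D ⊎ Q D) → AtMost P (δ ℕ.* y⁴ ℕ.* 1728) → Sound Q (acc ℕ.+ δ) k → Sound S acc k
    sound-⊎ {acc = acc} {k} δ f hP (ε , t , hQ) = δ ℕ.+ ε , trans (cong k (sym (ℕ.+-assoc acc δ ε))) t , atMost-map f (ℕ.≤-reflexive (distrib δ ε y⁴)) (atMost-⊎ hP hQ)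
      where
      distrib : ∀ a b c → a ℕ.* c ℕ.* 1728 ℕ.+ b ℕ.* c ℕ.* 1728 ≡ (a ℕ.+ b) ℕ.* c ℕ.* 1728
      distrib = ℕRing.solve-∀

    sound-∅ : ∀ {P : ℕ → Set} {acc k} → (∀ {D} → ¬ P D) → k acc ≡ true → Sound P acc k
    sound-∅ {acc = acc} {k} f t = 0 , trans (cong k (ℕ.+-identityʳ acc)) t , atMost-∅ f

    module _ (X≤R² : + X ≤ + R * + R) where
      RowSound : ℕ → Set
      RowSound n = ∀ p₀ p₁ st A₀ g W acc k → 1 ℕ.≤ p₀ → p₀ ℕ.< p₁ → row X R bound fuel n p₀ p₁ st A₀ g W acc k ≡ true → Sound (GridForm p₀ p₁ A₀) acc k

      row-check-sound : ∀ n → RowSound n → ∀ p₀ p₁ st A₀ g W acc k A₁ Δ ρ → 1 ℕ.≤ p₀ → p₀ ℕ.< p₁ → row-check X R bound fuel n p₀ p₁ st A₀ g W acc k A₁ Δ ρ ≡ true → Sound (GridForm p₀ p₁ A₀) acc k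
      row-check-sound n rec p₀ p₁ st A₀ g W acc k A₁ Δ ρ 1≤p₀ p₀<p₁ t =
        sound-⊎ {GridCell p₀ p₁ A₀ A₁} {GridForm p₀ p₁ A₁} {k = k} ((p₁ ℕ.∸ p₀) ℕ.* (p₁ ℕ.* (ρ ℕ.* W))) split (cell-sound {p₀} {p₁} {A₀} {A₁} {Δ} {g} {W} {ρ} 1≤p₀ p₀<p₁ (proj₁ (∧-true {cellOK X R bound fuel p₀ p₁ A₀ A₁ Δ g W ρ} (proj₁ checks))))
          (rec p₀ p₁ st A₁ g W (acc ℕ.+ (p₁ ℕ.∸ p₀) ℕ.* (p₁ ℕ.* (ρ ℕ.* W))) k 1≤p₀ p₀<p₁ (proj₂ checks))
        where
        checks = if-true {cellOK X R bound fuel p₀ p₁ A₀ A₁ Δ g W ρ ∧ (acc ≤ᵇ bound)} t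
        split : ∀ {D} → GridForm p₀ p₁ A₀ D → GridCell p₀ p₁ A₀ A₁ D ⊎ GridForm p₀ p₁ A₁ D
        split (p , q , r , s , N , D<X , lo , hi , loA , cl) with A₁ * h² ≤? coefA p q r
        ... | yes le = inj₂ (p , q , r , s , N , D<X , lo , hi , le , cl)
        ... | no ¬le = inj₁ (p , q , r , s , N , D<X , lo , hi , loA , ≰⇒> ¬le , cl)

      row-ρ-sound : ∀ n → RowSound n → ∀ p₀ p₁ st A₀ g W acc k A₁ Δ → 1 ℕ.≤ p₀ → p₀ ℕ.< p₁ → row-ρ X R bound fuel n p₀ p₁ st A₀ g W acc k A₁ Δ ≡ true → Sound (GridForm p₀ p₁ A₀) acc k
      row-ρ-sound n rec p₀ p₁ st A₀ g W acc k A₁ Δ 1≤p₀ p₀<p₁ t = row-check-sound n rec p₀ p₁ st A₀ g W acc k A₁ Δ (suc (quot (posPart (+ 3 * (A₁ - A₀))) p₀)) 1≤p₀ p₀<p₁ t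

      row-W-sound : ∀ n → RowSound n → ∀ p₀ p₁ st A₀ g W acc k A₁ Δ → 1 ℕ.≤ p₀ → p₀ ℕ.< p₁ → row-W X R bound fuel n p₀ p₁ st A₀ g W acc k A₁ Δ ≡ true → Sound (GridForm p₀ p₁ A₀) acc k
      row-W-sound n rec p₀ p₁ st A₀ g W acc k A₁ Δ 1≤p₀ p₀<p₁ t = row-ρ-sound n rec p₀ p₁ st A₀ g (newtonWidth 4 (p₀ ℕ.* p₀) g (X ℕ.∸ Δ) W) acc k A₁ Δ 1≤p₀ p₀<p₁ t

      row-g-sound : ∀ n → RowSound n → ∀ p₀ p₁ st A₀ g W acc k A₁ Δ v → 1 ℕ.≤ p₀ → p₀ ℕ.< p₁ → row-g X R bound fuel n p₀ p₁ st A₀ g W acc k A₁ Δ v ≡ true → Sound (GridForm p₀ p₁ A₀) acc k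
      row-g-sound n rec p₀ p₁ st A₀ g W acc k A₁ Δ v 1≤p₀ p₀<p₁ t = row-W-sound n rec p₀ p₁ st A₀ (quot v (newtonSqrt 4 v (if g ≤ᵇ 0 then p₀ ℕ.* R else g))) W acc k A₁ Δ 1≤p₀ p₀<p₁ t

      row-Δ-sound : ∀ n → RowSound n → ∀ p₀ p₁ st A₀ g W acc k A₁ Δ → 1 ℕ.≤ p₀ → p₀ ℕ.< p₁ → row-Δ X R bound fuel n p₀ p₁ st A₀ g W acc k A₁ Δ ≡ true → Sound (GridForm p₀ p₁ A₀) acc k
      row-Δ-sound n rec p₀ p₁ st A₀ g W acc k A₁ Δ 1≤p₀ p₀<p₁ t = row-g-sound n rec p₀ p₁ st A₀ g W acc k A₁ Δ (posPart (+ 4 * (A₀ * A₀ * A₀) + + Δ * + (p₀ ℕ.* p₀))) 1≤p₀ p₀<p₁ t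

      row-stop-sound : ∀ n → RowSound n → ∀ p₀ p₁ st A₀ g W acc k d A₁ → d ≡ + (p₀ ℕ.* p₀) + + 3 * A₀ → 1 ℕ.≤ p₀ → p₀ ℕ.< p₁ → row-stop X R bound fuel n p₀ p₁ st A₀ g W acc k d A₁ ≡ true → Sound (GridForm p₀ p₁ A₀) acc k
      row-stop-sound n rec p₀ p₁ st A₀ g W acc k d A₁ d≡ 1≤p₀ p₀<p₁ t =
          [ (λ (b , t′) → sound-∅ {k = k} (empty b) t′) , row-Δ-sound n rec p₀ p₁ st A₀ g W acc k A₁ (max (posPart d ℕ.* posPart d) (quot (4 ℕ.* (posPart (- A₁) ℕ.* posPart (- A₁) ℕ.* posPart (- A₁))) (p₁ ℕ.* p₁))) 1≤p₀ p₀<p₁ ]′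
          (if-cases {(+ R) ℤ.≤ᵇ d} {k acc} {row-Δ X R bound fuel n p₀ p₁ st A₀ g W acc k A₁ (max (posPart d ℕ.* posPart d) (quot (4 ℕ.* (posPart (- A₁) ℕ.* posPart (- A₁) ℕ.* posPart (- A₁))) (p₁ ℕ.* p₁)))} t)
        where
        empty : ((+ R) ℤ.≤ᵇ d) ≡ true → ∀ {D} → ¬ GridForm p₀ p₁ A₀ D
        empty b {D} (p , q , r , s , N , D<X , lo , hi , loA , _) = <⇒≱ D<X (≤-trans (≤-trans (*-mono-≤′ {+ X} {+ R * + R} (+≤+ z≤n) (nonneg-sq h²) X≤R² ≤-refl) (≤-reflexive (solve 2 (λ R h → R :* R :* (h :* h) := R :* h :* (R :* h)) refl (+ R) h²)))
          (bounded⇒Δ≤D {+ D} {+ 2 * p} {coefA p q r} {+ R * h²} (Normal.bound N) (nonneg-* {+ R} (+≤+ z≤n) 0≤h²) (≤-trans (*-mono-≤′ {+ R} {d} {h²} (+≤+ z≤n) 0≤h² (≤ᵇ⇒≤ {+ R} {d} (subst T (sym b) tt)) ≤-refl) (subst (λ w → w * h² ≤ + 2 * p * (+ 2 * p) + + 3 * coefA p q r) (sym d≡) (lead-scaled {p₀} {A₀} {p} {q} {r} (1≤⇒0≤ (1≤p N)) lo loA)))))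

      row-sound : ∀ n → RowSound n
      row-sound (suc n) p₀ p₁ st A₀ g W acc k 1≤p₀ p₀<p₁ t = row-stop-sound n (row-sound n) p₀ p₁ st A₀ g W acc k (+ (p₀ ℕ.* p₀) + + 3 * A₀) (A₀ + + quot (max st ∣ A₀ ∣) 24) refl 1≤p₀ p₀<p₁ t

      GridRange : ℕ → ℕ → ℕ → Set
      GridRange p₀ p₁ D = ∃[ p ] ∃[ q ] ∃[ r ] ∃[ s ] (Normal (+ D) p q r s × + D < + X * (h² * h²) × + p₀ * h ≤ + 2 * p × + 2 * p < + p₁ * h × ∃[ κ ] (κ ∈ goodClasses × InClass 9 3 κ p q r s))

      rowFrom-sound : ∀ p₀ p₁ st acc k → rowFrom X R bound fuel p₀ p₁ st acc k ≡ true → Sound (GridRange p₀ p₁) acc k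
      rowFrom-sound p₀ p₁ st acc k t = result (row-sound fuel p₀ p₁ st (- (+ st)) 0 (suc (quot R p₀)) acc k 1≤p₀ p₀<p₁ (proj₂ checks))
        where
        checks = if-true {(1 ≤ᵇ p₀) ∧ (suc p₀ ≤ᵇ p₁) ∧ (p₁ ℕ.* p₁ ℕ.* X ≤ᵇ 4 ℕ.* (st ℕ.* st ℕ.* st))} {row X R bound fuel fuel p₀ p₁ st (- (+ st)) 0 (suc (quot R p₀)) acc k} t
        c₁ = ∧-true {1 ≤ᵇ p₀} (proj₁ checks)
        c₂ = ∧-true {suc p₀ ≤ᵇ p₁} (proj₂ c₁)
        1≤p₀ : 1 ℕ.≤ p₀
        1≤p₀ = ≤ᵇ-true {1} {p₀} (proj₁ c₁)
        p₀<p₁ : p₀ ℕ.< p₁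
        p₀<p₁ = ≤ᵇ-true {suc p₀} {p₁} (proj₁ c₂)
        leℤ : + p₁ * + p₁ * + X ≤ + 4 * (+ st * + st * + st)
        leℤ = subst₂ _≤_ (trans (pos-* (p₁ ℕ.* p₁) X) (cong (_* + X) (pos-* p₁ p₁))) (trans (pos-* 4 (st ℕ.* st ℕ.* st)) (cong (λ w → + 4 * w) (trans (pos-* (st ℕ.* st) st) (cong (_* + st) (pos-* st st))))) (+≤+ (≤ᵇ-true (proj₂ c₂)))
        cover : ∀ {D} → GridRange p₀ p₁ D → GridForm p₀ p₁ (- (+ st)) D
        cover {D} (p , q , r , s , N , D<X , lo , hi , cl) = p , q , r , s , N , D<X , lo , hi ,
          subst (_≤ coefA p q r) (neg-distribˡ-* (+ st) h²) (A-lower {+ D} {p} {q} {r} {s} {+ p₁ * h} {+ X * (h² * h²)} {+ st * h²} N (+≤+ z≤n) D<X (<⇒≤ hi) (pos-*′ (+≤+ (ℕ.≤-trans (s≤s z≤n) p₀<p₁)) 1≤h)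
            (≤-trans (≤-reflexive (solve 3 (λ p X h → p :* h :* (p :* h) :* (X :* (h :* h :* (h :* h))) := p :* p :* X :* (h :* h :* (h :* h) :* (h :* h))) refl (+ p₁) (+ X) h))
              (≤-trans (*-mono-≤′ (nonneg-* (nonneg-sq (+ p₁)) (+≤+ z≤n)) (nonneg-* (nonneg-sq h²) 0≤h²) leℤ ≤-refl) (≤-reflexive (solve 2 (λ n h → con (+ 4) :* (n :* n :* n) :* (h :* h :* h) := con (+ 4) :* (n :* h :* (n :* h) :* (n :* h))) refl (+ st) h²))))) , cl
        result : Sound (GridForm p₀ p₁ (- (+ st))) acc k → Sound (GridRange p₀ p₁) acc k
        result (δ , t , at) = δ , t , atMost-map cover ℕ.≤-refl at

      Covered : List ℕ → ℕ → Set
      Covered [] D = ⊥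
      Covered (c₀ ∷ []) D = ⊥
      Covered (c₀ ∷ c₁ ∷ cs) D = GridRange (c₀ ℕ.* c₀ ℕ.* c₀) (c₁ ℕ.* c₁ ℕ.* c₁) D ⊎ Covered (c₁ ∷ cs) D

      rows-sound : ∀ cs acc k → rows X R bound fuel cs acc k ≡ true → Sound (Covered cs) acc k
      rows-sound (c₀ ∷ []) acc k t = sound-∅ {k = k} (λ ()) t
      rows-sound (c₀ ∷ c₁ ∷ cs) acc k t = go (λ acc → rows-sound (c₁ ∷ cs) acc k) (rowFrom-sound (c₀ ℕ.* c₀ ℕ.* c₀) (c₁ ℕ.* c₁ ℕ.* c₁) (c₁ ℕ.* c₁ ℕ.* 2 ℕ.^ 86) acc (λ acc → rows X R bound fuel (c₁ ∷ cs) acc k) t)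
        where
        go : (∀ acc → rows X R bound fuel (c₁ ∷ cs) acc k ≡ true → Sound (Covered (c₁ ∷ cs)) acc k) → Sound (GridRange (c₀ ℕ.* c₀ ℕ.* c₀) (c₁ ℕ.* c₁ ℕ.* c₁)) acc (λ acc → rows X R bound fuel (c₁ ∷ cs) acc k) → Sound (Covered (c₀ ∷ c₁ ∷ cs)) acc k
        go rec (δ , t′ , at) = sound-⊎ {k = k} δ (λ x → x) at (rec (acc ℕ.+ δ) t′)

      covered : ∀ c cs {D} → GridRange (c ℕ.* c ℕ.* c) (cubeLast (c ∷ cs)) D → Covered (c ∷ cs) D
      covered c [] (p , q , r , s , N , D<X , lo , hi , cl) = <⇒≱ hi lo
      covered c (c₁ ∷ cs) (p , q , r , s , N , D<X , lo , hi , cl) with + (c₁ ℕ.* c₁ ℕ.* c₁) * h ≤? + 2 * p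
      ... | yes le = inj₂ (covered c₁ cs (p , q , r , s , N , D<X , le , hi , cl))
      ... | no ¬le = inj₁ (p , q , r , s , N , D<X , lo , ≰⇒> ¬le , cl)

-- Dyadic estimates near the cusp

module Cusp where

  open import Data.Nat as ℕ using (ℕ; zero; suc; z≤n; s≤s; _/_)
  import Data.Nat.Properties as ℕ
  import Data.Nat.DivMod as ℕ
  import Data.Nat.Tactic.RingSolver as ℕRing
  open import Data.Integer hiding (suc; _/_)
  open import Data.Integer.Properties
  open import Data.Integer.DivMod using (n%ℕd<d)
  open import Data.Integer.Solver
  open import Data.Product using (∃-syntax; _×_; _,_)
  open import Data.Sum using (_⊎_; inj₁; inj₂)
  open import Data.Empty using (⊥)
  open import Relation.Nullary using (yes; no)
  open import Relation.Binary.PropositionalEquality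
  open IntegerOrder
  open CubicForm
  open Cells
  open NormalForms
  open Grid using (fifth)
  open GridSound
  open +-*-Solver hiding (Normal; normalise)

  ceilDiv : (m n : ℕ) .{{_ : ℕ.NonZero n}} → ∃[ c ] (ℕ.NonZero c × m ℕ.≤ n ℕ.* c × (n ℕ.≤ m → n ℕ.* c ℕ.≤ 2 ℕ.* m))
  ceilDiv m n = suc (m / n) , _ , lower , upper
    where
    lower : m ℕ.≤ n ℕ.* suc (m / n)
    lower = ℕ.≤-trans (ℕ.≤-reflexive (ℕ.m≡m%n+[m/n]*n m n)) (ℕ.≤-trans (ℕ.+-monoˡ-≤ (m / n ℕ.* n) (ℕ.<⇒≤ (ℕ.m%n<n m n))) (ℕ.≤-reflexive (ℕ.*-comm (suc (m / n)) n)))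
    upper : n ℕ.≤ m → n ℕ.* suc (m / n) ℕ.≤ 2 ℕ.* m
    upper n≤m = ℕ.≤-trans (ℕ.≤-reflexive (ℕ.*-comm n (suc (m / n)))) (ℕ.≤-trans (ℕ.+-mono-≤ n≤m (ℕ.m/n*n≤m m n)) (ℕ.≤-reflexive (cong (m ℕ.+_) (sym (ℕ.+-identityʳ m)))))

  -- With `w = 16ρ²`, the condition `w ≤ e` is what makes `-ρ²e⁴` a lower limit for `A` as long as
  -- the leading coefficient stays below `32ρ⁵`.
  cusp-A-bound : ∀ {ρ e w E} → + 0 ≤ ρ → + 0 ≤ e → + 0 ≤ w → w ≤ e → E ≡ e * e * (e * e) → let P = + 2 * (w * (ρ * ρ * ρ)) ; A = ρ * ρ * E in
    P * P * (E * e * (E * e)) ≤ + 4 * (A * A * A)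
  cusp-A-bound {ρ} {e} {w} {E} 0≤ρ 0≤e 0≤w w≤e E≡ = ≤-by-diff (+ 4 * (ρ * ρ * (ρ * ρ) * (ρ * ρ) * (E * E) * (E - w * w * (e * e))))
      (nonneg-scale 4 (nonneg-* (nonneg-* (nonneg-* (nonneg-* 0≤ρρ 0≤ρρ) 0≤ρρ) (nonneg-sq E)) 0≤diff))
      (solve 4 (λ ρ e w E → let P = con (+ 2) :* (w :* (ρ :* ρ :* ρ)) ; A = ρ :* ρ :* E in
        con (+ 4) :* (A :* A :* A) :- P :* P :* (E :* e :* (E :* e)) := con (+ 4) :* (ρ :* ρ :* (ρ :* ρ) :* (ρ :* ρ) :* (E :* E) :* (E :- w :* w :* (e :* e)))) refl ρ e w E)
    where
    0≤ρρ = nonneg-* 0≤ρ 0≤ρ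
    0≤diff : + 0 ≤ E - w * w * (e * e)
    0≤diff = subst (λ E → + 0 ≤ E - w * w * (e * e)) (sym E≡) (≤⇒nonneg (*-mono-≤′ (nonneg-sq w) (nonneg-sq e) (*-mono-≤′ 0≤w 0≤e w≤e w≤e) ≤-refl))

  cusp-γ : ∀ {ρ e E} R → E ≡ e * e * (e * e) → let γ = + 2 * (ρ * ρ * ρ * (E * e * e)) ; A = ρ * ρ * E in γ * γ ≡ + 4 * (A * A * A) + + 0 * R
  cusp-γ {ρ} {e} {E} R E≡ = trans (solve 4 (λ ρ e E R → let γ = con (+ 2) :* (ρ :* ρ :* ρ :* (E :* e :* e)) ; A = ρ :* ρ :* E in
    γ :* γ := con (+ 4) :* (A :* A :* A) :+ con (+ 0) :* R :+ (:- (con (+ 4) :* (ρ :* ρ :* (ρ :* ρ) :* (ρ :* ρ) :* (E :* E)))) :* (E :- e :* e :* (e :* e))) refl ρ e E R) (diff-zero E≡ _ (- (+ 4 * (ρ * ρ * (ρ * ρ) * (ρ * ρ) * (E * E)))))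

  -- X = e¹⁰ with e = τ², and E₈, E₁₀ are τ⁸, τ¹⁰; near the cusp the natural size of A is ρ²e⁴ when p lies between ρ⁵ and (2ρ)⁵.
  module _ (e : ℕ) where
    E₈ E₁₀ : ℕ
    E₈ = e ℕ.* e ℕ.* (e ℕ.* e)
    E₁₀ = E₈ ℕ.* e

    Below : ℕ → ℕ → Set
    Below P D = ∃[ p ] ∃[ q ] ∃[ r ] ∃[ s ] (Normal (+ D) p q r s × + D < + E₁₀ * + E₁₀ × + 2 * p < + P)

    module _ (ρ : ℕ) .{{_ : ℕ.NonZero ρ}} (16ρ²≤e : 16 ℕ.* (ρ ℕ.* ρ) ℕ.≤ e) where
      private
        ρz = + ρ
        ez = + e
        e₈ = ez * ez * (ez * ez)
        e₁₀ = e₈ * ez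
        ρ₂ = ρz * ρz
        ρ₅ = ρ₂ * ρ₂ * ρz
        A₀ = ρ₂ * e₈
        1≤ρ : + 1 ≤ ρz
        1≤ρ = +≤+ (ℕ.>-nonZero⁻¹ ρ)
        0≤ρ = 1≤⇒0≤ 1≤ρ
        0≤e : + 0 ≤ ez
        0≤e = +≤+ z≤n
        0≤e₈ : + 0 ≤ e₈
        0≤e₈ = nonneg-* (nonneg-* 0≤e 0≤e) (nonneg-* 0≤e 0≤e)
        0≤e₁₀ : + 0 ≤ e₁₀
        0≤e₁₀ = nonneg-* 0≤e₈ 0≤e
        0≤ρ₂ : + 0 ≤ ρ₂
        0≤ρ₂ = nonneg-* 0≤ρ 0≤ρ
        1≤ρ₅ : + 1 ≤ ρ₅
        1≤ρ₅ = pos-*′ (pos-*′ (pos-*′ 1≤ρ 1≤ρ) (pos-*′ 1≤ρ 1≤ρ)) 1≤ρ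
        0≤ρ₅ = 1≤⇒0≤ 1≤ρ₅
        e₈≡ : + E₈ ≡ e₈
        e₈≡ = trans (pos-* (e ℕ.* e) (e ℕ.* e)) (cong₂ _*_ (pos-* e e) (pos-* e e))
        e₁₀≡ : + E₁₀ ≡ e₁₀
        e₁₀≡ = trans (pos-* E₈ e) (cong (_* ez) e₈≡)
        ρ₅≡ : + fifth ρ ≡ ρ₅
        ρ₅≡ = trans (pos-* (ρ ℕ.* ρ ℕ.* (ρ ℕ.* ρ)) ρ) (cong (_* ρz) (trans (pos-* (ρ ℕ.* ρ) (ρ ℕ.* ρ)) (cong₂ _*_ (pos-* ρ ρ) (pos-* ρ ρ))))
        16ρ₂≤e : + 16 * ρ₂ ≤ ez
        16ρ₂≤e = ≤-trans (≤-reflexive (sym (trans (pos-* 16 (ρ ℕ.* ρ)) (cong (λ w → + 16 * w) (pos-* ρ ρ))))) (+≤+ 16ρ²≤e)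
        X = e₁₀ * e₁₀
        w = + 16 * ρ₂
        P₁ = + 2 * (w * (ρ₂ * ρz))
        P₁≡ : P₁ ≡ + 2 * (+ 16 * ρ₅)
        P₁≡ = solve 1 (λ ρ → let u = ρ :* ρ in con (+ 2) :* (con (+ 16) :* u :* (u :* ρ)) := con (+ 2) :* (con (+ 16) :* (u :* u :* ρ))) refl ρz

        -- Below `A₀` only `γ = 0` is used, and `s` varies by about `√X/p`. Above it `G ≥ 2ρ³e⁶`,
        -- which leaves `s` less room while `A` runs up to `√X`. The choice `A₀ = ρ²e⁴` gives both
        -- cells the same bound.
        cell₁ cell₂ : Cell
        cell₁ = record { P₀ = ρ₅ ; P₁ = P₁ ; A₀ = - A₀ ; A₁ = A₀ ; Δ = + 0 ; γ = + 0 ; X = X }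
        cell₂ = record { P₀ = ρ₅ ; P₁ = P₁ ; A₀ = A₀ ; A₁ = e₁₀ ; Δ = + 0 ; γ = + 2 * (ρ₂ * ρz * (e₁₀ * ez)) ; X = X }

        n₅ = 16 ℕ.* fifth ρ
        fifth≢0 : ℕ.NonZero (fifth ρ)
        fifth≢0 = ℕ.m*n≢0 (ρ ℕ.* ρ ℕ.* (ρ ℕ.* ρ)) ρ {{ℕ.m*n≢0 (ρ ℕ.* ρ) (ρ ℕ.* ρ) {{ℕ.m*n≢0 ρ ρ}} {{ℕ.m*n≢0 ρ ρ}}}}
        instance
          n₅≢0 : ℕ.NonZero n₅
          n₅≢0 = ℕ.m*n≢0 16 (fifth ρ) {{_}} {{fifth≢0}}
          ρ³≢0 : ℕ.NonZero (ρ ℕ.* ρ ℕ.* ρ)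
          ρ³≢0 = ℕ.m*n≢0 (ρ ℕ.* ρ) ρ {{ℕ.m*n≢0 ρ ρ}}
        n₅≡ : + n₅ ≡ + 16 * ρ₅
        n₅≡ = trans (pos-* 16 (fifth ρ)) (cong (λ w → + 16 * w) ρ₅≡)
        hq : P₁ ≤ + 2 * (+ 1 * + n₅)
        hq = ≤-reflexive (trans P₁≡ (cong (λ w → + 2 * w) (trans (sym n₅≡) (sym (*-identityˡ (+ n₅))))))
        hp : P₁ - ρ₅ ≤ + 2 * (+ 1 * + n₅)
        hp = ≤-trans (≤-by-diff ρ₅ 0≤ρ₅ (solve 2 (λ x P → P :- (P :- x) := x) refl ρ₅ P₁)) hq
        κ₀ : Class
        κ₀ = 0 , 0 , 0 , 0
        trivial-class : ∀ p q r s → InClass 1 1 κ₀ p q r s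
        trivial-class p q r s = z p , z q , z r , z s
          where
          z : ∀ x → x %ℕ 1 ≡ 0
          z x = ℕ.n<1⇒n≡0 (n%ℕd<d x 1)

        module _ (c₈ c₁₀ : ℕ) .{{_ : ℕ.NonZero c₈}} .{{_ : ℕ.NonZero c₁₀}} (l₈ : e₈ ≤ ρ₂ * ρz * + c₈) (l₁₀ : e₁₀ ≤ ρ₅ * + c₁₀) where
          drop-1 : ∀ {x y} → x ≤ + 2 * y → x ≤ + 2 * (+ 1 * y)
          drop-1 {x} {y} h = ≤-trans h (≤-reflexive (cong (λ w → + 2 * w) (sym (*-identityˡ y))))
          width : ∀ n → + n ≤ + 2 * (+ 1 * + n)
          width n = drop-1 {+ n} {+ n} (≤-by-diff (+ n) (+≤+ z≤n) (solve 1 (λ n → con (+ 2) :* n :- n := n) refl (+ n)))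

          count₁ : AtMost (Members cell₁ 1 1 κ₀) (n₅ ℕ.* (n₅ ℕ.* (c₈ ℕ.* c₁₀)))
          count₁ = cell-count cell₁ 1 1 κ₀ n₅ n₅ c₈ c₁₀ (+ c₁₀) 1≤ρ₅ (+≤+ z≤n) (+≤+ z≤n) hp hq
            (≤-by-diff (+ 2 * (ρ₂ * (ρ₂ * ρz * + c₈ - e₈))) (nonneg-scale 2 (nonneg-* 0≤ρ₂ (≤⇒nonneg l₈))) (solve 3 (λ ρ c E → ρ :* ρ :* (ρ :* ρ) :* ρ :* (con (+ 2) :* (con (+ 1) :* c)) :- (ρ :* ρ :* E :- (:- (ρ :* ρ :* E))) := con (+ 2) :* (ρ :* ρ :* (ρ :* ρ :* ρ :* c :- E))) refl ρz (+ c₈) e₈))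
            (≤-trans (≤-reflexive (+-identityʳ X)) (≤-trans (*-mono-≤′ 0≤e₁₀ (nonneg-* {ρ₅} {+ c₁₀} 0≤ρ₅ (+≤+ z≤n)) l₁₀ l₁₀) (≤-reflexive (solve 2 (λ r c → r :* c :* (r :* c) := c :* (con (+ 2) :* con (+ 0) :+ r :* r :* c)) refl ρ₅ (+ c₁₀)))))
            (width c₁₀)

          count₂ : AtMost (Members cell₂ 1 1 κ₀) (n₅ ℕ.* (n₅ ℕ.* (c₁₀ ℕ.* c₈)))
          count₂ = cell-count cell₂ 1 1 κ₀ n₅ n₅ c₁₀ c₈ (+ c₈) 1≤ρ₅ (nonneg-scale 2 (nonneg-* (nonneg-* 0≤ρ₂ 0≤ρ) (nonneg-* 0≤e₁₀ 0≤e))) (+≤+ z≤n) hp hq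
            (≤-by-diff ((ρ₅ * + c₁₀ - e₁₀) + (ρ₅ * + c₁₀) + A₀) (nonneg-+ (nonneg-+ (≤⇒nonneg l₁₀) (nonneg-* {ρ₅} {+ c₁₀} 0≤ρ₅ (+≤+ z≤n))) (nonneg-* 0≤ρ₂ 0≤e₈)) (solve 4 (λ r c E A → r :* (con (+ 2) :* (con (+ 1) :* c)) :- (E :- A) := (r :* c :- E) :+ r :* c :+ A) refl ρ₅ (+ c₁₀) e₁₀ A₀))
            (≤-by-diff ((ρ₂ * ρz * + c₈ - e₈) * (e₁₀ * ez) + (ρ₂ * ρz * + c₈) * (+ 3 * (e₁₀ * ez)) + ρ₅ * ρ₅ * (+ c₈ * + c₈))
              (nonneg-+ (nonneg-+ (nonneg-* (≤⇒nonneg l₈) (nonneg-* 0≤e₁₀ 0≤e)) (nonneg-* (nonneg-* {ρ₂ * ρz} {+ c₈} (nonneg-* 0≤ρ₂ 0≤ρ) (+≤+ z≤n)) (nonneg-scale 3 (nonneg-* 0≤e₁₀ 0≤e)))) (nonneg-* (nonneg-sq ρ₅) (nonneg-sq (+ c₈))))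
              (solve 5 (λ R r c E e → let E₁₀ = E :* e in c :* (con (+ 2) :* (con (+ 2) :* (r :* (E₁₀ :* e))) :+ R :* R :* c) :- (E₁₀ :* E₁₀ :- con (+ 0)) := (r :* c :- E) :* (E₁₀ :* e) :+ r :* c :* (con (+ 3) :* (E₁₀ :* e)) :+ R :* R :* (c :* c)) refl ρ₅ (ρ₂ * ρz) (+ c₈) e₈ ez))
            (width c₈)

        split : ∀ {D} → Below (fifth (2 ℕ.* ρ)) D → Below (fifth ρ) D ⊎ (Members cell₁ 1 1 κ₀ D ⊎ Members cell₂ 1 1 κ₀ D)
        split {D} (p , q , r , s , N , D<X , p<) with + fifth ρ ≤? + 2 * p
        ... | no ¬le = inj₁ (p , q , r , s , N , D<X , ≰⇒> ¬le)
        ... | yes le = inj₂ (by (A₀ ≤? A))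
          where
          A = hess (+ 2 * p) (+ 2 * q + + 1) (+ 2 * r + + 1)
          G = gForm (+ 2 * p) (+ 2 * q + + 1) (+ 2 * r + + 1) (+ 2 * s)
          D<X′ : + D < X
          D<X′ = subst (λ w → + D < w * w) e₁₀≡ D<X
          lo : ρ₅ ≤ + 2 * p
          lo = ≤-trans (≤-reflexive (sym ρ₅≡)) le
          hi : + 2 * p < P₁
          hi = subst (+ 2 * p <_) (trans (cong +_ (thirty-two ρ)) (trans (pos-* 2 n₅) (trans (cong (λ w → + 2 * w) n₅≡) (sym P₁≡)))) p<
            where
            thirty-two : ∀ ρ → 2 ℕ.* ρ ℕ.* (2 ℕ.* ρ) ℕ.* (2 ℕ.* ρ ℕ.* (2 ℕ.* ρ)) ℕ.* (2 ℕ.* ρ) ≡ 2 ℕ.* (16 ℕ.* (ρ ℕ.* ρ ℕ.* (ρ ℕ.* ρ) ℕ.* ρ))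
            thirty-two = ℕRing.solve-∀
          loA : - A₀ ≤ A
          loA = A-lower {+ D} {p} {q} {r} {s} {P₁} {X} {A₀} N (+≤+ z≤n) D<X′ (<⇒≤ hi) (pos-*′ {+ 2} (+≤+ (s≤s z≤n)) (pos-*′ (pos-*′ {+ 16} (+≤+ (s≤s z≤n)) (pos-*′ 1≤ρ 1≤ρ)) (pos-*′ (pos-*′ 1≤ρ 1≤ρ) 1≤ρ)))
            (cusp-A-bound {ρz} {ez} {w} {e₈} 0≤ρ 0≤e (nonneg-scale 16 0≤ρ₂) 16ρ₂≤e refl)
          -- If `A ≥ √X`, then `p² + 3A ≥ √X`, and reducedness would give `D ≥ X`.
          hiA : A < e₁₀
          hiA = ≰⇒> λ e₁₀≤A → <⇒≱ D<X′ (bounded⇒Δ≤D {+ D} {+ 2 * p} {A} {e₁₀} (Normal.bound N) 0≤e₁₀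
            (≤-trans e₁₀≤A (≤-by-diff (+ 2 * p * (+ 2 * p) + + 2 * A) (nonneg-+ (nonneg-sq (+ 2 * p)) (nonneg-scale 2 (≤-trans 0≤e₁₀ e₁₀≤A))) (solve 2 (λ x A → x :+ con (+ 3) :* A :- A := x :+ con (+ 2) :* A) refl (+ 2 * p * (+ 2 * p)) A))))
          by : Relation.Nullary.Dec (A₀ ≤ A) → Members cell₁ 1 1 κ₀ D ⊎ Members cell₂ 1 1 κ₀ D
          by (no ¬le′) = inj₁ (p , q , r , s , N , record { D<X = D<X′ ; P₀≤p = lo ; p<P₁ = hi ; A₀≤A = loA ; A<A₁ = ≰⇒> ¬le′ ; Δ≤D = +≤+ z≤n ; γ≤G = Normal.0≤G N } , trivial-class p q r s)
          by (yes le′) = inj₂ (p , q , r , s , N , record { D<X = D<X′ ; P₀≤p = lo ; p<P₁ = hi ; A₀≤A = le′ ; A<A₁ = hiA ; Δ≤D = +≤+ z≤n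
            ; γ≤G = γ-valid {+ D} {+ 2 * p} {A} {G} {ρ₅} {A₀} {+ 0} (normal-syzygy N) (Normal.0≤G N) le′ 0≤ρ₅ lo ≤-refl (+≤+ z≤n)
                (≤-reflexive (cusp-γ {ρz} {ez} {e₈} (ρ₅ * ρ₅) refl)) } , trivial-class p q r s)

      -- Each of the two cells has at most `(16ρ⁵)² · (2e⁴/ρ³) · (2e⁵/ρ⁵) = 1024ρ²e⁹` members, where
      -- the factors 2 pay for rounding up.
      block : ∀ {B} → AtMost (Below (fifth ρ)) B → AtMost (Below (fifth (2 ℕ.* ρ))) (B ℕ.+ ρ ℕ.* ρ ℕ.* (E₈ ℕ.* E₁₀) ℕ.* 2048)
      block {B} below = go (ceilDiv E₈ (ρ ℕ.* ρ ℕ.* ρ)) (ceilDiv E₁₀ (fifth ρ) {{fifth≢0}})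
        where
        ρ²≤e : ρ ℕ.* ρ ℕ.≤ e
        ρ²≤e = ℕ.≤-trans (ℕ.m≤n*m (ρ ℕ.* ρ) 16) 16ρ²≤e
        ρ≤ρ² : ρ ℕ.≤ ρ ℕ.* ρ
        ρ≤ρ² = ℕ.m≤m*n ρ ρ
        ρ≤e : ρ ℕ.≤ e
        ρ≤e = ℕ.≤-trans ρ≤ρ² ρ²≤e
        1≤e : 1 ℕ.≤ e
        1≤e = ℕ.≤-trans (ℕ.>-nonZero⁻¹ ρ) ρ≤e
        small₈ : ρ ℕ.* ρ ℕ.* ρ ℕ.≤ E₈
        small₈ = ℕ.≤-trans (ℕ.*-mono-≤ ρ²≤e ρ≤e) (ℕ.m≤m*n (e ℕ.* e) (e ℕ.* e) {{ℕ.m*n≢0 e e {{ℕ.>-nonZero 1≤e}} {{ℕ.>-nonZero 1≤e}}}})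
        small₁₀ : fifth ρ ℕ.≤ E₁₀
        small₁₀ = ℕ.*-mono-≤ (ℕ.*-mono-≤ (ℕ.≤-trans ρ²≤e (ℕ.m≤m*n e e {{ℕ.>-nonZero 1≤e}})) (ℕ.≤-trans ρ²≤e (ℕ.m≤m*n e e {{ℕ.>-nonZero 1≤e}}))) ρ≤e
        go : _ → _ → AtMost (Below (fifth (2 ℕ.* ρ))) (B ℕ.+ ρ ℕ.* ρ ℕ.* (E₈ ℕ.* E₁₀) ℕ.* 2048)
        go (c₈ , nz₈ , l₈ , u₈) (c₁₀ , nz₁₀ , l₁₀ , u₁₀) = atMost-map split (ℕ.+-monoʳ-≤ B total) (atMost-⊎ below (atMost-⊎ (count₁ c₈ c₁₀ {{nz₈}} {{nz₁₀}} l₈ℤ l₁₀ℤ) (count₂ c₈ c₁₀ {{nz₈}} {{nz₁₀}} l₈ℤ l₁₀ℤ)))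
          where
          l₈ℤ : e₈ ≤ ρ₂ * ρz * + c₈
          l₈ℤ = ≤-trans (≤-reflexive (sym e₈≡)) (≤-trans (+≤+ l₈) (≤-reflexive (trans (pos-* (ρ ℕ.* ρ ℕ.* ρ) c₈) (cong (_* + c₈) (trans (pos-* (ρ ℕ.* ρ) ρ) (cong (_* ρz) (pos-* ρ ρ)))))))
          l₁₀ℤ : e₁₀ ≤ ρ₅ * + c₁₀
          l₁₀ℤ = ≤-trans (≤-reflexive (sym e₁₀≡)) (≤-trans (+≤+ l₁₀) (≤-reflexive (trans (pos-* (fifth ρ) c₁₀) (cong (_* + c₁₀) ρ₅≡))))
          regroup : ∀ ρ a b → let f = ρ ℕ.* ρ ℕ.* (ρ ℕ.* ρ) ℕ.* ρ in 16 ℕ.* f ℕ.* (16 ℕ.* f ℕ.* (a ℕ.* b)) ℕ.+ 16 ℕ.* f ℕ.* (16 ℕ.* f ℕ.* (b ℕ.* a)) ≡ ρ ℕ.* ρ ℕ.* (ρ ℕ.* ρ ℕ.* ρ ℕ.* a ℕ.* (f ℕ.* b)) ℕ.* 512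
          regroup = ℕRing.solve-∀
          expand : ∀ ρ² a b → ρ² ℕ.* (2 ℕ.* a ℕ.* (2 ℕ.* b)) ℕ.* 512 ≡ ρ² ℕ.* (a ℕ.* b) ℕ.* 2048
          expand = ℕRing.solve-∀
          total : n₅ ℕ.* (n₅ ℕ.* (c₈ ℕ.* c₁₀)) ℕ.+ n₅ ℕ.* (n₅ ℕ.* (c₁₀ ℕ.* c₈)) ℕ.≤ ρ ℕ.* ρ ℕ.* (E₈ ℕ.* E₁₀) ℕ.* 2048
          total = ℕ.≤-trans (ℕ.≤-reflexive (regroup ρ c₈ c₁₀)) (ℕ.≤-trans (ℕ.*-monoˡ-≤ 512 (ℕ.*-monoʳ-≤ (ρ ℕ.* ρ) (ℕ.*-mono-≤ (u₈ small₈) (u₁₀ small₁₀)))) (ℕ.≤-reflexive (expand (ρ ℕ.* ρ) E₈ E₁₀)))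

    -- A geometric series: the blocks grow by a factor 4, and 683 is `2048/3` rounded up.
    cusp-count : ∀ l → 4 ℕ.* (2 ℕ.^ l ℕ.* 2 ℕ.^ l) ℕ.≤ e → AtMost (Below (fifth (2 ℕ.^ l))) (2 ℕ.^ l ℕ.* 2 ℕ.^ l ℕ.* (E₈ ℕ.* E₁₀) ℕ.* 683)
    cusp-count zero _ = atMost-map {Q = λ _ → ⊥} (λ (p , q , r , s , N , _ , p<1) → <⇒≱ p<1 (Normal.1≤p N)) z≤n (atMost-∅ λ ())
    cusp-count (suc l) h = atMost-map (λ x → x) (ℕ.≤-trans (ℕ.≤-reflexive (collect ρ (E₈ ℕ.* E₁₀))) (ℕ.≤-trans (ℕ.*-monoʳ-≤ (ρ ℕ.* ρ ℕ.* (E₈ ℕ.* E₁₀)) (ℕ.n≤1+n 2731)) (ℕ.≤-reflexive (expand ρ (E₈ ℕ.* E₁₀)))))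
        (block ρ {{ℕ.m^n≢0 2 l}} 16ρ²≤e (cusp-count l (ℕ.≤-trans (ℕ.*-monoˡ-≤ (ρ ℕ.* ρ) (ℕ.m≤n+m 4 12)) 16ρ²≤e)))
      where
      ρ = 2 ℕ.^ l
      sixteen : ∀ ρ → 16 ℕ.* (ρ ℕ.* ρ) ≡ 4 ℕ.* (2 ℕ.* ρ ℕ.* (2 ℕ.* ρ))
      sixteen = ℕRing.solve-∀
      16ρ²≤e : 16 ℕ.* (ρ ℕ.* ρ) ℕ.≤ e
      16ρ²≤e = ℕ.≤-trans (ℕ.≤-reflexive (sixteen ρ)) h
      collect : ∀ ρ E → ρ ℕ.* ρ ℕ.* E ℕ.* 683 ℕ.+ ρ ℕ.* ρ ℕ.* E ℕ.* 2048 ≡ ρ ℕ.* ρ ℕ.* E ℕ.* 2731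
      collect = ℕRing.solve-∀
      expand : ∀ ρ E → ρ ℕ.* ρ ℕ.* E ℕ.* 2732 ≡ 2 ℕ.* ρ ℕ.* (2 ℕ.* ρ) ℕ.* E ℕ.* 683
      expand = ℕRing.solve-∀

-- The number of exceptional discriminants

module Exceptions where

  open import Data.Nat as ℕ using (ℕ; zero; suc; z≤n; s≤s; _≤ᵇ_)
  import Data.Nat.Properties as ℕ
  import Data.Nat.Divisibility as ℕD
  import Data.Nat.Tactic.RingSolver as ℕRing
  open import Data.Integer hiding (suc; _≤ᵇ_)
  open import Data.Integer.Properties
  open import Data.Integer.Solver
  open import Data.List using (_∷_)
  open import Data.Product using (∃-syntax; _×_; _,_)
  open import Data.Sum using (_⊎_; inj₁; inj₂)
  open import Relation.Nullary using (¬_; yes; no)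
  open import Relation.Binary.PropositionalEquality
  open IntegerOrder
  open CubicForm
  open Cells
  open NormalForms
  open Grid
  open GridSound
  open Cusp
  open +-*-Solver hiding (Normal; normalise)

  -- From p² + 3A < S² and 4(-A)³ ≤ p²D one gets 4(p² - S²)³ < 27p²S⁴, which fails for p ≥ 2S.
  lead-upper : ∀ {D p q r s S} → Normal D p q r s → + 0 ≤ D → + 0 ≤ S → D < S * S * (S * S) → + 2 * p < + 2 * S
  lead-upper {D} {p} {q} {r} {s} {S} N 0≤D 0≤S D< = ≰⇒> λ 2S≤P → <⇒≱ D< (contra 2S≤P)
    where
    P = + 2 * p
    B = S * S
    A = hess (+ 2 * p) (+ 2 * q + + 1) (+ 2 * r + + 1)
    G = gForm (+ 2 * p) (+ 2 * q + + 1) (+ 2 * r + + 1) (+ 2 * s)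
    small : P * P + + 3 * A < B
    small = ≰⇒> λ B≤ → <⇒≱ D< (bounded⇒Δ≤D {D} {P} {A} {B} (Normal.bound N) (nonneg-sq S) B≤)
    1≤PP : + 1 ≤ P * P
    1≤PP = pos-*′ (1≤p N) (1≤p N)
    contra : + 2 * S ≤ P → S * S * (S * S) ≤ D
    contra 2S≤P = *-cancel-≤′ {S * S * (S * S)} {D} {P * P} 1≤PP (*-cancel-≤′ {P * P * (S * S * (S * S))} {P * P * D} {+ 27} (+≤+ (s≤s z≤n)) (≤-trans cubic (≤-trans four upper)))
      where
      n = P * P - B
      v = P * P - + 4 * B
      0≤v : + 0 ≤ v
      0≤v = subst (+ 0 ≤_) (cong (λ w → P * P - w) (solve 1 (λ S → con (+ 2) :* S :* (con (+ 2) :* S) := con (+ 4) :* (S :* S)) refl S)) (≤⇒nonneg (*-mono-≤′ (nonneg-scale 2 0≤S) (1≤⇒0≤ (1≤p N)) 2S≤P 2S≤P))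
      cubic : + 27 * (P * P * (S * S * (S * S))) ≤ + 4 * (n * n * n)
      cubic = ≤-by-diff (+ 81 * (B * B * v) + + 36 * (B * (v * v)) + + 4 * (v * v * v)) (nonneg-+ (nonneg-+ (nonneg-scale 81 (nonneg-* (nonneg-sq B) 0≤v)) (nonneg-scale 36 (nonneg-* (nonneg-sq S) (nonneg-sq v)))) (nonneg-scale 4 (nonneg-* (nonneg-sq v) 0≤v)))
        (solve 2 (λ Q B → let n = Q :- B ; v = Q :- con (+ 4) :* B in con (+ 4) :* (n :* n :* n) :- con (+ 27) :* (Q :* (B :* B)) := con (+ 81) :* (B :* B :* v) :+ con (+ 36) :* (B :* (v :* v)) :+ con (+ 4) :* (v :* v :* v)) refl (P * P) B)
      n≤ : n ≤ - (+ 3 * A)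
      n≤ = ≤-by-diff (B - (P * P + + 3 * A)) (≤⇒nonneg (<⇒≤ small)) (solve 3 (λ Q B A → :- (con (+ 3) :* A) :- (Q :- B) := B :- (Q :+ con (+ 3) :* A)) refl (P * P) B A)
      four : + 4 * (n * n * n) ≤ + 27 * (+ 4 * (- A * - A * - A))
      four = ≤-trans (≤-by-diff (+ 4 * (- (+ 3 * A) * - (+ 3 * A) * - (+ 3 * A) - n * n * n)) (nonneg-scale 4 (≤⇒nonneg (cube-mono n≤))) (solve 2 (λ x y → con (+ 4) :* x :- con (+ 4) :* y := con (+ 4) :* (x :- y)) refl (- (+ 3 * A) * - (+ 3 * A) * - (+ 3 * A)) (n * n * n)))
        (≤-reflexive (solve 1 (λ A → con (+ 4) :* ((:- (con (+ 3) :* A)) :* (:- (con (+ 3) :* A)) :* (:- (con (+ 3) :* A))) := con (+ 27) :* (con (+ 4) :* ((:- A) :* (:- A) :* (:- A)))) refl A))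
      upper : + 27 * (+ 4 * (- A * - A * - A)) ≤ + 27 * (P * P * D)
      upper = ≤-by-diff (+ 27 * (P * P * D - + 4 * (- A * - A * - A))) (nonneg-scale 27 (≤⇒nonneg (negative-A⇒ {D} {P} {A} {G} { - A} (normal-syzygy N) ≤-refl))) (solve 2 (λ x y → con (+ 27) :* x :- con (+ 27) :* y := con (+ 27) :* (x :- y)) refl (P * P * D) (+ 4 * (- A * - A * - A)))

  X≤R² : + gridX ≤ + gridR * + gridR
  X≤R² = ≤-reflexive (trans (cong +_ gridX≡R²) (pos-* gridR gridR))

  power-of-two : ∀ v → 1 ℕ.≤ v → ∃[ l ] (v ℕ.≤ 2 ℕ.^ l × 2 ℕ.^ l ℕ.≤ 2 ℕ.* v)
  power-of-two (suc zero) _ = 0 , s≤s z≤n , s≤s z≤n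
  power-of-two (suc (suc v)) _ with power-of-two (suc v) (s≤s z≤n)
  ... | l , lo , hi with suc (suc v) ℕ.≤? 2 ℕ.^ l
  ... | yes le = l , le , ℕ.≤-trans hi (ℕ.*-monoʳ-≤ 2 (ℕ.n≤1+n (suc v)))
  ... | no ¬le = suc l , ℕ.≤-trans (ℕ.+-mono-≤ (s≤s (z≤n {v})) lo) (ℕ.≤-trans (ℕ.+-monoˡ-≤ (2 ℕ.^ l) lo) (ℕ.≤-reflexive (cong (2 ℕ.^ l ℕ.+_) (sym (ℕ.+-identityʳ _))))) , ℕ.*-monoʳ-≤ 2 (ℕ.<⇒≤ (ℕ.≰⇒> ¬le))

  fifth-* : ∀ a b → fifth (a ℕ.* b) ≡ fifth a ℕ.* fifth b
  fifth-* = regroup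
    where
    regroup : ∀ a b → a ℕ.* b ℕ.* (a ℕ.* b) ℕ.* (a ℕ.* b ℕ.* (a ℕ.* b)) ℕ.* (a ℕ.* b) ≡ a ℕ.* a ℕ.* (a ℕ.* a) ℕ.* a ℕ.* (b ℕ.* b ℕ.* (b ℕ.* b) ℕ.* b)
    regroup = ℕRing.solve-∀

  fifth-mono : ∀ {a b} → a ℕ.≤ b → fifth a ℕ.≤ fifth b
  fifth-mono h = ℕ.*-mono-≤ (ℕ.*-mono-≤ (ℕ.*-mono-≤ h h) (ℕ.*-mono-≤ h h)) h

  twentieth-* : ∀ a b → twentieth (a ℕ.* b) ≡ twentieth a ℕ.* twentieth b
  twentieth-* a b = trans (cong (λ w → w ℕ.* w ℕ.* (w ℕ.* w)) (fifth-* a b)) (regroup (fifth a) (fifth b))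
    where
    regroup : ∀ x y → x ℕ.* y ℕ.* (x ℕ.* y) ℕ.* (x ℕ.* y ℕ.* (x ℕ.* y)) ≡ x ℕ.* x ℕ.* (x ℕ.* x) ℕ.* (y ℕ.* y ℕ.* (y ℕ.* y))
    regroup = ℕRing.solve-∀

  twentieth-mono : ∀ {a b} → a ℕ.≤ b → twentieth a ℕ.≤ twentieth b
  twentieth-mono h = ℕ.*-mono-≤ (ℕ.*-mono-≤ (fifth-mono h) (fifth-mono h)) (ℕ.*-mono-≤ (fifth-mono h) (fifth-mono h))

  module _ (z : ℕ) .{{z≢0 : ℕ.NonZero z}} where
    private
      v = 18 ℕ.* z
      a = gridK ℕ.* v
      e = a ℕ.* a
      -- This makes `v⁵ = 18y`, so the cusp region ends exactly at one grid unit, where the grid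
      -- begins.
      y = z ℕ.* (v ℕ.* v ℕ.* (v ℕ.* v))
      instance
        v≢0 : ℕ.NonZero v
        v≢0 = ℕ.m*n≢0 18 z
        y≢0 : ℕ.NonZero y
        y≢0 = ℕ.m*n≢0 z (v ℕ.* v ℕ.* (v ℕ.* v)) {{z≢0}} {{ℕ.m*n≢0 (v ℕ.* v) (v ℕ.* v) {{ℕ.m*n≢0 v v}} {{ℕ.m*n≢0 v v}}}}
      fifth-v : fifth v ≡ 18 ℕ.* y
      fifth-v = regroup (v ℕ.* v ℕ.* (v ℕ.* v)) z
        where
        regroup : ∀ w z → w ℕ.* (18 ℕ.* z) ≡ 18 ℕ.* (z ℕ.* w)
        regroup = ℕRing.solve-∀
      E₁₀≡ : E₁₀ e ≡ fifth a ℕ.* fifth a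
      E₁₀≡ = regroup a
        where
        regroup : ∀ a → a ℕ.* a ℕ.* (a ℕ.* a) ℕ.* (a ℕ.* a ℕ.* (a ℕ.* a)) ℕ.* (a ℕ.* a) ≡ a ℕ.* a ℕ.* (a ℕ.* a) ℕ.* a ℕ.* (a ℕ.* a ℕ.* (a ℕ.* a) ℕ.* a)
        regroup = ℕRing.solve-∀
      h = + 18 * + y
      h≡ : h ≡ + fifth v
      h≡ = trans (sym (pos-* 18 y)) (cong +_ (sym fifth-v))

    -- A twentieth power `a²⁰`, because its fourth root `a⁵` measures the grid, while the cusp
    -- estimate works with `e = a²`, the tenth root, and with fifth powers as boundaries.
    rangeSize : ℕ
    rangeSize = twentieth a

    private
      X≡ : + rangeSize ≡ + E₁₀ e * + E₁₀ e
      X≡ = trans (pos-* (fifth a ℕ.* fifth a) (fifth a ℕ.* fifth a)) (cong₂ _*_ (cong +_ (sym E₁₀≡)) (cong +_ (sym E₁₀≡)))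
      S = + fifth gridK * h
      S≡ : S ≡ + fifth a
      S≡ = trans (cong (+ fifth gridK *_) h≡) (trans (sym (pos-* (fifth gridK) (fifth v))) (cong +_ (sym (fifth-* gridK v))))
      X≡S⁴ : + rangeSize ≡ S * S * (S * S)
      X≡S⁴ = trans (trans (pos-* (fifth a ℕ.* fifth a) (fifth a ℕ.* fifth a)) (cong₂ _*_ (pos-* (fifth a) (fifth a)) (pos-* (fifth a) (fifth a)))) (cong (λ w → w * w * (w * w)) (sym S≡))
      X≡grid : + rangeSize ≡ + gridX * (h * h * (h * h))
      X≡grid = trans X≡S⁴ (trans (solve 2 (λ f h → f :* h :* (f :* h) :* (f :* h :* (f :* h)) := f :* f :* (f :* f) :* (h :* h :* (h :* h))) refl (+ fifth gridK) h)
        (cong (_* (h * h * (h * h))) (trans (sym (trans (pos-* (fifth gridK ℕ.* fifth gridK) (fifth gridK ℕ.* fifth gridK)) (cong₂ _*_ (pos-* (fifth gridK) (fifth gridK)) (pos-* (fifth gridK) (fifth gridK))))) (cong +_ (sym gridX≡)))))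

    Exceptional : ℕ → Set
    Exceptional D = HasNormal (+ D) × D ℕ.< rangeSize × ¬ (9 ℕD.∣ D)

    private
      GridCovered = Covered gridX gridR gridBound gridFuel y X≤R²

      split : ∀ {D} → Exceptional D → GridCovered (1 ∷ gridTail) D ⊎ Below e (fifth v) D
      split {D} ((p , q , r , s , N) , D<X , 9∤D) with + fifth v ≤? + 2 * p
      ... | no ¬le = inj₂ (p , q , r , s , N , subst (+ D <_) X≡ (+<+ D<X) , ≰⇒> ¬le)
      ... | yes le = inj₁ (covered gridX gridR gridBound gridFuel y X≤R² 1 gridTail (p , q , r , s , N , subst (+ D <_) X≡grid (+<+ D<X) , lo , hi , class-good N 9∤D))
        where
        lo : + 1 * h ≤ + 2 * p
        lo = ≤-trans (≤-reflexive (trans (*-identityˡ h) h≡)) le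
        hi : + 2 * p < + cubeLast (1 ∷ gridTail) * h
        hi = subst (+ 2 * p <_) (trans (sym (*-assoc (+ 2) (+ fifth gridK) h)) (cong (_* h) (trans (sym (pos-* 2 (fifth gridK))) (cong +_ (sym gridTop≡)))))
          (lead-upper {+ D} {p} {q} {r} {s} {S} N (+≤+ z≤n) (nonneg-* {+ fifth gridK} {h} (+≤+ z≤n) (nonneg-scale 18 {+ y} (+≤+ z≤n))) (subst (+ D <_) X≡S⁴ (+<+ D<X)))

      y⁴′ = y ℕ.* y ℕ.* (y ℕ.* y)

      grid-part : AtMost (GridCovered (1 ∷ gridTail)) (gridBound ℕ.* y⁴′ ℕ.* 1728)
      grid-part = from (rows-sound gridX gridR gridBound gridFuel y X≤R² (1 ∷ gridTail) 0 (λ acc → acc ≤ᵇ gridBound) grid-check)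
        where
        from : _ → AtMost (GridCovered (1 ∷ gridTail)) (gridBound ℕ.* y⁴′ ℕ.* 1728)
        from (δ , t , at) = atMost-map (λ x → x) (ℕ.*-monoˡ-≤ 1728 (ℕ.*-monoˡ-≤ y⁴′ (≤ᵇ-true {δ} {gridBound} t))) at

      grid-part-≤ : gridBound ℕ.* y⁴′ ℕ.* 1728 ℕ.* 972 ≡ 71 ℕ.* rangeSize
      grid-part-≤ = ℕ.*-cancelʳ-≡ _ _ 16 (trans (regroup gridBound y⁴′ 1728 972 16) (trans (cong (λ w → w ℕ.* y⁴′ ℕ.* 1728 ℕ.* 972) gridBound≡) (trans (scale 71 gridX y 18 1728 972 16 refl) (cong (λ w → 71 ℕ.* w ℕ.* 16) (sym size≡)))))
        where
        regroup : ∀ g w c d f → g ℕ.* w ℕ.* c ℕ.* d ℕ.* f ≡ g ℕ.* f ℕ.* w ℕ.* c ℕ.* d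
        regroup = ℕRing.solve-∀
        scale : ∀ s X y t c d f → c ℕ.* d ≡ t ℕ.* t ℕ.* (t ℕ.* t) ℕ.* f → s ℕ.* X ℕ.* (y ℕ.* y ℕ.* (y ℕ.* y)) ℕ.* c ℕ.* d ≡ s ℕ.* (X ℕ.* (t ℕ.* y ℕ.* (t ℕ.* y) ℕ.* (t ℕ.* y ℕ.* (t ℕ.* y)))) ℕ.* f
        scale s X y t c d f eq = trans (ℕ.*-assoc (s ℕ.* X ℕ.* (y ℕ.* y ℕ.* (y ℕ.* y))) c d) (trans (cong (s ℕ.* X ℕ.* (y ℕ.* y ℕ.* (y ℕ.* y)) ℕ.*_) eq) (expand s X y t f))
          where
          expand : ∀ s X y t f → s ℕ.* X ℕ.* (y ℕ.* y ℕ.* (y ℕ.* y)) ℕ.* (t ℕ.* t ℕ.* (t ℕ.* t) ℕ.* f) ≡ s ℕ.* (X ℕ.* (t ℕ.* y ℕ.* (t ℕ.* y) ℕ.* (t ℕ.* y ℕ.* (t ℕ.* y)))) ℕ.* f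
          expand = ℕRing.solve-∀
        size≡ : rangeSize ≡ gridX ℕ.* (18 ℕ.* y ℕ.* (18 ℕ.* y) ℕ.* (18 ℕ.* y ℕ.* (18 ℕ.* y)))
        size≡ = trans (twentieth-* gridK v) (cong₂ ℕ._*_ (sym gridX≡) (cong (λ w → w ℕ.* w ℕ.* (w ℕ.* w)) fifth-v))

      cusp-small : ∀ {ρ} → ρ ℕ.≤ 2 ℕ.* v → ρ ℕ.* ρ ℕ.≤ 4 ℕ.* (v ℕ.* v)
      cusp-small hi = ℕ.≤-trans (ℕ.*-mono-≤ hi hi) (ℕ.≤-reflexive (regroup v))
        where
        regroup : ∀ v → 2 ℕ.* v ℕ.* (2 ℕ.* v) ≡ 4 ℕ.* (v ℕ.* v)
        regroup = ℕRing.solve-∀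

      16≤K² : 16 ℕ.≤ gridK ℕ.* gridK
      16≤K² = ℕ.≤-trans (ℕ.≤ᵇ⇒≤ 16 67108864 _) (ℕ.≤-reflexive (sym (cong₂ ℕ._*_ gridK≡ gridK≡)))

      regroup₃ : ∀ k v → k ℕ.* k ℕ.* (v ℕ.* v) ≡ k ℕ.* v ℕ.* (k ℕ.* v)
      regroup₃ = ℕRing.solve-∀

      cusp-condition : ∀ {ρ} → ρ ℕ.≤ 2 ℕ.* v → 4 ℕ.* (ρ ℕ.* ρ) ℕ.≤ e
      cusp-condition hi = ℕ.≤-trans (ℕ.*-monoʳ-≤ 4 (cusp-small hi)) (ℕ.≤-trans (ℕ.≤-reflexive (sym (ℕ.*-assoc 4 4 (v ℕ.* v)))) (ℕ.≤-trans (ℕ.*-monoˡ-≤ (v ℕ.* v) 16≤K²) (ℕ.≤-reflexive (regroup₃ gridK v))))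

      -- Since `e = K²v²` for `K = gridK`, the bound `ρ² ≤ 4v²` says that `K²ρ² ≤ 4e`, which makes
      -- the cusp a fraction `2732/K²` of the range.
      cusp-size : ∀ {ρ F H} → ρ ℕ.≤ 2 ℕ.* v → F ℕ.* e ≡ H → ρ ℕ.* ρ ℕ.* (F ℕ.* H) ℕ.* 683 ℕ.* (gridK ℕ.* gridK) ℕ.≤ 2732 ℕ.* (H ℕ.* H)
      cusp-size {ρ} {F} {H} hi refl = ℕ.≤-trans (ℕ.*-monoˡ-≤ (gridK ℕ.* gridK) (ℕ.*-monoˡ-≤ 683 (ℕ.*-monoˡ-≤ (F ℕ.* H) (cusp-small {ρ} hi)))) (ℕ.≤-reflexive (trans (regroup gridK v F H 4 683) (cong (λ w → 2732 ℕ.* (F ℕ.* w ℕ.* H)) (regroup₃ gridK v))))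
        where
        regroup : ∀ k v E F c d → c ℕ.* (v ℕ.* v) ℕ.* (E ℕ.* F) ℕ.* d ℕ.* (k ℕ.* k) ≡ c ℕ.* d ℕ.* (E ℕ.* (k ℕ.* k ℕ.* (v ℕ.* v)) ℕ.* F)
        regroup = ℕRing.solve-∀

      cusp-part : ∃[ C ] (AtMost (Below e (fifth v)) C × C ℕ.* (gridK ℕ.* gridK) ℕ.≤ 2732 ℕ.* rangeSize)
      cusp-part = from (power-of-two v (ℕ.>-nonZero⁻¹ v))
        where
        from : (∃[ l ] (v ℕ.≤ 2 ℕ.^ l × 2 ℕ.^ l ℕ.≤ 2 ℕ.* v)) → ∃[ C ] (AtMost (Below e (fifth v)) C × C ℕ.* (gridK ℕ.* gridK) ℕ.≤ 2732 ℕ.* rangeSize)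
        from (l , lo , hi) = 2 ℕ.^ l ℕ.* 2 ℕ.^ l ℕ.* (E₈ e ℕ.* E₁₀ e) ℕ.* 683 , atMost-map widen ℕ.≤-refl (cusp-count e l (cusp-condition {2 ℕ.^ l} hi)) ,
            ℕ.≤-trans (cusp-size {2 ℕ.^ l} {E₈ e} {E₁₀ e} hi refl) (ℕ.≤-reflexive (cong (λ w → 2732 ℕ.* (w ℕ.* w)) E₁₀≡))
          where
          widen : ∀ {D} → Below e (fifth v) D → Below e (fifth (2 ℕ.^ l)) D
          widen (p , q , r , s , N , D<X , p<) = p , q , r , s , N , D<X , <-≤-trans p< (+≤+ (fifth-mono lo))

    -- Here `24300 = 25 · 972`. The grid contributes `71/972 = 1775/24300`, and the cusp, with
    -- `2732/2²⁶`, less than `1/24300`.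
    exceptions : ∃[ B ] (AtMost Exceptional B × 24300 ℕ.* B ℕ.≤ 1776 ℕ.* rangeSize)
    exceptions = from cusp-part
      where
      from : (∃[ C ] (AtMost (Below e (fifth v)) C × C ℕ.* (gridK ℕ.* gridK) ℕ.≤ 2732 ℕ.* rangeSize)) → ∃[ B ] (AtMost Exceptional B × 24300 ℕ.* B ℕ.≤ 1776 ℕ.* rangeSize)
      from (C , at , C≤) = gridBound ℕ.* y⁴′ ℕ.* 1728 ℕ.+ C , atMost-map split ℕ.≤-refl (atMost-⊎ grid-part at) ,
        ℕ.≤-trans (ℕ.≤-reflexive (distrib (gridBound ℕ.* y⁴′ ℕ.* 1728) C 25 972)) (ℕ.≤-trans (ℕ.+-mono-≤ (ℕ.≤-reflexive (trans (cong (25 ℕ.*_) grid-part-≤) (sym (ℕ.*-assoc 25 71 rangeSize)))) C′) (ℕ.≤-reflexive (ℕ.+-comm (1775 ℕ.* rangeSize) rangeSize)))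
        where
        distrib : ∀ g c m n → m ℕ.* n ℕ.* (g ℕ.+ c) ≡ m ℕ.* (g ℕ.* n) ℕ.+ m ℕ.* n ℕ.* c
        distrib = ℕRing.solve-∀
        C₂ : C ℕ.* 67108864 ℕ.≤ 2732 ℕ.* rangeSize
        C₂ = subst (λ k → C ℕ.* (k ℕ.* k) ℕ.≤ 2732 ℕ.* rangeSize) gridK≡ C≤
        C′ : 24300 ℕ.* C ℕ.≤ rangeSize
        C′ = ℕ.*-cancelˡ-≤ 2732 (ℕ.≤-trans (ℕ.≤-reflexive (trans (sym (ℕ.*-assoc 2732 24300 C)) (ℕ.*-comm (2732 ℕ.* 24300) C))) (ℕ.≤-trans (ℕ.*-monoʳ-≤ C (ℕ.≤ᵇ⇒≤ (2732 ℕ.* 24300) 67108864 _)) C₂))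

-- Equivalent conditions for odd trace

module OddTrace where

  open import Data.Nat as ℕ using (ℕ; zero; suc; z≤n; s≤s; _%_)
  import Data.Nat.Properties as ℕ
  open import Data.Integer hiding (suc; _%_)
  open import Data.Product using (∃-syntax; _×_; _,_; proj₁; proj₂)
  open import Data.Sum using (_⊎_; inj₁; inj₂)
  open import Relation.Binary.PropositionalEquality
  open import Function.Bundles using (_⇔_; mk⇔)
  open import Defs
  open Units
  open FundamentalUnit
  open OddUnits

  disc≥5 : ∀ {D} → RealQuadDisc D → 5 ℕ.≤ D
  disc≥5 (1<D , inj₁ (r , _)) = odd 1<D r
    where
    odd : ∀ {D} → 1 ℕ.< D → D % 4 ≡ 1 → 5 ℕ.≤ D
    odd {suc (suc (suc (suc (suc D))))} _ _ = s≤s (s≤s (s≤s (s≤s (s≤s z≤n))))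
    odd {1} (s≤s ()) _
  disc≥5 (_ , inj₂ (m , refl , r , _)) = ℕ.≤-trans (ℕ.m≤m+n 5 3) (ℕ.*-monoʳ-≤ 4 {2} {m} (even m r))
    where
    even : ∀ m → m % 4 ≡ 2 ⊎ m % 4 ≡ 3 → 2 ℕ.≤ m
    even zero (inj₁ ())
    even zero (inj₂ ())
    even (suc zero) (inj₁ ())
    even (suc zero) (inj₂ ())
    even (suc (suc m)) _ = s≤s (s≤s z≤n)

  module _ (D : ℕ) (disc : RealQuadDisc D) where

    odd-unit⇒fundamental-odd : ∀ {a b c d} → IsFundUnit D a b → UnitNorm (+ D) c d → OddZ c → OddZ a
    odd-unit⇒fundamental-odd {a} {b} {c} {d} fund u o = odd?⇒OddZ {a} (odd-unit⇒least-odd D (+≤+ (disc≥5 disc)) {a} {b} {c} {d} (proj₁ elim) (proj₂ elim) u (OddZ⇒odd? {c} o))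
      where
      elim = fundamental-elim D (+≤+ (disc≥5 disc)) {a} {b} fund

    odd⇔totallyPositive-odd : ∀ a b → IsFundUnit D a b → OddZ a ⇔ (∃[ a′ ] ∃[ b′ ] (IsTotPosFundUnit D a′ b′ × OddZ a′))
    odd⇔totallyPositive-odd a b fund = mk⇔ (fundamental-odd⇒totallyPositive-odd D (+≤+ (disc≥5 disc)) fund)
      λ (c , d , ((_ , norm) , _) , o) → odd-unit⇒fundamental-odd {a} {b} {c} {d} fund (inj₁ norm) o

    odd⇔some-odd : ∀ a b → IsFundUnit D a b → OddZ a ⇔ (∃[ a′ ] ∃[ b′ ] (IsUnit D a′ b′ × OddZ a′))
    odd⇔some-odd a b fund = mk⇔ (λ o → a , b , proj₁ fund , o) λ (c , d , (_ , norm) , o) → odd-unit⇒fundamental-odd {a} {b} {c} {d} fund norm o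

-- Comparison of the counts

module Proportion where

  open import Data.Nat
  open import Data.Nat.Properties
  open import Data.Nat.DivMod using (m≡m%n+[m/n]*n; m*n%n≡0)
  open import Data.Nat.Primality using (prime?)
  open import Data.Nat.Tactic.RingSolver using (solve-∀)
  import Data.Integer as ℤ
  import Data.Integer.Properties as ℤ
  open import Data.List using (_++_; filter)
  open import Data.List.Properties using (length-++)
  open import Data.List.Membership.Propositional using (_∈_)
  open import Data.List.Membership.Propositional.Properties using (∈-++⁺ˡ; ∈-++⁺ʳ; ∈-filter⁺; ∈-filter⁻)
  open import Data.List.Membership.DecPropositional _≟_ using (_∈?_)
  open import Data.List.Relation.Unary.All as All using (All)
  open import Data.List.Relation.Unary.Unique.Propositional.Properties using (filter⁺)
  open import Data.Product using (∃-syntax; _×_; _,_; proj₁; proj₂)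
  open import Data.Sum using (inj₁; inj₂)
  open import Data.Empty using (⊥-elim)
  open import Relation.Nullary using (¬_; ¬?; yes; no; Dec)
  open import Relation.Nullary.Decidable using (from-yes)
  open import Relation.Binary.PropositionalEquality
  open import Function.Bundles using (Equivalence)
  open import Defs
  open Units
  open EvenUnits
  open Counting
  open Sieve
  open Discriminants
  open Density
  open Cells
  open NormalForms
  open Exceptions
  open OddTrace

  bracket : (f : ℕ → ℕ) → (∀ n → n ≤ f n) → ∀ a X → f a < X → ∃[ z ] (a ≤ z × f z < X × X ≤ f (suc z))
  bracket f grows a X = go X a (≤-trans (m≤m+n X a) (grows (X + a)))
    where
    go : ∀ k a → X ≤ f (k + a) → f a < X → ∃[ z ] (a ≤ z × f z < X × X ≤ f (suc z))
    go zero a hi lo = ⊥-elim (<⇒≱ lo hi)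
    go (suc k) a hi lo with X ≤? f (suc a)
    ... | yes le = a , ≤-refl , lo , le
    ... | no ¬le with go k (suc a) (subst (λ w → X ≤ f w) (sym (+-suc k a)) hi) (≰⇒> ¬le)
    ... | z , a≤z , rest = z , <⇒≤ a≤z , rest

  module _ (X : ℕ) where

    oddTrace-≤ : ∀ {n} → CountsTo FundUnitTraceOdd X n → n ≤ M₅ X
    oddTrace-≤ (L , u , mem , refl) = ≤-trans (subset-length u (λ {D} d∈ → sub D (Equivalence.to (mem D) d∈))) (≤-reflexive (length-els (f₅ X) X))
      where
      sub : ∀ D → 0 < D × D < X × RealQuadDisc D × FundUnitTraceOdd D → D ∈ els (f₅ X) X
      sub D (_ , D<X , disc , a , b , ((_ , norm) , _) , odd) = els-complete (f₅ X) X D<X (mod8⇒f₅ X (odd-unit⇒5mod8 D a b norm (OddZ⇒odd? {a} odd)) disc)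

    disc₅-squareFree : ∀ {D} → D % 8 ≡ 5 → RealQuadDisc D → SquareFree D
    disc₅-squareFree r (_ , inj₁ (_ , sf)) = sf
    disc₅-squareFree {D} r (_ , inj₂ (m , refl , _)) = ⊥-elim (absurd (trans (sym (m*n%n≡0 m 4)) (trans (cong (_% 4) (*-comm m 4)) (mod8⇒mod4 {4 * m} r))))
      where
      absurd : 0 ≢ 1
      absurd ()

    even-trace⇒exceptional : ∀ {D z} .{{_ : NonZero z}} → D % 8 ≡ 5 → RealQuadDisc D → ¬ FundUnitTraceOdd D → D < rangeSize z → ¬ ¬ Exceptional z D
    even-trace⇒exceptional {D} {z} r disc noOdd D<T k = no-odd-unit⇒reducedForm D (ℤ.+ (D / 8)) D≡ (ℤ.+≤+ (disc≥5 disc)) sf noOdd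
        λ (p , q′ , r′ , s , form) → k (toNormal {ℤ.+ D} {p} {q′} {r′} {s} form , D<T , sf 3 (from-yes (prime? 3)))
      where
      sf = disc₅-squareFree r disc
      q = D / 8
      D≡ : ℤ.+ D ≡ ℤ.+ 4 ℤ.* (ℤ.+ 2 ℤ.* ℤ.+ q ℤ.+ ℤ.+ 1) ℤ.+ ℤ.+ 1
      D≡ = trans (cong ℤ.+_ (trans (m≡m%n+[m/n]*n D 8) (trans (cong (_+ q * 8) r) (regroup q)))) (trans (cong (λ w → w ℤ.+ ℤ.+ 1) (ℤ.pos-* 4 (2 * q + 1))) (cong (λ w → ℤ.+ 4 ℤ.* (w ℤ.+ ℤ.+ 1) ℤ.+ ℤ.+ 1) (ℤ.pos-* 2 q)))
        where
        regroup : ∀ q → 5 + q * 8 ≡ 4 * (2 * q + 1) + 1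
        regroup = solve-∀

    -- Membership in the given list `L` is decidable and stands in for deciding whether the
    -- fundamental unit has odd trace. What lies outside `L` is exceptional up to double negation,
    -- as `AtMost` allows.
    M₅-≤ : ∀ {n B z} .{{_ : NonZero z}} → CountsTo FundUnitTraceOdd X n → X ≤ rangeSize z → AtMost (Exceptional z) B → M₅ X ≤ n + B
    M₅-≤ {n} {B} {z} (L , _ , mem , len) X≤T at = ≤-trans (≤-reflexive (sym (length-els (f₅ X) X)))
        (≤-trans (subset-length (els-unique (f₅ X) X) cover) (≤-trans (≤-reflexive (length-++ L)) (+-mono-≤ (≤-reflexive len) (at rest (filter⁺ out? (els-unique (f₅ X) X)) (All.tabulate λ {D} d∈ → bad D (∈-filter⁻ out? {xs = els (f₅ X) X} d∈))))))
      where
      out? : ∀ D → Dec (¬ D ∈ L)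
      out? D = ¬? (D ∈? L)
      rest = filter out? (els (f₅ X) X)
      cover : ∀ {D} → D ∈ els (f₅ X) X → D ∈ L ++ rest
      cover {D} d∈ with D ∈? L
      ... | yes in-L = ∈-++⁺ˡ in-L
      ... | no out = ∈-++⁺ʳ L (∈-filter⁺ out? d∈ out)
      bad : ∀ D → D ∈ els (f₅ X) X × ¬ (D ∈ L) → ¬ ¬ Exceptional z D
      bad D (d∈ , out) = even-trace⇒exceptional {D} {z} (f₅⇒mod8 X f₅D) disc (λ odd → out (Equivalence.from (mem D) (<⇒≤ 1<D , D<X , disc , odd))) (<-≤-trans D<X X≤T)
        where
        D<X = proj₁ (All.lookup (els-sound (f₅ X) X) d∈)
        f₅D = proj₂ (All.lookup (els-sound (f₅ X) X) d∈)
        1<D : 1 < D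
        1<D = big D (f₅⇒mod8 X f₅D)
          where
          big : ∀ D → D % 8 ≡ 5 → 1 < D
          big zero ()
          big (suc zero) ()
          big (suc (suc D)) _ = s≤s (s≤s z≤n)
        disc : RealQuadDisc D
        disc = f₅⇒disc X 1<D D<X f₅D

    total-upper : ∀ {m s} → CountsTo Always X m → X ≤ s * s → m ≤ 3 * M₅ X + 8 * s
    total-upper {m} {s} count X≤ = ≤-trans (total-≤ X count) (≤-trans (+-mono-≤ (close X {χ₁} {χ₅} {s} admissible₁ admissible₅ X≤) (+-monoʳ-≤ (M₅ X) (close X {χ₈} {χ₅} {s} admissible₈ admissible₅ X≤))) (≤-reflexive (regroup (M₅ X) s)))
      where
      regroup : ∀ M s → M + 4 * s + (M + (M + 4 * s)) ≡ 3 * M + 8 * s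
      regroup = solve-∀

    total-lower : ∀ {m s} → CountsTo Always X m → X ≤ s * s → 3 * M₅ X ≤ suc m + 8 * s
    total-lower {m} {s} count X≤ = ≤-trans (≤-reflexive (split (M₅ X))) (≤-trans (+-mono-≤ (close X {χ₅} {χ₁} {s} admissible₅ admissible₁ X≤) (+-monoʳ-≤ (M₅ X) (close X {χ₅} {χ₈} {s} admissible₅ admissible₈ X≤)))
        (≤-trans (≤-reflexive (regroup (M₁ X) (M₅ X) (M₈ X) s)) (+-monoˡ-≤ (8 * s) (total-≥ X count))))
      where
      split : ∀ M → 3 * M ≡ M + (M + M)
      split = solve-∀
      regroup : ∀ L M N s → L + 4 * s + (M + (N + 4 * s)) ≡ L + (M + N) + 8 * s
      regroup = solve-∀

-- The two asymptotic bounds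

module Asymptotics where

  open import Data.Nat
  open import Data.Nat.Properties
  open import Data.Nat.Tactic.RingSolver using (solve-∀)
  open import Data.Product using (∃-syntax; _×_; _,_)
  open import Relation.Binary.PropositionalEquality
  open import Defs
  open Discriminants
  open Density
  open Cells
  open Grid
  open Exceptions
  open Proportion

  fifth-increasing : ∀ a → a ≤ fifth a
  fifth-increasing zero = z≤n
  fifth-increasing a@(suc _) = m≤n*m a (a * a * (a * a))

  twentieth-increasing : ∀ a → a ≤ twentieth a
  twentieth-increasing zero = z≤n
  twentieth-increasing a@(suc _) = ≤-trans (fifth-increasing a) (≤-trans (m≤m*n b b {{nz}}) (m≤m*n (b * b) (b * b) {{m*n≢0 b b {{nz}} {{nz}}}}))
    where
    b = fifth a
    nz : NonZero b
    nz = >-nonZero (≤-trans (s≤s z≤n) (fifth-increasing a))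

  rangeSizeAt : ℕ → ℕ
  rangeSizeAt z = twentieth (gridK * (18 * z))

  rangeSizeAt-increasing : ∀ z → z ≤ rangeSizeAt z
  rangeSizeAt-increasing z = ≤-trans (≤-trans (m≤n*m z 18) (m≤n*m (18 * z) gridK {{subst NonZero (sym gridK≡) _}})) (twentieth-increasing (gridK * (18 * z)))

  -- Consecutive ranges differ by less than one per cent, because (2101/2100)²⁰ < 101/100.
  rangeSizeAt-ratio : ∀ z → 2100 ≤ z → 100 * rangeSizeAt (suc z) ≤ 101 * rangeSizeAt z
  rangeSizeAt-ratio z 2100≤z = ratio (twentieth 2100) (twentieth 2101) (rangeSizeAt z) (rangeSizeAt (suc z)) compared (≤ᵇ⇒≤ (100 * twentieth 2101) (101 * twentieth 2100) _)
    where
    ratio : ∀ a b T T′ .{{_ : NonZero a}} → T′ * a ≤ T * b → 100 * b ≤ 101 * a → 100 * T′ ≤ 101 * T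
    ratio a b T T′ le ab = *-cancelʳ-≤ (100 * T′) (101 * T) a (≤-trans (≤-reflexive (*-assoc 100 T′ a)) (≤-trans (*-monoʳ-≤ 100 le) (≤-trans (≤-reflexive (swap 100 T b)) (≤-trans (*-monoʳ-≤ T ab) (≤-reflexive (swap′ 101 T a))))))
      where
      swap : ∀ c T b → c * (T * b) ≡ T * (c * b)
      swap = solve-∀
      swap′ : ∀ c T a → T * (c * a) ≡ c * T * a
      swap′ = solve-∀
    factor : ∀ x a → twentieth (gridK * (18 * x)) * twentieth a ≡ twentieth (gridK * 18 * (x * a))
    factor x a = trans (sym (twentieth-* (gridK * (18 * x)) a)) (cong twentieth (regroup gridK 18 x a))
      where
      regroup : ∀ k c x a → k * (c * x) * a ≡ k * c * (x * a)
      regroup = solve-∀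
    compared : rangeSizeAt (suc z) * twentieth 2100 ≤ rangeSizeAt z * twentieth 2101
    compared = ≤-trans (≤-reflexive (factor (suc z) 2100)) (≤-trans (twentieth-mono (*-monoʳ-≤ (gridK * 18) step)) (≤-reflexive (sym (factor z 2101))))
      where
      step : suc z * 2100 ≤ z * 2101
      step = ≤-trans (+-monoˡ-≤ (z * 2100) 2100≤z) (≤-reflexive (sym (*-suc z 2100)))


  -- The first summand puts `X` where consecutive ranges differ by less than one per cent; the
  -- second makes `√X` negligible against `X`.
  sufficientlyLarge : ℕ
  sufficientlyLarge = suc (rangeSizeAt 2100 + 40000 * 40000)

  record Scale (X : ℕ) : Set where
    field
      s : ℕ
      1≤s : 1 ≤ s
      X≤s² : X ≤ s * s
      s²≤4X : s * s ≤ 4 * X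
      s≪X : 10000 * s ≤ X

  scale : ∀ {X} → 40000 * 40000 < X → Scale X
  scale {X} big = from (bracket (λ n → n * n) square-increasing 40000 X big)
    where
    square-increasing : ∀ n → n ≤ n * n
    square-increasing zero = z≤n
    square-increasing n@(suc _) = m≤m*n n n
    from : ∃[ z ] (40000 ≤ z × z * z < X × X ≤ suc z * suc z) → Scale X
    from (z , 40000≤z , lo , hi) = record
      { s = suc z ; 1≤s = s≤s z≤n ; X≤s² = hi
      ; s²≤4X = ≤-trans (*-mono-≤ s≤2z s≤2z) (≤-trans (≤-reflexive (regroup z)) (*-monoʳ-≤ 4 (<⇒≤ lo)))
      ; s≪X = ≤-trans (*-monoʳ-≤ 10000 s≤2z) (≤-trans (≤-reflexive (sym (*-assoc 10000 2 z))) (≤-trans (*-monoˡ-≤ z (≤-trans (≤ᵇ⇒≤ 20000 40000 _) 40000≤z)) (<⇒≤ lo)))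
      }
      where
      s≤2z : suc z ≤ 2 * z
      s≤2z = ≤-trans (+-monoˡ-≤ z (≤-trans (≤ᵇ⇒≤ 1 40000 _) 40000≤z)) (≤-reflexive (cong (z +_) (sym (+-identityʳ z))))
      regroup : ∀ z → 2 * z * (2 * z) ≡ 4 * (z * z)
      regroup = solve-∀

  -- The numerical margin: (w + d)X ≤ 21KM + es and 27KB ≤ wX leave dX to absorb the error terms.
  lower-margin : ∀ K w d e X M B n m s .{{_ : NonZero K}} → m ≤ 3 * M + 8 * s → M ≤ n + B → (w + d) * X ≤ 21 * (K * M) + e * s → 27 * (K * B) ≤ w * X → (e + 16 * K) * s ≤ d * X → 2 * m ≤ 27 * n
  lower-margin K w d e X M B n m s h₁ h₂ h₃ h₄ h₅ = *-cancelˡ-≤ K (+-cancelʳ-≤ common (K * (2 * m)) (K * (27 * n))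
      (≤-trans (≤-reflexive (left K w d e X M B m s)) (≤-trans (+-mono-≤ (+-mono-≤ (+-mono-≤ (*-monoʳ-≤ (2 * K) h₁) (*-monoʳ-≤ (27 * K) h₂)) h₃) (+-mono-≤ h₄ h₅)) (≤-reflexive (right K w d e X M B n s)))))
    where
    common = 27 * (K * M) + (w + d) * X + 27 * (K * B) + (e + 16 * K) * s
    left : ∀ K w d e X M B m s → K * (2 * m) + (27 * (K * M) + (w + d) * X + 27 * (K * B) + (e + 16 * K) * s) ≡ 2 * K * m + 27 * K * M + (w + d) * X + (27 * (K * B) + (e + 16 * K) * s)
    left = solve-∀
    right : ∀ K w d e X M B n s → 2 * K * (3 * M + 8 * s) + 27 * K * (n + B) + (21 * (K * M) + e * s) + (w * X + d * X) ≡ K * (27 * n) + (27 * (K * M) + (w + d) * X + 27 * (K * B) + (e + 16 * K) * s)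
    right = solve-∀

  scale-density : ∀ {p q r t X M s} c K u e → 1 ≤ s → c * p ≡ u → c * q ≡ 21 * K → c * (r + t) ≡ e → p * X ≤ q * M + (r * s + t) → u * X ≤ 21 * (K * M) + e * s
  scale-density {p} {q} {r} {t} {X} {M} {s@(suc _)} c K u e _ refl qK refl h = ≤-trans (≤-reflexive (*-assoc c p X)) (≤-trans (*-monoʳ-≤ c (≤-trans h (+-monoʳ-≤ (q * M) (+-monoʳ-≤ (r * s) (m≤m*n t s)))))
      (≤-reflexive (trans (expand c q r t M s) (cong (_+ c * (r + t) * s) (trans (cong (_* M) qK) (*-assoc 21 K M))))))
    where
    expand : ∀ c q r t M s → c * (q * M + (r * s + t * s)) ≡ c * q * M + c * (r + t) * s
    expand = solve-∀

  scale-exceptions : ∀ {a b g h B T T′ X} c K f w → a * B ≤ b * T′ → g * T′ ≤ h * T → T ≤ X → c * a ≡ 27 * K → c * b ≡ f * g → f * h ≡ w → 27 * (K * B) ≤ w * X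
  scale-exceptions {a} {b} {g} {h} {B} {T} {T′} {X} c K f w aB gT T≤X ca cb refl = begin
    27 * (K * B) ≡⟨ *-assoc 27 K B ⟨
    27 * K * B ≡⟨ cong (_* B) ca ⟨
    c * a * B ≡⟨ *-assoc c a B ⟩
    c * (a * B) ≤⟨ *-monoʳ-≤ c aB ⟩
    c * (b * T′) ≡⟨ *-assoc c b T′ ⟨
    c * b * T′ ≡⟨ cong (_* T′) cb ⟩
    f * g * T′ ≡⟨ *-assoc f g T′ ⟩
    f * (g * T′) ≤⟨ *-monoʳ-≤ f (≤-trans gT (*-monoʳ-≤ h T≤X)) ⟩
    f * (h * X) ≡⟨ *-assoc f h X ⟨
    f * h * X ∎
    where open ≤-Reasoning

  module _ (X n m : ℕ) (odds : CountsTo FundUnitTraceOdd X n) (all : CountsTo Always X m) where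

    -- `X` lies between two consecutive range sizes. Exceptions are counted up to the larger one and
    -- compared with the smaller, at the cost of the factor 101/100.
    lower-bound : sufficientlyLarge ≤ X → 2 * m ≤ 27 * n
    lower-bound large = from (bracket rangeSizeAt rangeSizeAt-increasing 2100 X (≤-<-trans (m≤m+n (rangeSizeAt 2100) (40000 * 40000)) large))
      where
      open Scale (scale {X} (≤-<-trans (m≤n+m (40000 * 40000) (rangeSizeAt 2100)) large))
      from : ∃[ z ] (2100 ≤ z × rangeSizeAt z < X × X ≤ rangeSizeAt (suc z)) → 2 * m ≤ 27 * n
      from (z , 2100≤z , lo , hi) = withBound (exceptions (suc z))
        where
        withBound : ∃[ B ] (AtMost (Exceptional (suc z)) B × 24300 * B ≤ 1776 * rangeSizeAt (suc z)) → 2 * m ≤ 27 * n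
        -- In units of `X/180000`, the main term of `21M` is `525 · 689 = 361725` and `27B` is at
        -- most `3552 · 101 = 358752`. The difference 2973 absorbs `18472500s`, because
        -- `10000s ≤ X`.
        withBound (B , at , B≤) = lower-margin 180000 358752 2973 15592500 X (M₅ X) B n m s
          (total-upper X {m} {s} all X≤s²)
          (M₅-≤ X {n} {B} {suc z} odds hi at)
          (scale-density {689} {7200} {15300} {14400} {X} {M₅ X} {s} 525 180000 361725 15592500 1≤s refl refl refl (M₅-lower X {s} X≤s²))
          (scale-exceptions {24300} {1776} {100} {101} {B} {rangeSizeAt z} {rangeSizeAt (suc z)} {X} 200 180000 3552 358752 B≤ (rangeSizeAt-ratio z 2100≤z) (<⇒≤ lo) refl refl refl)
          (absorb 18472500 2973 (≤ᵇ⇒≤ 18472500 29730000 _))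
          where
          absorb : ∀ c d → c ≤ d * 10000 → c * s ≤ d * X
          absorb c d c≤ = ≤-trans (*-monoˡ-≤ s c≤) (≤-trans (≤-reflexive (*-assoc d 10000 s)) (*-monoʳ-≤ d s≪X))

    -- The bound `M₅ ≥ 689X/7200` is weakened to `600X/7200 = X/12`; the spare 89 pays for the error
    -- terms.
    total-density : ∀ {s} → 1 ≤ s → X ≤ s * s → 10000 * s ≤ X → X ≤ 12 * m
    total-density {s} 1≤s X≤s² s≪X = *-cancelˡ-≤ 600 (≤-trans (density 600 89 7200 15300 14400 (M₅-lower X {s} X≤s²) M₅≤ (≤-trans (*-monoˡ-≤ s (≤ᵇ⇒≤ 36900 890000 _)) (≤-trans (≤-reflexive (*-assoc 89 10000 s)) (*-monoʳ-≤ 89 s≪X)))) (≤-reflexive (*-assoc 600 12 m)))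
      where
      M₅≤ : M₅ X ≤ suc m
      M₅≤ = ≤-trans (≤-trans (m≤m+n (M₅ X) (M₈ X)) (m≤n+m (M₅ X + M₈ X) (M₁ X))) (total-≥ X all)
      density : ∀ p q c r t {M} → (p + q) * X ≤ c * M + (r * s + t) → M ≤ suc m → (c + r + t) * s ≤ q * X → p * X ≤ c * m
      density p q c r t {M} h M≤ small = +-cancelʳ-≤ (q * X) (p * X) (c * m) (≤-trans (≤-reflexive (sym (*-distribʳ-+ X p q))) (≤-trans h (≤-trans (+-monoˡ-≤ (r * s + t) (*-monoʳ-≤ c M≤))
          (≤-trans (≤-reflexive (split c m r s t)) (≤-trans (+-monoʳ-≤ (c * m) (≤-trans (+-mono-≤ (+-monoˡ-≤ (r * s) (grow c)) (grow t)) (≤-reflexive (collect c r t s)))) (+-monoʳ-≤ (c * m) small))))))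
        where
        grow : ∀ c → c ≤ c * s
        grow c = m≤m*n c s {{>-nonZero 1≤s}}
        split : ∀ c m r s t → c * suc m + (r * s + t) ≡ c * m + (c + r * s + t)
        split = solve-∀
        collect : ∀ c r t s → c * s + r * s + t * s ≡ (c + r + t) * s
        collect = solve-∀

    -- From `3n ≤ m + 9s`, `s² ≤ 4X` and `X ≤ 12m` one gets `(3n - m)²X ≤ 81 · 4X² ≤ (216m)²`, and
    -- `216 = 3 · 72`.
    upper-bound : 40000 * 40000 < X → (3 * n ∸ m) * (3 * n ∸ m) * X ≤ (3 * 72 * m) * (3 * 72 * m)
    upper-bound large = ≤-trans (*-monoˡ-≤ X (*-mono-≤ excess excess)) (≤-trans (≤-reflexive (regroup s X)) (≤-trans (*-monoʳ-≤ 81 (*-monoˡ-≤ X s²≤4X))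
        (≤-trans (*-monoʳ-≤ 81 (*-mono-≤ (*-monoʳ-≤ 4 X≤12m) X≤12m)) (≤-reflexive (collect m)))))
      where
      open Scale (scale {X} large)
      X≤12m = total-density 1≤s X≤s² s≪X
      excess : 3 * n ∸ m ≤ 9 * s
      excess = m≤n+o⇒m∸n≤o (3 * n) m (≤-trans (*-monoʳ-≤ 3 (oddTrace-≤ X odds)) (≤-trans (total-lower X {m} {s} all X≤s²) (≤-trans (≤-reflexive (sym (+-suc m (8 * s)))) (+-monoʳ-≤ m (+-monoˡ-≤ (8 * s) 1≤s)))))
      regroup : ∀ s X → 9 * s * (9 * s) * X ≡ 81 * (s * s * X)
      regroup = solve-∀
      collect : ∀ m → 81 * (4 * (12 * m) * (12 * m)) ≡ 3 * 72 * m * (3 * 72 * m)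
      collect = solve-∀

open import Defs
open import Data.Nat using (ℕ; suc; _*_; _+_; _∸_; _≤_)
open import Data.Nat.Properties using (≤-trans; ≤-reflexive; *-monoʳ-≤; m≤m+n)
open import Data.Nat.Tactic.RingSolver using (solve-∀)
open import Data.Integer using (ℤ)
open import Data.Product using (_×_; ∃-syntax; _,_)
open import Function.Bundles using (_⇔_)
open import Relation.Binary.PropositionalEquality using (_≡_)
open OddTrace
open Asymptotics

theorem6p15 : ((D : ℕ) → RealQuadDisc D → (a b : ℤ) → IsFundUnit D a b →
    (OddZ (Trace D a b) ⇔ (∃[ a' ] ∃[ b' ] (IsTotPosFundUnit D a' b' × OddZ (Trace D a' b'))))
    × (OddZ (Trace D a b) ⇔ (∃[ a' ] ∃[ b' ] (IsUnit D a' b' × OddZ (Trace D a' b')))))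
    × ((k : ℕ) → ∃[ X₀ ] ((X n m : ℕ) → X₀ ≤ X →
    CountsTo FundUnitTraceOdd X n → CountsTo Always X m →
    2 * suc k * m ≤ 27 * suc k * n + 27 * m))
    × (∃[ C ] ∃[ X₀ ] ((X n m : ℕ) → X₀ ≤ X →
    CountsTo FundUnitTraceOdd X n → CountsTo Always X m →
    (3 * n ∸ m) * (3 * n ∸ m) * X ≤ (3 * C * m) * (3 * C * m)))
theorem6p15 =
    (λ D disc a b fund → odd⇔totallyPositive-odd D disc a b fund , odd⇔some-odd D disc a b fund)
  -- Beyond a fixed threshold `2m ≤ 27n` holds outright, so a single `X₀` serves every `k`.
  , (λ k → sufficientlyLarge , λ X n m large odds all → lower k n m (lower-bound X n m odds all large))
  , 72 , suc (40000 * 40000) , λ X n m large odds all → upper-bound X n m odds all large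
  where
  lower : ∀ k n m → 2 * m ≤ 27 * n → 2 * suc k * m ≤ 27 * suc k * n + 27 * m
  lower k n m h = ≤-trans (≤-reflexive (regroup 2 (suc k) m)) (≤-trans (*-monoʳ-≤ (suc k) h) (≤-trans (≤-reflexive (regroup′ 27 (suc k) n)) (m≤m+n (27 * suc k * n) (27 * m))))
    where
    regroup : ∀ c k m → c * k * m ≡ k * (c * m)
    regroup = solve-∀
    regroup′ : ∀ c k n → k * (c * n) ≡ c * k * n
    regroup′ = solve-∀
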